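{- For each of the objectives (1), (2) and (3), the preemptive Lazy Bureaucrat Problem under Constraint III is NP-complete (in the ordinary sense, with numbers encoded in binary), and for every constant $\rho\ge1$, unless P = NP, no polynomial-time algorithm approximates its optimum within factor $\rho$.
   Context: An instance of the Lazy Bureaucrat Problem consists of jobs $1,\dots,n$; job $i$ has a processing time $t_i$, an arrival time $a_i$ and a deadline $d_i$, all nonnegative integers. A single processor (the bureaucrat) processes at most one job at each time. In the preemptive setting a job may be interrupted and resumed later at no cost. For a schedule, let $y_i(\tau)$ be the amount of job $i$ processed before time $\tau$; no job is processed for more than $t_i$ in total, and job $i$ is completed if it receives $t_i$ units of processing by time $d_i$. Which jobs may be processed (are executable) at time $\tau$ is governed by one of three rules. Constraint I: $a_i\le\tau\le d_i$ and $y_i(\tau)<t_i$. Constraint II: $a_i\le\tau$, $y_i(\tau)<t_i$ and $\tau\le d_i-t_i+y_i(\tau)$ (the job can still be completed by its deadline). Constraint III: $a_i\le\tau\le d_i$ and $y_i(\tau)<t_i$, and moreover every job that receives a positive amount of processing must be completed by its deadline. A schedule is feasible if it obeys the chosen rule and the busy requirement: the processor is idle at time $\tau$ only if there is no job it could work on at $\tau$ consistently with the rule (under Constraint III: no job that has arrived, is not completed, and can still be completed by its deadline). The objectives, minimized over feasible schedules, are: (1) the total time spent working, $\sum_i y_i(\infty)$; (2) the sum of $t_i$ over completed jobs; (3) the makespan, the last time at which the processor works (the time the bureaucrat goes home). "No polynomial-time algorithm approximates the optimum within factor $\rho$" means there is no polynomial-time algorithm that on every instance outputs a feasible schedule whose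 objective value is at most $\rho$ times the optimal value.
   Formalization: Times at which jobs are started, interrupted and resumed, and the constant ρ, are rational numbers instead of real numbers; a schedule consists of finitely many intervals. -}

module Defs where

open import Data.Bool.Base using (Bool; true; false; T; if_then_else_)
open import Data.Fin.Base as Fin using (Fin; toℕ)
import Data.Fin.Properties as Fin
open import Data.Integer.Base using (ℤ; +_; -[1+_])
open import Data.List.Base using (List; []; _∷_; _++_; map; concatMap; foldr; length; lookup; allFin)
open import Data.List.Relation.Unary.All using (All)
open import Data.List.Relation.Unary.AllPairs using (AllPairs)
open import Data.List.Relation.Unary.Any using (Any)
open import Data.Maybe.Base as Maybe using (Maybe; just; nothing)
open import Data.Nat.Base as ℕ using (ℕ; zero; suc)
open import Data.Product.Base using (Σ; ∃-syntax; _×_; _,_)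
open import Data.Rational.Base using (ℚ; 0ℚ; _+_; _-_; _*_; _⊓_; _⊔_; _≤_; _<_; ↥_; ↧ₙ_)
open import Data.Rational.Literals using (fromℤ)
open import Data.Rational.Properties using (_≤?_)
open import Data.Vec.Base as Vec using (Vec)
open import Function.Bundles using (_⇔_)
open import Relation.Binary.PropositionalEquality.Core using (_≡_)
open import Relation.Nullary using (¬_; Dec; does)

data Symbol (m : ℕ) : Set where
  blank : Symbol m
  bit   : Bool → Symbol m
  aux   : Fin m → Symbol m

data Move : Set where
  goLeft stay goRight : Move

-- There are suc workTapes tapes, suc moreStates states and
-- auxSymbols symbols besides the blank and the two bits.
-- The initial state is Fin.zero; the machine halts when δ yields nothing.
record Machine : Set where
  field
    workTapes moreStates auxSymbols : ℕ

  State : Set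
  State = Fin (suc moreStates)

  Sym : Set
  Sym = Symbol auxSymbols

  field
    δ : State → Vec Sym (suc workTapes) → Maybe (State × Vec (Sym × Move) (suc workTapes))

-- Two-way infinite tape; cells beyond either list are blank, and the
-- list leftOf starts with the cell adjacent to the head.
record Tape (m : ℕ) : Set where
  constructor tape
  field
    leftOf  : List (Symbol m)
    scanned : Symbol m
    rightOf : List (Symbol m)

open Tape public

fromSymbols : ∀ {m} → List (Symbol m) → Tape m
fromSymbols []       = tape [] blank []
fromSymbols (s ∷ ss) = tape [] s ss

moveHead : ∀ {m} → Move → Tape m → Tape m
moveHead goLeft  (tape []       s rs)       = tape [] blank (s ∷ rs)
moveHead goLeft  (tape (l ∷ ls) s rs)       = tape ls l (s ∷ rs)
moveHead stay    t                          = t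
moveHead goRight (tape ls       s [])       = tape (s ∷ ls) blank []
moveHead goRight (tape ls       s (r ∷ rs)) = tape (s ∷ ls) r rs

writeMove : ∀ {m} → Tape m → Symbol m × Move → Tape m
writeMove (tape ls _ rs) (s , d) = moveHead d (tape ls s rs)

leadingBits : ∀ {m} → List (Symbol m) → List Bool
leadingBits (bit b ∷ ss)   = b ∷ leadingBits ss
leadingBits []             = []
leadingBits (blank ∷ _)    = []
leadingBits (aux _ ∷ _)    = []

module _ (M : Machine) where
  open Machine M

  Config : Set
  Config = State × Vec (Tape auxSymbols) (suc workTapes)

  step : Config → Maybe Config
  step (q , ts) = Maybe.map (λ (q′ , acts) → q′ , Vec.zipWith writeMove ts acts)
                            (δ q (Vec.map scanned ts))

  initial : List Bool → Config
  initial x = Fin.zero , fromSymbols (map bit x) Vec.∷ Vec.replicate workTapes (fromSymbols [])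

  -- The output is the maximal bit string on the first tape beginning at its head.
  output : Config → List Bool
  output (_ , t Vec.∷ _) = leadingBits (scanned t ∷ rightOf t)

  data HaltsIn : ℕ → Config → Config → Set where
    halted : ∀ {c} → step c ≡ nothing → HaltsIn zero c c
    next   : ∀ {n c c′ d} → step c ≡ just c′ → HaltsIn n c′ d → HaltsIn (suc n) c d

  OutputsWithin : ℕ → List Bool → List Bool → Set
  OutputsWithin t x y =
    ∃[ n ] ∃[ d ] n ℕ.≤ t × HaltsIn n (initial x) d × output d ≡ y

-- Coefficients, constant term first.
Polynomial : Set
Polynomial = List ℕ

eval : Polynomial → ℕ → ℕ
eval []      n = 0
eval (c ∷ p) n = c ℕ.+ n ℕ.* eval p n

PolyTime : (List Bool → List Bool) → Set
PolyTime f = ∃[ M ] Σ Polynomial λ p → ∀ x → OutputsWithin M (eval p (length x)) x (f x)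

PolyTimeTest : (List Bool → Bool) → Set
PolyTimeTest v = PolyTime (λ x → v x ∷ [])

Language : Set₁
Language = List Bool → Set

-- Self-delimiting code: 1 before every bit of the word, 0 at its end.
frame : List Bool → List Bool
frame []      = false ∷ []
frame (b ∷ w) = true ∷ b ∷ frame w

pair : List Bool → List Bool → List Bool
pair x c = frame x ++ c

InP : Language → Set
InP L = ∃[ v ] PolyTimeTest v × (∀ x → L x ⇔ T (v x))

InNP : Language → Set
InNP L = ∃[ v ] Σ Polynomial λ q → PolyTimeTest v ×
  (∀ x → L x ⇔ (∃[ c ] length c ℕ.≤ eval q (length x) × T (v (pair x c))))

P≡NP : Set₁
P≡NP = ∀ L → InP L ⇔ InNP L

_≤ₚ_ : Language → Language → Set
A ≤ₚ B = ∃[ f ] PolyTime f × (∀ x → A x ⇔ B (f x))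

NPComplete : Language → Set₁
NPComplete L = InNP L × (∀ A → InNP A → A ≤ₚ L)

record Job : Set where
  constructor job
  field
    processing arrival deadline : ℕ

Instance : Set
Instance = List Job

-- The half-open time interval [start , finish) devoted to one of n jobs.
record Segment (n : ℕ) : Set where
  constructor segment
  field
    worksOn      : Fin n
    start finish : ℚ

open Segment public

Schedule : ℕ → Set
Schedule n = List (Segment n)

fromℕ : ℕ → ℚ
fromℕ n = fromℤ (+ n)

sumℚ : List ℚ → ℚ
sumℚ = foldr _+_ 0ℚ

module _ {n : ℕ} (σ : Schedule n) where

  Working : Fin n → ℚ → Set
  Working i τ = Any (λ s → worksOn s ≡ i × start s ≤ τ × τ < finish s) σ

  Idle : ℚ → Set
  Idle τ = ∀ i → ¬ Working i τ

  -- y i τ = y_i(τ); each summand is the length of [start , finish) ∩ (-∞ , τ).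
  y : Fin n → ℚ → ℚ
  y i τ = sumℚ (map contribution σ)
    where
    contribution : Segment n → ℚ
    contribution s = if does (worksOn s Fin.≟ i) then 0ℚ ⊔ ((finish s ⊓ τ) - start s) else 0ℚ

  -- y∞ i = y_i(∞), for segments with start ≤ finish.
  y∞ : Fin n → ℚ
  y∞ i = sumℚ (map contribution σ)
    where
    contribution : Segment n → ℚ
    contribution s = if does (worksOn s Fin.≟ i) then finish s - start s else 0ℚ

module _ (I : Instance) where

  t a d : Fin (length I) → ℚ
  t i = fromℕ (Job.processing (lookup I i))
  a i = fromℕ (Job.arrival    (lookup I i))
  d i = fromℕ (Job.deadline   (lookup I i))

  module _ (σ : Schedule (length I)) where

    Completed : Fin (length I) → Set
    Completed i = t i ≤ y σ i (d i)

    completed? : ∀ i → Dec (Completed i)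
    completed? i = t i ≤? y σ i (d i)

    Executable : Fin (length I) → ℚ → Set
    Executable i τ = a i ≤ τ × τ ≤ d i × y σ i τ < t i

    -- The last component is τ ≤ d_i - t_i + y_i(τ): the job can still be
    -- completed by its deadline.
    Completable : Fin (length I) → ℚ → Set
    Completable i τ = a i ≤ τ × y σ i τ < t i × τ ≤ (d i - t i) + y σ i τ

    -- Feasibility under Constraint III. Segments are nonempty and listed
    -- chronologically, so at most one job is processed at each time.
    record Feasible : Set where
      field
        nonempty      : All (λ s → start s < finish s) σ
        chronological : AllPairs (λ s s′ → finish s ≤ start s′) σ
        notExceeded   : ∀ i → y∞ σ i ≤ t i
        executable    : ∀ i τ → Working σ i τ → Executable i τ
        committed     : ∀ i → 0ℚ < y∞ σ i → Completed i
        busy          : ∀ τ → 0ℚ ≤ τ → Idle σ τ → ∀ i → ¬ Completable i τ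

data Objective : Set where
  totalWork completedWork makespan : Objective

value : Objective → (I : Instance) → Schedule (length I) → ℚ
value totalWork     I σ = sumℚ (map (y∞ σ) (allFin (length I)))
value completedWork I σ =
  sumℚ (map (λ i → if does (completed? I σ i) then t I i else 0ℚ) (allFin (length I)))
value makespan      I σ = foldr (λ s m → finish s ⊔ m) 0ℚ σ

increment : List Bool → List Bool
increment []          = true ∷ []
increment (false ∷ w) = true ∷ w
increment (true  ∷ w) = false ∷ increment w

-- Least significant bit first, no leading zeros; 0 is the empty word.
binary : ℕ → List Bool
binary zero    = []
binary (suc n) = increment (binary n)

signedBinary : ℤ → List Bool
signedBinary (+ n)    = false ∷ binary n
signedBinary -[1+ n ] = true ∷ binary (suc n)

encodeℕ : ℕ → List Bool
encodeℕ n = frame (binary n)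

encodeℚ : ℚ → List Bool
encodeℚ q = frame (signedBinary (↥ q)) ++ encodeℕ (↧ₙ q)

encodeInstance : Instance → List Bool
encodeInstance = concatMap λ (job p r e) → encodeℕ p ++ encodeℕ r ++ encodeℕ e

encodeSchedule : ∀ {n} → Schedule n → List Bool
encodeSchedule = concatMap λ (segment i b e) → encodeℕ (toℕ i) ++ encodeℚ b ++ encodeℚ e

LazyBureaucrat : Objective → Language
LazyBureaucrat obj x =
  ∃[ I ] ∃[ K ] x ≡ encodeℕ K ++ encodeInstance I
    × (∃[ σ ] Feasible I σ × value obj I σ ≤ fromℕ K)

-- Being at most ρ times the optimum is expressed as being at most ρ
-- times the value of every feasible schedule.
ApproximableWithin : Objective → ℚ → Set
ApproximableWithin obj ρ = ∃[ M ] Σ Polynomial λ p → ∀ I →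
  ∃[ σ ] OutputsWithin M (eval p (length (encodeInstance I))) (encodeInstance I) (encodeSchedule σ)
    × Feasible I σ
    × (∀ σ′ → Feasible I σ′ → value obj I σ ≤ ρ * value obj I σ′)

{-# OPTIONS --safe #-}

-- Membership in NP.  Only the set S of processed jobs has to be guessed.  It
-- belongs to a feasible schedule iff every time window is long enough for the
-- jobs of S that arrive and fall due in it, and every job outside S finds the
-- processor busy during the whole period in which it could still be started.
-- Both conditions can be tested in polynomial time.  They are necessary for
-- schedules with arbitrary rational times, and conversely a unit-step
-- earliest-deadline-first schedule of S is feasible.  For the makespan,
-- deadlines are first lowered to the bound K.
--
-- Hardness.  The computations of a verifying Turing machine are the tilings of
-- a rectangle by Wang tiles whose bottom row guesses the certificate, and such
-- a tiling is a solution of a subset sum problem whose digits express that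
-- neighbouring tiles match.  Weights w with goal B become jobs of length w,
-- arrival 0 and deadline B, accompanied by a job of length c B which can be
-- skipped only if the others occupy the processor during all of [0 , B).  So
-- the optimum is B if the goal can be reached and at least c B otherwise; as c
-- is arbitrary this also excludes approximation within a constant factor.
--
-- Polynomial-time bounds are obtained compositionally, for functions computed
-- by programs on three stacks that are compiled to Turing machines.
module Submission where

-- Constraint III makes a job all or nothing, so objectives (1) and (2) both equal the total length
-- of the selected jobs. Hence one kind of certificate and one gadget serve all three objectives.
-- Hardness starts from the definition of NP: an arbitrary language is given by a machine and two
-- polynomials. Wang tiles fit subset sums because each of their constraints is an equality of two
-- colours, and a digit can express it: a colour `k` from one tile and `C - k` from its neighbour
-- add up to `C`. In a helical tiling the left and the lower neighbour are a fixed number of places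
-- back, so all cells have the same weights up to a power of the base. A decision procedure obtained
-- from an approximation algorithm sees only the code of a schedule and does not evaluate it.
-- Feasibility alone turns a skipped long job into a solution, and the ratio forces a skip when a
-- solution exists; so it is enough to read off whether job 0 occurs.

-- Finite state sets, tapes up to trailing blanks, and automata.

module Automata where

  open import Defs
  open import Data.Bool.Base using (Bool; true; false)
  open import Data.Fin.Base as Fin using (Fin; _↑ˡ_; _↑ʳ_; splitAt; combine; remQuot)
  open import Data.Fin.Properties using (splitAt-↑ˡ; splitAt-↑ʳ; remQuot-combine)
  open import Data.List.Base using (List; []; _∷_)
  open import Data.Maybe.Base as Maybe using (Maybe; just; nothing)
  open import Data.Nat.Base using (ℕ; zero; suc; _+_; _*_)
  open import Data.Product.Base using (∃-syntax; _×_; _,_; proj₁; proj₂)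
  open import Data.Sum.Base using (_⊎_; inj₁; inj₂; [_,_]′)
  open import Data.Unit.Base using (⊤; tt)
  open import Data.Vec.Base as Vec using (Vec; []; _∷_)
  open import Function.Base using (_∘_)
  open import Relation.Binary.PropositionalEquality using (_≡_; refl; trans; cong; cong₂)

  -- An injection into `Fin size` with a left inverse is enough to number machine states and tile
  -- colours, and such codings pass through sums, products and retracts without surjectivity proofs.
  record Finite (A : Set) : Set where
    field
      size    : ℕ
      to      : A → Fin size
      from    : Fin size → A
      from-to : ∀ a → from (to a) ≡ a

  open Finite

  Finite-⊤ : Finite ⊤
  Finite-⊤ = record { size = 1 ; to = λ _ → Fin.zero ; from = λ _ → tt ; from-to = λ _ → refl }

  Finite-Fin : ∀ {n} → Finite (Fin n)
  Finite-Fin {n} = record { size = n ; to = λ i → i ; from = λ i → i ; from-to = λ _ → refl }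

  Finite-retract : ∀ {A B : Set} (f : B → A) (g : A → B) → (∀ b → g (f b) ≡ b) → Finite A → Finite B
  Finite-retract f g gf FA = record
    { size = size FA ; to = to FA ∘ f ; from = g ∘ from FA
    ; from-to = λ b → trans (cong g (from-to FA (f b))) (gf b) }

  Finite-⊎ : ∀ {A B : Set} → Finite A → Finite B → Finite (A ⊎ B)
  Finite-⊎ {A} {B} FA FB = record
    { size = size FA + size FB ; to = to′ ; from = [ inj₁ ∘ from FA , inj₂ ∘ from FB ]′ ∘ splitAt (size FA)
    ; from-to = ft }
    where
    to′ : A ⊎ B → Fin (size FA + size FB)
    to′ (inj₁ a) = to FA a ↑ˡ size FB
    to′ (inj₂ b) = size FA ↑ʳ to FB b
    ft : ∀ x → [ inj₁ ∘ from FA , inj₂ ∘ from FB ]′ (splitAt (size FA) (to′ x)) ≡ x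
    ft (inj₁ a) rewrite splitAt-↑ˡ (size FA) (to FA a) (size FB) = cong inj₁ (from-to FA a)
    ft (inj₂ b) rewrite splitAt-↑ʳ (size FA) (size FB) (to FB b) = cong inj₂ (from-to FB b)

  Finite-× : ∀ {A B : Set} → Finite A → Finite B → Finite (A × B)
  Finite-× {A} {B} FA FB = record
    { size = size FA * size FB
    ; to = λ (a , b) → combine (to FA a) (to FB b)
    ; from = from′ ∘ remQuot (size FB)
    ; from-to = λ (a , b) → trans (cong from′ (remQuot-combine (to FA a) (to FB b)))
                                  (cong₂ _,_ (from-to FA a) (from-to FB b)) }
    where
    from′ : Fin (size FA) × Fin (size FB) → A × B
    from′ (i , j) = from FA i , from FB j

  Finite-Bool : Finite Bool
  Finite-Bool = Finite-retract {⊤ ⊎ ⊤} (λ { false → inj₁ tt ; true → inj₂ tt })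
    (λ { (inj₁ _) → false ; (inj₂ _) → true }) (λ { false → refl ; true → refl }) (Finite-⊎ Finite-⊤ Finite-⊤)

  Finite-Maybe : ∀ {A : Set} → Finite A → Finite (Maybe A)
  Finite-Maybe {A} FA = Finite-retract {⊤ ⊎ A} (λ { nothing → inj₁ tt ; (just a) → inj₂ a })
    (λ { (inj₁ _) → nothing ; (inj₂ a) → just a }) (λ { nothing → refl ; (just a) → refl }) (Finite-⊎ Finite-⊤ FA)

  Finite-Vec : ∀ {A : Set} n → Finite A → Finite (Vec A n)
  Finite-Vec zero FA = Finite-retract {⊤} (λ _ → tt) (λ _ → []) (λ { [] → refl }) Finite-⊤
  Finite-Vec {A} (suc n) FA = Finite-retract {A × Vec A n} (λ { (x ∷ xs) → x , xs }) (λ (x , xs) → x ∷ xs)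
    (λ { (x ∷ xs) → refl }) (Finite-× FA (Finite-Vec n FA))

  Finite-Symbol : ∀ m → Finite (Symbol m)
  Finite-Symbol m = Finite-retract {⊤ ⊎ (Bool ⊎ Fin m)}
    (λ { blank → inj₁ tt ; (bit b) → inj₂ (inj₁ b) ; (aux i) → inj₂ (inj₂ i) })
    (λ { (inj₁ _) → blank ; (inj₂ (inj₁ b)) → bit b ; (inj₂ (inj₂ i)) → aux i })
    (λ { blank → refl ; (bit b) → refl ; (aux i) → refl })
    (Finite-⊎ Finite-⊤ (Finite-⊎ Finite-Bool Finite-Fin))

  -- Lists that differ by trailing blanks describe the same half of a tape, so simulations compare
  -- tapes through `nth` and `ahead`.
  nth : ∀ {m} → List (Symbol m) → ℕ → Symbol m
  nth []       _       = blank
  nth (s ∷ ss) zero    = s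
  nth (s ∷ ss) (suc i) = nth ss i

  ahead : ∀ {m} → Tape m → ℕ → Symbol m
  ahead t = nth (scanned t ∷ rightOf t)

  nth-left-goLeft : ∀ {m} (t : Tape m) i → nth (leftOf (moveHead goLeft t)) i ≡ nth (leftOf t) (suc i)
  nth-left-goLeft (tape [] s rs) i = refl
  nth-left-goLeft (tape (l ∷ ls) s rs) i = refl

  scanned-goLeft : ∀ {m} (t : Tape m) → scanned (moveHead goLeft t) ≡ nth (leftOf t) 0
  scanned-goLeft (tape [] s rs) = refl
  scanned-goLeft (tape (l ∷ ls) s rs) = refl

  right-goLeft : ∀ {m} (t : Tape m) → rightOf (moveHead goLeft t) ≡ scanned t ∷ rightOf t
  right-goLeft (tape [] s rs) = refl
  right-goLeft (tape (l ∷ ls) s rs) = refl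

  nth-right-goRight : ∀ {m} (t : Tape m) i → nth (rightOf (moveHead goRight t)) i ≡ nth (rightOf t) (suc i)
  nth-right-goRight (tape ls s []) i = refl
  nth-right-goRight (tape ls s (r ∷ rs)) i = refl

  scanned-goRight : ∀ {m} (t : Tape m) → scanned (moveHead goRight t) ≡ nth (rightOf t) 0
  scanned-goRight (tape ls s []) = refl
  scanned-goRight (tape ls s (r ∷ rs)) = refl

  left-goRight : ∀ {m} (t : Tape m) → leftOf (moveHead goRight t) ≡ scanned t ∷ leftOf t
  left-goRight (tape ls s []) = refl
  left-goRight (tape ls s (r ∷ rs)) = refl

  -- The leading bit string ends at the first blank or auxiliary symbol. A translation that fixes
  -- blanks and bits and keeps auxiliary symbols auxiliary cannot move that end.
  leadingBits-cong : ∀ {m m′} (l : List (Symbol m)) (l′ : List (Symbol m′)) (f : Symbol m → Symbol m′) →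
    f blank ≡ blank → (∀ b → f (bit b) ≡ bit b) → (∀ i → ∃[ j ] f (aux i) ≡ aux j) →
    (∀ i → nth l′ i ≡ f (nth l i)) → leadingBits l′ ≡ leadingBits l
  leadingBits-cong [] [] f fb fbit fa eq = refl
  leadingBits-cong [] (s ∷ l′) f fb fbit fa eq with s | trans (eq 0) fb
  ... | .blank | refl = refl
  leadingBits-cong (blank ∷ l) [] f fb fbit fa eq = refl
  leadingBits-cong (bit b ∷ l) [] f fb fbit fa eq with trans (eq 0) (fbit b)
  ... | ()
  leadingBits-cong (aux i ∷ l) [] f fb fbit fa eq = refl
  leadingBits-cong (blank ∷ l) (s ∷ l′) f fb fbit fa eq with s | trans (eq 0) fb
  ... | .blank | refl = refl
  leadingBits-cong (bit b ∷ l) (s ∷ l′) f fb fbit fa eq with s | trans (eq 0) (fbit b)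
  ... | .(bit b) | refl = cong (b ∷_) (leadingBits-cong l l′ f fb fbit fa (λ i → eq (suc i)))
  leadingBits-cong (aux i ∷ l) (s ∷ l′) f fb fbit fa eq with s | trans (eq 0) (proj₂ (fa i))
  ... | .(aux _) | refl = refl

  -- Unlike `HaltsIn` this does not demand that the last configuration halts, so the runs of
  -- successive phases can be concatenated.
  data Run {C : Set} (f : C → Maybe C) : ℕ → C → C → Set where
    done : ∀ {c} → Run f zero c c
    more : ∀ {n c c′ d} → f c ≡ just c′ → Run f n c′ d → Run f (suc n) c d

  _++ᴿ_ : ∀ {C : Set} {f : C → Maybe C} {m n c d e} → Run f m c d → Run f n d e → Run f (m + n) c e
  done     ++ᴿ s = s
  more p r ++ᴿ s = more p (r ++ᴿ s)

  halts⇒run : ∀ {M n c d} → HaltsIn M n c d → Run (step M) n c d × step M d ≡ nothing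
  halts⇒run (halted p) = done , p
  halts⇒run (next p h) = more p (proj₁ (halts⇒run h)) , proj₂ (halts⇒run h)

  record Automaton : Set₁ where
    field
      Q      : Set
      finite : Finite Q
      entry  : Q
      tapes  : ℕ
      auxs   : ℕ
      δ      : Q → Vec (Symbol auxs) (suc tapes) → Maybe (Q × Vec (Symbol auxs × Move) (suc tapes))

  module _ (A : Automaton) where
    open Automaton A

    stepᴬ : Q × Vec (Tape auxs) (suc tapes) → Maybe (Q × Vec (Tape auxs) (suc tapes))
    stepᴬ (q , ts) = Maybe.map (λ (q′ , acts) → q′ , Vec.zipWith writeMove ts acts) (δ q (Vec.map scanned ts))

    private
      decode : Fin (suc (size finite)) → Q
      decode Fin.zero    = entry
      decode (Fin.suc i) = from finite i

    -- One state is added because a `Machine` starts in `Fin.zero`: that state is decoded as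
    -- `entry`, and the proper codes are shifted by one.
    machine : Machine
    machine = record
      { workTapes = tapes ; moreStates = size finite ; auxSymbols = auxs
      ; δ = λ q v → Maybe.map (λ (q′ , acts) → Fin.suc (to finite q′) , acts) (δ (decode q) v) }

    private
      step-just : ∀ i q ts q′ ts′ → decode i ≡ q → stepᴬ (q , ts) ≡ just (q′ , ts′) →
        ∃[ j ] step machine (i , ts) ≡ just (j , ts′) × decode j ≡ q′
      step-just i q ts q′ ts′ refl eq with δ (decode i) (Vec.map scanned ts)
      step-just i q ts q′ ts′ refl refl | just _ = _ , refl , from-to finite q′

      step-nothing : ∀ i q ts → decode i ≡ q → stepᴬ (q , ts) ≡ nothing → step machine (i , ts) ≡ nothing
      step-nothing i q ts refl eq with δ (decode i) (Vec.map scanned ts)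
      ... | nothing = refl

      run : ∀ {n q ts q′ ts′} i → decode i ≡ q → Run stepᴬ n (q , ts) (q′ , ts′) → stepᴬ (q′ , ts′) ≡ nothing →
        ∃[ j ] HaltsIn machine n (i , ts) (j , ts′)
      run {q = q} {ts = ts} i dec done h = i , halted (step-nothing i q ts dec h)
      run i dec (more p r) h with step-just i _ _ _ _ dec p
      ... | j , st , dec′ with run j dec′ r h
      ... | j′ , H = j′ , next st H

    machine-halts : ∀ {n ts q′ ts′} → Run stepᴬ n (entry , ts) (q′ , ts′) → stepᴬ (q′ , ts′) ≡ nothing →
      ∃[ j ] HaltsIn machine n (Fin.zero , ts) (j , ts′)
    machine-halts = run Fin.zero refl

  split : ∀ {A : Set} n {m} → Vec A (n + m) → Vec A n × Vec A m
  split zero    xs       = [] , xs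
  split (suc n) (x ∷ xs) = x ∷ proj₁ (split n xs) , proj₂ (split n xs)

  split-++ : ∀ {A : Set} {n m} (xs : Vec A n) (ys : Vec A m) → split n (xs Vec.++ ys) ≡ (xs , ys)
  split-++ []       ys = refl
  split-++ (x ∷ xs) ys rewrite split-++ xs ys = refl

  map-scanned-++ : ∀ {m k l} (ts : Vec (Tape m) k) (us : Vec (Tape m) l) →
    Vec.map scanned (ts Vec.++ us) ≡ Vec.map scanned ts Vec.++ Vec.map scanned us
  map-scanned-++ []       us = refl
  map-scanned-++ (t ∷ ts) us = cong (_ ∷_) (map-scanned-++ ts us)

  zipWith-writeMove-++ : ∀ {m k l} (ts : Vec (Tape m) k) (us : Vec (Tape m) l) as bs →
    Vec.zipWith writeMove (ts Vec.++ us) (as Vec.++ bs) ≡ Vec.zipWith writeMove ts as Vec.++ Vec.zipWith writeMove us bs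
  zipWith-writeMove-++ []       us []       bs = refl
  zipWith-writeMove-++ (t ∷ ts) us (a ∷ as) bs = cong (_ ∷_) (zipWith-writeMove-++ ts us as bs)

  idle : ∀ {m k} → Vec (Symbol m) k → Vec (Symbol m × Move) k
  idle = Vec.map (_, stay)

  zipWith-idle : ∀ {m k} (ts : Vec (Tape m) k) → Vec.zipWith writeMove ts (idle (Vec.map scanned ts)) ≡ ts
  zipWith-idle []       = refl
  zipWith-idle (t ∷ ts) = cong (t ∷_) (zipWith-idle ts)

-- Moving a word between tapes, and simulation over a larger alphabet.

module Transfers where

  open import Defs
  open Automata
  open import Data.Bool.Base using (Bool; true; false)
  open import Data.Empty using (⊥-elim)
  open import Data.List.Base using (List; []; _∷_; map; length; _ʳ++_)
  open import Data.List.Properties using (ʳ++-ʳ++; length-ʳ++)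
  import Data.List.Properties as List
  open import Data.Maybe.Base using (Maybe; just)
  open import Data.Nat.Base using (ℕ; zero; suc; pred; _+_)
  open import Data.Nat.Properties using (+-identityʳ)
  open import Data.Product.Base using (∃-syntax; _×_; _,_; proj₁; proj₂)
  open import Data.Sum.Base using (_⊎_; inj₁; inj₂)
  open import Data.Vec.Base as Vec using (Vec; []; _∷_)
  open import Data.Vec.Relation.Binary.Pointwise.Inductive using (Pointwise; []; _∷_)
  open import Relation.Binary.PropositionalEquality using (_≡_; _≢_; refl; sym; trans; cong; cong₂; subst)

  asBit? : ∀ {m} (s : Symbol m) → (∃[ b ] s ≡ bit b) ⊎ (∀ b → s ≢ bit b)
  asBit? blank   = inj₂ λ _ ()
  asBit? (bit b) = inj₁ (b , refl)
  asBit? (aux i) = inj₂ λ _ ()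

  -- The controller is abstracted to two modes: `K false` moves bits from `t` to `u` and erases them
  -- on `t`, `K true` drives the head of `u` back to the first bit. One argument then serves both
  -- transfers of a composed machine.
  module Transfer {m : ℕ} {C : Set} (f : C → Maybe C) (K : Bool → Tape m → Tape m → C) (end : Tape m → Tape m → C)
    (copy-bit : ∀ t u b → scanned t ≡ bit b →
       f (K false t u) ≡ just (K false (writeMove t (blank , goRight)) (writeMove u (bit b , goRight))))
    (copy-end : ∀ t u → (∀ b → scanned t ≢ bit b) → f (K false t u) ≡ just (K true t (writeMove u (scanned u , goLeft))))
    (rewind-bit : ∀ t u b → scanned u ≡ bit b → f (K true t u) ≡ just (K true t (writeMove u (scanned u , goLeft))))
    (rewind-end : ∀ t u → (∀ b → scanned u ≢ bit b) → f (K true t u) ≡ just (end t (writeMove u (scanned u , goRight))))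
    where

    private
      rewind : ∀ (l z : List Bool) t u → (∀ i → nth (leftOf u) i ≡ nth (map bit l) i) → (∀ i → ahead u i ≡ nth (map bit z) i) →
        ∃[ u′ ] Run f (suc (length l)) (K true t (writeMove u (scanned u , goLeft))) (end t u′)
          × (∀ i → nth (leftOf u′) i ≡ blank) × (∀ i → ahead u′ i ≡ nth (map bit (l ʳ++ z)) i)
      rewind [] z t u left right = _ ,
          more (rewind-end t u₁ (λ b eq → case-blank (trans (sym sc) eq))) done ,
          (λ { zero → trans (cong (λ l → nth l 0) (left-goRight u₁)) sc
             ; (suc i) → trans (cong (λ l → nth l (suc i)) (left-goRight u₁)) (trans (nth-left-goLeft u i) (left (suc i))) }) ,
          (λ { zero → trans (scanned-goRight u₁) (trans (cong (λ l → nth l 0) (right-goLeft u)) (right 0))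
             ; (suc i) → trans (nth-right-goRight u₁ i) (trans (cong (λ l → nth l (suc i)) (right-goLeft u)) (right (suc i))) })
        where
        u₁ = moveHead goLeft u
        sc : scanned u₁ ≡ blank
        sc = trans (scanned-goLeft u) (left 0)
        case-blank : ∀ {b} → blank {m} ≢ bit b
        case-blank ()
      rewind (b ∷ l) z t u left right
        with rewind l (b ∷ z) t (moveHead goLeft u)
               (λ i → trans (nth-left-goLeft u i) (left (suc i)))
               (λ { zero → trans (scanned-goLeft u) (left 0)
                  ; (suc i) → trans (cong (λ l → nth l i) (right-goLeft u)) (right i) })
      ... | u′ , r , p , q = u′ , more (rewind-bit t _ b (trans (scanned-goLeft u) (left 0))) r , p , q

      leading-ahead : ∀ (t : Tape m) (y : List Bool) → leadingBits (scanned t ∷ rightOf t) ≡ y →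
        (∀ b → scanned t ≢ bit b) → y ≡ []
      leading-ahead (tape ls blank rs) y refl n = refl
      leading-ahead (tape ls (bit b) rs) y eq n = ⊥-elim (n b refl)
      leading-ahead (tape ls (aux i) rs) y refl n = refl

      leading-cons : ∀ (t : Tape m) (y : List Bool) b → leadingBits (scanned t ∷ rightOf t) ≡ y → scanned t ≡ bit b →
        ∃[ y′ ] y ≡ b ∷ y′ × leadingBits (scanned (writeMove t (blank , goRight)) ∷ rightOf (writeMove t (blank , goRight))) ≡ y′
      leading-cons (tape ls (bit b) []) y .b refl refl = _ , refl , refl
      leading-cons (tape ls (bit b) (r ∷ rs)) y .b refl refl = _ , refl , refl

      -- `l` holds the bits already written, nearest first, so the left half of `u` spells a
      -- reversed prefix. The recursion is on `n` because the word is tied to the tape only by an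
      -- equation.
      copy : ∀ n (y l : List Bool) t u → length y ≡ n → leadingBits (scanned t ∷ rightOf t) ≡ y →
        (∀ i → nth (leftOf u) i ≡ nth (map bit l) i) → (∀ i → ahead u i ≡ blank) →
        ∃[ t′ ] ∃[ u′ ] Run f (suc (length y) + suc (length (y ʳ++ l))) (K false t u) (end t′ u′)
          × (∀ i → nth (leftOf u′) i ≡ blank) × (∀ i → ahead u′ i ≡ nth (map bit ((y ʳ++ l) ʳ++ [])) i)
          × ((∀ i → nth (leftOf t) i ≡ blank) → ∀ i → nth (leftOf t′) i ≡ blank) × (∀ i → ahead t′ i ≡ ahead t (length y + i))
      copy n y l t u len eq left right with asBit? (scanned t)
      copy n y l t u len eq left right | inj₂ nb with leading-ahead t y eq nb
      ... | refl with rewind l [] t u left right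
      ... | u′ , r , p , q = t , u′ , more (copy-end t u nb) r , p , q , (λ h → h) , λ i → refl
      copy n y l t u len eq left right | inj₁ (b , sc) with leading-cons t y b eq sc
      copy (suc n) y l t u len eq left right | inj₁ (b , sc) | y′ , refl , eq′
        with copy n y′ (b ∷ l) (writeMove t (blank , goRight)) (writeMove u (bit b , goRight))
               (cong pred len) eq′
               (λ { zero → cong (λ l → nth l 0) (left-goRight (tape (leftOf u) (bit b) (rightOf u)))
                  ; (suc i) → trans (cong (λ l → nth l (suc i)) (left-goRight (tape (leftOf u) (bit b) (rightOf u)))) (left i) })
               (λ { zero → trans (scanned-goRight (tape (leftOf u) (bit b) (rightOf u))) (right 1)
                  ; (suc i) → trans (nth-right-goRight (tape (leftOf u) (bit b) (rightOf u)) i) (right (suc (suc i))) })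
      ... | t′ , u′ , r , p , q , p′ , q′ = t′ , u′ , more (copy-bit t u b sc) r , p , q ,
            (λ h → p′ (λ { zero → cong (λ l → nth l 0) (left-goRight (tape (leftOf t) blank (rightOf t)))
                         ; (suc i) → trans (cong (λ l → nth l (suc i)) (left-goRight (tape (leftOf t) blank (rightOf t)))) (h i) })) ,
            λ i → trans (q′ i) (aheadt (length y′ + i))
        where
        aheadt : ∀ i → ahead (writeMove t (blank , goRight)) i ≡ ahead t (suc i)
        aheadt zero = scanned-goRight (tape (leftOf t) blank (rightOf t))
        aheadt (suc i) = nth-right-goRight (tape (leftOf t) blank (rightOf t)) i

    -- The last two conclusions describe the source: beyond the erased word it is unchanged. If it
    -- contained nothing else, it is empty afterwards and can serve as a fresh tape.
    transfer : ∀ (y : List Bool) t u → leadingBits (scanned t ∷ rightOf t) ≡ y →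
        (∀ i → nth (leftOf u) i ≡ blank) → (∀ i → ahead u i ≡ blank) →
        ∃[ t′ ] ∃[ u′ ] Run f (suc (length y) + suc (length y)) (K false t u) (end t′ u′)
          × (∀ i → nth (leftOf u′) i ≡ blank) × (∀ i → ahead u′ i ≡ nth (map bit y) i)
          × ((∀ i → nth (leftOf t) i ≡ blank) → ∀ i → nth (leftOf t′) i ≡ blank) × (∀ i → ahead t′ i ≡ ahead t (length y + i))
    transfer y t u eq l r with copy (length y) y [] t u refl eq l r
    ... | t′ , u′ , run , p , q , p′ , q′ = t′ , u′ ,
      subst (λ k → Run f (suc (length y) + suc k) (K false t u) (end t′ u′))
        (trans (length-ʳ++ y) (+-identityʳ (length y))) run ,
      p , (λ i → trans (q i) (cong (λ z → nth (map bit z) i) (trans (ʳ++-ʳ++ y) (List.++-identityʳ y)))) , p′ , q′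

  -- Simulation of a machine on tapes over a larger alphabet

  -- `ret` is total and may send foreign symbols to junk; on the simulated tapes only symbols in the
  -- image of `emb` are ever scanned.
  record Embedding (m m′ : ℕ) : Set where
    field
      emb       : Symbol m → Symbol m′
      ret       : Symbol m′ → Symbol m
      ret-emb   : ∀ s → ret (emb s) ≡ s
      emb-blank : emb blank ≡ blank
      emb-bit   : ∀ b → emb (bit b) ≡ bit b
      emb-aux   : ∀ i → ∃[ j ] emb (aux i) ≡ aux j

  module Simulation {m m′ : ℕ} (E : Embedding m m′) where
    open Embedding E

    record Sim (t : Tape m) (t′ : Tape m′) : Set where
      constructor sim
      field
        simAhead : ∀ i → ahead t′ i ≡ emb (ahead t i)
        simLeft  : ∀ i → nth (leftOf t′) i ≡ emb (nth (leftOf t) i)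

    open Sim

    embAct : Symbol m × Move → Symbol m′ × Move
    embAct (s , d) = emb s , d

    sim-write : ∀ {t t′} → Sim t t′ → ∀ s d → Sim (writeMove t (s , d)) (writeMove t′ (emb s , d))
    sim-write {tape ls c rs} {tape ls′ c′ rs′} (sim a l) s stay = sim (λ { zero → refl ; (suc i) → a (suc i) }) l
    sim-write {t} {t′} (sim a l) s goLeft = sim
      (λ { zero → trans (scanned-goLeft u′) (trans (l 0) (cong emb (sym (scanned-goLeft u))))
         ; (suc zero) → trans (cong (λ l → nth l 0) (right-goLeft u′)) (cong emb (sym (cong (λ l → nth l 0) (right-goLeft u))))
         ; (suc (suc i)) → trans (cong (λ l → nth l (suc i)) (right-goLeft u′)) (trans (a (suc i)) (cong emb (sym (cong (λ l → nth l (suc i)) (right-goLeft u))))) })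
      (λ i → trans (nth-left-goLeft u′ i) (trans (l (suc i)) (cong emb (sym (nth-left-goLeft u i)))))
      where
      u  = tape (leftOf t) s (rightOf t)
      u′ = tape (leftOf t′) (emb s) (rightOf t′)
    sim-write {t} {t′} (sim a l) s goRight = sim
      (λ { zero → trans (scanned-goRight u′) (trans (a 1) (cong emb (sym (scanned-goRight u))))
         ; (suc i) → trans (nth-right-goRight u′ i) (trans (a (suc (suc i))) (cong emb (sym (nth-right-goRight u i)))) })
      (λ { zero → trans (cong (λ l → nth l 0) (left-goRight u′)) (cong emb (sym (cong (λ l → nth l 0) (left-goRight u))))
         ; (suc i) → trans (cong (λ l → nth l (suc i)) (left-goRight u′)) (trans (l i) (cong emb (sym (cong (λ l → nth l (suc i)) (left-goRight u))))) })
      where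
      u  = tape (leftOf t) s (rightOf t)
      u′ = tape (leftOf t′) (emb s) (rightOf t′)

    sims-write : ∀ {k} {ts : Vec (Tape m) k} {ts′} → Pointwise Sim ts ts′ → ∀ as →
      Pointwise Sim (Vec.zipWith writeMove ts as) (Vec.zipWith writeMove ts′ (Vec.map embAct as))
    sims-write []       []       = []
    sims-write (s ∷ ss) (a ∷ as) = sim-write s (proj₁ a) (proj₂ a) ∷ sims-write ss as

    sims-scanned : ∀ {k} {ts : Vec (Tape m) k} {ts′} → Pointwise Sim ts ts′ →
      Vec.map ret (Vec.map scanned ts′) ≡ Vec.map scanned ts
    sims-scanned [] = refl
    sims-scanned (s ∷ ss) = cong₂ _∷_ (trans (cong ret (simAhead s 0)) (ret-emb _)) (sims-scanned ss)

    nth-bits : ∀ x i → nth {m′} (map bit x) i ≡ emb (nth (map bit x) i)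
    nth-bits []      i       = sym emb-blank
    nth-bits (b ∷ x) zero    = sym (emb-bit b)
    nth-bits (b ∷ x) (suc i) = nth-bits x i

    ahead-fromBits : ∀ {m} x i → ahead {m} (fromSymbols (map bit x)) i ≡ nth (map bit x) i
    ahead-fromBits []      zero    = refl
    ahead-fromBits []      (suc i) = refl
    ahead-fromBits (b ∷ x) i       = refl

    left-fromBits : ∀ {m} x i → nth {m} (leftOf (fromSymbols (map bit x))) i ≡ blank
    left-fromBits []      i = refl
    left-fromBits (b ∷ x) i = refl

    sim-input : ∀ x {t′} → (∀ i → ahead t′ i ≡ nth (map bit x) i) → (∀ i → nth (leftOf t′) i ≡ blank) →
      Sim (fromSymbols (map bit x)) t′
    sim-input x a l = sim
      (λ i → trans (a i) (trans (nth-bits x i) (cong emb (sym (ahead-fromBits x i)))))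
      (λ i → trans (l i) (trans (sym emb-blank) (cong emb (sym (left-fromBits x i)))))

    sims-empty : ∀ k → Pointwise Sim (Vec.replicate k (fromSymbols [])) (Vec.replicate k (fromSymbols []))
    sims-empty zero    = []
    sims-empty (suc k) = sim-input [] (λ { zero → refl ; (suc i) → refl }) (λ i → refl) ∷ sims-empty k

    sim-output : ∀ {t t′} → Sim t t′ → leadingBits (scanned t′ ∷ rightOf t′) ≡ leadingBits (scanned t ∷ rightOf t)
    sim-output {t} {t′} s = leadingBits-cong (scanned t ∷ rightOf t) (scanned t′ ∷ rightOf t′) emb emb-blank emb-bit emb-aux (simAhead s)

-- Composition of Turing machines.

module MachineComposition where

  open import Defs
  open Automata
  open Transfers
  open import Data.Bool.Base using (Bool; true; false)
  open import Data.Empty using (⊥-elim)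
  open import Data.Fin.Base as Fin using (_↑ˡ_; _↑ʳ_; splitAt)
  open import Data.Fin.Properties using (splitAt-↑ˡ; splitAt-↑ʳ)
  open import Data.List.Base using (List; []; _∷_; map; length)
  open import Data.Maybe.Base as Maybe using (Maybe; just; nothing)
  open import Data.Nat.Base using (ℕ; zero; suc; _+_; _≤_; z≤n; s≤s)
  open import Data.Nat.Properties
  open import Data.Product.Base using (Σ; ∃-syntax; _×_; _,_; proj₁; proj₂)
  open import Data.Sum.Base using (_⊎_; inj₁; inj₂; [_,_]′)
  open import Data.Vec.Base as Vec using (Vec; []; _∷_)
  open import Data.Vec.Relation.Binary.Pointwise.Inductive using (Pointwise; []; _∷_)
  open import Relation.Binary.PropositionalEquality using (_≡_; _≢_; refl; sym; trans; cong; cong₂; subst)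

  embˡ : ∀ m n → Embedding m (m + n)
  embˡ m n = record
    { emb = λ { blank → blank ; (bit b) → bit b ; (aux i) → aux (i ↑ˡ n) }
    ; ret = λ { blank → blank ; (bit b) → bit b ; (aux i) → [ aux , (λ _ → blank) ]′ (splitAt m i) }
    ; ret-emb = λ { blank → refl ; (bit b) → refl ; (aux i) → cong [ aux , (λ _ → blank) ]′ (splitAt-↑ˡ m i n) }
    ; emb-blank = refl ; emb-bit = λ _ → refl ; emb-aux = λ i → _ , refl }

  embʳ : ∀ m n → Embedding n (m + n)
  embʳ m n = record
    { emb = λ { blank → blank ; (bit b) → bit b ; (aux i) → aux (m ↑ʳ i) }
    ; ret = λ { blank → blank ; (bit b) → bit b ; (aux i) → [ (λ _ → blank) , aux ]′ (splitAt m i) }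
    ; ret-emb = λ { blank → refl ; (bit b) → refl ; (aux i) → cong [ (λ _ → blank) , aux ]′ (splitAt-↑ʳ m n i) }
    ; emb-blank = refl ; emb-bit = λ _ → refl ; emb-aux = λ i → _ , refl }

  step-nothing : ∀ M {q ts} → step M (q , ts) ≡ nothing → Machine.δ M q (Vec.map scanned ts) ≡ nothing
  step-nothing M {q} {ts} h with Machine.δ M q (Vec.map scanned ts)
  ... | nothing = refl

  step-just : ∀ M {q ts d} → step M (q , ts) ≡ just d →
    ∃[ q′ ] ∃[ a ] Machine.δ M q (Vec.map scanned ts) ≡ just (q′ , a) × d ≡ (q′ , Vec.zipWith writeMove ts a)
  step-just M {q} {ts} h with Machine.δ M q (Vec.map scanned ts)
  step-just M {q} {ts} refl | just (q′ , a) = q′ , a , refl , refl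

  module Composition (M₁ M₂ : Machine) where
    private
      module M₁ = Machine M₁
      module M₂ = Machine M₂
      w₁ = M₁.workTapes
      w₂ = M₂.workTapes
      m = M₁.auxSymbols + M₂.auxSymbols
      E₁ = embˡ M₁.auxSymbols M₂.auxSymbols
      E₂ = embʳ M₁.auxSymbols M₂.auxSymbols
      module E₁ = Embedding E₁
      module E₂ = Embedding E₂
      module S₁ = Simulation E₁
      module S₂ = Simulation E₂

    -- The tapes of M₂ come first: the input is moved from the first tape to
    -- the input tape of M₁, which leaves the tapes of M₂ empty.
    data Phase : Set where
      load pass : Bool → Phase
      run₁      : M₁.State → Phase
      run₂      : M₂.State → Phase

    private
      Acts : ℕ → Set
      Acts k = Vec (Symbol m × Move) k

      transferAct : Bool → Symbol m → Symbol m → Maybe Bool × (Symbol m × Move) × (Symbol m × Move)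
      transferAct false (bit x) b       = just false , (blank , goRight) , (bit x , goRight)
      transferAct false a       b       = just true , (a , stay) , (b , goLeft)
      transferAct true  a       (bit x) = just true , (a , stay) , (bit x , goLeft)
      transferAct true  a       b       = nothing , (a , stay) , (b , goRight)

      after₁ : Maybe (M₁.State × Vec (M₁.Sym × Move) (suc w₁)) → Vec (Symbol m) (suc w₂) → Vec (Symbol m) (suc w₁) →
        Maybe (Phase × Acts (suc w₂) × Acts (suc w₁))
      after₁ nothing         v₂ v₁ = just (pass false , idle v₂ , idle v₁)
      after₁ (just (q′ , a)) v₂ v₁ = just (run₁ q′ , idle v₂ , Vec.map S₁.embAct a)

      after₂ : Maybe (M₂.State × Vec (M₂.Sym × Move) (suc w₂)) → Vec (Symbol m) (suc w₁) →
        Maybe (Phase × Acts (suc w₂) × Acts (suc w₁))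
      after₂ nothing         v₁ = nothing
      after₂ (just (q′ , a)) v₁ = just (run₂ q′ , Vec.map S₂.embAct a , idle v₁)

      δ′ : Phase → Vec (Symbol m) (suc w₂) → Vec (Symbol m) (suc w₁) → Maybe (Phase × Acts (suc w₂) × Acts (suc w₁))
      δ′ (load c) (a ∷ v₂) (b ∷ v₁) =
        let (c′ , x , y) = transferAct c a b in just (Maybe.maybe′ load (run₁ Fin.zero) c′ , (x ∷ idle v₂) , (y ∷ idle v₁))
      δ′ (pass c) (b ∷ v₂) (a ∷ v₁) =
        let (c′ , x , y) = transferAct c a b in just (Maybe.maybe′ pass (run₂ Fin.zero) c′ , (y ∷ idle v₂) , (x ∷ idle v₁))
      δ′ (run₁ q) v₂ v₁ = after₁ (M₁.δ q (Vec.map E₁.ret v₁)) v₂ v₁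
      δ′ (run₂ q) v₂ v₁ = after₂ (M₂.δ q (Vec.map E₂.ret v₂)) v₁

      finitePhase : Finite Phase
      finitePhase = Finite-retract {(Bool ⊎ Bool) ⊎ (M₁.State ⊎ M₂.State)}
        (λ { (load b) → inj₁ (inj₁ b) ; (pass b) → inj₁ (inj₂ b) ; (run₁ q) → inj₂ (inj₁ q) ; (run₂ q) → inj₂ (inj₂ q) })
        (λ { (inj₁ (inj₁ b)) → load b ; (inj₁ (inj₂ b)) → pass b ; (inj₂ (inj₁ q)) → run₁ q ; (inj₂ (inj₂ q)) → run₂ q })
        (λ { (load b) → refl ; (pass b) → refl ; (run₁ q) → refl ; (run₂ q) → refl })
        (Finite-⊎ (Finite-⊎ Finite-Bool Finite-Bool) (Finite-⊎ Finite-Fin Finite-Fin))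

      joinActs : Phase × Acts (suc w₂) × Acts (suc w₁) → Phase × Acts (suc w₂ + suc w₁)
      joinActs (q , a , b) = q , a Vec.++ b

    automaton : Automaton
    automaton = record
      { Q = Phase ; finite = finitePhase ; entry = load false
      ; tapes = w₂ + suc w₁ ; auxs = m
      ; δ = λ q v → Maybe.map joinActs (δ′ q (proj₁ (split (suc w₂) v)) (proj₂ (split (suc w₂) v))) }

    private
      Tapes : ℕ → Set
      Tapes = Vec (Tape m)

      stepᶜ : Phase × Tapes (suc w₂ + suc w₁) → Maybe (Phase × Tapes (suc w₂ + suc w₁))
      stepᶜ = stepᴬ automaton

      step-δ′ : ∀ q (ts₂ : Tapes (suc w₂)) (ts₁ : Tapes (suc w₁)) {q′ a b} →
        δ′ q (Vec.map scanned ts₂) (Vec.map scanned ts₁) ≡ just (q′ , a , b) →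
        stepᶜ (q , ts₂ Vec.++ ts₁) ≡ just (q′ , Vec.zipWith writeMove ts₂ a Vec.++ Vec.zipWith writeMove ts₁ b)
      step-δ′ q ts₂ ts₁ {q′} {a} {b} eq
        rewrite map-scanned-++ ts₂ ts₁ | split-++ (Vec.map scanned ts₂) (Vec.map scanned ts₁) | eq
        = cong (λ ts → just (q′ , ts)) (zipWith-writeMove-++ ts₂ ts₁ a b)

      step-δ′-nothing : ∀ q (ts₂ : Tapes (suc w₂)) (ts₁ : Tapes (suc w₁)) →
        δ′ q (Vec.map scanned ts₂) (Vec.map scanned ts₁) ≡ nothing → stepᶜ (q , ts₂ Vec.++ ts₁) ≡ nothing
      step-δ′-nothing q ts₂ ts₁ eq
        rewrite map-scanned-++ ts₂ ts₁ | split-++ (Vec.map scanned ts₂) (Vec.map scanned ts₁) | eq = refl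

      transferAct-end : ∀ a b → (∀ x → a ≢ bit x) → transferAct false a b ≡ (just true , (a , stay) , (b , goLeft))
      transferAct-end blank   b n = refl
      transferAct-end (bit x) b n = ⊥-elim (n x refl)
      transferAct-end (aux i) b n = refl

      transferAct-done : ∀ a b → (∀ x → b ≢ bit x) → transferAct true a b ≡ (nothing , (a , stay) , (b , goRight))
      transferAct-done a blank   n = refl
      transferAct-done a (bit x) n = ⊥-elim (n x refl)
      transferAct-done a (aux i) n = refl

      load-step : ∀ c t u ts₂ ts₁ {c′ x y} → transferAct c (scanned t) (scanned u) ≡ (c′ , x , y) →
        stepᶜ (load c , (t ∷ ts₂) Vec.++ (u ∷ ts₁)) ≡
          just (Maybe.maybe′ load (run₁ Fin.zero) c′ , (writeMove t x ∷ ts₂) Vec.++ (writeMove u y ∷ ts₁))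
      load-step c t u ts₂ ts₁ {c′} {x} {y} eq =
        trans (step-δ′ (load c) (t ∷ ts₂) (u ∷ ts₁)
                (cong (λ (c′ , x , y) → just (Maybe.maybe′ load (run₁ Fin.zero) c′ , (x ∷ _) , (y ∷ _))) eq))
              (cong₂ (λ us vs → just (Maybe.maybe′ load (run₁ Fin.zero) c′ , (writeMove t x ∷ us) Vec.++ (writeMove u y ∷ vs)))
                (zipWith-idle ts₂) (zipWith-idle ts₁))

      pass-step : ∀ c t u ts₂ ts₁ {c′ x y} → transferAct c (scanned t) (scanned u) ≡ (c′ , x , y) →
        stepᶜ (pass c , (u ∷ ts₂) Vec.++ (t ∷ ts₁)) ≡
          just (Maybe.maybe′ pass (run₂ Fin.zero) c′ , (writeMove u y ∷ ts₂) Vec.++ (writeMove t x ∷ ts₁))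
      pass-step c t u ts₂ ts₁ {c′} {x} {y} eq =
        trans (step-δ′ (pass c) (u ∷ ts₂) (t ∷ ts₁)
                (cong (λ (c′ , x , y) → just (Maybe.maybe′ pass (run₂ Fin.zero) c′ , (y ∷ _) , (x ∷ _))) eq))
              (cong₂ (λ us vs → just (Maybe.maybe′ pass (run₂ Fin.zero) c′ , (writeMove u y ∷ us) Vec.++ (writeMove t x ∷ vs)))
                (zipWith-idle ts₂) (zipWith-idle ts₁))

      transferAct-bit : ∀ a b x → a ≡ bit x → transferAct false a b ≡ (just false , (blank , goRight) , (bit x , goRight))
      transferAct-bit _ b x refl = refl

      transferAct-rewind : ∀ a b x → b ≡ bit x → transferAct true a b ≡ (just true , (a , stay) , (b , goLeft))
      transferAct-rewind blank   _ x refl = refl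
      transferAct-rewind (bit y) _ x refl = refl
      transferAct-rewind (aux i) _ x refl = refl

      module Load ts₂ ts₁ = Transfer stepᶜ (λ c t u → load c , (t ∷ ts₂) Vec.++ (u ∷ ts₁))
        (λ t u → run₁ Fin.zero , (t ∷ ts₂) Vec.++ (u ∷ ts₁))
        (λ t u b eq → load-step false t u ts₂ ts₁ (transferAct-bit _ _ b eq))
        (λ t u n → load-step false t u ts₂ ts₁ (transferAct-end _ _ n))
        (λ t u b eq → load-step true t u ts₂ ts₁ (transferAct-rewind _ _ b eq))
        (λ t u n → load-step true t u ts₂ ts₁ (transferAct-done _ _ n))

      module Pass ts₂ ts₁ = Transfer stepᶜ (λ c t u → pass c , (u ∷ ts₂) Vec.++ (t ∷ ts₁))
        (λ t u → run₂ Fin.zero , (u ∷ ts₂) Vec.++ (t ∷ ts₁))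
        (λ t u b eq → pass-step false t u ts₂ ts₁ (transferAct-bit _ _ b eq))
        (λ t u n → pass-step false t u ts₂ ts₁ (transferAct-end _ _ n))
        (λ t u b eq → pass-step true t u ts₂ ts₁ (transferAct-rewind _ _ b eq))
        (λ t u n → pass-step true t u ts₂ ts₁ (transferAct-done _ _ n))

      run₁-sim : ∀ {n q ts d us} → Run (step M₁) n (q , ts) (d , us) → step M₁ (d , us) ≡ nothing →
        (ts₂ : Tapes (suc w₂)) (ts′ : Tapes (suc w₁)) → Pointwise S₁.Sim ts ts′ →
        Σ (Tapes (suc w₁)) λ us′ → Run stepᶜ (n + 1) (run₁ q , ts₂ Vec.++ ts′) (pass false , ts₂ Vec.++ us′) × Pointwise S₁.Sim us us′
      run₁-sim {q = q} {ts} done h ts₂ ts′ s = ts′ ,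
        more (trans (step-δ′ (run₁ q) ts₂ ts′
                      (cong (λ r → after₁ r (Vec.map scanned ts₂) (Vec.map scanned ts′)) (trans (cong (M₁.δ q) (S₁.sims-scanned s)) (step-nothing M₁ h))))
                    (cong₂ (λ a b → just (pass false , a Vec.++ b)) (zipWith-idle ts₂) (zipWith-idle ts′))) done , s
      run₁-sim {q = q} (more p r) h ts₂ ts′ s with step-just M₁ p
      ... | q′ , a , eq , refl with run₁-sim r h ts₂ (Vec.zipWith writeMove ts′ (Vec.map S₁.embAct a)) (S₁.sims-write s a)
      ... | us′ , r′ , s′ = us′ ,
        more (trans (step-δ′ (run₁ q) ts₂ ts′ (cong (λ r → after₁ r (Vec.map scanned ts₂) (Vec.map scanned ts′)) (trans (cong (M₁.δ q) (S₁.sims-scanned s)) eq)))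
                    (cong (λ b → just (run₁ q′ , b Vec.++ Vec.zipWith writeMove ts′ (Vec.map S₁.embAct a))) (zipWith-idle ts₂))) r′ , s′

      run₂-sim : ∀ {n q ts d us} → Run (step M₂) n (q , ts) (d , us) → step M₂ (d , us) ≡ nothing →
        (ts′ : Tapes (suc w₂)) (ts₁ : Tapes (suc w₁)) → Pointwise S₂.Sim ts ts′ →
        Σ (Tapes (suc w₂)) λ us′ → Run stepᶜ n (run₂ q , ts′ Vec.++ ts₁) (run₂ d , us′ Vec.++ ts₁)
          × Pointwise S₂.Sim us us′ × stepᶜ (run₂ d , us′ Vec.++ ts₁) ≡ nothing
      run₂-sim {q = q} done h ts′ ts₁ s = ts′ , done , s , step-δ′-nothing (run₂ q) ts′ ts₁
        (cong (λ r → after₂ r (Vec.map scanned ts₁)) (trans (cong (M₂.δ q) (S₂.sims-scanned s)) (step-nothing M₂ h)))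
      run₂-sim {q = q} (more p r) h ts′ ts₁ s with step-just M₂ p
      ... | q′ , a , eq , refl with run₂-sim r h (Vec.zipWith writeMove ts′ (Vec.map S₂.embAct a)) ts₁ (S₂.sims-write s a)
      ... | us′ , r′ , s′ , h′ = us′ ,
        more (trans (step-δ′ (run₂ q) ts′ ts₁ (cong (λ r → after₂ r (Vec.map scanned ts₁)) (trans (cong (M₂.δ q) (S₂.sims-scanned s)) eq)))
                    (cong (λ b → just (run₂ q′ , Vec.zipWith writeMove ts′ (Vec.map S₂.embAct a) Vec.++ b)) (zipWith-idle ts₁))) r′ , s′ , h′

      replicate-++ : ∀ {A : Set} k l (x : A) → Vec.replicate (k + l) x ≡ Vec.replicate k x Vec.++ Vec.replicate l x
      replicate-++ zero    l x = refl
      replicate-++ (suc k) l x = cong (x ∷_) (replicate-++ k l x)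

      leading-input : ∀ x → leadingBits {m} (scanned (fromSymbols (map bit x)) ∷ rightOf (fromSymbols (map bit x))) ≡ x
      leading-input []      = refl
      leading-input (b ∷ x) = cong (b ∷_) (go x)
        where
        go : ∀ x → leadingBits {m} (map bit x) ≡ x
        go []      = refl
        go (b ∷ x) = cong (b ∷_) (go x)

      beyond : ∀ (x : List Bool) i → ahead {m} (fromSymbols (map bit x)) (length x + i) ≡ blank
      beyond []          zero    = refl
      beyond []          (suc i) = refl
      beyond (b ∷ [])    i       = refl
      beyond (b ∷ c ∷ x) i       = beyond (c ∷ x) i

    compose : Machine
    compose = machine automaton

    compose-time : ℕ → ℕ → ℕ → ℕ → ℕ
    compose-time t₁ t₂ lx ly = (suc lx + suc lx) + ((t₁ + 1) + ((suc ly + suc ly) + t₂))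

    -- Four runs are joined: the input is loaded for `M₁`, `M₁` runs, its output is passed to the
    -- first tape, which the loading has left blank, and `M₂` runs there.
    compose-outputs : ∀ {t₁ t₂ x y z} → OutputsWithin M₁ t₁ x y → OutputsWithin M₂ t₂ y z →
      OutputsWithin compose (compose-time t₁ t₂ (length x) (length y)) x z
    compose-outputs {t₁} {t₂} {x} {y} {z} (n₁ , (d₁ , us₁) , n₁≤ , h₁ , out₁) (n₂ , (d₂ , us₂) , n₂≤ , h₂ , out₂)
      with Load.transfer (Vec.replicate w₂ (fromSymbols [])) (Vec.replicate w₁ (fromSymbols [])) x
             (fromSymbols (map bit x)) (fromSymbols []) (leading-input x) (λ i → refl) (λ { zero → refl ; (suc i) → refl })
    ... | t′ , u′ , r₀ , ul , ua , tl , ta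
      with run₁-sim (proj₁ (halts⇒run h₁)) (proj₂ (halts⇒run h₁)) (t′ ∷ Vec.replicate w₂ (fromSymbols [])) (u′ ∷ Vec.replicate w₁ (fromSymbols []))
             (S₁.sim-input x ua ul ∷ S₁.sims-empty w₁)
    compose-outputs {t₁} {t₂} {x} {y} {z} (n₁ , (d₁ , (v₁ ∷ us₁)) , n₁≤ , h₁ , out₁) (n₂ , (d₂ , (v₂ ∷ us₂)) , n₂≤ , h₂ , out₂)
      | t′ , u′ , r₀ , ul , ua , tl , ta | (v₁′ ∷ us₁′) , r₁ , (s₁ ∷ ss₁)
      with Pass.transfer (Vec.replicate w₂ (fromSymbols [])) us₁′ y v₁′ t′ (trans (S₁.sim-output s₁) out₁)
             (tl (S₁.left-fromBits x)) (λ i → trans (ta i) (beyond x i))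
    ... | t″ , u″ , r₂ , ul′ , ua′ , _ , _
      with run₂-sim (proj₁ (halts⇒run h₂)) (proj₂ (halts⇒run h₂)) (u″ ∷ Vec.replicate w₂ (fromSymbols [])) (t″ ∷ us₁′)
             (S₂.sim-input y ua′ ul′ ∷ S₂.sims-empty w₂)
    ... | (v₂′ ∷ us₂′) , r₃ , (s₂ ∷ ss₂) , stop
      with machine-halts automaton (r₀ ++ᴿ (r₁ ++ᴿ (r₂ ++ᴿ r₃))) stop
    ... | j , H = _ , (j , (v₂′ ∷ us₂′) Vec.++ (t″ ∷ us₁′)) ,
      +-monoʳ-≤ (suc (length x) + suc (length x)) (+-mono-≤ (+-monoˡ-≤ 1 n₁≤) (+-monoʳ-≤ (suc (length y) + suc (length y)) n₂≤)) ,
      subst (λ ts → HaltsIn compose _ (Fin.zero , fromSymbols (map bit x) ∷ ts) (j , (v₂′ ∷ us₂′) Vec.++ (t″ ∷ us₁′))) (sym (replicate-++ w₂ (suc w₁) _)) H ,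
      trans (S₂.sim-output s₂) out₂

  tapeLength : ∀ {m} → Tape m → ℕ
  tapeLength t = length (leftOf t) + length (rightOf t)

  tapeLength-write : ∀ {m} (t : Tape m) a → tapeLength (writeMove t a) ≤ suc (tapeLength t)
  tapeLength-write (tape [] _ rs)       (s , goLeft)  = ≤-refl
  tapeLength-write (tape (l ∷ ls) _ rs) (s , goLeft)  = ≤-trans (≤-reflexive (+-suc (length ls) (length rs))) (n≤1+n _)
  tapeLength-write (tape ls _ rs)       (s , stay)    = n≤1+n _
  tapeLength-write (tape ls _ [])       (s , goRight) = ≤-refl
  tapeLength-write (tape ls _ (r ∷ rs)) (s , goRight) = s≤s (+-monoʳ-≤ (length ls) (n≤1+n _))

  leadingBits-length : ∀ {m} (l : List (Symbol m)) → length (leadingBits l) ≤ length l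
  leadingBits-length []            = z≤n
  leadingBits-length (blank ∷ l)   = z≤n
  leadingBits-length (bit b ∷ l)   = s≤s (leadingBits-length l)
  leadingBits-length (aux i ∷ l)   = z≤n

  firstTape : ∀ {A : Set} {k} → Vec A (suc k) → A
  firstTape (t ∷ _) = t

  run-tapeLength : ∀ M {n c d} → Run (step M) n c d → tapeLength (firstTape (proj₂ d)) ≤ n + tapeLength (firstTape (proj₂ c))
  run-tapeLength M done = ≤-refl
  run-tapeLength M {suc n} {q , (t ∷ ts)} (more p r) with Machine.δ M q (scanned t ∷ Vec.map scanned ts)
  run-tapeLength M {suc n} {q , (t ∷ ts)} (more refl r) | just (q′ , a ∷ as) =
    ≤-trans (run-tapeLength M r) (≤-trans (+-monoʳ-≤ n (tapeLength-write t a)) (≤-reflexive (+-suc n _)))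

  -- The first tape grows by at most one cell per step; the extra unit is the scanned cell, which
  -- `tapeLength` leaves out. The bound turns a polynomial in the length of an intermediate word
  -- into one in the length of the input.
  output-length : ∀ {M t x y} → OutputsWithin M t x y → length y ≤ suc (t + length x)
  output-length {M} {t} {x} {y} (n , (d , v ∷ us) , n≤ , h , refl) =
    ≤-trans (leadingBits-length (scanned v ∷ rightOf v)) (s≤s (≤-trans (m≤n+m _ (length (leftOf v)))
      (≤-trans (run-tapeLength M (proj₁ (halts⇒run h))) (+-mono-≤ n≤ (inputLength x)))))
    where
    inputLength : ∀ {m} x → tapeLength {m} (fromSymbols (map bit x)) ≤ length x
    inputLength []      = z≤n
    inputLength (b ∷ x) = ≤-trans (≤-reflexive (length-map′ x)) (n≤1+n _)
      where
      length-map′ : ∀ {m} (x : List Bool) → length (map (bit {m}) x) ≡ length x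
      length-map′ []      = refl
      length-map′ (b ∷ x) = cong suc (length-map′ x)

-- Programs on three stacks and their compilation to machines with three tapes.

module StackPrograms where

  open import Defs
  open Automata
  open import Data.Bool.Base using (Bool; true; false)
  open import Data.Fin.Base as Fin using (Fin)
  open import Data.List.Base using (List; []; _∷_; map)
  open import Data.Maybe.Base as Maybe using (Maybe; just; nothing; maybe′)
  open import Data.Nat.Base using (ℕ; zero; suc; _+_; _≤_)
  open import Data.Product.Base using (∃-syntax; _×_; _,_)
  open import Data.Sum.Base using (_⊎_; inj₁; inj₂)
  open import Data.Unit.Base using (⊤; tt)
  open import Data.Vec.Base as Vec using (Vec; []; _∷_; _[_]≔_)
  open import Data.Vec.Relation.Binary.Pointwise.Inductive as Pointwise using (Pointwise; []; _∷_)
  open import Function.Base using (_∘_)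
  open import Relation.Binary.PropositionalEquality using (_≡_; refl; sym; trans; cong; subst)

  -- Marks separate the words lying on one stack, so that a program can run on top of data which it
  -- must not touch.
  data Letter : Set where
    bt   : Bool → Letter
    mark : Letter

  Register : Set
  Register = Fin 3

  Stacks : Set
  Stacks = Vec (List Letter) 3

  data Prog : Set where
    skip : Prog
    push : Register → Letter → Prog
    _⨾_  : Prog → Prog → Prog
    -- pop a register and branch; the last argument handles a mark or an empty stack
    case : Register → (Bool → Prog) → Prog → Prog
    -- pop a register and run the body, up to and including the first mark
    each : Register → (Bool → Prog) → Prog

  infixr 5 _⨾_

  -- The index counts machine steps exactly: a pop and its branch are one step, while a push takes
  -- two because the head first moves left onto a free cell.
  data _⊢_⇓[_]_ : Prog → Stacks → ℕ → Stacks → Set where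
    ⇓skip : ∀ {s} → skip ⊢ s ⇓[ 1 ] s
    ⇓push : ∀ {r a s} → push r a ⊢ s ⇓[ 2 ] (s [ r ]≔ (a ∷ Vec.lookup s r))
    ⇓seq  : ∀ {p q s s′ s″ n m} → p ⊢ s ⇓[ n ] s′ → q ⊢ s′ ⇓[ m ] s″ → (p ⨾ q) ⊢ s ⇓[ n + m ] s″
    ⇓case-bt   : ∀ {r p e s s′ n b w} → Vec.lookup s r ≡ bt b ∷ w → p b ⊢ s [ r ]≔ w ⇓[ n ] s′ → case r p e ⊢ s ⇓[ suc n ] s′
    ⇓case-mark : ∀ {r p e s s′ n w} → Vec.lookup s r ≡ mark ∷ w → e ⊢ s [ r ]≔ w ⇓[ n ] s′ → case r p e ⊢ s ⇓[ suc n ] s′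
    ⇓each-bt   : ∀ {r p s s′ s″ n m b w} → Vec.lookup s r ≡ bt b ∷ w → p b ⊢ s [ r ]≔ w ⇓[ n ] s′ →
                   each r p ⊢ s′ ⇓[ m ] s″ → each r p ⊢ s ⇓[ suc (n + m) ] s″
    ⇓each-mark : ∀ {r p s w} → Vec.lookup s r ≡ mark ∷ w → each r p ⊢ s ⇓[ 1 ] (s [ r ]≔ w)
    ⇓each-[]   : ∀ {r p s} → Vec.lookup s r ≡ [] → each r p ⊢ s ⇓[ 1 ] s

  infix 4 _⊢_⇓[_]_

  private
    Sym₁ : Set
    Sym₁ = Symbol 1

    Acts : Set
    Acts = Vec (Sym₁ × Move) 3

    Tapes : Set
    Tapes = Vec (Tape 1) 3

    letter : Letter → Sym₁
    letter (bt b) = bit b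
    letter mark   = aux Fin.zero

    -- States are control points: every part contributes its own, and a test or a loop has one more,
    -- in which it pops.
    St : Prog → Set
    St skip         = ⊤
    St (push r a)   = Bool
    St (p ⨾ q)      = St p ⊎ St q
    St (case r p e) = ⊤ ⊎ ((St (p false) ⊎ St (p true)) ⊎ St e)
    St (each r p)   = ⊤ ⊎ (St (p false) ⊎ St (p true))

    finiteSt : ∀ p → Finite (St p)
    finiteSt skip         = Finite-⊤
    finiteSt (push r a)   = Finite-Bool
    finiteSt (p ⨾ q)      = Finite-⊎ (finiteSt p) (finiteSt q)
    finiteSt (case r p e) = Finite-⊎ Finite-⊤ (Finite-⊎ (Finite-⊎ (finiteSt (p false)) (finiteSt (p true))) (finiteSt e))
    finiteSt (each r p)   = Finite-⊎ Finite-⊤ (Finite-⊎ (finiteSt (p false)) (finiteSt (p true)))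

    first : ∀ p → St p
    first skip         = tt
    first (push r a)   = false
    first (p ⨾ q)      = inj₁ (first p)
    first (case r p e) = inj₁ tt
    first (each r p)   = inj₁ tt

    branch : ∀ (p : Bool → Prog) b → St (p b) → St (p false) ⊎ St (p true)
    branch p false = inj₁
    branch p true  = inj₂

    act : Register → Sym₁ × Move → Vec Sym₁ 3 → Acts
    act r a v = idle v [ r ]≔ a

    -- A part that finishes answers `nothing`. `κ` says where control goes then, and `nothing` for
    -- `κ` means that the enclosing program finishes in the same step. So leaving a part costs no
    -- extra step.
    onward : ∀ {Q Q′ : Set} → (Q → Q′) → Maybe Q′ → Maybe Q × Acts → Maybe Q′ × Acts
    onward ι κ (q , a) = maybe′ (just ∘ ι) κ q , a

    caseδ : ∀ (r : Register) {Q : Set} → (Bool → Q) → Q → Sym₁ → Vec Sym₁ 3 → Maybe Q × Acts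
    caseδ r p e (bit b) v = just (p b) , act r (blank , goRight) v
    caseδ r p e (aux i) v = just e , act r (blank , goRight) v
    caseδ r p e blank   v = just e , idle v

    eachδ : ∀ (r : Register) {Q : Set} → (Bool → Q) → Sym₁ → Vec Sym₁ 3 → Maybe Q × Acts
    eachδ r p (bit b) v = just (p b) , act r (blank , goRight) v
    eachδ r p (aux i) v = nothing , act r (blank , goRight) v
    eachδ r p blank   v = nothing , idle v

    δᴾ : ∀ p → St p → Vec Sym₁ 3 → Maybe (St p) × Acts
    δᴾ skip         q        v = nothing , idle v
    δᴾ (push r a)   false    v = just true , act r (Vec.lookup v r , goLeft) v
    δᴾ (push r a)   true     v = nothing , act r (letter a , stay) v
    δᴾ (p ⨾ p′)     (inj₁ q) v = onward inj₁ (just (inj₂ (first p′))) (δᴾ p q v)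
    δᴾ (p ⨾ p′)     (inj₂ q) v = onward inj₂ nothing (δᴾ p′ q v)
    δᴾ (case r p e) (inj₁ _) v = caseδ r (λ b → inj₂ (inj₁ (branch p b (first (p b))))) (inj₂ (inj₂ (first e))) (Vec.lookup v r) v
    δᴾ (case r p e) (inj₂ (inj₁ (inj₁ q))) v = onward (inj₂ ∘ inj₁ ∘ inj₁) nothing (δᴾ (p false) q v)
    δᴾ (case r p e) (inj₂ (inj₁ (inj₂ q))) v = onward (inj₂ ∘ inj₁ ∘ inj₂) nothing (δᴾ (p true) q v)
    δᴾ (case r p e) (inj₂ (inj₂ q)) v = onward (inj₂ ∘ inj₂) nothing (δᴾ e q v)
    δᴾ (each r p)   (inj₁ _) v = eachδ r (λ b → inj₂ (branch p b (first (p b)))) (Vec.lookup v r) v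
    δᴾ (each r p)   (inj₂ (inj₁ q)) v = onward (inj₂ ∘ inj₁) (just (inj₁ tt)) (δᴾ (p false) q v)
    δᴾ (each r p)   (inj₂ (inj₂ q)) v = onward (inj₂ ∘ inj₂) (just (inj₁ tt)) (δᴾ (p true) q v)

    data Exec {Q : Set} (δ : Q → Vec Sym₁ 3 → Maybe Q × Acts) : ℕ → Q → Tapes → Tapes → Set where
      stop : ∀ {q ts a} → δ q (Vec.map scanned ts) ≡ (nothing , a) → Exec δ 1 q ts (Vec.zipWith writeMove ts a)
      go   : ∀ {n q q′ ts ts′ a} → δ q (Vec.map scanned ts) ≡ (just q′ , a) →
               Exec δ n q′ (Vec.zipWith writeMove ts a) ts′ → Exec δ (suc n) q ts ts′

    module _ {Q Q′ : Set} {δ : Q → Vec Sym₁ 3 → Maybe Q × Acts} {δ′ : Q′ → Vec Sym₁ 3 → Maybe Q′ × Acts} (ι : Q → Q′) where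

      exit : (∀ q v → δ′ (ι q) v ≡ onward ι nothing (δ q v)) → ∀ {n q ts ts′} → Exec δ n q ts ts′ → Exec δ′ n (ι q) ts ts′
      exit eq (stop p) = stop (trans (eq _ _) (cong (onward ι nothing) p))
      exit eq (go p r) = go (trans (eq _ _) (cong (onward ι nothing) p)) (exit eq r)

      continue : ∀ q₂ → (∀ q v → δ′ (ι q) v ≡ onward ι (just q₂) (δ q v)) →
        ∀ {n m q ts ts′ ts″} → Exec δ n q ts ts′ → Exec δ′ m q₂ ts′ ts″ → Exec δ′ (n + m) (ι q) ts ts″
      continue q₂ eq (stop p) s = go (trans (eq _ _) (cong (onward ι (just q₂)) p)) s
      continue q₂ eq (go p r) s = go (trans (eq _ _) (cong (onward ι (just q₂)) p)) (continue q₂ eq r s)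

    -- The top of the stack is under the head and everything to the left is blank: a push moves left
    -- into free space, and a pop restores this by writing a blank before it moves right.
    record Rep (t : Tape 1) (w : List Letter) : Set where
      constructor rep
      field
        repAhead : ∀ i → ahead t i ≡ nth (map letter w) i
        repLeft  : ∀ i → nth (leftOf t) i ≡ blank

    open Rep

    Reps : Tapes → Stacks → Set
    Reps = Pointwise Rep

    zipWith-act : ∀ {k m} (ts : Vec (Tape m) k) r a →
      Vec.zipWith writeMove ts (idle (Vec.map scanned ts) [ r ]≔ a) ≡ ts [ r ]≔ writeMove (Vec.lookup ts r) a
    zipWith-act (t ∷ ts) Fin.zero    a = cong (_ ∷_) (zipWith-idle ts)
    zipWith-act (t ∷ ts) (Fin.suc r) a = cong (_ ∷_) (zipWith-act ts r a)

    lookup-scanned : ∀ {k m} (ts : Vec (Tape m) k) r → Vec.lookup (Vec.map scanned ts) r ≡ scanned (Vec.lookup ts r)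
    lookup-scanned (t ∷ ts) Fin.zero    = refl
    lookup-scanned (t ∷ ts) (Fin.suc r) = lookup-scanned ts r

    update : ∀ {k} {ts : Vec (Tape 1) k} {s} r {t w} → Pointwise Rep ts s → Rep t w → Pointwise Rep (ts [ r ]≔ t) (s [ r ]≔ w)
    update Fin.zero    (_ ∷ ps) p = p ∷ ps
    update (Fin.suc r) (q ∷ ps) p = q ∷ update r ps p

    update² : ∀ {A : Set} {k} (ts : Vec A k) r t u → (ts [ r ]≔ t) [ r ]≔ u ≡ ts [ r ]≔ u
    update² (_ ∷ ts) Fin.zero    t u = refl
    update² (_ ∷ ts) (Fin.suc r) t u = cong (_ ∷_) (update² ts r t u)

    lookup-update : ∀ {A : Set} {k} (ts : Vec A k) r t → Vec.lookup (ts [ r ]≔ t) r ≡ t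
    lookup-update (_ ∷ ts) Fin.zero    t = refl
    lookup-update (_ ∷ ts) (Fin.suc r) t = lookup-update ts r t

    peek : ∀ {ts s} r → Reps ts s → Vec.lookup (Vec.map scanned ts) r ≡ nth (map letter (Vec.lookup s r)) 0
    peek {ts} r ps = trans (lookup-scanned ts r) (repAhead (Pointwise.lookup ps r) 0)

    rep-pop : ∀ {t a w} → Rep t (a ∷ w) → Rep (writeMove t (blank , goRight)) w
    rep-pop {t} (rep h l) = rep
      (λ { zero → trans (scanned-goRight u) (h 1) ; (suc i) → trans (nth-right-goRight u i) (h (suc (suc i))) })
      (λ { zero → cong (λ l → nth l 0) (left-goRight u) ; (suc i) → trans (cong (λ l → nth l (suc i)) (left-goRight u)) (l i) })
      where
      u = tape (leftOf t) blank (rightOf t)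

    rep-push : ∀ {t w} a → Rep t w → Rep (writeMove (writeMove t (scanned t , goLeft)) (letter a , stay)) (a ∷ w)
    rep-push {t} a (rep h l) = rep
      (λ { zero → refl
         ; (suc zero) → trans (cong (λ l → nth l 0) (right-goLeft t)) (h 0)
         ; (suc (suc i)) → trans (cong (λ l → nth l (suc i)) (right-goLeft t)) (h (suc i)) })
      (λ i → trans (nth-left-goLeft t i) (l (suc i)))

    pop-ok : ∀ {ts s a w} r → Reps ts s → Vec.lookup s r ≡ a ∷ w →
      Reps (Vec.zipWith writeMove ts (act r (blank , goRight) (Vec.map scanned ts))) (s [ r ]≔ w)
    pop-ok {ts} {s} {a} {w} r ps eq rewrite zipWith-act ts r (blank , goRight) =
      update r ps (rep-pop (subst (Rep _) eq (Pointwise.lookup ps r)))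

    simulate : ∀ {p s n s′ ts} → p ⊢ s ⇓[ n ] s′ → Reps ts s → ∃[ ts′ ] Exec (δᴾ p) n (first p) ts ts′ × Reps ts′ s′
    simulate {ts = ts} ⇓skip ps = _ , stop refl , subst (λ ts → Reps ts _) (sym (zipWith-idle ts)) ps
    simulate {ts = ts} (⇓push {r} {a} {s}) ps = _ , go refl (stop refl) , subst (λ ts → Reps ts _) (sym eq) (update r ps (rep-push a (Pointwise.lookup ps r)))
      where
      tᵣ = Vec.lookup ts r
      ts₁ = Vec.zipWith writeMove ts (act r (Vec.lookup (Vec.map scanned ts) r , goLeft) (Vec.map scanned ts))
      eq₁ : ts₁ ≡ ts [ r ]≔ writeMove tᵣ (scanned tᵣ , goLeft)
      eq₁ = trans (zipWith-act ts r _) (cong (λ s → ts [ r ]≔ writeMove tᵣ (s , goLeft)) (lookup-scanned ts r))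
      eq : Vec.zipWith writeMove ts₁ (act r (letter a , stay) (Vec.map scanned ts₁)) ≡
           ts [ r ]≔ writeMove (writeMove tᵣ (scanned tᵣ , goLeft)) (letter a , stay)
      eq = trans (zipWith-act ts₁ r _) (trans (cong (λ us → us [ r ]≔ writeMove (Vec.lookup us r) (letter a , stay)) eq₁)
             (trans (update² ts r _ _) (cong (λ u → ts [ r ]≔ writeMove u (letter a , stay)) (lookup-update ts r _))))
    simulate (⇓seq d e) ps with simulate d ps
    ... | us , r , qs with simulate e qs
    ... | vs , r′ , rs = vs , continue inj₁ _ (λ _ _ → refl) r (exit inj₂ (λ _ _ → refl) r′) , rs
    simulate {ts = ts} (⇓case-bt {r} {p} {e} {b = b} eq d) ps with simulate d (pop-ok r ps eq)
    ... | us , x , qs = us , go (cong (λ c → caseδ r _ _ c (Vec.map scanned ts)) (trans (peek r ps) (cong (λ w → nth (map letter w) 0) eq))) (within b x) , qs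
      where
      within : ∀ b {n ts us} → Exec (δᴾ (p b)) n (first (p b)) ts us →
        Exec (δᴾ (case r p e)) n (inj₂ (inj₁ (branch p b (first (p b))))) ts us
      within false = exit (inj₂ ∘ inj₁ ∘ inj₁) (λ _ _ → refl)
      within true  = exit (inj₂ ∘ inj₁ ∘ inj₂) (λ _ _ → refl)
    simulate {ts = ts} (⇓case-mark {r} eq d) ps with simulate d (pop-ok r ps eq)
    ... | us , x , qs = us , go (cong (λ c → caseδ r _ _ c (Vec.map scanned ts)) (trans (peek r ps) (cong (λ w → nth (map letter w) 0) eq)))
                                (exit (inj₂ ∘ inj₂) (λ _ _ → refl) x) , qs
    simulate {ts = ts} (⇓each-bt {r} {p} {b = b} eq d e) ps with simulate d (pop-ok r ps eq)
    ... | us , x , qs with simulate e qs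
    ... | vs , y , rs = vs , go (cong (λ c → eachδ r _ c (Vec.map scanned ts)) (trans (peek r ps) (cong (λ w → nth (map letter w) 0) eq))) (within b x y) , rs
      where
      within : ∀ b {n m ts us vs} → Exec (δᴾ (p b)) n (first (p b)) ts us → Exec (δᴾ (each r p)) m (inj₁ tt) us vs →
        Exec (δᴾ (each r p)) (n + m) (inj₂ (branch p b (first (p b)))) ts vs
      within false = continue (inj₂ ∘ inj₁) _ (λ _ _ → refl)
      within true  = continue (inj₂ ∘ inj₂) _ (λ _ _ → refl)
    simulate {ts = ts} (⇓each-mark {r} eq) ps = _ ,
      stop (cong (λ c → eachδ r _ c (Vec.map scanned ts)) (trans (peek r ps) (cong (λ w → nth (map letter w) 0) eq))) , pop-ok r ps eq
    simulate {ts = ts} (⇓each-[] {r} eq) ps = _ ,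
      stop (cong (λ c → eachδ r _ c (Vec.map scanned ts)) (trans (peek r ps) (cong (λ w → nth (map letter w) 0) eq))) ,
      subst (λ ts → Reps ts _) (sym (zipWith-idle ts)) ps

    automaton : Prog → Automaton
    automaton p = record
      { Q = Maybe (St p) ; finite = Finite-Maybe (finiteSt p) ; entry = just (first p) ; tapes = 2 ; auxs = 1
      ; δ = λ q v → Maybe.map (λ q → δᴾ p q v) q }

    exec-run : ∀ {p n q ts ts′} → Exec (δᴾ p) n q ts ts′ → Run (stepᴬ (automaton p)) n (just q , ts) (nothing , ts′)
    exec-run (stop {ts = ts} eq) = more (cong (λ (q , a) → just (q , Vec.zipWith writeMove ts a)) eq) done
    exec-run (go {ts = ts} eq r) = more (cong (λ (q , a) → just (q , Vec.zipWith writeMove ts a)) eq) (exec-run r)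

  infixr 5 _▹_

  _▹_ : List Bool → List Letter → List Letter
  []      ▹ w = mark ∷ w
  (b ∷ x) ▹ w = bt b ∷ (x ▹ w)

  private
    leading-block : ∀ x w (l : List Sym₁) → (∀ i → nth l i ≡ nth (map letter (x ▹ w)) i) → leadingBits l ≡ x
    leading-block []      w []       eq = refl
    leading-block []      w (s ∷ l)  eq with s | eq 0
    ... | .(aux Fin.zero) | refl = refl
    leading-block (b ∷ x) w []       eq with eq 0
    ... | ()
    leading-block (b ∷ x) w (s ∷ l)  eq with s | eq 0
    ... | .(bit b) | refl = cong (b ∷_) (leading-block x w l (λ i → eq (suc i)))

    rep-input : ∀ x → Rep (fromSymbols (map bit x)) (map bt x)
    rep-input []      = rep (λ { zero → refl ; (suc i) → refl }) (λ _ → refl)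
    rep-input (b ∷ x) = rep (λ { zero → refl ; (suc i) → bits x i }) (λ _ → refl)
      where
      bits : ∀ x i → nth (map bit x) i ≡ nth (map letter (map bt x)) i
      bits []      i       = refl
      bits (b ∷ x) zero    = refl
      bits (b ∷ x) (suc i) = bits x i

  compile : Prog → Machine
  compile p = machine (automaton p)

  -- The result only has to be the topmost word of the first stack. Its mark ends the output string,
  -- so what lies below it or on the other stacks may be garbage.
  compile-outputs : ∀ {p x y w n t ξ η} → p ⊢ map bt x ∷ [] ∷ [] ∷ [] ⇓[ n ] (y ▹ w) ∷ ξ ∷ η ∷ [] → n ≤ t →
    OutputsWithin (compile p) t x y
  compile-outputs {p} {x} {y} {w} d n≤t with simulate d (rep-input x ∷ rep-input [] ∷ rep-input [] ∷ [])
  ... | (t₀ ∷ us) , r , (q ∷ qs) with machine-halts (automaton p) (exec-run r) refl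
  ... | j , H = _ , (j , t₀ ∷ us) , n≤t , H , leading-block y w _ (repAhead q)

-- Polynomially bounded programs and their combinators.

module Computable where

  open import Defs
  open StackPrograms
  open import Data.Bool.Base using (Bool; true; false)
  import Data.Fin.Base as Fin
  open import Data.List.Base using (List; []; _∷_; _++_; map; length; _ʳ++_; concatMap)
  open import Data.List.Properties using (ʳ++-ʳ++; length-ʳ++; length-++)
  import Data.List.Properties as List
  open import Data.Nat.Base using (ℕ; zero; suc; _+_; _*_; _≤_; z≤n; s≤s)
  open import Data.Nat.Properties
  open import Data.Product.Base using (∃-syntax; _×_; _,_; proj₁; proj₂)
  open import Data.Sum.Base using (_⊎_; inj₁; inj₂)
  open import Data.Vec.Base using ([]; _∷_)
  open import Function.Base using (_∘_; id)
  open import Relation.Binary.PropositionalEquality using (_≡_; refl; sym; trans; cong; cong₂; subst; subst₂)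
  open import Data.Nat.Solver using (module +-*-Solver)

  -- Bounds are syntax trees, so that monotonicity and closure under composition are structural
  -- recursions. They are flattened to coefficient lists only at the end.
  data Px : Set where
    𝕏   : Px
    𝕂   : ℕ → Px
    _⊕_ : Px → Px → Px
    _⊗_ : Px → Px → Px

  infixr 6 _⊕_
  infixr 7 _⊗_
  infixr 8 _∘ₚ_

  ⟦_⟧ : Px → ℕ → ℕ
  ⟦ 𝕏 ⟧     n = n
  ⟦ 𝕂 c ⟧   n = c
  ⟦ p ⊕ q ⟧ n = ⟦ p ⟧ n + ⟦ q ⟧ n
  ⟦ p ⊗ q ⟧ n = ⟦ p ⟧ n * ⟦ q ⟧ n

  mono : ∀ p {m n} → m ≤ n → ⟦ p ⟧ m ≤ ⟦ p ⟧ n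
  mono 𝕏       m≤n = m≤n
  mono (𝕂 c)   m≤n = ≤-refl
  mono (p ⊕ q) m≤n = +-mono-≤ (mono p m≤n) (mono q m≤n)
  mono (p ⊗ q) m≤n = *-mono-≤ (mono p m≤n) (mono q m≤n)

  _∘ₚ_ : Px → Px → Px
  𝕏       ∘ₚ r = r
  𝕂 c     ∘ₚ r = 𝕂 c
  (p ⊕ q) ∘ₚ r = (p ∘ₚ r) ⊕ (q ∘ₚ r)
  (p ⊗ q) ∘ₚ r = (p ∘ₚ r) ⊗ (q ∘ₚ r)

  ∘ₚ-eval : ∀ p r n → ⟦ p ∘ₚ r ⟧ n ≡ ⟦ p ⟧ (⟦ r ⟧ n)
  ∘ₚ-eval 𝕏       r n = refl
  ∘ₚ-eval (𝕂 c)   r n = refl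
  ∘ₚ-eval (p ⊕ q) r n = cong₂ _+_ (∘ₚ-eval p r n) (∘ₚ-eval q r n)
  ∘ₚ-eval (p ⊗ q) r n = cong₂ _*_ (∘ₚ-eval p r n) (∘ₚ-eval q r n)

  mono-∘ₚ : ∀ p r n {m} → m ≤ ⟦ r ⟧ n → ⟦ p ⟧ m ≤ ⟦ p ∘ₚ r ⟧ n
  mono-∘ₚ p r n m≤ = ≤-trans (mono p m≤) (≤-reflexive (sym (∘ₚ-eval p r n)))

  fromPolynomial : Polynomial → Px
  fromPolynomial []      = 𝕂 0
  fromPolynomial (c ∷ p) = 𝕂 c ⊕ (𝕏 ⊗ fromPolynomial p)

  fromPolynomial-eval : ∀ p n → ⟦ fromPolynomial p ⟧ n ≡ eval p n
  fromPolynomial-eval []      n = refl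
  fromPolynomial-eval (c ∷ p) n = cong (λ e → c + n * e) (fromPolynomial-eval p n)

  private
    _+ₗ_ : Polynomial → Polynomial → Polynomial
    []      +ₗ q       = q
    (c ∷ p) +ₗ []      = c ∷ p
    (c ∷ p) +ₗ (d ∷ q) = (c + d) ∷ (p +ₗ q)

    +ₗ-eval : ∀ p q n → eval (p +ₗ q) n ≡ eval p n + eval q n
    +ₗ-eval []      q       n = refl
    +ₗ-eval (c ∷ p) []      n = sym (+-identityʳ _)
    +ₗ-eval (c ∷ p) (d ∷ q) n = trans (cong (λ e → c + d + n * e) (+ₗ-eval p q n))
      (solve 5 (λ c d n e f → c :+ d :+ n :* (e :+ f) := (c :+ n :* e) :+ (d :+ n :* f)) refl c d n (eval p n) (eval q n))
      where open +-*-Solver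

    scale : ℕ → Polynomial → Polynomial
    scale c []      = []
    scale c (d ∷ q) = (c * d) ∷ scale c q

    scale-eval : ∀ c q n → eval (scale c q) n ≡ c * eval q n
    scale-eval c []      n = sym (*-zeroʳ c)
    scale-eval c (d ∷ q) n = trans (cong (λ e → c * d + n * e) (scale-eval c q n))
      (solve 4 (λ c d n e → c :* d :+ n :* (c :* e) := c :* (d :+ n :* e)) refl c d n (eval q n))
      where open +-*-Solver

    _*ₗ_ : Polynomial → Polynomial → Polynomial
    []      *ₗ q = []
    (c ∷ p) *ₗ q = scale c q +ₗ (0 ∷ (p *ₗ q))

    *ₗ-eval : ∀ p q n → eval (p *ₗ q) n ≡ eval p n * eval q n
    *ₗ-eval []      q n = refl
    *ₗ-eval (c ∷ p) q n = trans (+ₗ-eval (scale c q) (0 ∷ (p *ₗ q)) n)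
      (trans (cong₂ (λ e f → e + n * f) (scale-eval c q n) (*ₗ-eval p q n))
        (solve 4 (λ c n e f → c :* f :+ n :* (e :* f) := (c :+ n :* e) :* f) refl c n (eval p n) (eval q n)))
      where open +-*-Solver

  toPolynomial : Px → Polynomial
  toPolynomial 𝕏       = 0 ∷ 1 ∷ []
  toPolynomial (𝕂 c)   = c ∷ []
  toPolynomial (p ⊕ q) = toPolynomial p +ₗ toPolynomial q
  toPolynomial (p ⊗ q) = toPolynomial p *ₗ toPolynomial q

  toPolynomial-eval : ∀ p n → eval (toPolynomial p) n ≡ ⟦ p ⟧ n
  toPolynomial-eval 𝕏       n = trans (cong (n *_) (cong suc (*-zeroʳ n))) (*-identityʳ n)
  toPolynomial-eval (𝕂 c)   n = trans (cong (c +_) (*-zeroʳ n)) (+-identityʳ c)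
  toPolynomial-eval (p ⊕ q) n = trans (+ₗ-eval (toPolynomial p) _ n) (cong₂ _+_ (toPolynomial-eval p n) (toPolynomial-eval q n))
  toPolynomial-eval (p ⊗ q) n = trans (*ₗ-eval (toPolynomial p) _ n) (cong₂ _*_ (toPolynomial-eval p n) (toPolynomial-eval q n))

  Bits : Set
  Bits = List Bool

  -- Types that carry a binary code. In a pair only the first component is framed, the second
  -- extends to the end of the word. As a consequence many changes of type leave the code alone and
  -- are free by `retype`.
  data Ty : Set₁ where
    prim : (A : Set) → (A → Bits) → Ty
    _⊠_  : Ty → Ty → Ty
    list : Ty → Ty

  infixr 4 _⊠_

  El : Ty → Set
  El (prim A e) = A
  El (A ⊠ B)    = El A × El B
  El (list A)   = List (El A)

  enc : ∀ A → El A → Bits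
  enc (prim A e) a       = e a
  enc (A ⊠ B)    (a , b) = frame (enc A a) ++ enc B b
  enc (list A)   as      = concatMap (λ a → frame (enc A a)) as

  len : ∀ A → El A → ℕ
  len A a = length (enc A a)

  bits nat bool : Ty
  bits = prim Bits id
  nat  = prim ℕ binary
  bool = prim Bool λ { false → [] ; true → true ∷ [] }

  length-frame : ∀ w → length (frame w) ≡ suc (length w * 2)
  length-frame []      = refl
  length-frame (b ∷ w) = cong (suc ∘ suc) (length-frame w)

  length-frame-++ : ∀ w z → length (frame w ++ z) ≡ suc (length w * 2) + length z
  length-frame-++ w z = trans (length-++ (frame w)) (cong (_+ length z) (length-frame w))

  unframe : Bits → Bits
  unframe []              = []
  unframe (false ∷ w)     = []
  unframe (true ∷ [])     = []
  unframe (true ∷ b ∷ w)  = b ∷ unframe w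

  afterFrame : Bits → Bits
  afterFrame []             = []
  afterFrame (false ∷ w)    = w
  afterFrame (true ∷ [])    = []
  afterFrame (true ∷ b ∷ w) = afterFrame w

  unframe-frame : ∀ w z → unframe (frame w ++ z) ≡ w
  unframe-frame []      z = refl
  unframe-frame (b ∷ w) z = cong (b ∷_) (unframe-frame w z)

  afterFrame-frame : ∀ w z → afterFrame (frame w ++ z) ≡ z
  afterFrame-frame []      z = refl
  afterFrame-frame (b ∷ w) z = afterFrame-frame w z

  frame-length-bound : ∀ w → length (unframe w) + length (afterFrame w) ≤ length w
  frame-length-bound []             = z≤n
  frame-length-bound (false ∷ w)    = n≤1+n _
  frame-length-bound (true ∷ [])    = z≤n
  frame-length-bound (true ∷ b ∷ w) = s≤s (≤-trans (frame-length-bound w) (n≤1+n _))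

  record _⊢_⇓≤_∣_ (p : Prog) (s : Stacks) (N : ℕ) (s′ : Stacks) : Set where
    constructor within
    field
      {cost} : ℕ
      bound  : cost ≤ N
      deriv  : p ⊢ s ⇓[ cost ] s′

  infix 4 _⊢_⇓≤_∣_

  exactly : ∀ {p s n s′} → p ⊢ s ⇓[ n ] s′ → p ⊢ s ⇓≤ n ∣ s′
  exactly d = within ≤-refl d

  _⨟_ : ∀ {p q s s′ s″ n m} → p ⊢ s ⇓≤ n ∣ s′ → q ⊢ s′ ⇓≤ m ∣ s″ → (p ⨾ q) ⊢ s ⇓≤ n + m ∣ s″
  within b d ⨟ within b′ d′ = within (+-mono-≤ b b′) (⇓seq d d′)

  infixr 5 _⨟_

  weaken : ∀ {p s n m s′} → n ≤ m → p ⊢ s ⇓≤ n ∣ s′ → p ⊢ s ⇓≤ m ∣ s′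
  weaken n≤m (within b d) = within (≤-trans b n≤m) d

  pattern #D = Fin.zero
  pattern #X = Fin.suc Fin.zero
  pattern #Y = Fin.suc (Fin.suc Fin.zero)

  private
    variable
      δ ξ η : List Letter

    pushBit : Register → Bool → Prog
    pushBit r b = push r (bt b)

    D→X : ∀ x y → each #D (pushBit #X) ⊢ (x ▹ δ) ∷ (y ▹ ξ) ∷ η ∷ [] ⇓[ suc (length x * 3) ] δ ∷ ((x ʳ++ y) ▹ ξ) ∷ η ∷ []
    D→X []      y = ⇓each-mark refl
    D→X (b ∷ x) y = ⇓each-bt refl ⇓push (D→X x (b ∷ y))

    X→D : ∀ x y → each #X (pushBit #D) ⊢ (y ▹ δ) ∷ (x ▹ ξ) ∷ η ∷ [] ⇓[ suc (length x * 3) ] ((x ʳ++ y) ▹ δ) ∷ ξ ∷ η ∷ []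
    X→D []      y = ⇓each-mark refl
    X→D (b ∷ x) y = ⇓each-bt refl ⇓push (X→D x (b ∷ y))

    Y→D : ∀ x y → each #Y (pushBit #D) ⊢ (y ▹ δ) ∷ ξ ∷ (x ▹ η) ∷ [] ⇓[ suc (length x * 3) ] ((x ʳ++ y) ▹ δ) ∷ ξ ∷ η ∷ []
    Y→D []      y = ⇓each-mark refl
    Y→D (b ∷ x) y = ⇓each-bt refl ⇓push (Y→D x (b ∷ y))

    D→XY : ∀ x y z → each #D (λ b → pushBit #X b ⨾ pushBit #Y b) ⊢ (x ▹ δ) ∷ (y ▹ ξ) ∷ (z ▹ η) ∷ []
      ⇓[ suc (length x * 5) ] δ ∷ ((x ʳ++ y) ▹ ξ) ∷ ((x ʳ++ z) ▹ η) ∷ []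
    D→XY []      y z = ⇓each-mark refl
    D→XY (b ∷ x) y z = ⇓each-bt refl (⇓seq ⇓push ⇓push) (D→XY x (b ∷ y) (b ∷ z))

    drop-D : ∀ x → each #D (λ _ → skip) ⊢ (x ▹ δ) ∷ ξ ∷ η ∷ [] ⇓[ suc (length x * 2) ] δ ∷ ξ ∷ η ∷ []
    drop-D []      = ⇓each-mark refl
    drop-D (b ∷ x) = ⇓each-bt refl ⇓skip (drop-D x)

    drop-X : ∀ x → each #X (λ _ → skip) ⊢ δ ∷ (x ▹ ξ) ∷ η ∷ [] ⇓[ suc (length x * 2) ] δ ∷ ξ ∷ η ∷ []
    drop-X []      = ⇓each-mark refl
    drop-X (b ∷ x) = ⇓each-bt refl ⇓skip (drop-X x)

    unreverse : ∀ (x : Bits) → (x ʳ++ []) ʳ++ [] ≡ x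
    unreverse x = trans (ʳ++-ʳ++ x) (List.++-identityʳ x)

    length-reverse : ∀ (x : Bits) → length (x ʳ++ []) ≡ length x
    length-reverse x = trans (length-ʳ++ x) (+-identityʳ _)

    restore-X : ∀ x → each #X (pushBit #D) ⊢ ([] ▹ δ) ∷ ((x ʳ++ []) ▹ ξ) ∷ η ∷ [] ⇓≤ suc (length x * 3) ∣ (x ▹ δ) ∷ ξ ∷ η ∷ []
    restore-X {δ} {ξ} {η} x = within (≤-reflexive (cong (λ k → suc (k * 3)) (length-reverse x)))
      (subst (λ z → each #X (pushBit #D) ⊢ ([] ▹ δ) ∷ ((x ʳ++ []) ▹ ξ) ∷ η ∷ [] ⇓[ suc (length (x ʳ++ []) * 3) ] (z ▹ δ) ∷ ξ ∷ η ∷ []) (unreverse x) (X→D (x ʳ++ []) []))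

    restore-Y : ∀ x → each #Y (pushBit #D) ⊢ ([] ▹ δ) ∷ ξ ∷ ((x ʳ++ []) ▹ η) ∷ [] ⇓≤ suc (length x * 3) ∣ (x ▹ δ) ∷ ξ ∷ η ∷ []
    restore-Y {δ} {ξ} {η} x = within (≤-reflexive (cong (λ k → suc (k * 3)) (length-reverse x)))
      (subst (λ z → each #Y (pushBit #D) ⊢ ([] ▹ δ) ∷ ξ ∷ ((x ʳ++ []) ▹ η) ∷ [] ⇓[ suc (length (x ʳ++ []) * 3) ] (z ▹ δ) ∷ ξ ∷ η ∷ []) (unreverse x) (Y→D (x ʳ++ []) []))

    emitFrame : Prog
    emitFrame = each #X (λ b → pushBit #D b ⨾ pushBit #D true)

    flags : Bits → Bits → Bits
    flags []      w = w
    flags (b ∷ y) w = true ∷ b ∷ flags y w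

    flags-frame : ∀ y z → flags y (false ∷ z) ≡ frame y ++ z
    flags-frame []      z = refl
    flags-frame (b ∷ y) z = cong (λ w → true ∷ b ∷ w) (flags-frame y z)

    emit : ∀ l w → emitFrame ⊢ (w ▹ δ) ∷ (l ▹ ξ) ∷ η ∷ [] ⇓[ suc (length l * 5) ] (flags (l ʳ++ []) w ▹ δ) ∷ ξ ∷ η ∷ []
    emit {δ} {ξ} {η} l w = go l [] w
      where
      go : ∀ l k w → emitFrame ⊢ (flags k w ▹ δ) ∷ (l ▹ ξ) ∷ η ∷ [] ⇓[ suc (length l * 5) ] (flags (l ʳ++ k) w ▹ δ) ∷ ξ ∷ η ∷ []
      go []      k w = ⇓each-mark refl
      go (b ∷ l) k w = ⇓each-bt refl (⇓seq ⇓push ⇓push) (go l (b ∷ k) w)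

    emit-frame : ∀ y z → emitFrame ⊢ ((false ∷ z) ▹ δ) ∷ ((y ʳ++ []) ▹ ξ) ∷ η ∷ [] ⇓≤ suc (length y * 5) ∣ ((frame y ++ z) ▹ δ) ∷ ξ ∷ η ∷ []
    emit-frame {δ} {ξ} {η} y z = within (≤-reflexive (cong (λ k → suc (k * 5)) (length-reverse y)))
      (subst (λ w → emitFrame ⊢ ((false ∷ z) ▹ δ) ∷ ((y ʳ++ []) ▹ ξ) ∷ η ∷ [] ⇓[ suc (length (y ʳ++ []) * 5) ] (w ▹ δ) ∷ ξ ∷ η ∷ [])
        (trans (cong (λ k → flags k (false ∷ z)) (unreverse y)) (flags-frame y z)) (emit (y ʳ++ []) (false ∷ z)))

    splitBody : Bool → Prog
    splitBody false = case #Y (λ _ → pushBit #Y true) skip ⨾ push #D mark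
    splitBody true  = case #D (pushBit #X) (push #D mark)

    splitEnd : Bool → Prog
    splitEnd false = push #D mark
    splitEnd true  = skip

    -- Detaches a frame from the word on the first stack and leaves its bits reversed on the second.
    -- A bit on the third stack records whether the terminator was met. If so, the loop was stopped
    -- by an extra mark and the rest of the word still has its own; if the word ended too early, the
    -- loop has consumed that mark and it is put back.
    splitFrame : Prog
    splitFrame = push #X mark ⨾ pushBit #Y false ⨾ each #D splitBody ⨾ case #Y splitEnd skip

    splitLoop : ∀ x y →
      each #D splitBody ⊢ (x ▹ δ) ∷ (y ▹ ξ) ∷ (bt false ∷ η) ∷ [] ⇓≤ length x * 8 + 8 ∣ (afterFrame x ▹ δ) ∷ ((unframe x ʳ++ y) ▹ ξ) ∷ (bt true ∷ η) ∷ []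
      ⊎ (each #D splitBody ⊢ (x ▹ δ) ∷ (y ▹ ξ) ∷ (bt false ∷ η) ∷ [] ⇓≤ length x * 8 + 8 ∣ δ ∷ ((unframe x ʳ++ y) ▹ ξ) ∷ (bt false ∷ η) ∷ [] × afterFrame x ≡ [])
    splitLoop []          y = inj₂ (within (s≤s z≤n) (⇓each-mark refl) , refl)
    splitLoop (false ∷ x) y = inj₁ (within (≤-trans (m≤m+n 7 _) (m≤n+m _ (length (false ∷ x) * 8))) (⇓each-bt refl (⇓seq (⇓case-bt refl ⇓push) ⇓push) (⇓each-mark refl)))
    splitLoop (true ∷ [])  y = inj₂ (within (s≤s (s≤s (s≤s (s≤s (s≤s z≤n))))) (⇓each-bt refl (⇓case-mark refl ⇓push) (⇓each-mark refl)) , refl)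
    splitLoop (true ∷ b ∷ x) y with splitLoop x (b ∷ y)
    ... | inj₁ (within le d) = inj₁ (within (s≤s (s≤s (s≤s (s≤s (≤-trans le (m≤n+m _ 12)))))) (⇓each-bt refl (⇓case-bt refl ⇓push) d))
    ... | inj₂ (within le d , eq) = inj₂ (within (s≤s (s≤s (s≤s (s≤s (≤-trans le (m≤n+m _ 12)))))) (⇓each-bt refl (⇓case-bt refl ⇓push) d) , eq)

    split-frame : ∀ x → splitFrame ⊢ (x ▹ δ) ∷ ξ ∷ η ∷ [] ⇓≤ 2 + (2 + ((length x * 8 + 8) + 3)) ∣ (afterFrame x ▹ δ) ∷ ((unframe x ʳ++ []) ▹ ξ) ∷ η ∷ []
    split-frame {δ} {ξ} {η} x with splitLoop {δ} {ξ} {η} x []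
    ... | inj₁ d = exactly ⇓push ⨟ exactly ⇓push ⨟ d ⨟ within (s≤s (s≤s z≤n)) (⇓case-bt refl ⇓skip)
    ... | inj₂ (d , eq) = exactly ⇓push ⨟ exactly ⇓push ⨟ d ⨟
      subst (λ w → case #Y splitEnd skip ⊢ δ ∷ ((unframe x ʳ++ []) ▹ ξ) ∷ (bt false ∷ η) ∷ [] ⇓≤ 3 ∣ (w ▹ δ) ∷ ((unframe x ʳ++ []) ▹ ξ) ∷ η ∷ [])
        (sym eq) (within ≤-refl (⇓case-bt refl ⇓push))

  -- The program replaces the topmost word of the first stack above arbitrary contents `δ`, `ξ`,
  -- `η`, which is what lets programs be nested. Output length is bounded separately because the
  -- time of a composite depends on the length of the intermediate result.
  record Comp (A B : Ty) (f : El A → El B) : Set where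
    field
      code    : Prog
      size    : Px
      time    : Px
      size-ok : ∀ a → len B (f a) ≤ ⟦ size ⟧ (len A a)
      runs    : ∀ a δ ξ η → code ⊢ (enc A a ▹ δ) ∷ ξ ∷ η ∷ [] ⇓≤ ⟦ time ⟧ (len A a) ∣ (enc B (f a) ▹ δ) ∷ ξ ∷ η ∷ []

  open Comp

  private
    variable
      A B C Γ Z S U : Ty

  compᶜ : ∀ {f : El A → El B} {g : El B → El C} → Comp B C g → Comp A B f → Comp A C (λ a → g (f a))
  compᶜ {A = A} {f = f} g∈ f∈ = record
    { code = code f∈ ⨾ code g∈
    ; size = size g∈ ∘ₚ size f∈
    ; time = time f∈ ⊕ (time g∈ ∘ₚ size f∈)
    ; size-ok = λ a → ≤-trans (size-ok g∈ (f a)) (mono-∘ₚ (size g∈) (size f∈) _ (size-ok f∈ a))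
    ; runs = λ a δ ξ η → runs f∈ a δ ξ η ⨟ weaken (mono-∘ₚ (time g∈) (size f∈) _ (size-ok f∈ a)) (runs g∈ (f a) δ ξ η) }

  extᶜ : ∀ {f g : El A → El B} → (∀ a → f a ≡ g a) → Comp A B f → Comp A B g
  extᶜ {A = A} {B} eq f∈ = record
    { code = code f∈ ; size = size f∈ ; time = time f∈
    ; size-ok = λ a → subst (λ b → len B b ≤ ⟦ size f∈ ⟧ (len A a)) (eq a) (size-ok f∈ a)
    ; runs = λ a δ ξ η → subst (λ b → code f∈ ⊢ (enc A a ▹ δ) ∷ ξ ∷ η ∷ [] ⇓≤ ⟦ time f∈ ⟧ (len A a) ∣ (enc B b ▹ δ) ∷ ξ ∷ η ∷ []) (eq a) (runs f∈ a δ ξ η) }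

  onCodes : ∀ {F : Bits → Bits} {f : El A → El B} → Comp bits bits F → (∀ a → F (enc A a) ≡ enc B (f a)) → Comp A B f
  onCodes {A = A} F∈ eq = record
    { code = code F∈ ; size = size F∈ ; time = time F∈
    ; size-ok = λ a → subst (λ w → length w ≤ ⟦ size F∈ ⟧ (len A a)) (eq a) (size-ok F∈ (enc A a))
    ; runs = λ a δ ξ η → subst (λ w → code F∈ ⊢ (enc A a ▹ δ) ∷ ξ ∷ η ∷ [] ⇓≤ ⟦ time F∈ ⟧ (len A a) ∣ (w ▹ δ) ∷ ξ ∷ η ∷ []) (eq a) (runs F∈ (enc A a) δ ξ η) }

  retype : ∀ {f : El A → El B} → (∀ a → enc A a ≡ enc B (f a)) → Comp A B f
  retype = onCodes {F = id} (record { code = skip ; size = 𝕏 ; time = 𝕂 1 ; size-ok = λ _ → ≤-refl ; runs = λ _ _ _ _ → exactly ⇓skip })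

  idᶜ : Comp A A id
  idᶜ = retype λ _ → refl

  pairᶜ : ∀ {f : El A → El B} {g : El A → El C} → Comp A B f → Comp A C g → Comp A (B ⊠ C) (λ a → f a , g a)
  pairᶜ {A = A} {B} {C} {f = f} {g = g} f∈ g∈ = record
    { code = push #X mark ⨾ push #Y mark ⨾ each #D (λ b → pushBit #X b ⨾ pushBit #Y b) ⨾ push #D mark ⨾ each #X (pushBit #D) ⨾ code f∈
             ⨾ push #X mark ⨾ each #D (pushBit #X) ⨾ push #D mark ⨾ each #Y (pushBit #D) ⨾ code g∈
             ⨾ pushBit #D false ⨾ emitFrame
    ; size = (𝕂 1 ⊕ (size f∈ ⊗ 𝕂 2)) ⊕ size g∈
    ; time = 𝕂 2 ⊕ 𝕂 2 ⊕ (𝕂 1 ⊕ (𝕏 ⊗ 𝕂 5)) ⊕ 𝕂 2 ⊕ (𝕂 1 ⊕ (𝕏 ⊗ 𝕂 3)) ⊕ time f∈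
             ⊕ 𝕂 2 ⊕ (𝕂 1 ⊕ (size f∈ ⊗ 𝕂 3)) ⊕ 𝕂 2 ⊕ (𝕂 1 ⊕ (𝕏 ⊗ 𝕂 3)) ⊕ time g∈ ⊕ 𝕂 2 ⊕ (𝕂 1 ⊕ (size f∈ ⊗ 𝕂 5))
    ; size-ok = λ a → ≤-trans (≤-reflexive (length-frame-++ (enc B (f a)) (enc C (g a))))
        (+-mono-≤ (s≤s (*-monoˡ-≤ 2 (size-ok f∈ a))) (size-ok g∈ a))
    ; runs = λ a δ ξ η → exactly ⇓push ⨟ exactly ⇓push ⨟ exactly (D→XY (enc A a) [] []) ⨟ exactly ⇓push ⨟ restore-X (enc A a)
        ⨟ runs f∈ a δ ξ _ ⨟ exactly ⇓push ⨟ weaken (s≤s (*-monoˡ-≤ 3 (size-ok f∈ a))) (exactly (D→X (enc B (f a)) []))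
        ⨟ exactly ⇓push ⨟ restore-Y (enc A a) ⨟ runs g∈ a δ _ η ⨟ exactly ⇓push
        ⨟ weaken (s≤s (*-monoˡ-≤ 5 (size-ok f∈ a))) (emit-frame (enc B (f a)) (enc C (g a))) }

  private
    splitTime : Px
    splitTime = 𝕂 2 ⊕ 𝕂 2 ⊕ (𝕏 ⊗ 𝕂 8 ⊕ 𝕂 8) ⊕ 𝕂 3

  unframeᶜ : Comp bits bits unframe
  unframeᶜ = record
    { code = splitFrame ⨾ each #D (λ _ → skip) ⨾ push #D mark ⨾ each #X (pushBit #D)
    ; size = 𝕏
    ; time = splitTime ⊕ (𝕂 1 ⊕ (𝕏 ⊗ 𝕂 2)) ⊕ 𝕂 2 ⊕ (𝕂 1 ⊕ (𝕏 ⊗ 𝕂 3))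
    ; size-ok = unframe≤
    ; runs = λ w δ ξ η → split-frame w ⨟ weaken (s≤s (*-monoˡ-≤ 2 (after≤ w))) (exactly (drop-D (afterFrame w))) ⨟ exactly ⇓push
        ⨟ weaken (s≤s (*-monoˡ-≤ 3 (unframe≤ w))) (restore-X (unframe w)) }
    where
    unframe≤ : ∀ w → length (unframe w) ≤ length w
    unframe≤ w = ≤-trans (m≤m+n _ _) (frame-length-bound w)
    after≤ : ∀ w → length (afterFrame w) ≤ length w
    after≤ w = ≤-trans (m≤n+m _ _) (frame-length-bound w)

  afterFrameᶜ : Comp bits bits afterFrame
  afterFrameᶜ = record
    { code = splitFrame ⨾ each #X (λ _ → skip)
    ; size = 𝕏
    ; time = splitTime ⊕ (𝕂 1 ⊕ (𝕏 ⊗ 𝕂 2))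
    ; size-ok = λ w → ≤-trans (m≤n+m _ _) (frame-length-bound w)
    ; runs = λ w δ ξ η → split-frame w ⨟
        weaken (s≤s (*-monoˡ-≤ 2 (≤-trans (≤-reflexive (length-reverse (unframe w))) (≤-trans (m≤m+n _ _) (frame-length-bound w)))))
          (exactly (drop-X (unframe w ʳ++ []))) }

  fstᶜ : Comp (A ⊠ B) A proj₁
  fstᶜ {A = A} {B} = onCodes unframeᶜ λ (a , b) → unframe-frame (enc A a) (enc B b)

  sndᶜ : Comp (A ⊠ B) B proj₂
  sndᶜ {A = A} {B} = onCodes afterFrameᶜ λ (a , b) → afterFrame-frame (enc A a) (enc B b)

  private
    pushWord : Bits → Prog
    pushWord []      = skip
    pushWord (b ∷ w) = pushWord w ⨾ pushBit #D b

    push-word : ∀ w z → pushWord w ⊢ (z ▹ δ) ∷ ξ ∷ η ∷ [] ⇓[ length w * 2 + 1 ] ((w ++ z) ▹ δ) ∷ ξ ∷ η ∷ []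
    push-word []      z = ⇓skip
    push-word {δ} {ξ} {η} (b ∷ w) z = subst (λ n → pushWord (b ∷ w) ⊢ (z ▹ δ) ∷ ξ ∷ η ∷ [] ⇓[ n ] ((b ∷ w ++ z) ▹ δ) ∷ ξ ∷ η ∷ [])
      (+-comm (length w * 2 + 1) 2) (⇓seq (push-word w z) ⇓push)

  prefixᶜ : ∀ w → Comp bits bits (w ++_)
  prefixᶜ w = record
    { code = pushWord w ; size = 𝕂 (length w) ⊕ 𝕏 ; time = 𝕂 (length w * 2 + 1)
    ; size-ok = λ z → ≤-reflexive (length-++ w) ; runs = λ z δ ξ η → exactly (push-word w z) }

  private
    clearᶜ : Comp bits bits (λ _ → [])
    clearᶜ = record
      { code = each #D (λ _ → skip) ⨾ push #D mark ; size = 𝕂 0 ; time = (𝕂 1 ⊕ (𝕏 ⊗ 𝕂 2)) ⊕ 𝕂 2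
      ; size-ok = λ _ → z≤n ; runs = λ w δ ξ η → exactly (drop-D w) ⨟ exactly ⇓push }

  constᶜ : (b : El B) → Comp A B (λ _ → b)
  constᶜ {B = B} b = onCodes (compᶜ (prefixᶜ (enc B b)) clearᶜ) λ _ → List.++-identityʳ (enc B b)

  dropBit : Bits → Bits
  dropBit []      = []
  dropBit (b ∷ w) = w

  dropBitᶜ : Comp bits bits dropBit
  dropBitᶜ = record
    { code = case #D (λ _ → skip) (push #D mark) ; size = 𝕏 ; time = 𝕂 3
    ; size-ok = λ { [] → z≤n ; (b ∷ w) → n≤1+n _ }
    ; runs = λ { [] δ ξ η → exactly (⇓case-mark refl ⇓push) ; (b ∷ w) δ ξ η → within (s≤s (s≤s z≤n)) (⇓case-bt refl ⇓skip) } }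

  Branching : ∀ A B C (Z : Ty) → (El B → El Z) → (El C → El Z) → El A → El Z → Set
  Branching A B C Z f g a z =
      (∃[ b ] ∃[ w ] enc A a ≡ false ∷ w × enc A a ≡ enc B b × f b ≡ z)
    ⊎ (∃[ c ] ∃[ w ] enc A a ≡ true ∷ w × enc A a ≡ enc C c × g c ≡ z)

  -- Case analysis by the first bit of the code. The bit is pushed back, so the chosen program
  -- receives the whole word, reinterpreted as an element of `B` or `C` with the same code; nothing
  -- is decoded.
  branchᶜ : ∀ {f : El B → El Z} {g : El C → El Z} {h : El A → El Z} → Comp B Z f → Comp C Z g →
    (∀ a → Branching A B C Z f g a (h a)) → Comp A Z h
  branchᶜ {B = B} {Z} {C} {A} {f} {g} {h} f∈ g∈ by = record
    { code = case #D body skip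
    ; size = size f∈ ⊕ size g∈
    ; time = 𝕂 1 ⊕ (𝕂 2 ⊕ (time f∈ ⊕ time g∈))
    ; size-ok = size-ok′
    ; runs = runs′ }
    where
    body : Bool → Prog
    body false = pushBit #D false ⨾ code f∈
    body true  = pushBit #D true ⨾ code g∈
    size-ok′ : ∀ a → len Z (h a) ≤ ⟦ size f∈ ⟧ (len A a) + ⟦ size g∈ ⟧ (len A a)
    size-ok′ a with by a
    ... | inj₁ (b , _ , _ , eq , v) rewrite eq | sym v = ≤-trans (size-ok f∈ b) (m≤m+n _ _)
    ... | inj₂ (c , _ , _ , eq , v) rewrite eq | sym v = ≤-trans (size-ok g∈ c) (m≤n+m _ _)
    case-bt : ∀ {b w s′ n} → body b ⊢ (w ▹ δ) ∷ ξ ∷ η ∷ [] ⇓≤ n ∣ s′ → case #D body skip ⊢ ((b ∷ w) ▹ δ) ∷ ξ ∷ η ∷ [] ⇓≤ suc n ∣ s′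
    case-bt (within le d) = within (s≤s le) (⇓case-bt refl d)
    runs′ : ∀ a δ ξ η → case #D body skip ⊢ (enc A a ▹ δ) ∷ ξ ∷ η ∷ []
      ⇓≤ 1 + (2 + (⟦ time f∈ ⟧ (len A a) + ⟦ time g∈ ⟧ (len A a))) ∣ (enc Z (h a) ▹ δ) ∷ ξ ∷ η ∷ []
    runs′ a δ ξ η with by a
    ... | inj₁ (b , w , hd , eq , v) rewrite hd | sym v =
      case-bt {b = false} (exactly ⇓push ⨟ weaken (m≤m+n _ _)
        (subst (λ u → code f∈ ⊢ (u ▹ δ) ∷ ξ ∷ η ∷ [] ⇓≤ ⟦ time f∈ ⟧ (length u) ∣ _) (sym eq) (runs f∈ b δ ξ η)))
    ... | inj₂ (c , w , hd , eq , v) rewrite hd | sym v =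
      case-bt {b = true} (exactly ⇓push ⨟ weaken (m≤n+m _ _)
        (subst (λ u → code g∈ ⊢ (u ▹ δ) ∷ ξ ∷ η ∷ [] ⇓≤ ⟦ time g∈ ⟧ (length u) ∣ _) (sym eq) (runs g∈ c δ ξ η)))

  iterate : ∀ {A : Set} → (A → A) → ℕ → A → A
  iterate f zero    a = a
  iterate f (suc n) a = iterate f n (f a)

  -- The code of `u` is a clock: detached from the word, it pays for one round per bit. `bd` must
  -- bound all intermediate states, since repeated growth could otherwise be exponential.
  iterᶜ : ∀ {f : El S → El S} → Comp S S f → (bd : Px) →
    (∀ u s j → j ≤ len U u → len S (iterate f j s) ≤ ⟦ bd ⟧ (len (U ⊠ S) (u , s))) →
    Comp (U ⊠ S) S (λ (u , s) → iterate f (len U u) s)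
  iterᶜ {S = S} {U} {f} f∈ bd ok = record
    { code = splitFrame ⨾ each #X (λ _ → code f∈)
    ; size = bd
    ; time = splitTime ⊕ (𝕏 ⊗ (𝕂 1 ⊕ (time f∈ ∘ₚ bd)) ⊕ 𝕂 1)
    ; size-ok = λ (u , s) → ok u s (len U u) ≤-refl
    ; runs = runs′ }
    where
    loop : ∀ v s T δ ξ η → (∀ j → j ≤ length v → ⟦ time f∈ ⟧ (len S (iterate f j s)) ≤ T) →
      each #X (λ _ → code f∈) ⊢ (enc S s ▹ δ) ∷ (v ▹ ξ) ∷ η ∷ [] ⇓≤ length v * (1 + T) + 1 ∣ (enc S (iterate f (length v) s) ▹ δ) ∷ ξ ∷ η ∷ []
    loop []      s T δ ξ η h = exactly (⇓each-mark refl)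
    loop (b ∷ v) s T δ ξ η h with runs f∈ s δ (v ▹ ξ) η | loop v (f s) T δ ξ η (λ j le → h (suc j) (s≤s le))
    ... | within le d | within le′ d′ = within (s≤s (≤-trans (+-mono-≤ (≤-trans le (h 0 z≤n)) le′) (≤-reflexive (sym (+-assoc T _ 1))))) (⇓each-bt refl d d′)
    runs′ : ∀ a δ ξ η → (splitFrame ⨾ each #X (λ _ → code f∈)) ⊢ (enc (U ⊠ S) a ▹ δ) ∷ ξ ∷ η ∷ [] ⇓≤ _ ∣ _ ∷ ξ ∷ η ∷ []
    runs′ (u , s) δ ξ η = split-frame e ⨟ weaken (+-monoˡ-≤ 1 (*-monoˡ-≤ (1 + ⟦ time f∈ ∘ₚ bd ⟧ (length e)) le-u)) main
      where
      e = enc (U ⊠ S) (u , s)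
      v = unframe e ʳ++ []
      len-v : length v ≡ len U u
      len-v = trans (length-reverse (unframe e)) (cong length (unframe-frame (enc U u) (enc S s)))
      le-u : length v ≤ length e
      le-u = ≤-trans (≤-reflexive (length-reverse (unframe e))) (≤-trans (m≤m+n _ _) (frame-length-bound e))
      main : each #X (λ _ → code f∈) ⊢ (afterFrame e ▹ δ) ∷ (v ▹ ξ) ∷ η ∷ [] ⇓≤ length v * (1 + ⟦ time f∈ ∘ₚ bd ⟧ (length e)) + 1
               ∣ (enc S (iterate f (len U u) s) ▹ δ) ∷ ξ ∷ η ∷ []
      main = subst₂ (λ z k → each #X (λ _ → code f∈) ⊢ (z ▹ δ) ∷ (v ▹ ξ) ∷ η ∷ [] ⇓≤ length v * (1 + ⟦ time f∈ ∘ₚ bd ⟧ (length e)) + 1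
                                ∣ (enc S (iterate f k s) ▹ δ) ∷ ξ ∷ η ∷ [])
        (sym (afterFrame-frame (enc U u) (enc S s))) len-v
        (loop v s _ δ ξ η (λ j le → mono-∘ₚ (time f∈) bd (length e) (ok u s j (≤-trans le (≤-reflexive len-v)))))

  private
    -- No mark ends the input of a machine, so the first loop stops at the empty stack; then the
    -- word is put back above a mark.
    wrap : Prog
    wrap = push #X mark ⨾ each #D (pushBit #X) ⨾ push #D mark ⨾ each #X (pushBit #D)

    wrap-D→X : ∀ x y → each #D (pushBit #X) ⊢ map bt x ∷ (y ▹ ξ) ∷ η ∷ [] ⇓[ suc (length x * 3) ] [] ∷ ((x ʳ++ y) ▹ ξ) ∷ η ∷ []
    wrap-D→X []      y = ⇓each-[] refl
    wrap-D→X (b ∷ x) y = ⇓each-bt refl ⇓push (wrap-D→X x (b ∷ y))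

  Comp⇒PolyTime : ∀ {f : Bits → Bits} → Comp bits bits f → PolyTime f
  Comp⇒PolyTime {f} f∈ = compile (wrap ⨾ code f∈) , toPolynomial bd , λ x →
    let within le d = (exactly ⇓push ⨟ exactly (wrap-D→X x []) ⨟ exactly ⇓push ⨟ restore-X x) ⨟ runs f∈ x [] [] []
    in compile-outputs d (≤-trans le (≤-reflexive (sym (toPolynomial-eval bd (length x)))))
    where
    bd : Px
    bd = (𝕂 2 ⊕ (𝕂 1 ⊕ (𝕏 ⊗ 𝕂 3)) ⊕ 𝕂 2 ⊕ (𝕂 1 ⊕ (𝕏 ⊗ 𝕂 3))) ⊕ time f∈

-- Case analysis and folds on booleans, words and lists.

module ListPrograms where

  open import Defs
  open Computable
  open import Data.Bool.Base using (Bool; true; false; if_then_else_; _∧_; _∨_; not)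
  open import Data.List.Base using (List; []; _∷_; _++_; map; length; _ʳ++_; concatMap; foldr; foldl; reverse)
  open import Data.List.Properties using (length-++; reverse-foldr; reverse-involutive)
  import Data.List.Properties as List
  open import Data.Nat.Base using (ℕ; zero; suc; _+_; _*_; _≤_; z≤n; s≤s)
  open import Data.Nat.Properties
  open import Data.Product.Base using (∃-syntax; _×_; _,_; proj₂)
  open import Data.Sum.Base using (inj₁; inj₂)
  open import Function.Base using (_∘_; id)
  open import Relation.Binary.PropositionalEquality using (_≡_; refl; sym; trans; cong)

  private
    variable
      A B C Γ Z S : Ty

  private
    -- The same values with a fixed word before their codes: what a branch sees until the tag has
    -- been removed.
    pre : Bits → Ty → Ty
    pre w Γ = prim (El Γ) (λ γ → w ++ enc Γ γ)

    dropBits : ∀ (w : Bits) → Comp (pre w Γ) Γ id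
    dropBits []      = retype λ _ → refl
    dropBits (b ∷ w) = compᶜ (dropBits w) (onCodes dropBitᶜ λ _ → refl)

  boolCase : ∀ {f g : El Γ → El Z} → Comp Γ Z f → Comp Γ Z g → Comp (bool ⊠ Γ) Z (λ (b , γ) → if b then f γ else g γ)
  -- The frame around the code of `false` is 0 and that around the code of `true` is 1, 1, 0, so the
  -- first bit tells them apart.
  boolCase {Γ = Γ} f∈ g∈ = branchᶜ {B = pre (false ∷ []) Γ} {C = pre (true ∷ true ∷ false ∷ []) Γ}
    (compᶜ g∈ (dropBits (false ∷ []))) (compᶜ f∈ (dropBits (true ∷ true ∷ false ∷ [])))
    λ { (false , γ) → inj₁ (γ , _ , refl , refl , refl) ; (true , γ) → inj₂ (γ , _ , refl , refl , refl) }

  ifᶜ : ∀ {b : El Γ → Bool} {f g : El Γ → El Z} → Comp Γ bool b → Comp Γ Z f → Comp Γ Z g →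
    Comp Γ Z (λ γ → if b γ then f γ else g γ)
  ifᶜ b∈ f∈ g∈ = compᶜ (boolCase f∈ g∈) (pairᶜ b∈ idᶜ)

  bitsMatch : ∀ {Γ Z : Set} → (Γ → Z) → (Bool → Bits × Γ → Z) → Bits × Γ → Z
  bitsMatch f g ([] , γ)    = f γ
  bitsMatch f g (b ∷ w , γ) = g b (w , γ)

  bitsCase : ∀ {f : El Γ → El Z} {g : Bool → Bits × El Γ → El Z} →
    Comp Γ Z f → (∀ b → Comp (bits ⊠ Γ) Z (g b)) → Comp (bits ⊠ Γ) Z (bitsMatch f g)
  bitsCase {Γ = Γ} {Z} {f} {g} f∈ g∈ = branchᶜ {B = pre (false ∷ []) Γ} {C = prim (Bool × Bits × El Γ) (λ (b , w , γ) → true ∷ b ∷ frame w ++ enc Γ γ)}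
    (compᶜ f∈ (dropBits (false ∷ []))) (compᶜ second first)
    λ { ([] , γ) → inj₁ (γ , _ , refl , refl , refl) ; (b ∷ w , γ) → inj₂ ((b , w , γ) , _ , refl , refl , refl) }
    where
    Rest : Ty
    Rest = prim (Bool × Bits × El Γ) (λ (b , w , γ) → b ∷ frame w ++ enc Γ γ)
    first : Comp (prim (Bool × Bits × El Γ) (λ (b , w , γ) → true ∷ b ∷ frame w ++ enc Γ γ)) Rest id
    first = onCodes dropBitᶜ λ _ → refl
    second : Comp Rest Z (λ (b , w , γ) → g b (w , γ))
    second = branchᶜ {B = pre (false ∷ []) (bits ⊠ Γ)} {C = pre (true ∷ []) (bits ⊠ Γ)}
      (compᶜ (g∈ false) (dropBits (false ∷ []))) (compᶜ (g∈ true) (dropBits (true ∷ [])))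
      λ { (false , w , γ) → inj₁ ((w , γ) , _ , refl , refl , refl) ; (true , w , γ) → inj₂ ((w , γ) , _ , refl , refl , refl) }

  listMatch : ∀ {A Γ Z : Set} → (Γ → Z) → ((A × List A) × Γ → Z) → List A × Γ → Z
  listMatch f g ([] , γ)     = f γ
  listMatch f g (a ∷ as , γ) = g ((a , as) , γ)

  -- A nonempty list has the same code as the pair of its head and its tail, so the second branch
  -- needs no conversion. The frame of an empty word starts with 0, every other frame with 1.
  listCase : ∀ {f : El Γ → El Z} {g : (El A × List (El A)) × El Γ → El Z} →
    Comp Γ Z f → Comp ((A ⊠ list A) ⊠ Γ) Z g → Comp (list A ⊠ Γ) Z (listMatch f g)
  listCase {Γ = Γ} {A = A} f∈ g∈ = branchᶜ {B = pre (false ∷ []) Γ} {C = (A ⊠ list A) ⊠ Γ}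
    (compᶜ f∈ (dropBits (false ∷ []))) g∈
    λ { ([] , γ) → inj₁ (γ , _ , refl , refl , refl)
      ; (a ∷ as , γ) → inj₂ (((a , as) , γ) , _ , cong (_++ enc Γ γ) (proj₂ (frame² (enc A a) (enc (list A) as))) , refl , refl) }
    where
    frame² : ∀ w z → ∃[ v ] frame (frame w ++ z) ≡ true ∷ v
    frame² []      z = _ , refl
    frame² (b ∷ w) z = _ , refl

  consᶜ : ∀ {f : El Γ → El A} {g : El Γ → List (El A)} → Comp Γ A f → Comp Γ (list A) g → Comp Γ (list A) (λ γ → f γ ∷ g γ)
  consᶜ {A = A} f∈ g∈ = compᶜ {B = A ⊠ list A} {C = list A} {g = λ (a , as) → a ∷ as} (retype λ _ → refl) (pairᶜ f∈ g∈)

  consBitᶜ : ∀ b → Comp bits bits (b ∷_)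
  consBitᶜ b = prefixᶜ (b ∷ [])

  -- Folds; the size of the accumulator may grow by an amount not depending on it

  foldTail : ∀ {A Γ S : Set} → (Γ × (A × List A) × S → S) → Γ → List A → S → S
  foldTail g γ []       s = s
  foldTail g γ (a ∷ as) s = foldTail g γ as (g (γ , (a , as) , s))

  len-⊠ : ∀ A B (a : El A) (b : El B) → len (A ⊠ B) (a , b) ≡ suc (len A a * 2) + len B b
  len-⊠ A B a b = length-frame-++ (enc A a) (enc B b)

  len-∷ : ∀ A a as → len (list A) (a ∷ as) ≡ suc (len A a * 2) + len (list A) as
  len-∷ A a as = length-frame-++ (enc A a) (enc (list A) as)

  len-fst : ∀ A B (a : El A) (b : El B) → len A a ≤ len (A ⊠ B) (a , b)
  len-fst A B a b = ≤-trans (≤-trans (m≤m*n _ 2) (≤-trans (n≤1+n _) (m≤m+n _ (len B b)))) (≤-reflexive (sym (len-⊠ A B a b)))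

  len-snd : ∀ A B (a : El A) (b : El B) → len B b ≤ len (A ⊠ B) (a , b)
  len-snd A B a b = ≤-trans (m≤n+m _ _) (≤-reflexive (sym (len-⊠ A B a b)))

  len-head : ∀ A a as → len A a ≤ len (list A) (a ∷ as)
  len-head A a as = len-fst A (list A) a as

  len-tail : ∀ A a as → len (list A) as ≤ len (list A) (a ∷ as)
  len-tail A a as = len-snd A (list A) a as

  length≤len : ∀ A as → length as ≤ len (list A) as
  length≤len A []       = z≤n
  length≤len A (a ∷ as) = ≤-trans (s≤s (≤-trans (length≤len A as) (m≤n+m _ (len A a * 2)))) (≤-reflexive (sym (len-∷ A a as)))

  module _ {A Γ S : Ty} {g : El (Γ ⊠ (A ⊠ list A) ⊠ S) → El S} (g∈ : Comp (Γ ⊠ (A ⊠ list A) ⊠ S) S g) (G : Px)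
    (grow : ∀ γ a as s → len S (g (γ , (a , as) , s)) ≤ len S s + ⟦ G ⟧ (len Γ γ + len (list A) (a ∷ as))) where

    private
      St : Ty
      St = list A ⊠ (Γ ⊠ S)

      next′ : (El A × List (El A)) × (El Γ × El S) → El St
      next′ ((a , as) , (γ , s)) = as , (γ , g (γ , (a , as) , s))

      stepF : El St → El St
      stepF = listMatch (λ γs → [] , γs) next′

      step∈ : Comp St St stepF
      step∈ = listCase (pairᶜ (constᶜ []) idᶜ)
        (pairᶜ (compᶜ sndᶜ fstᶜ) (pairᶜ (compᶜ fstᶜ sndᶜ) (compᶜ g∈ (pairᶜ (compᶜ fstᶜ sndᶜ) (pairᶜ fstᶜ (compᶜ sndᶜ sndᶜ))))))

      iterate-[] : ∀ n γs → iterate stepF n ([] , γs) ≡ ([] , γs)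
      iterate-[] zero    γs = refl
      iterate-[] (suc n) γs = iterate-[] n γs

      iterate-fold : ∀ n l γ s → length l ≤ n → iterate stepF n (l , (γ , s)) ≡ ([] , (γ , foldTail g γ l s))
      iterate-fold n       []      γ s le = iterate-[] n (γ , s)
      iterate-fold (suc n) (a ∷ l) γ s (s≤s le) = iterate-fold n l γ _ le

      iterate-len : ∀ j l γ s → let (l′ , (γ′ , s′)) = iterate stepF j (l , (γ , s)) in
        len (list A) l′ ≤ len (list A) l × γ′ ≡ γ × len S s′ ≤ len S s + j * ⟦ G ⟧ (len Γ γ + len (list A) l)
      iterate-len zero    l       γ s = ≤-refl , refl , m≤m+n _ _
      iterate-len (suc j) []      γ s with iterate stepF j ([] , (γ , s)) | iterate-[] j (γ , s)
      ... | _ | refl = ≤-refl , refl , m≤m+n _ _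
      iterate-len (suc j) (a ∷ l) γ s with iterate-len j l γ (g (γ , (a , l) , s))
      ... | p , q , r = ≤-trans p (len-tail A a l) , q ,
        ≤-trans r (≤-trans (+-mono-≤ (grow γ a l s) (*-monoʳ-≤ j (mono G (+-monoʳ-≤ (len Γ γ) (len-tail A a l)))))
          (≤-reflexive (+-assoc (len S s) _ _)))

      bd : Px
      bd = (𝕂 1 ⊕ 𝕏 ⊗ 𝕂 2) ⊕ ((𝕂 1 ⊕ 𝕏 ⊗ 𝕂 2) ⊕ (𝕏 ⊕ 𝕏 ⊗ (G ∘ₚ (𝕏 ⊕ 𝕏))))

      ok : ∀ l st j → j ≤ len (list A) l → len St (iterate stepF j st) ≤ ⟦ bd ⟧ (len (list A ⊠ St) (l , st))
      ok l₀ (l , (γ , s)) j j≤ with iterate stepF j (l , (γ , s)) | iterate-len j l γ s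
      ... | (l′ , (γ′ , s′)) | p , refl , r =
        ≤-trans (≤-reflexive (trans (len-⊠ (list A) (Γ ⊠ S) l′ (γ , s′)) (cong (suc (len (list A) l′ * 2) +_) (len-⊠ Γ S γ s′))))
          (+-mono-≤ (s≤s (*-monoˡ-≤ 2 (≤-trans p l≤)))
            (+-mono-≤ (s≤s (*-monoˡ-≤ 2 γ≤))
              (≤-trans r (+-mono-≤ s≤ (*-mono-≤ (≤-trans j≤ (len-fst (list A) St l₀ (l , (γ , s)))) (mono-∘ₚ G (𝕏 ⊕ 𝕏) n (+-mono-≤ γ≤ l≤)))))))
        where
        n = len (list A ⊠ St) (l₀ , (l , (γ , s)))
        st≤ : len St (l , (γ , s)) ≤ n
        st≤ = len-snd (list A) St l₀ (l , (γ , s))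
        l≤ : len (list A) l ≤ n
        l≤ = ≤-trans (len-fst (list A) (Γ ⊠ S) l (γ , s)) st≤
        γ≤ : len Γ γ ≤ n
        γ≤ = ≤-trans (len-fst Γ S γ s) (≤-trans (len-snd (list A) (Γ ⊠ S) l (γ , s)) st≤)
        s≤ : len S s ≤ n
        s≤ = ≤-trans (len-snd Γ S γ s) (≤-trans (len-snd (list A) (Γ ⊠ S) l (γ , s)) st≤)

    -- The list is its own clock: its code has at least as many bits as the list has elements, and
    -- surplus rounds change nothing once the list is used up.
    foldTailᶜ : Comp (list A ⊠ (Γ ⊠ S)) S (λ (l , (γ , s)) → foldTail g γ l s)
    foldTailᶜ = extᶜ (λ (l , (γ , s)) → cong (proj₂ ∘ proj₂) (iterate-fold _ l γ s (length≤len A l)))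
      (compᶜ (compᶜ sndᶜ sndᶜ) (compᶜ (iterᶜ {U = list A} step∈ bd ok) (pairᶜ fstᶜ idᶜ)))

  reverseᶜ : Comp (list A) (list A) reverse
  reverseᶜ {A = A} = extᶜ (λ l → fold-ʳ++ l [])
    (compᶜ (foldTailᶜ {Γ = bits} {S = list A} {g = λ (_ , (a , _) , s) → a ∷ s}
             (consᶜ (compᶜ fstᶜ (compᶜ fstᶜ sndᶜ)) (compᶜ sndᶜ sndᶜ)) (𝕂 1 ⊕ 𝕏 ⊗ 𝕂 2)
             (λ γ a as s → ≤-trans (≤-reflexive (trans (len-∷ A a s) (+-comm (suc (len A a * 2)) (len (list A) s))))
               (+-monoʳ-≤ (len (list A) s) (s≤s (*-monoˡ-≤ 2 (≤-trans (len-head A a as) (m≤n+m (len (list A) (a ∷ as)) (length γ))))))))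
      (pairᶜ idᶜ (pairᶜ (constᶜ []) (constᶜ []))))
    where
    fold-ʳ++ : ∀ l s → foldTail {Γ = Bits} (λ (_ , (a , _) , s) → a ∷ s) [] l s ≡ l ʳ++ s
    fold-ʳ++ []      s = refl
    fold-ʳ++ (a ∷ l) s = fold-ʳ++ l (a ∷ s)

  -- The loop consumes a list from the left, so a right fold is run as a left fold of the reversed
  -- list.
  foldrᶜ : ∀ {l : El Γ → List (El A)} {z : El Γ → El S} {g : El (Γ ⊠ (A ⊠ S)) → El S} →
    Comp Γ (list A) l → Comp Γ S z → Comp (Γ ⊠ (A ⊠ S)) S g → (G : Px) →
    (∀ γ a s → len S (g (γ , (a , s))) ≤ len S s + ⟦ G ⟧ (len Γ γ + len A a)) →
    Comp Γ S (λ γ → foldr (λ a s → g (γ , (a , s))) (z γ) (l γ))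
  foldrᶜ {Γ = Γ} {A} {S} {l} {z} {g} l∈ z∈ g∈ G grow =
    extᶜ (λ γ → trans (fold-foldl γ (reverse (l γ)) (z γ))
                      (trans (sym (reverse-foldr (λ a s → g (γ , (a , s))) (z γ) (reverse (l γ))))
                             (cong (foldr (λ a s → g (γ , (a , s))) (z γ)) (reverse-involutive (l γ)))))
      (compᶜ (foldTailᶜ {Γ = Γ} {S = S} {g = λ (γ , (a , _) , s) → g (γ , (a , s))}
               (compᶜ g∈ (pairᶜ fstᶜ (pairᶜ (compᶜ fstᶜ (compᶜ fstᶜ sndᶜ)) (compᶜ sndᶜ sndᶜ)))) G
               (λ γ a as s → ≤-trans (grow γ a s) (+-monoʳ-≤ (len S s) (mono G (+-monoʳ-≤ (len Γ γ) (len-head A a as))))))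
        (pairᶜ (compᶜ reverseᶜ l∈) (pairᶜ idᶜ z∈)))
    where
    fold-foldl : ∀ γ l s → foldTail (λ (γ , (a , _) , s) → g (γ , (a , s))) γ l s ≡ foldl (λ s a → g (γ , (a , s))) s l
    fold-foldl γ []      s = refl
    fold-foldl γ (a ∷ l) s = fold-foldl γ l _

  len-pair-bound : ∀ A B (a : El A) (b : El B) → len (A ⊠ B) (a , b) ≤ 1 + (len A a + len B b) * 2
  len-pair-bound A B a b = ≤-trans (≤-reflexive (len-⊠ A B a b))
    (s≤s (≤-trans (+-monoʳ-≤ (len A a * 2) (m≤m*n (len B b) 2)) (≤-reflexive (sym (*-distribʳ-+ 2 (len A a) (len B b))))))

  mapᶜ : ∀ {l : El Γ → List (El A)} {f : El (Γ ⊠ A) → El B} → Comp Γ (list A) l → Comp (Γ ⊠ A) B f →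
    Comp Γ (list B) (λ γ → map (λ a → f (γ , a)) (l γ))
  mapᶜ {Γ = Γ} {A} {B} {l} {f} l∈ f∈ = extᶜ (λ γ → foldr-map γ (l γ))
    (foldrᶜ {S = list B} {g = λ (γ , (a , s)) → f (γ , a) ∷ s} l∈ (constᶜ [])
      (consᶜ (compᶜ f∈ (pairᶜ fstᶜ (compᶜ fstᶜ sndᶜ))) (compᶜ sndᶜ sndᶜ))
      (𝕂 1 ⊕ (Comp.size f∈ ∘ₚ (𝕂 1 ⊕ 𝕏 ⊗ 𝕂 2)) ⊗ 𝕂 2)
      (λ γ a s → ≤-trans (≤-reflexive (trans (len-∷ B (f (γ , a)) s) (+-comm (suc (len B (f (γ , a)) * 2)) (len (list B) s))))
        (+-monoʳ-≤ (len (list B) s) (s≤s (*-monoˡ-≤ 2 (≤-trans (Comp.size-ok f∈ (γ , a))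
          (mono-∘ₚ (Comp.size f∈) (𝕂 1 ⊕ 𝕏 ⊗ 𝕂 2) (len Γ γ + len A a) (len-pair-bound Γ A γ a))))))))
    where
    foldr-map : ∀ γ l → foldr (λ a s → f (γ , a) ∷ s) [] l ≡ map (λ a → f (γ , a)) l
    foldr-map γ []      = refl
    foldr-map γ (a ∷ l) = cong (f (γ , a) ∷_) (foldr-map γ l)

  len-++ : ∀ A as bs → len (list A) (as ++ bs) ≡ len (list A) as + len (list A) bs
  len-++ A as bs = trans (cong length (List.concatMap-++ (λ a → frame (enc A a)) as bs)) (length-++ (enc (list A) as))

  appendᶜ : ∀ {f g : El Γ → List (El A)} → Comp Γ (list A) f → Comp Γ (list A) g → Comp Γ (list A) (λ γ → f γ ++ g γ)
  appendᶜ {Γ = Γ} {A} {f} {g} f∈ g∈ = extᶜ (λ γ → sym (List.++-is-foldr (f γ) (g γ)))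
    (foldrᶜ {S = list A} {g = λ (γ , (a , s)) → a ∷ s} f∈ g∈ (consᶜ (compᶜ fstᶜ sndᶜ) (compᶜ sndᶜ sndᶜ)) (𝕂 1 ⊕ 𝕏 ⊗ 𝕂 2)
      (λ γ a s → ≤-trans (≤-reflexive (trans (len-∷ A a s) (+-comm (suc (len A a * 2)) (len (list A) s))))
        (+-monoʳ-≤ (len (list A) s) (s≤s (*-monoˡ-≤ 2 (m≤n+m (len A a) (len Γ γ)))))))

  concatMapᶜ : ∀ {l : El Γ → List (El A)} {f : El (Γ ⊠ A) → List (El B)} → Comp Γ (list A) l → Comp (Γ ⊠ A) (list B) f →
    Comp Γ (list B) (λ γ → concatMap (λ a → f (γ , a)) (l γ))
  concatMapᶜ {Γ = Γ} {A} {B} {l} {f} l∈ f∈ = extᶜ (λ γ → foldr-concatMap γ (l γ))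
    (foldrᶜ {S = list B} {g = λ (γ , (a , s)) → f (γ , a) ++ s} l∈ (constᶜ [])
      (appendᶜ (compᶜ f∈ (pairᶜ fstᶜ (compᶜ fstᶜ sndᶜ))) (compᶜ sndᶜ sndᶜ))
      (Comp.size f∈ ∘ₚ (𝕂 1 ⊕ 𝕏 ⊗ 𝕂 2))
      (λ γ a s → ≤-trans (≤-reflexive (trans (len-++ B (f (γ , a)) s) (+-comm (len (list B) (f (γ , a))) _)))
        (+-monoʳ-≤ (len (list B) s) (≤-trans (Comp.size-ok f∈ (γ , a))
          (mono-∘ₚ (Comp.size f∈) (𝕂 1 ⊕ 𝕏 ⊗ 𝕂 2) (len Γ γ + len A a) (len-pair-bound Γ A γ a))))))
    where
    foldr-concatMap : ∀ γ l → foldr (λ a s → f (γ , a) ++ s) [] l ≡ concatMap (λ a → f (γ , a)) l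
    foldr-concatMap γ []      = refl
    foldr-concatMap γ (a ∷ l) = cong (f (γ , a) ++_) (foldr-concatMap γ l)

  _∧ᶜ_ : ∀ {f g : El Γ → Bool} → Comp Γ bool f → Comp Γ bool g → Comp Γ bool (λ γ → f γ ∧ g γ)
  _∧ᶜ_ {f = f} {g} f∈ g∈ = extᶜ (λ γ → if-∧ (f γ) (g γ)) (ifᶜ f∈ g∈ (constᶜ false))
    where
    if-∧ : ∀ a b → (if a then b else false) ≡ a ∧ b
    if-∧ false b = refl
    if-∧ true  b = refl

  _∨ᶜ_ : ∀ {f g : El Γ → Bool} → Comp Γ bool f → Comp Γ bool g → Comp Γ bool (λ γ → f γ ∨ g γ)
  _∨ᶜ_ {f = f} {g} f∈ g∈ = extᶜ (λ γ → if-∨ (f γ) (g γ)) (ifᶜ f∈ (constᶜ true) g∈)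
    where
    if-∨ : ∀ a b → (if a then true else b) ≡ a ∨ b
    if-∨ false b = refl
    if-∨ true  b = refl

  notᶜ : ∀ {f : El Γ → Bool} → Comp Γ bool f → Comp Γ bool (λ γ → not (f γ))
  notᶜ {f = f} f∈ = extᶜ (λ γ → if-not (f γ)) (ifᶜ f∈ (constᶜ false) (constᶜ true))
    where
    if-not : ∀ a → (if a then false else true) ≡ not a
    if-not false = refl
    if-not true  = refl

  len-bool : ∀ b → len bool b ≤ 1
  len-bool false = z≤n
  len-bool true  = ≤-refl

  allᵇ anyᵇ : ∀ {A : Set} → (A → Bool) → List A → Bool
  allᵇ p = foldr (λ a b → p a ∧ b) true
  anyᵇ p = foldr (λ a b → p a ∨ b) false

  allᶜ : ∀ {l : El Γ → List (El A)} {p : El (Γ ⊠ A) → Bool} → Comp Γ (list A) l → Comp (Γ ⊠ A) bool p →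
    Comp Γ bool (λ γ → allᵇ (λ a → p (γ , a)) (l γ))
  allᶜ {p = p} l∈ p∈ = foldrᶜ {S = bool} {g = λ (γ , (a , s)) → p (γ , a) ∧ s} l∈ (constᶜ true)
    (compᶜ p∈ (pairᶜ fstᶜ (compᶜ fstᶜ sndᶜ)) ∧ᶜ compᶜ sndᶜ sndᶜ) (𝕂 1)
    (λ γ a s → ≤-trans (len-bool (p (γ , a) ∧ s)) (m≤n+m _ _))

  anyᶜ : ∀ {l : El Γ → List (El A)} {p : El (Γ ⊠ A) → Bool} → Comp Γ (list A) l → Comp (Γ ⊠ A) bool p →
    Comp Γ bool (λ γ → anyᵇ (λ a → p (γ , a)) (l γ))
  anyᶜ {p = p} l∈ p∈ = foldrᶜ {S = bool} {g = λ (γ , (a , s)) → p (γ , a) ∨ s} l∈ (constᶜ false)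
    (compᶜ p∈ (pairᶜ fstᶜ (compᶜ fstᶜ sndᶜ)) ∨ᶜ compᶜ sndᶜ sndᶜ) (𝕂 1)
    (λ γ a s → ≤-trans (len-bool (p (γ , a) ∨ s)) (m≤n+m _ _))

  -- Simultaneous folds over two words, the shorter one padded with zeros

  zfold : ∀ {S : Set} → (Bool → Bool → S → S) → Bits → Bits → S → S
  zfold g []      []      s = s
  zfold g []      (y ∷ b) s = zfold g [] b (g false y s)
  zfold g (x ∷ a) []      s = zfold g a [] (g x false s)
  zfold g (x ∷ a) (y ∷ b) s = zfold g a b (g x y s)

  module _ {S : Ty} {g : Bool → Bool → El S → El S} (g∈ : ∀ x y → Comp S S (g x y)) (c : ℕ)
    (grow : ∀ x y s → len S (g x y s) ≤ len S s + c) where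

    private
      St : Ty
      St = bits ⊠ (bits ⊠ S)

      goB : Bool → El (bits ⊠ (bits ⊠ S)) → El St
      goB x = (λ (b , (a , s)) → bitsMatch (λ (a , s) → a , ([] , g x false s)) (λ y (b , (a , s)) → a , (b , g x y s)) (b , (a , s)))

      goB∈ : ∀ x → Comp (bits ⊠ (bits ⊠ S)) St (goB x)
      goB∈ x = bitsCase (pairᶜ fstᶜ (pairᶜ (constᶜ []) (compᶜ (g∈ x false) sndᶜ)))
        (λ y → pairᶜ (compᶜ fstᶜ sndᶜ) (pairᶜ fstᶜ (compᶜ (g∈ x y) (compᶜ sndᶜ sndᶜ))))

      stepF : El St → El St
      stepF = bitsMatch (bitsMatch (λ s → [] , ([] , s)) (λ y (b , s) → [] , (b , g false y s)))
                        (λ x (a , (b , s)) → goB x (b , (a , s)))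

      step∈ : Comp St St stepF
      step∈ = bitsCase (bitsCase (pairᶜ (constᶜ []) (pairᶜ (constᶜ []) idᶜ)) (λ y → pairᶜ (constᶜ []) (pairᶜ fstᶜ (compᶜ (g∈ false y) sndᶜ))))
                       (λ x → compᶜ (goB∈ x) (pairᶜ (compᶜ fstᶜ sndᶜ) (pairᶜ fstᶜ (compᶜ sndᶜ sndᶜ))))

      iterate-done : ∀ n s → iterate stepF n ([] , ([] , s)) ≡ ([] , ([] , s))
      iterate-done zero    s = refl
      iterate-done (suc n) s = iterate-done n s

      iterate-zfold : ∀ n a b s → length a + length b ≤ n → iterate stepF n (a , (b , s)) ≡ ([] , ([] , zfold g a b s))
      iterate-zfold n       []      []      s le       = iterate-done n s
      iterate-zfold (suc n) []      (y ∷ b) s (s≤s le) = iterate-zfold n [] b _ le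
      iterate-zfold (suc n) (x ∷ a) []      s (s≤s le) = iterate-zfold n a [] _ le
      iterate-zfold (suc n) (x ∷ a) (y ∷ b) s (s≤s le) = iterate-zfold n a b _ (≤-trans (+-monoʳ-≤ (length a) (n≤1+n _)) le)

      iterate-len : ∀ j a b s → let (a′ , (b′ , s′)) = iterate stepF j (a , (b , s)) in
        length a′ ≤ length a × length b′ ≤ length b × len S s′ ≤ len S s + j * c
      iterate-len zero a b s = ≤-refl , ≤-refl , m≤m+n _ _
      iterate-len (suc j) [] [] s with iterate-len j [] [] s
      ... | p , q , r = p , q , ≤-trans r (+-monoʳ-≤ (len S s) (m≤n+m _ c))
      iterate-len (suc j) [] (y ∷ b) s with iterate-len j [] b (g false y s)
      ... | p , q , r = p , ≤-trans q (n≤1+n _) , ≤-trans r (≤-trans (+-monoˡ-≤ (j * c) (grow false y s)) (≤-reflexive (+-assoc (len S s) c _)))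
      iterate-len (suc j) (x ∷ a) [] s with iterate-len j a [] (g x false s)
      ... | p , q , r = ≤-trans p (n≤1+n _) , q , ≤-trans r (≤-trans (+-monoˡ-≤ (j * c) (grow x false s)) (≤-reflexive (+-assoc (len S s) c _)))
      iterate-len (suc j) (x ∷ a) (y ∷ b) s with iterate-len j a b (g x y s)
      ... | p , q , r = ≤-trans p (n≤1+n _) , ≤-trans q (n≤1+n _) , ≤-trans r (≤-trans (+-monoˡ-≤ (j * c) (grow x y s)) (≤-reflexive (+-assoc (len S s) c _)))

      U : Ty
      U = bits ⊠ bits

      bd : Px
      bd = (𝕂 1 ⊕ 𝕏 ⊗ 𝕂 2) ⊕ ((𝕂 1 ⊕ 𝕏 ⊗ 𝕂 2) ⊕ (𝕏 ⊕ 𝕏 ⊗ 𝕂 c))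

      ok : ∀ u st j → j ≤ len U u → len St (iterate stepF j st) ≤ ⟦ bd ⟧ (len (U ⊠ St) (u , st))
      ok u (a , (b , s)) j j≤ with iterate stepF j (a , (b , s)) | iterate-len j a b s
      ... | (a′ , (b′ , s′)) | p , q , r =
        ≤-trans (≤-reflexive (trans (len-⊠ bits (bits ⊠ S) a′ (b′ , s′)) (cong (suc (length a′ * 2) +_) (len-⊠ bits S b′ s′))))
          (+-mono-≤ (s≤s (*-monoˡ-≤ 2 (≤-trans p (≤-trans (len-fst bits (bits ⊠ S) a (b , s)) st≤))))
            (+-mono-≤ (s≤s (*-monoˡ-≤ 2 (≤-trans q (≤-trans (len-fst bits S b s) (≤-trans (len-snd bits (bits ⊠ S) a (b , s)) st≤)))))
              (≤-trans r (+-mono-≤ (≤-trans (len-snd bits S b s) (≤-trans (len-snd bits (bits ⊠ S) a (b , s)) st≤))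
                (*-monoˡ-≤ c (≤-trans j≤ (len-fst U St u (a , (b , s)))))))))
        where
        st≤ : len St (a , (b , s)) ≤ len (U ⊠ St) (u , (a , (b , s)))
        st≤ = len-snd U St u (a , (b , s))

      count : ∀ a b → length a + length b ≤ len U (a , b)
      count a b = ≤-trans (+-monoˡ-≤ (length b) (≤-trans (m≤m*n (length a) 2) (n≤1+n _))) (≤-reflexive (sym (len-⊠ bits bits a b)))

    -- The pair of words is the clock; its code is at least as long as both words together.
    zfoldᶜ : Comp (bits ⊠ (bits ⊠ S)) S (λ (a , (b , s)) → zfold g a b s)
    zfoldᶜ = extᶜ (λ (a , (b , s)) → cong (proj₂ ∘ proj₂) (iterate-zfold _ a b s (count a b)))
      (compᶜ (compᶜ sndᶜ sndᶜ) (compᶜ (iterᶜ {U = U} step∈ bd ok) (pairᶜ (pairᶜ fstᶜ (compᶜ fstᶜ sndᶜ)) idᶜ)))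

-- Binary arithmetic, comparison and parsing.

module BinaryPrograms where

  open import Defs
  open Computable
  open ListPrograms
  open StackPrograms using (_▹_)
  open import Data.Vec.Base using ([]; _∷_)
  open import Data.Bool.Base using (Bool; true; false; not; T)
  open import Data.Empty using (⊥; ⊥-elim)
  open import Data.List.Base using (List; []; _∷_; _++_; length; _ʳ++_; foldr; reverse)
  open import Data.List.Properties using (ʳ++-ʳ++)
  import Data.List.Properties as List
  open import Data.Nat.Base using (ℕ; zero; suc; _+_; _*_; _≤_; _<_; _≤ᵇ_; _<ᵇ_; z≤n; s≤s)
  open import Data.Nat.ListAction using (sum)
  open import Data.Nat.Properties
  open import Data.Product.Base using (_×_; _,_; proj₁; proj₂)
  open import Data.Unit.Base using (tt)
  open import Function.Base using (_∘_; id)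
  open import Relation.Binary.PropositionalEquality using (_≡_; refl; sym; trans; cong; cong₂; subst)
  open import Data.Nat.Solver using (module +-*-Solver)

  private
    variable
      A B C Γ Z S : Ty

  retypeResult : ∀ {f : El A → El B} {g : El A → El C} → Comp A B f → (∀ a → enc B (f a) ≡ enc C (g a)) → Comp A C g
  retypeResult {A = A} {B} {C} {f} {g} f∈ eq = record
    { code = Comp.code f∈ ; size = Comp.size f∈ ; time = Comp.time f∈
    ; size-ok = λ a → subst (λ w → length w ≤ _) (eq a) (Comp.size-ok f∈ a)
    ; runs = λ a δ ξ η → subst (λ w → Comp.code f∈ ⊢ (enc A a ▹ δ) ∷ ξ ∷ η ∷ [] ⇓≤ _ ∣ (w ▹ δ) ∷ ξ ∷ η ∷ []) (eq a) (Comp.runs f∈ a δ ξ η) }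

  bitℕ : Bool → ℕ
  bitℕ false = 0
  bitℕ true  = 1

  val : Bits → ℕ
  val []      = 0
  val (b ∷ w) = bitℕ b + 2 * val w

  -- The most significant bit, which comes last, is 1. These are exactly the words `binary n`, so
  -- statements about codes can be proved through values.
  data Canonical : Bits → Set where
    c[] : Canonical []
    c1  : Canonical (true ∷ [])
    c∷  : ∀ {b c w} → Canonical (c ∷ w) → Canonical (b ∷ c ∷ w)

  canonical-tail : ∀ {b w} → Canonical (b ∷ w) → Canonical w
  canonical-tail c1     = c[]
  canonical-tail (c∷ c) = c

  val-increment : ∀ w → val (increment w) ≡ suc (val w)
  val-increment []          = refl
  val-increment (false ∷ w) = refl
  val-increment (true ∷ w)  = trans (cong (2 *_) (val-increment w)) (*-suc 2 (val w))

  val-binary : ∀ n → val (binary n) ≡ n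
  val-binary zero    = refl
  val-binary (suc n) = trans (val-increment (binary n)) (cong suc (val-binary n))

  canonical-increment : ∀ {w} → Canonical w → Canonical (increment w)
  canonical-increment c[] = c1
  canonical-increment c1  = c∷ c1
  canonical-increment {false ∷ c ∷ w} (c∷ p) = c∷ p
  canonical-increment {true ∷ false ∷ w} (c∷ p) = c∷ (canonical-increment p)
  canonical-increment {true ∷ true ∷ w} (c∷ p) = c∷ (canonical-increment p)

  canonical-binary : ∀ n → Canonical (binary n)
  canonical-binary zero    = c[]
  canonical-binary (suc n) = canonical-increment (canonical-binary n)

  binary-odd : ∀ n → binary (suc (2 * n)) ≡ true ∷ binary n
  binary-odd zero    = refl
  binary-odd (suc n) = trans (cong (λ k → binary (suc k)) (*-suc 2 n))
    (cong (increment ∘ increment) (binary-odd n))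

  binary-even : ∀ n → binary (2 * suc n) ≡ false ∷ binary (suc n)
  binary-even n = trans (cong binary (*-suc 2 n)) (cong increment (binary-odd n))

  binary-val : ∀ {w} → Canonical w → binary (val w) ≡ w
  binary-val c[] = refl
  binary-val c1  = refl
  binary-val {true ∷ w} (c∷ p) = trans (binary-odd (val w)) (cong (true ∷_) (binary-val p))
  binary-val {false ∷ w} (c∷ p) with val w | binary-val p
  ... | suc n | eq = trans (binary-even n) (cong (false ∷_) eq)

  private
    carry sumBit : Bool → Bool → Bool → Bool
    carry false false c = false
    carry true  true  c = true
    carry _     _     c = c
    sumBit false false c = c
    sumBit true  true  c = c
    sumBit _     _     c = not c

    fullAdder : ∀ x y c → bitℕ (sumBit x y c) + 2 * bitℕ (carry x y c) ≡ bitℕ x + bitℕ y + bitℕ c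
    fullAdder false false false = refl
    fullAdder false false true  = refl
    fullAdder false true  false = refl
    fullAdder false true  true  = refl
    fullAdder true  false false = refl
    fullAdder true  false true  = refl
    fullAdder true  true  false = refl
    fullAdder true  true  true  = refl

    carryWord : Bool → Bits
    carryWord false = []
    carryWord true  = true ∷ []

    addBits : Bits → Bits → Bool → Bits
    addBits []      []      c = carryWord c
    addBits []      (y ∷ b) c = sumBit false y c ∷ addBits [] b (carry false y c)
    addBits (x ∷ a) []      c = sumBit x false c ∷ addBits a [] (carry x false c)
    addBits (x ∷ a) (y ∷ b) c = sumBit x y c ∷ addBits a b (carry x y c)

    val-addBits : ∀ a b c → val (addBits a b c) ≡ val a + val b + bitℕ c
    val-addBits []      []      false = refl
    val-addBits []      []      true  = refl
    val-addBits []      (y ∷ b) c = trans (cong (λ v → bitℕ (sumBit false y c) + 2 * v) (val-addBits [] b (carry false y c)))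
      (trans (solve 3 (λ s v k → s :+ con 2 :* (v :+ k) := (s :+ con 2 :* k) :+ con 2 :* v) refl (bitℕ (sumBit false y c)) (val b) (bitℕ (carry false y c)))
        (trans (cong (_+ 2 * val b) (fullAdder false y c)) (solve 3 (λ y c v → (y :+ c) :+ con 2 :* v := (y :+ con 2 :* v) :+ c) refl (bitℕ y) (bitℕ c) (val b))))
      where open +-*-Solver
    val-addBits (x ∷ a) []      c = trans (cong (λ v → bitℕ (sumBit x false c) + 2 * v) (val-addBits a [] (carry x false c)))
      (trans (solve 3 (λ s v k → s :+ con 2 :* (v :+ con 0 :+ k) := (s :+ con 2 :* k) :+ con 2 :* v) refl (bitℕ (sumBit x false c)) (val a) (bitℕ (carry x false c)))
        (trans (cong (_+ 2 * val a) (fullAdder x false c)) (solve 3 (λ y c v → (y :+ con 0 :+ c) :+ con 2 :* v := (y :+ con 2 :* v) :+ con 0 :+ c) refl (bitℕ x) (bitℕ c) (val a))))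
      where open +-*-Solver
    val-addBits (x ∷ a) (y ∷ b) c = trans (cong (λ v → bitℕ (sumBit x y c) + 2 * v) (val-addBits a b (carry x y c)))
      (trans (solve 4 (λ s u v k → s :+ con 2 :* (u :+ v :+ k) := (s :+ con 2 :* k) :+ con 2 :* (u :+ v)) refl (bitℕ (sumBit x y c)) (val a) (val b) (bitℕ (carry x y c)))
        (trans (cong (_+ 2 * (val a + val b)) (fullAdder x y c))
          (solve 5 (λ x y c u v → (x :+ y :+ c) :+ con 2 :* (u :+ v) := (x :+ con 2 :* u) :+ (y :+ con 2 :* v) :+ c) refl (bitℕ x) (bitℕ y) (bitℕ c) (val a) (val b))))
      where open +-*-Solver

    canonical-cons : ∀ s {r} → Canonical r → (r ≡ [] → s ≡ true) → Canonical (s ∷ r)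
    canonical-cons s {[]}    p h rewrite h refl = c1
    canonical-cons s {c ∷ r} p h = c∷ p

    canonical-addBits : ∀ {a b} c → Canonical a → Canonical b → Canonical (addBits a b c)
    canonical-addBits {[]}    {[]}    false p q = c[]
    canonical-addBits {[]}    {[]}    true  p q = c1
    canonical-addBits {[]}    {y ∷ b} c p q = canonical-cons _ (canonical-addBits (carry false y c) p (canonical-tail q)) (h y b c q)
      where
      h : ∀ y b c → Canonical (y ∷ b) → addBits [] b (carry false y c) ≡ [] → sumBit false y c ≡ true
      h true [] false q eq = refl
      h true [] true  q ()
      h y (_ ∷ _) c q ()
    canonical-addBits {x ∷ a} {[]}    c p q = canonical-cons _ (canonical-addBits (carry x false c) (canonical-tail p) q) (h x a c p)
      where
      h : ∀ x a c → Canonical (x ∷ a) → addBits a [] (carry x false c) ≡ [] → sumBit x false c ≡ true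
      h true [] false q eq = refl
      h true [] true  q ()
      h y (_ ∷ _) c q ()
    canonical-addBits {x ∷ a} {y ∷ b} c p q = canonical-cons _ (canonical-addBits (carry x y c) (canonical-tail p) (canonical-tail q)) (h x y a b c p q)
      where
      h : ∀ x y a b c → Canonical (x ∷ a) → Canonical (y ∷ b) → addBits a b (carry x y c) ≡ [] → sumBit x y c ≡ true
      h true true [] [] c p q ()
      h x y [] (_ ∷ _) c p q ()
      h x y (_ ∷ _) [] c p q ()
      h x y (_ ∷ _) (_ ∷ _) c p q ()

    length-addBits : ∀ a b c → length (addBits a b c) ≤ suc (length a + length b)
    length-addBits []      []      false = z≤n
    length-addBits []      []      true  = ≤-refl
    length-addBits []      (y ∷ b) c = s≤s (length-addBits [] b _)
    length-addBits (x ∷ a) []      c = s≤s (length-addBits a [] _)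
    length-addBits (x ∷ a) (y ∷ b) c = s≤s (≤-trans (length-addBits a b _) (s≤s (+-monoʳ-≤ (length a) (n≤1+n _))))

  -- Canonical words are determined by their values, so it is enough that ripple-carry addition adds
  -- the values and never creates a leading zero.
  addBits-binary : ∀ m n → addBits (binary m) (binary n) false ≡ binary (m + n)
  addBits-binary m n = trans (sym (binary-val (canonical-addBits false (canonical-binary m) (canonical-binary n))))
    (cong binary (trans (val-addBits (binary m) (binary n) false)
      (trans (+-identityʳ _) (cong₂ _+_ (val-binary m) (val-binary n)))))

  len-+ : ∀ m n → len nat (m + n) ≤ suc (len nat m + len nat n)
  len-+ m n = ≤-trans (≤-reflexive (cong length (sym (addBits-binary m n)))) (length-addBits (binary m) (binary n) false)

  reverseBitsᶜ : Comp bits bits (λ w → w ʳ++ [])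
  reverseBitsᶜ = extᶜ (λ w → go w []) (compᶜ (zfoldᶜ {S = bits} {g = λ x _ s → x ∷ s} (λ x _ → consBitᶜ x) 1 (λ x y s → ≤-reflexive (+-comm 1 (length s))))
      (pairᶜ idᶜ (pairᶜ (constᶜ []) (constᶜ []))))
    where
    go : ∀ w s → zfold (λ x _ s → x ∷ s) w [] s ≡ w ʳ++ s
    go []      s = refl
    go (x ∷ w) s = go w (x ∷ s)

  _+ᶜ_ : ∀ {f g : El Γ → ℕ} → Comp Γ nat f → Comp Γ nat g → Comp Γ nat (λ γ → f γ + g γ)
  _+ᶜ_ {f = f} {g = g} f∈ g∈ = compᶜ add∈ (pairᶜ f∈ g∈)
    where
    St : Ty
    St = bool ⊠ bits
    adder : Bool → Bool → Bool × Bits → Bool × Bits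
    adder x y (c , acc) = carry x y c , sumBit x y c ∷ acc
    pushBit : ∀ x y → Comp St bits (λ (c , acc) → sumBit x y c ∷ acc)
    pushBit x y = extᶜ (λ { (false , acc) → refl ; (true , acc) → refl })
      (boolCase {f = sumBit x y true ∷_} {g = sumBit x y false ∷_} (consBitᶜ _) (consBitᶜ _))
    newCarry : ∀ x y → Comp St bool (λ (c , acc) → carry x y c)
    newCarry false false = constᶜ false
    newCarry true  true  = constᶜ true
    newCarry false true  = fstᶜ
    newCarry true  false = fstᶜ
    grow : ∀ x y s → len St (adder x y s) ≤ len St s + 3
    grow x y (c , acc) = ≤-trans (≤-reflexive (len-⊠ bool bits (carry x y c) (sumBit x y c ∷ acc)))
      (≤-trans (≤-trans (s≤s (+-monoˡ-≤ (suc (length acc)) (*-monoˡ-≤ 2 (len-bool (carry x y c)))))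
          (≤-trans (≤-reflexive (+-comm 4 (length acc))) (≤-trans (≤-reflexive (+-suc (length acc) 3)) (+-monoˡ-≤ 3 (s≤s (m≤n+m (length acc) (len bool c * 2)))))))
        (≤-reflexive (cong (_+ 3) (sym (len-⊠ bool bits c acc)))))
    -- The fold has pushed the digits of the sum least significant first. The final carry becomes
    -- the leading digit when they are reversed.
    flush : Bool × Bits → Bits
    flush (c , acc) = acc ʳ++ carryWord c
    flush∈ : Comp St bits flush
    flush∈ = extᶜ (λ { (false , acc) → refl ; (true , acc) → refl })
      (boolCase (compᶜ reverseBitsᶜ (consBitᶜ true)) reverseBitsᶜ)
    flush-zfold : ∀ a b c acc → flush (zfold adder a b (c , acc)) ≡ acc ʳ++ addBits a b c
    flush-zfold []      []      c acc = refl
    flush-zfold []      (y ∷ b) c acc = flush-zfold [] b _ _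
    flush-zfold (x ∷ a) []      c acc = flush-zfold a [] _ _
    flush-zfold (x ∷ a) (y ∷ b) c acc = flush-zfold a b _ _
    addBits∈ : Comp (bits ⊠ bits) bits (λ (a , b) → addBits a b false)
    addBits∈ = extᶜ (λ (a , b) → flush-zfold a b false [])
      (compᶜ flush∈ (compᶜ (zfoldᶜ {S = St} {g = adder} (λ x y → pairᶜ (newCarry x y) (pushBit x y)) 3 grow)
        (pairᶜ fstᶜ (pairᶜ sndᶜ (constᶜ (false , []))))))
    add∈ : Comp (nat ⊠ nat) nat (λ (m , n) → m + n)
    add∈ = retypeResult (compᶜ {f = λ (m , n) → binary m , binary n} addBits∈ (retype {A = nat ⊠ nat} {B = bits ⊠ bits} λ _ → refl)) λ (m , n) → addBits-binary m n

  -- Bits arrive least significant first, so a later difference overrides the verdict of all earlier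
  -- ones.
  leBit : Bool → Bool → Bool → Bool
  leBit false true  f = true
  leBit true  false f = false
  leBit _     _     f = f

  private
    T⇔⇒≡ : ∀ {p q} → (T p → T q) → (T q → T p) → p ≡ q
    T⇔⇒≡ {false} {false} f g = refl
    T⇔⇒≡ {false} {true}  f g = ⊥-elim (g tt)
    T⇔⇒≡ {true}  {false} f g = ⊥-elim (f tt)
    T⇔⇒≡ {true}  {true}  f g = refl

    <ᵇ-cong : ∀ {m n m′ n′} → (m < n → m′ < n′) → (m′ < n′ → m < n) → (m <ᵇ n) ≡ (m′ <ᵇ n′)
    <ᵇ-cong f g = T⇔⇒≡ (λ t → <⇒<ᵇ (f (<ᵇ⇒< _ _ t))) (λ t → <⇒<ᵇ (g (<ᵇ⇒< _ _ t)))

    half-< : ∀ {a b} → 2 * a < 2 * b → a < b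
    half-< {a} {b} h = *-cancelˡ-< 2 a b h

    double-< : ∀ {a b} → a < b → suc (2 * a) < 2 * b
    double-< {a} {b} h = ≤-trans (≤-reflexive (sym (*-suc 2 a))) (*-monoʳ-≤ 2 h)

    half-≤ : ∀ {a b} → 2 * a < suc (2 * b) → a ≤ b
    half-≤ (s≤s h) = *-cancelˡ-≤ 2 h

    -- `f` is the verdict on a tie, `true` meaning `≤` and `false` meaning `<`. Two numbers compare
    -- as their halves do, a tie of the halves being decided by the lowest bits and, if these agree,
    -- by `f`.
    leStep : ∀ x y f A B → (bitℕ x + 2 * A <ᵇ (bitℕ y + 2 * B) + bitℕ f) ≡ (A <ᵇ B + bitℕ (leBit x y f))
    leStep false false false A B rewrite +-identityʳ (2 * B) = trans
      (<ᵇ-cong {2 * A} {2 * B} {A} {B} half-< (λ h → <⇒≤ (double-< h)))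
      (cong (A <ᵇ_) (sym (+-identityʳ B)))
    leStep false false true  A B rewrite +-comm (2 * B) 1 = trans
      (<ᵇ-cong {2 * A} {suc (2 * B)} {A} {suc B} (λ h → s≤s (half-≤ h)) (λ { (s≤s h) → s≤s (*-monoʳ-≤ 2 h) }))
      (cong (A <ᵇ_) (sym (+-comm B 1)))
    leStep false true  false A B rewrite +-identityʳ (2 * B) = trans
      (<ᵇ-cong {2 * A} {suc (2 * B)} {A} {suc B} (λ h → s≤s (half-≤ h)) (λ { (s≤s h) → s≤s (*-monoʳ-≤ 2 h) }))
      (cong (A <ᵇ_) (sym (+-comm B 1)))
    leStep false true  true  A B rewrite +-comm (2 * B) 1 = trans
      (<ᵇ-cong {2 * A} {suc (suc (2 * B))} {A} {suc B} (λ h → half-< (≤-trans h (≤-reflexive (sym (*-suc 2 B))))) (λ { (s≤s h) → s≤s (≤-trans (*-monoʳ-≤ 2 h) (n≤1+n _)) }))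
      (cong (A <ᵇ_) (sym (+-comm B 1)))
    leStep true  false false A B rewrite +-identityʳ (2 * B) = trans
      (<ᵇ-cong {suc (2 * A)} {2 * B} {A} {B} (λ h → half-< (<⇒≤ h)) double-<)
      (cong (A <ᵇ_) (sym (+-identityʳ B)))
    leStep true  false true  A B rewrite +-comm (2 * B) 1 = trans
      (<ᵇ-cong {suc (2 * A)} {suc (2 * B)} {A} {B} (λ { (s≤s h) → half-< h }) (λ h → s≤s (<⇒≤ (double-< h))))
      (cong (A <ᵇ_) (sym (+-identityʳ B)))
    leStep true  true  false A B rewrite +-identityʳ (2 * B) = trans
      (<ᵇ-cong {suc (2 * A)} {suc (2 * B)} {A} {B} (λ { (s≤s h) → half-< h }) (λ h → s≤s (<⇒≤ (double-< h))))
      (cong (A <ᵇ_) (sym (+-identityʳ B)))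
    leStep true  true  true  A B rewrite +-comm (2 * B) 1 = trans
      (<ᵇ-cong {suc (2 * A)} {suc (suc (2 * B))} {A} {suc B} (λ { (s≤s h) → s≤s (half-≤ h) }) (λ { (s≤s h) → s≤s (s≤s (*-monoʳ-≤ 2 h)) }))
      (cong (A <ᵇ_) (sym (+-comm B 1)))

    zfold-le : ∀ a b f → zfold leBit a b f ≡ (val a <ᵇ val b + bitℕ f)
    zfold-le []      []      false = refl
    zfold-le []      []      true  = refl
    zfold-le []      (y ∷ b) f = trans (zfold-le [] b (leBit false y f)) (sym (leStep false y f 0 (val b)))
    zfold-le (x ∷ a) []      f = trans (zfold-le a [] (leBit x false f)) (sym (leStep x false f (val a) 0))
    zfold-le (x ∷ a) (y ∷ b) f = trans (zfold-le a b (leBit x y f)) (sym (leStep x y f (val a) (val b)))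

    ≤ᵇ-suc : ∀ m n → (m <ᵇ n + 1) ≡ (m ≤ᵇ n)
    ≤ᵇ-suc m n rewrite +-comm n 1 = T⇔⇒≡ (λ t → ≤⇒≤ᵇ (≤-pred (<ᵇ⇒< m (suc n) t))) (λ t → <⇒<ᵇ (s≤s (≤ᵇ⇒≤ m n t)))

  _≤ᶜ_ : ∀ {f g : El Γ → ℕ} → Comp Γ nat f → Comp Γ nat g → Comp Γ bool (λ γ → f γ ≤ᵇ g γ)
  _≤ᶜ_ {f = f} {g = g} f∈ g∈ = compᶜ le∈ (pairᶜ f∈ g∈)
    where
    leBit∈ : ∀ x y → Comp bool bool (leBit x y)
    leBit∈ false false = idᶜ
    leBit∈ false true  = constᶜ true
    leBit∈ true  false = constᶜ false
    leBit∈ true  true  = idᶜ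
    le∈ : Comp (nat ⊠ nat) bool (λ (m , n) → m ≤ᵇ n)
    le∈ = extᶜ (λ (m , n) → trans (zfold-le (binary m) (binary n) true)
                  (trans (cong₂ (λ a b → a <ᵇ b + 1) (val-binary m) (val-binary n)) (≤ᵇ-suc m n)))
      (compᶜ {f = λ (m , n) → binary m , (binary n , true)} (zfoldᶜ {S = bool} {g = leBit} leBit∈ 1 (λ x y s → ≤-trans (len-bool (leBit x y s)) (m≤n+m _ _)))
        (pairᶜ (compᶜ {f = proj₁} (retype {A = nat} {B = bits} λ _ → refl) fstᶜ)
               (pairᶜ (compᶜ {f = proj₂} (retype {A = nat} {B = bits} λ _ → refl) sndᶜ) (constᶜ true))))

  private
    sameBit : Bool → Bool → Bool → Bool
    sameBit false false f = f
    sameBit true  true  f = f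
    sameBit _     _     f = false

    zfold-same-false : ∀ a b → zfold sameBit a b false ≡ false
    zfold-same-false []      []      = refl
    zfold-same-false []      (false ∷ b) = zfold-same-false [] b
    zfold-same-false []      (true ∷ b)  = zfold-same-false [] b
    zfold-same-false (false ∷ a) []      = zfold-same-false a []
    zfold-same-false (true ∷ a)  []      = zfold-same-false a []
    zfold-same-false (false ∷ a) (false ∷ b) = zfold-same-false a b
    zfold-same-false (false ∷ a) (true ∷ b)  = zfold-same-false a b
    zfold-same-false (true ∷ a)  (false ∷ b) = zfold-same-false a b
    zfold-same-false (true ∷ a)  (true ∷ b)  = zfold-same-false a b

  -- The fold pads the shorter word with zeros and would identify words that differ by final zeros;
  -- framing the words first prevents this.
  eqBits : Bits → Bits → Bool
  eqBits a b = zfold sameBit (frame a) (frame b) true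

  eqBits-refl : ∀ a → eqBits a a ≡ true
  eqBits-refl []          = refl
  eqBits-refl (false ∷ a) = eqBits-refl a
  eqBits-refl (true ∷ a)  = eqBits-refl a

  eqBits-sound : ∀ a b → T (eqBits a b) → a ≡ b
  eqBits-sound []          []          t = refl
  eqBits-sound []          (y ∷ b)     t = ⊥-elim (subst T (zfold-same-false [] (y ∷ frame b)) t)
  eqBits-sound (x ∷ a)     []          t = ⊥-elim (subst T (zfold-same-false (x ∷ frame a) []) t)
  eqBits-sound (false ∷ a) (false ∷ b) t = cong (false ∷_) (eqBits-sound a b t)
  eqBits-sound (true ∷ a)  (true ∷ b)  t = cong (true ∷_) (eqBits-sound a b t)
  eqBits-sound (false ∷ a) (true ∷ b)  t = ⊥-elim (subst T (zfold-same-false (frame a) (frame b)) t)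
  eqBits-sound (true ∷ a)  (false ∷ b) t = ⊥-elim (subst T (zfold-same-false (frame a) (frame b)) t)

  frameᶜ : Comp bits bits frame
  frameᶜ = extᶜ (λ w → List.++-identityʳ (frame w)) (compᶜ {B = bits ⊠ bits} {f = λ w → w , []} (retype {A = bits ⊠ bits} {B = bits} {f = λ (a , b) → frame a ++ b} λ _ → refl) (pairᶜ idᶜ (constᶜ [])))

  eqBitsᶜ : ∀ {f g : El Γ → Bits} → Comp Γ bits f → Comp Γ bits g → Comp Γ bool (λ γ → eqBits (f γ) (g γ))
  eqBitsᶜ f∈ g∈ = compᶜ (zfoldᶜ {S = bool} {g = sameBit} same∈ 1 (λ x y s → ≤-trans (len-bool (sameBit x y s)) (m≤n+m _ _)))
    (pairᶜ (compᶜ frameᶜ f∈) (pairᶜ (compᶜ frameᶜ g∈) (constᶜ true)))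
    where
    same∈ : ∀ x y → Comp bool bool (sameBit x y)
    same∈ false false = idᶜ
    same∈ false true  = constᶜ false
    same∈ true  false = constᶜ false
    same∈ true  true  = idᶜ

  private
    consDigit : Bool → Bits → Bits
    consDigit false []      = []
    consDigit false (b ∷ w) = false ∷ b ∷ w
    consDigit true  w       = true ∷ w

    consDigit-binary : ∀ b n → consDigit b (binary n) ≡ binary (bitℕ b + 2 * n)
    consDigit-binary true  n       = sym (binary-odd n)
    consDigit-binary false zero    = refl
    consDigit-binary false (suc n) with binary (suc n) | canonical-binary (suc n) | binary-even n | val-binary (suc n)
    ... | []    | _ | eq | ()
    ... | c ∷ w | _ | eq | _ = sym eq

    consDigit∈ : ∀ b → Comp bits bits (consDigit b)
    consDigit∈ true  = consBitᶜ true
    consDigit∈ false = extᶜ (λ { [] → refl ; (b ∷ w) → refl })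
      (compᶜ (bitsCase {Γ = bits} {f = λ _ → []} {g = λ _ (_ , w) → false ∷ w} (constᶜ []) (λ _ → compᶜ (consBitᶜ false) sndᶜ)) (pairᶜ idᶜ idᶜ))

  doubleᶜ : ∀ {f : El Γ → ℕ} → Comp Γ nat f → Comp Γ nat (λ γ → 2 * f γ)
  doubleᶜ f∈ = compᶜ {f = _} {g = 2 *_} (onCodes (consDigit∈ false) (consDigit-binary false)) f∈

  len-double : ∀ n → len nat (2 * n) ≤ suc (len nat n)
  len-double n = ≤-trans (≤-reflexive (cong length (sym (consDigit-binary false n)))) (go (binary n))
    where
    go : ∀ w → length (consDigit false w) ≤ suc (length w)
    go []      = z≤n
    go (b ∷ w) = ≤-refl

  -- Every word denotes a number, but only canonical words are codes of numbers. The program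
  -- therefore strips leading zeros.
  valᶜ : ∀ {f : El Γ → Bits} → Comp Γ bits f → Comp Γ nat (λ γ → val (f γ))
  valᶜ f∈ = compᶜ {g = val} val∈ f∈
    where
    normal : Bits → Bits
    normal = foldr consDigit []
    normal-val : ∀ w → normal w ≡ binary (val w)
    normal-val []      = refl
    normal-val (b ∷ w) = trans (cong (consDigit b) (normal-val w)) (consDigit-binary b (val w))
    go : ∀ w s → zfold (λ x _ → consDigit x) w [] s ≡ foldr consDigit s (w ʳ++ [])
    go []      s = refl
    go (x ∷ w) s = trans (go w (consDigit x s)) (sym (shift w [] ))
      where
      shift : ∀ w l → foldr consDigit s (w ʳ++ (l ++ x ∷ [])) ≡ foldr consDigit (consDigit x s) (w ʳ++ l)
      shift []      l = List.foldr-++ consDigit s l (x ∷ [])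
      shift (y ∷ w) l = shift w (y ∷ l)
    length-consDigit : ∀ x s → length (consDigit x s) ≤ length s + 1
    length-consDigit true  s       = ≤-reflexive (+-comm 1 (length s))
    length-consDigit false []      = z≤n
    length-consDigit false (b ∷ s) = ≤-reflexive (+-comm 1 (length (b ∷ s)))
    normal∈ : Comp bits bits normal
    normal∈ = extᶜ (λ w → trans (go (w ʳ++ []) []) (cong normal (trans (ʳ++-ʳ++ w) (List.++-identityʳ w))))
      (compᶜ (zfoldᶜ {S = bits} {g = λ x _ → consDigit x} (λ x _ → consDigit∈ x) 1 (λ x y s → length-consDigit x s))
        (pairᶜ reverseBitsᶜ (pairᶜ (constᶜ []) (constᶜ []))))
    val∈ : Comp bits nat val
    val∈ = onCodes normal∈ normal-val

  sumᶜ : ∀ {l : El Γ → List ℕ} → Comp Γ (list nat) l → Comp Γ nat (λ γ → sum (l γ))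
  sumᶜ {Γ = Γ} l∈ = foldrᶜ {A = nat} {S = nat} {g = λ (γ , (a , s)) → a + s} l∈ (constᶜ 0) (compᶜ fstᶜ sndᶜ +ᶜ compᶜ sndᶜ sndᶜ) (𝕂 1 ⊕ 𝕏)
    (λ γ a s → ≤-trans (len-+ a s) (≤-trans (≤-reflexive (+-comm (suc (len nat a)) (len nat s)))
      (+-monoʳ-≤ (len nat s) (s≤s (m≤n+m _ _)))))

  -- Every frame uses up at least one bit, so the length of the word is enough fuel. Broken frames
  -- are read as far as they go.
  frames : ℕ → Bits → List Bits
  frames n       []      = []
  frames zero    (b ∷ w) = []
  frames (suc n) (b ∷ w) = unframe (b ∷ w) ∷ frames n (afterFrame (b ∷ w))

  parse : Bits → List Bits
  parse w = frames (length w) w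

  frames-enc : ∀ n (ws : List Bits) → len (list bits) ws ≤ n → frames n (enc (list bits) ws) ≡ ws
  frames-enc zero    []       le = refl
  frames-enc (suc n) []       le = refl
  frames-enc zero    (w ∷ ws) le with ≤-trans (≤-reflexive (sym (len-∷ bits w ws))) le
  ... | ()
  frames-enc (suc n) (w ∷ ws) le with enc (list bits) (w ∷ ws) in eq
  ... | []    = ⊥-elim (nonempty-frame w _ eq)
    where
    nonempty-frame : ∀ w z → frame w ++ z ≡ [] → ⊥
    nonempty-frame []      z ()
    nonempty-frame (b ∷ w) z ()
  ... | b ∷ v rewrite sym eq = cong₂ _∷_ (unframe-frame w (enc (list bits) ws))
    (trans (cong (frames n) (afterFrame-frame w (enc (list bits) ws)))
      (frames-enc n ws (≤-pred (≤-trans (s≤s (m≤n+m (len (list bits) ws) (length w * 2))) (≤-trans (≤-reflexive (trans (sym (len-∷ bits w ws)) (cong length eq))) le)))))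

  parse-enc : ∀ ws → parse (enc (list bits) ws) ≡ ws
  parse-enc ws = frames-enc _ ws ≤-refl

  parseᶜ : Comp bits (list bits) parse
  parseᶜ = extᶜ (λ w → trans (cong reverse (iterate-frames (length w) w [])) (List.reverse-involutive (parse w)))
    (compᶜ {f = λ w → proj₂ (iterate stepF (length w) (w , []))} reverseᶜ
      (compᶜ {f = λ w → iterate stepF (length w) (w , [])} sndᶜ
        (compᶜ {f = λ w → w , (w , [])} (iterᶜ {S = St} {U = bits} step∈ bd ok) (pairᶜ idᶜ (pairᶜ idᶜ (constᶜ []))))))
    where
    St : Ty
    St = bits ⊠ list bits
    stepF : Bits × List Bits → Bits × List Bits
    stepF ([] , acc)    = [] , acc
    stepF (b ∷ w , acc) = afterFrame (b ∷ w) , unframe (b ∷ w) ∷ acc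
    step∈ : Comp St St stepF
    step∈ = extᶜ (λ { ([] , acc) → refl ; (b ∷ w , acc) → refl })
      (compᶜ (bitsCase {Γ = St} {f = id} {g = λ _ (_ , (w , acc)) → afterFrame w , unframe w ∷ acc} idᶜ
                (λ _ → pairᶜ (compᶜ afterFrameᶜ (compᶜ fstᶜ sndᶜ)) (consᶜ (compᶜ unframeᶜ (compᶜ fstᶜ sndᶜ)) (compᶜ sndᶜ sndᶜ))))
        (pairᶜ fstᶜ idᶜ))
    iterate-[] : ∀ n acc → iterate stepF n ([] , acc) ≡ ([] , acc)
    iterate-[] zero    acc = refl
    iterate-[] (suc n) acc = iterate-[] n acc
    iterate-frames : ∀ n w acc → proj₂ (iterate stepF n (w , acc)) ≡ frames n w ʳ++ acc
    iterate-frames zero    []      acc = refl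
    iterate-frames zero    (b ∷ w) acc = refl
    iterate-frames (suc n) []      acc = cong proj₂ (iterate-[] n acc)
    iterate-frames (suc n) (b ∷ w) acc = iterate-frames n (afterFrame (b ∷ w)) (unframe (b ∷ w) ∷ acc)
    iterate-len : ∀ j w acc m → length w ≤ m → let (w′ , acc′) = iterate stepF j (w , acc) in
      length w′ ≤ m × len (list bits) acc′ ≤ len (list bits) acc + j * suc (m * 2)
    iterate-len zero    w       acc m le = le , m≤m+n _ _
    iterate-len (suc j) []      acc m le with iterate-len j [] acc m le
    ... | p , q = p , ≤-trans q (+-monoʳ-≤ (len (list bits) acc) (m≤n+m _ (suc (m * 2))))
    iterate-len (suc j) (b ∷ w) acc m le with iterate-len j (afterFrame (b ∷ w)) (unframe (b ∷ w) ∷ acc) m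
      (≤-trans (≤-trans (m≤n+m _ _) (frame-length-bound (b ∷ w))) le)
    ... | p , q = p , ≤-trans q (≤-trans (+-monoˡ-≤ (j * suc (m * 2))
        (≤-trans (≤-reflexive (trans (len-∷ bits (unframe (b ∷ w)) acc) (+-comm (suc (length (unframe (b ∷ w)) * 2)) (len (list bits) acc))))
          (+-monoʳ-≤ (len (list bits) acc) (s≤s (*-monoˡ-≤ 2 (≤-trans (m≤m+n (length (unframe (b ∷ w))) (length (afterFrame (b ∷ w)))) (≤-trans (frame-length-bound (b ∷ w)) le)))))))
        (≤-reflexive (+-assoc (len (list bits) acc) (suc (m * 2)) _)))
    bd : Px
    bd = (𝕂 1 ⊕ 𝕏 ⊗ 𝕂 2) ⊕ (𝕏 ⊕ 𝕏 ⊗ (𝕂 1 ⊕ 𝕏 ⊗ 𝕂 2))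
    ok : ∀ u st j → j ≤ len bits u → len St (iterate stepF j st) ≤ ⟦ bd ⟧ (len (bits ⊠ St) (u , st))
    ok u (w , acc) j le with iterate stepF j (w , acc) | iterate-len j w acc (len (bits ⊠ St) (u , (w , acc))) (≤-trans (len-fst bits (list bits) w acc) (len-snd bits St u (w , acc)))
    ... | w′ , acc′ | p , q = ≤-trans (≤-reflexive (len-⊠ bits (list bits) w′ acc′))
      (+-mono-≤ (s≤s (*-monoˡ-≤ 2 p)) (≤-trans q (+-mono-≤ (≤-trans (len-snd bits (list bits) w acc) (len-snd bits St u (w , acc)))
        (*-monoˡ-≤ _ (≤-trans le (len-fst bits St u (w , acc)))))))

-- The earliest-deadline-first rule on unit steps.

module UnitStepSchedules where

  open import Data.Bool.Base using (Bool; true; false; _∧_; T)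
  open import Data.Empty using (⊥; ⊥-elim)
  open import Data.Fin.Base as Fin using (Fin)
  open import Data.Fin.Properties using (_≟_)
  open import Data.Nat.Base
  open import Data.Nat.Properties hiding (_≟_)
  open import Data.Product.Base using (∃-syntax; _×_; _,_; proj₁; proj₂)
  open import Data.Sum.Base using (_⊎_; inj₁; inj₂)
  open import Data.Unit.Base using (tt)
  open import Function.Base using (_∘_)
  open import Relation.Binary.PropositionalEquality using (_≡_; _≢_; refl; sym; trans; cong; cong₂; subst)
  open import Relation.Nullary using (yes; no)

  when : Bool → ℕ → ℕ
  when true  n = n
  when false n = 0

  when-∧ : ∀ b c n → when (b ∧ c) n ≡ when c (when b n)
  when-∧ true  c     n = refl
  when-∧ false true  n = refl
  when-∧ false false n = refl

  when≤ : ∀ b n → when b n ≤ n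
  when≤ true  n = ≤-refl
  when≤ false n = z≤n

  sumF : ∀ {n} → (Fin n → ℕ) → ℕ
  sumF {zero}  f = 0
  sumF {suc n} f = f Fin.zero + sumF (f ∘ Fin.suc)

  sumF-mono : ∀ {n} {f g : Fin n → ℕ} → (∀ i → f i ≤ g i) → sumF f ≤ sumF g
  sumF-mono {zero}  h = z≤n
  sumF-mono {suc n} h = +-mono-≤ (h Fin.zero) (sumF-mono (h ∘ Fin.suc))

  sumF-cong : ∀ {n} {f g : Fin n → ℕ} → (∀ i → f i ≡ g i) → sumF f ≡ sumF g
  sumF-cong {zero}  h = refl
  sumF-cong {suc n} h = cong₂ _+_ (h Fin.zero) (sumF-cong (h ∘ Fin.suc))

  sumF-zero : ∀ {n} {f : Fin n → ℕ} → (∀ i → f i ≡ 0) → sumF f ≡ 0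
  sumF-zero {zero}  h = refl
  sumF-zero {suc n} h = cong₂ _+_ (h Fin.zero) (sumF-zero (h ∘ Fin.suc))

  term≤sumF : ∀ {n} (f : Fin n → ℕ) i → f i ≤ sumF f
  term≤sumF f Fin.zero    = m≤m+n _ _
  term≤sumF f (Fin.suc i) = ≤-trans (term≤sumF (f ∘ Fin.suc) i) (m≤n+m _ _)

  sumF-suc : ∀ {n} {f g : Fin n → ℕ} j → f j ≡ suc (g j) → (∀ k → k ≢ j → f k ≡ g k) → sumF f ≡ suc (sumF g)
  sumF-suc Fin.zero    e h = cong₂ _+_ e (sumF-cong λ i → h (Fin.suc i) λ ())
  sumF-suc {g = g} (Fin.suc j) e h =
    trans (cong₂ _+_ (h Fin.zero λ ()) (sumF-suc j e λ k k≢j → h (Fin.suc k) λ { refl → k≢j refl })) (+-suc (g Fin.zero) _)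

  -- The order is a parameter so that minima and maxima are both instances.
  optimum : ∀ {n} (_≼_ : ℕ → ℕ → Set) → (∀ x y → x ≼ y ⊎ y ≼ x) → (∀ {x y z} → x ≼ y → y ≼ z → x ≼ z) →
    (P : Fin n → Bool) (f : Fin n → ℕ) →
    (∀ k → P k ≡ false) ⊎ (∃[ j ] P j ≡ true × (∀ k → P k ≡ true → f j ≼ f k))
  optimum {zero}  _≼_ tot tr P f = inj₁ λ ()
  optimum {suc n} _≼_ tot tr P f with P Fin.zero in eq | optimum _≼_ tot tr (P ∘ Fin.suc) (f ∘ Fin.suc)
  ... | false | inj₁ none = inj₁ λ { Fin.zero → eq ; (Fin.suc k) → none k }
  ... | true  | inj₁ none = inj₂ (Fin.zero , eq , λ { Fin.zero _ → rfl _ ; (Fin.suc k) p → ⊥-elim (absurd (trans (sym (none k)) p)) })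
    where
    rfl : ∀ x → x ≼ x
    rfl x with tot x x
    ... | inj₁ h = h
    ... | inj₂ h = h
    absurd : false ≡ true → ⊥
    absurd ()
  ... | false | inj₂ (j , Pj , best) = inj₂ (Fin.suc j , Pj , λ { Fin.zero p → ⊥-elim (absurd (trans (sym eq) p)) ; (Fin.suc k) p → best k p })
    where
    absurd : false ≡ true → ⊥
    absurd ()
  ... | true  | inj₂ (j , Pj , best) with tot (f Fin.zero) (f (Fin.suc j))
  ... | inj₁ le = inj₂ (Fin.zero , eq , λ { Fin.zero _ → rfl _ ; (Fin.suc k) p → tr le (best k p) })
    where
    rfl : ∀ x → x ≼ x
    rfl x with tot x x
    ... | inj₁ h = h
    ... | inj₂ h = h
  ... | inj₂ ge = inj₂ (Fin.suc j , Pj , λ { Fin.zero _ → ge ; (Fin.suc k) p → best k p })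

  T⇒true : ∀ {b} → T b → b ≡ true
  T⇒true {true} _ = refl

  ≤ᵇ-true : ∀ {m n} → m ≤ n → (m ≤ᵇ n) ≡ true
  ≤ᵇ-true h = T⇒true (≤⇒≤ᵇ h)

  true-≤ᵇ : ∀ {m n} → (m ≤ᵇ n) ≡ true → m ≤ n
  true-≤ᵇ eq = ≤ᵇ⇒≤ _ _ (subst T (sym eq) tt)

  <ᵇ-true : ∀ {m n} → m < n → (m <ᵇ n) ≡ true
  <ᵇ-true h = T⇒true (<⇒<ᵇ h)

  true-<ᵇ : ∀ {m n} → (m <ᵇ n) ≡ true → m < n
  true-<ᵇ eq = <ᵇ⇒< _ _ (subst T (sym eq) tt)

  ∧-true : ∀ {b c} → b ∧ c ≡ true → b ≡ true × c ≡ true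
  ∧-true {true} {true} eq = refl , refl

  true-∧ : ∀ {b c} → b ≡ true → c ≡ true → b ∧ c ≡ true
  true-∧ refl refl = refl

  bool-cases : ∀ b → b ≡ true ⊎ b ≡ false
  bool-cases true  = inj₁ refl
  bool-cases false = inj₂ refl

  ≢true⇒false : ∀ {b} → (b ≡ true → ⊥) → b ≡ false
  ≢true⇒false {true}  h = ⊥-elim (h refl)
  ≢true⇒false {false} h = refl

  -- hall: the jobs of S arriving at r or later and due by D fit into [r , D].
  -- covered: if job i is skipped although it could be completed, then the jobs
  -- of S arriving from time a k on leave no gap before d i - p i + 1, which is
  -- when i can no longer be started.  dl is d, or d capped by a bound on the
  -- makespan.
  record Schedulable {n} (p a d dl : Fin n → ℕ) (S : Fin n → Bool) : Set where
    field
      hall    : ∀ r D → sumF (λ k → when (S k ∧ ((r ≤ᵇ a k) ∧ (dl k ≤ᵇ D))) (p k)) ≤ D ∸ r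
      covered : ∀ i → S i ≡ false → 0 < p i → a i + p i ≤ d i →
        ∃[ k ] S k ≡ true × a k ≤ a i ×
          (∀ m → m + p i ≤ suc (d i) → m ≤ a k + sumF (λ l → when (S l ∧ ((a k ≤ᵇ a l) ∧ (a l <ᵇ m))) (p l)))

  dec : ∀ {n} → Fin n → (Fin n → ℕ) → Fin n → ℕ
  dec j rem k with k ≟ j
  ... | yes _ = pred (rem k)
  ... | no  _ = rem k

  dec-same : ∀ {n} (j : Fin n) rem → 0 < rem j → rem j ≡ suc (dec j rem j)
  dec-same j rem h with j ≟ j
  ... | no ¬e = ⊥-elim (¬e refl)
  ... | yes _ with rem j
  ... | suc _ = refl

  dec-other : ∀ {n} (j : Fin n) rem k → k ≢ j → rem k ≡ dec j rem k
  dec-other j rem k k≢j with k ≟ j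
  ... | yes e = ⊥-elim (k≢j e)
  ... | no _  = refl

  -- The unit-step run of the earliest-deadline-first rule from time τ, with
  -- rem k units of job k outstanding; nothing marks an idle step.
  module _ {n} (p a d dl : Fin n → ℕ) (S : Fin n → Bool) where

    data Trace : ℕ → ℕ → (Fin n → ℕ) → Set where
      stop : ∀ {τ rem} → (∀ k → rem k ≡ 0) → (∀ i → d i ≤ τ) → Trace 0 τ rem
      idle : ∀ {f τ rem} → (∀ k → a k ≤ τ → rem k ≡ 0) →
             (∀ i → S i ≡ false → 0 < p i → a i ≤ τ → τ + p i ≤ d i → ⊥) →
             Trace f (suc τ) rem → Trace (suc f) τ rem
      work : ∀ {f τ rem} j → a j ≤ τ → 0 < rem j → τ < dl j → Trace f (suc τ) (dec j rem) → Trace (suc f) τ rem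

  module _ {n} {p a d dl : Fin n → ℕ} {S : Fin n → Bool} (sch : Schedulable p a d dl S) (dl≤d : ∀ i → dl i ≤ d i) where
    open Schedulable sch

    load : Fin n → ℕ
    load k = when (S k) (p k)

    private
      -- `deadl` is Hall's condition for the work still outstanding. `pending` accounts for the
      -- past: since time `s` at most `τ ∸ s` units have been removed from the jobs that arrived
      -- from `s` on. `fresh` reduces statements about jobs still to come to the static condition
      -- `hall`.
      record Inv (τ : ℕ) (rem : Fin n → ℕ) : Set where
        field
          fresh   : ∀ k → τ ≤ a k → rem k ≡ load k
          deadl   : ∀ D → sumF (λ k → when (dl k ≤ᵇ D) (rem k)) ≤ D ∸ τ
          pending : ∀ s m → s ≤ τ → sumF (λ k → when ((s ≤ᵇ a k) ∧ (a k <ᵇ m)) (load k)) ≤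
                      sumF (λ k → when ((s ≤ᵇ a k) ∧ (a k <ᵇ m)) (rem k)) + (τ ∸ s)

      open Inv

      hall′ : ∀ r D → sumF (λ k → when ((r ≤ᵇ a k) ∧ (dl k ≤ᵇ D)) (load k)) ≤ D ∸ r
      hall′ r D = ≤-trans (≤-reflexive (sumF-cong λ k → sym (when-∧ (S k) _ (p k)))) (hall r D)

      start : Inv 0 load
      start = record
        { fresh   = λ _ _ → refl
        ; deadl   = λ D → hall′ 0 D
        ; pending = λ { zero m _ → m≤m+n _ _ } }

      fresh-pending : ∀ τ (rem : Fin n → ℕ) → (∀ k → τ ≤ a k → rem k ≡ load k) → ∀ m →
        sumF (λ k → when ((τ ≤ᵇ a k) ∧ (a k <ᵇ m)) (load k)) ≤ sumF (λ k → when ((τ ≤ᵇ a k) ∧ (a k <ᵇ m)) (rem k)) + (τ ∸ τ)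
      fresh-pending τ rem fr m = ≤-trans (sumF-mono eq) (m≤m+n _ _)
        where
        eq : ∀ k → when ((τ ≤ᵇ a k) ∧ (a k <ᵇ m)) (load k) ≤ when ((τ ≤ᵇ a k) ∧ (a k <ᵇ m)) (rem k)
        eq k with τ ≤ᵇ a k in e
        ... | false = z≤n
        ... | true  = ≤-reflexive (cong (when (a k <ᵇ m)) (sym (fr k (true-≤ᵇ e))))

      -- If nothing that has already arrived is outstanding and due by `D`, all remaining work due
      -- by `D` arrives at `τ` or later, and `hall τ D` bounds it.
      late : ∀ τ (rem : Fin n → ℕ) → (∀ k → τ ≤ a k → rem k ≡ load k) → ∀ D → (∀ k → a k < τ → dl k ≤ D → rem k ≡ 0) →
        sumF (λ k → when (dl k ≤ᵇ D) (rem k)) ≤ D ∸ τ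
      late τ rem fr D none = ≤-trans (sumF-mono le) (hall′ τ D)
        where
        le : ∀ k → when (dl k ≤ᵇ D) (rem k) ≤ when ((τ ≤ᵇ a k) ∧ (dl k ≤ᵇ D)) (load k)
        le k with dl k ≤ᵇ D in e | τ ≤? a k
        ... | false | _      = z≤n
        ... | true  | yes h rewrite ≤ᵇ-true h = ≤-reflexive (fr k h)
        ... | true  | no ¬h  = ≤-trans (≤-reflexive (none k (≰⇒> ¬h) (true-≤ᵇ e))) z≤n

      idle-step : ∀ {τ rem} → (∀ k → a k ≤ τ → rem k ≡ 0) → Inv τ rem → Inv (suc τ) rem
      idle-step {τ} {rem} none inv = record
        { fresh   = fr
        ; deadl   = λ D → late (suc τ) rem fr D (λ k h _ → none k (≤-pred h))
        ; pending = pend }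
        where
        fr : ∀ k → suc τ ≤ a k → rem k ≡ load k
        fr k h = fresh inv k (<⇒≤ h)
        pend : ∀ s m → s ≤ suc τ → _
        pend s m s≤ with m≤n⇒m<n∨m≡n s≤
        ... | inj₂ refl = fresh-pending (suc τ) rem fr m
        ... | inj₁ (s≤s h) = ≤-trans (pending inv s m h) (+-monoʳ-≤ _ (∸-monoˡ-≤ s (n≤1+n τ)))

      work-step : ∀ {τ rem} j → a j ≤ τ → 0 < rem j → (∀ k → a k ≤ τ → 0 < rem k → dl j ≤ dl k) → Inv τ rem → Inv (suc τ) (dec j rem)
      work-step {τ} {rem} j aj pos best inv = record { fresh = fr ; deadl = dead ; pending = pend }
        where
        fr : ∀ k → suc τ ≤ a k → dec j rem k ≡ load k
        fr k h = trans (sym (dec-other j rem k λ { refl → <-irrefl refl (≤-trans h aj) })) (fresh inv k (<⇒≤ h))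
        dead : ∀ D → sumF (λ k → when (dl k ≤ᵇ D) (dec j rem k)) ≤ D ∸ suc τ
        -- Either the unit just done was due by `D` and the sum drops by one, or by the choice of
        -- `j` no arrived job due by `D` is outstanding and `late` applies.
        dead D with dl j ≤? D
        ... | yes h = ≤-trans (≤-pred (≤-trans (≤-reflexive (sym eq)) (≤-trans (deadl inv D) (≤-reflexive (lem D τ posD))))) ≤-refl
          where
          eq : sumF (λ k → when (dl k ≤ᵇ D) (rem k)) ≡ suc (sumF (λ k → when (dl k ≤ᵇ D) (dec j rem k)))
          eq = sumF-suc j here (λ k k≢j → cong (when (dl k ≤ᵇ D)) (dec-other j rem k k≢j))
            where
            here : when (dl j ≤ᵇ D) (rem j) ≡ suc (when (dl j ≤ᵇ D) (dec j rem j))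
            here rewrite ≤ᵇ-true h = dec-same j rem pos
          posD : 0 < D ∸ τ
          posD = ≤-trans (s≤s z≤n) (≤-trans (≤-reflexive (sym eq)) (deadl inv D))
          lem : ∀ D τ → 0 < D ∸ τ → D ∸ τ ≡ suc (D ∸ suc τ)
          lem (suc D) zero    h = refl
          lem (suc D) (suc τ) h = lem D τ h
        ... | no ¬h = late (suc τ) (dec j rem) fr D none
          where
          none : ∀ k → a k < suc τ → dl k ≤ D → dec j rem k ≡ 0
          none k (s≤s h) h′ with k ≟ j
          ... | yes refl = ⊥-elim (¬h h′)
          ... | no  _ with rem k in e
          ... | zero  = refl
          ... | suc r = ⊥-elim (¬h (≤-trans (best k h (subst (0 <_) (sym e) (s≤s z≤n))) h′))
        drop-one : ∀ (c : Fin n → Bool) → sumF (λ k → when (c k) (rem k)) ≤ suc (sumF (λ k → when (c k) (dec j rem k)))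
        drop-one c with c j in e
        ... | true = ≤-reflexive (sumF-suc j here (λ k k≢j → cong (when (c k)) (dec-other j rem k k≢j)))
          where
          here : when (c j) (rem j) ≡ suc (when (c j) (dec j rem j))
          here rewrite e = dec-same j rem pos
        ... | false = ≤-trans (sumF-mono le) (n≤1+n _)
          where
          le : ∀ k → when (c k) (rem k) ≤ when (c k) (dec j rem k)
          le k with k ≟ j
          ... | yes refl rewrite e = z≤n
          ... | no _ = ≤-refl
        pend : ∀ s m → s ≤ suc τ → _
        pend s m s≤ with m≤n⇒m<n∨m≡n s≤
        ... | inj₂ refl = fresh-pending (suc τ) (dec j rem) fr m
        ... | inj₁ (s≤s h) = ≤-trans (pending inv s m h) (≤-trans (+-monoˡ-≤ (τ ∸ s) (drop-one (λ k → (s ≤ᵇ a k) ∧ (a k <ᵇ m))))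
                (≤-reflexive (trans (sym (+-suc (sumF (λ k → when ((s ≤ᵇ a k) ∧ (a k <ᵇ m)) (dec j rem k))) (τ ∸ s)))
                  (cong (sumF (λ k → when ((s ≤ᵇ a k) ∧ (a k <ᵇ m)) (dec j rem k)) +_) (sym (+-∸-assoc 1 h))))))

      -- At an idle step all work that arrived from `a k` to `τ` is finished, so by `pending` it
      -- amounts to at most `τ ∸ a k`. But `covered` at `m = suc τ` asks for one unit more.
      not-covered : ∀ {τ rem} → Inv τ rem → (∀ k → a k ≤ τ → rem k ≡ 0) →
        ∀ i → S i ≡ false → 0 < p i → a i ≤ τ → τ + p i ≤ d i → ⊥
      not-covered {τ} {rem} inv none i Si pos ai le with covered i Si pos (≤-trans (+-monoˡ-≤ (p i) ai) le)
      ... | k , Sk , ak , cov = <-irrefl refl (≤-trans (cov (suc τ) (s≤s le)) (≤-trans (+-monoʳ-≤ (a k) upper) (≤-reflexive (m+[n∸m]≡n (≤-trans ak ai)))))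
        where
        zero-rem : sumF (λ l → when ((a k ≤ᵇ a l) ∧ (a l <ᵇ suc τ)) (rem l)) ≡ 0
        zero-rem = sumF-zero z
          where
          z : ∀ l → when ((a k ≤ᵇ a l) ∧ (a l <ᵇ suc τ)) (rem l) ≡ 0
          z l with (a k ≤ᵇ a l) ∧ (a l <ᵇ suc τ) in e
          ... | false = refl
          ... | true  = none l (≤-pred (true-<ᵇ (proj₂ (∧-true {a k ≤ᵇ a l} e))))
        upper : sumF (λ l → when (S l ∧ ((a k ≤ᵇ a l) ∧ (a l <ᵇ suc τ))) (p l)) ≤ τ ∸ a k
        upper = ≤-trans (≤-reflexive (sumF-cong λ l → when-∧ (S l) _ (p l)))
          (≤-trans (pending inv (a k) (suc τ) (≤-trans ak ai)) (≤-reflexive (cong (_+ (τ ∸ a k)) zero-rem)))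

      build : ∀ f τ rem → Inv τ rem → (∀ i → d i ≤ τ + f) → Trace p a d dl S f τ rem
      build zero τ rem inv end = stop allZero (λ i → ≤-trans (end i) (≤-reflexive (+-identityʳ τ)))
        where
        allZero : ∀ k → rem k ≡ 0
        -- At the horizon all deadlines have passed, and `deadl` with `D = τ` leaves no room for
        -- outstanding work.
        allZero k = n≤0⇒n≡0 (≤-trans (≤-trans (≤-reflexive here) (term≤sumF (λ l → when (dl l ≤ᵇ τ) (rem l)) k)) (≤-trans (deadl inv τ) (≤-reflexive (n∸n≡0 τ))))
          where
          here : rem k ≡ when (dl k ≤ᵇ τ) (rem k)
          here rewrite ≤ᵇ-true (≤-trans (dl≤d k) (≤-trans (end k) (≤-reflexive (+-identityʳ τ)))) = refl
      build (suc f) τ rem inv end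
        with optimum _≤_ ≤-total ≤-trans (λ k → (a k ≤ᵇ τ) ∧ (0 <ᵇ rem k)) dl
      ... | inj₁ none = idle nr (not-covered inv nr) (build f (suc τ) rem (idle-step nr inv) (λ i → ≤-trans (end i) (≤-reflexive (+-suc τ f))))
        where
        nr : ∀ k → a k ≤ τ → rem k ≡ 0
        nr k h with none k
        ... | e rewrite ≤ᵇ-true h with rem k
        ... | zero = refl
        nr k h | () | suc _
      ... | inj₂ (j , Pj , best) = work j aj pos τ<dl
          (build f (suc τ) (dec j rem) (work-step j aj pos (λ k h h′ → best k (true-∧ (≤ᵇ-true h) (<ᵇ-true h′))) inv) (λ i → ≤-trans (end i) (≤-reflexive (+-suc τ f))))
        where
        aj = true-≤ᵇ {a j} {τ} (proj₁ (∧-true {a j ≤ᵇ τ} Pj))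
        pos = true-<ᵇ {0} {rem j} (proj₂ (∧-true {a j ≤ᵇ τ} Pj))
        τ<dl : τ < dl j
        τ<dl = m∸n≢0⇒n<m λ e → <-irrefl (sym e) (≤-trans (≤-trans pos (≤-trans (≤-reflexive here) (term≤sumF (λ l → when (dl l ≤ᵇ dl j) (rem l)) j))) (deadl inv (dl j)))
          where
          here : rem j ≡ when (dl j ≤ᵇ dl j) (rem j)
          here rewrite ≤ᵇ-true (≤-refl {dl j}) = refl

    trace : Trace p a d dl S (sumF d) 0 load
    -- The sum of the deadlines serves as horizon because it is at least each of them.
    trace = build (sumF d) 0 load start (term≤sumF d)

-- Rational arithmetic and finite sums.

module Rationals where

  open import Defs using (fromℕ; sumℚ)
  open import Data.Fin.Base as Fin using (Fin)
  open import Data.Integer.Base as ℤ using (+_)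
  import Data.Integer.Properties as ℤ
  open import Data.List.Base using ([]; _∷_; map; tabulate; allFin)
  open import Data.List.Properties using (map-tabulate)
  open import Data.Nat.Base as ℕ using (ℕ; zero; suc)
  import Data.Nat.Properties as ℕ
  open import Data.Rational.Base
  open import Data.Rational.Properties
  import Data.Rational.Unnormalised.Base as ℚᵘ
  import Data.Rational.Unnormalised.Properties as ℚᵘ
  open import Data.Rational.Solver using (module +-*-Solver)
  open import Function.Base using (_∘_; id)
  open import Relation.Binary.PropositionalEquality using (_≡_; refl; sym; trans; cong; cong₂; subst₂)

  open UnitStepSchedules using (sumF)

  fromℕ-mono-≤ : ∀ {m n} → m ℕ.≤ n → fromℕ m ≤ fromℕ n
  fromℕ-mono-≤ h = *≤* (ℤ.*-monoʳ-≤-nonNeg (+ 1) (ℤ.+≤+ h))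

  fromℕ-cancel-≤ : ∀ {m n} → fromℕ m ≤ fromℕ n → m ℕ.≤ n
  fromℕ-cancel-≤ {m} {n} (*≤* h) = ℤ.drop‿+≤+ (subst₂ ℤ._≤_ (ℤ.*-identityʳ (+ m)) (ℤ.*-identityʳ (+ n)) h)

  fromℕ-mono-< : ∀ {m n} → m ℕ.< n → fromℕ m < fromℕ n
  fromℕ-mono-< {m} {n} h = ≰⇒> λ le → ℕ.<-irrefl refl (ℕ.<-≤-trans h (fromℕ-cancel-≤ le))

  fromℕ-cancel-< : ∀ {m n} → fromℕ m < fromℕ n → m ℕ.< n
  fromℕ-cancel-< {m} {n} h = ℕ.≰⇒> λ le → <-irrefl refl (<-≤-trans h (fromℕ-mono-≤ le))

  fromℕ-+ : ∀ m n → fromℕ (m ℕ.+ n) ≡ fromℕ m + fromℕ n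
  fromℕ-+ m n = toℚᵘ-injective (ℚᵘ.≃-trans (ℚᵘ.*≡* eq) (ℚᵘ.≃-sym (toℚᵘ-homo-+ (fromℕ m) (fromℕ n))))
    where
    eq : + (m ℕ.+ n) ℤ.* + 1 ≡ (+ m ℤ.* + 1 ℤ.+ + n ℤ.* + 1) ℤ.* + 1
    eq = cong (ℤ._* + 1) (cong₂ ℤ._+_ (sym (ℤ.*-identityʳ (+ m))) (sym (ℤ.*-identityʳ (+ n))))

  fromℕ-suc : ∀ n → fromℕ (suc n) ≡ 1ℚ + fromℕ n
  fromℕ-suc n = fromℕ-+ 1 n

  0≤fromℕ : ∀ n → 0ℚ ≤ fromℕ n
  0≤fromℕ n = fromℕ-mono-≤ {0} ℕ.z≤n

  abstract
    private
      cancel : ∀ p r → (p + r) - r ≡ p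
      cancel = solve 2 (λ p r → (p :+ r) :- r := p) refl
        where open +-*-Solver

      uncancel : ∀ p r → (p - r) + r ≡ p
      uncancel = solve 2 (λ p r → (p :- r) :+ r := p) refl
        where open +-*-Solver

    cancelʳ-≤ : ∀ {p q} r → p + r ≤ q + r → p ≤ q
    cancelʳ-≤ {p} {q} r h = subst₂ _≤_ (cancel p r) (cancel q r) (+-monoˡ-≤ (- r) h)

    cancelʳ-< : ∀ {p q} r → p + r < q + r → p < q
    cancelʳ-< {p} {q} r h = subst₂ _<_ (cancel p r) (cancel q r) (+-monoˡ-< (- r) h)

    ≤-minus : ∀ {p q r} → p + r ≤ q → p ≤ q - r
    ≤-minus {p} {q} {r} h = cancelʳ-≤ r (≤-trans h (≤-reflexive (sym (uncancel q r))))

    minus-≤ : ∀ {p q r} → p ≤ q - r → p + r ≤ q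
    minus-≤ {p} {q} {r} h = ≤-trans (+-monoˡ-≤ r h) (≤-reflexive (uncancel q r))

    0≤minus : ∀ {p q} → p ≤ q → 0ℚ ≤ q - p
    0≤minus {p} {q} h = ≤-minus (≤-trans (≤-reflexive (+-identityˡ p)) h)

    0<minus : ∀ {p q} → p < q → 0ℚ < q - p
    0<minus {p} {q} h = cancelʳ-< p (subst₂ _<_ (sym (+-identityˡ p)) (sym (uncancel q p)) h)

    minus≤0 : ∀ {p q} → q ≤ p → q - p ≤ 0ℚ
    minus≤0 {p} {q} h = cancelʳ-≤ p (subst₂ _≤_ (sym (uncancel q p)) (sym (+-identityˡ p)) h)

    minus-<ˡ : ∀ {p q} r → p < q → p - r < q - r
    minus-<ˡ r h = +-monoˡ-< (- r) h

    minus+ : ∀ p r → (p - r) + r ≡ p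
    minus+ = uncancel

  ≤-+ʳ : ∀ {p q} r → 0ℚ ≤ r → p ≤ q → p ≤ q + r
  ≤-+ʳ {p} {q} r h k = ≤-trans (≤-reflexive (sym (+-identityʳ p))) (+-mono-≤ k h)

  ≤-+ˡ : ∀ {p q} r → 0ℚ ≤ r → p ≤ q → p ≤ r + q
  ≤-+ˡ {p} {q} r h k = ≤-trans (≤-reflexive (sym (+-identityˡ p))) (+-mono-≤ h k)

  sumℚ-mono : ∀ {A : Set} {f g : A → ℚ} → (∀ x → f x ≤ g x) → ∀ l → sumℚ (map f l) ≤ sumℚ (map g l)
  sumℚ-mono h []      = ≤-refl
  sumℚ-mono h (x ∷ l) = +-mono-≤ (h x) (sumℚ-mono h l)

  sumℚ-cong : ∀ {A : Set} {f g : A → ℚ} → (∀ x → f x ≡ g x) → ∀ l → sumℚ (map f l) ≡ sumℚ (map g l)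
  sumℚ-cong h []      = refl
  sumℚ-cong h (x ∷ l) = cong₂ _+_ (h x) (sumℚ-cong h l)

  sumℚ-nonNeg : ∀ {A : Set} {f : A → ℚ} → (∀ x → 0ℚ ≤ f x) → ∀ l → 0ℚ ≤ sumℚ (map f l)
  sumℚ-nonNeg h []      = ≤-refl
  sumℚ-nonNeg h (x ∷ l) = ≤-+ʳ _ (sumℚ-nonNeg h l) (h x)

  ΣF : ∀ {n} → (Fin n → ℚ) → ℚ
  ΣF {zero}  f = 0ℚ
  ΣF {suc n} f = f Fin.zero + ΣF (f ∘ Fin.suc)

  ΣF-cong : ∀ {n} {f g : Fin n → ℚ} → (∀ i → f i ≡ g i) → ΣF f ≡ ΣF g
  ΣF-cong {zero}  h = refl
  ΣF-cong {suc n} h = cong₂ _+_ (h Fin.zero) (ΣF-cong (h ∘ Fin.suc))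

  ΣF-mono : ∀ {n} {f g : Fin n → ℚ} → (∀ i → f i ≤ g i) → ΣF f ≤ ΣF g
  ΣF-mono {zero}  h = ≤-refl
  ΣF-mono {suc n} h = +-mono-≤ (h Fin.zero) (ΣF-mono (h ∘ Fin.suc))

  ΣF-zero : ∀ n → ΣF {n} (λ _ → 0ℚ) ≡ 0ℚ
  ΣF-zero zero    = refl
  ΣF-zero (suc n) = trans (+-identityˡ _) (ΣF-zero n)

  ΣF-nonNeg : ∀ {n} {f : Fin n → ℚ} → (∀ i → 0ℚ ≤ f i) → 0ℚ ≤ ΣF f
  ΣF-nonNeg {n} h = ≤-trans (≤-reflexive (sym (ΣF-zero n))) (ΣF-mono h)

  ΣF-+ : ∀ {n} (f g : Fin n → ℚ) → ΣF (λ i → f i + g i) ≡ ΣF f + ΣF g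
  ΣF-+ {zero}  f g = refl
  ΣF-+ {suc n} f g = trans (cong (λ z → (f Fin.zero + g Fin.zero) + z) (ΣF-+ (f ∘ Fin.suc) (g ∘ Fin.suc)))
    (solve 4 (λ a b c d → (a :+ b) :+ (c :+ d) := (a :+ c) :+ (b :+ d)) refl (f Fin.zero) (g Fin.zero) _ _)
    where open +-*-Solver

  term≤ΣF : ∀ {n} {f : Fin n → ℚ} → (∀ i → 0ℚ ≤ f i) → ∀ i → f i ≤ ΣF f
  term≤ΣF h Fin.zero    = ≤-+ʳ _ (ΣF-nonNeg (h ∘ Fin.suc)) ≤-refl
  term≤ΣF h (Fin.suc i) = ≤-+ˡ _ (h Fin.zero) (term≤ΣF (h ∘ Fin.suc) i)

  ΣF-fromℕ : ∀ {n} (f : Fin n → ℕ) → ΣF (fromℕ ∘ f) ≡ fromℕ (sumF f)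
  ΣF-fromℕ {zero}  f = refl
  ΣF-fromℕ {suc n} f = trans (cong (λ z → fromℕ (f Fin.zero) + z) (ΣF-fromℕ (f ∘ Fin.suc))) (sym (fromℕ-+ (f Fin.zero) _))

  sumℚ-allFin : ∀ {n} (f : Fin n → ℚ) → sumℚ (map f (allFin n)) ≡ ΣF f
  sumℚ-allFin {n} f = trans (cong sumℚ (map-tabulate id f)) (go f)
    where
    go : ∀ {n} (f : Fin n → ℚ) → sumℚ (tabulate f) ≡ ΣF f
    go {zero}  f = refl
    go {suc n} f = cong (λ z → f Fin.zero + z) (go (f ∘ Fin.suc))

-- Processing times as measures of disjoint segments.

module Measure where

  open import Defs
  open UnitStepSchedules using (when; sumF)
  open Rationals
  open import Data.Bool.Base using (Bool; true; false; if_then_else_)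
  open import Data.Empty using (⊥; ⊥-elim)
  open import Data.Fin.Base as Fin using (Fin)
  import Data.Fin.Properties as Fin
  open import Data.List.Base using ([]; _∷_; map)
  open import Data.List.Relation.Unary.All as All using (All; []; _∷_)
  open import Data.List.Relation.Unary.AllPairs using (AllPairs; []; _∷_)
  open import Data.List.Relation.Unary.Any using (Any; here; there)
  open import Data.List.Membership.Propositional using (_∈_; lose)
  open import Data.Nat.Base using (ℕ; suc)
  open import Data.Product.Base using (_×_; _,_; proj₁; proj₂)
  open import Data.Rational.Base
  open import Data.Rational.Properties
  open import Data.Rational.Solver using (module +-*-Solver)
  open import Data.Sum.Base using (inj₁; inj₂)
  open import Function.Base using (_∘_)
  open import Relation.Binary.PropositionalEquality using (_≡_; _≢_; refl; sym; trans; cong; cong₂; subst; subst₂)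
  open import Relation.Nullary using (yes; no; does)

  private
    variable
      n : ℕ

  duration : Segment n → ℚ
  duration s = finish s - start s

  elapsed : ℚ → Segment n → ℚ
  elapsed τ s = 0ℚ ⊔ ((finish s ⊓ τ) - start s)

  for : Fin n → (Segment n → ℚ) → Segment n → ℚ
  for i f s = if does (worksOn s Fin.≟ i) then f s else 0ℚ

  y-sum : ∀ (σ : Schedule n) i τ → y σ i τ ≡ sumℚ (map (for i (elapsed τ)) σ)
  y-sum σ i τ = sumℚ-cong (λ s → refl) σ

  y∞-sum : ∀ (σ : Schedule n) i → y∞ σ i ≡ sumℚ (map (for i duration) σ)
  y∞-sum σ i = sumℚ-cong (λ s → refl) σ

  elapsed-nonNeg : ∀ τ (s : Segment n) → 0ℚ ≤ elapsed τ s
  elapsed-nonNeg τ s = p≤p⊔q 0ℚ ((finish s ⊓ τ) - start s)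

  elapsed-mono : ∀ {τ τ′} → τ ≤ τ′ → ∀ (s : Segment n) → elapsed τ s ≤ elapsed τ′ s
  elapsed-mono h s = ⊔-monoʳ-≤ 0ℚ (+-monoˡ-≤ (- start s) (⊓-monoʳ-≤ (finish s) h))

  elapsed≤duration : ∀ τ (s : Segment n) → start s < finish s → elapsed τ s ≤ duration s
  elapsed≤duration τ s h = ⊔-lub (0≤minus (<⇒≤ h)) (+-monoˡ-≤ (- start s) (p⊓q≤p (finish s) τ))

  elapsed<duration : ∀ τ (s : Segment n) → start s < finish s → τ < finish s → elapsed τ s < duration s
  elapsed<duration τ s h k = ⊔-lub-< (0<minus h) (minus-<ˡ (start s) (≤-<-trans (p⊓q≤q (finish s) τ) k))
    where
    ⊔-lub-< : ∀ {p q r} → p < r → q < r → p ⊔ q < r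
    ⊔-lub-< {p} {q} u v with ⊔-sel p q
    ... | inj₁ e = subst (_< _) (sym e) u
    ... | inj₂ e = subst (_< _) (sym e) v

  duration≤elapsed : ∀ τ (s : Segment n) → finish s ≤ τ → duration s ≤ elapsed τ s
  duration≤elapsed τ s h = ≤-trans (≤-reflexive (cong (_- start s) (sym (p≤q⇒p⊓q≡p h)))) (p≤q⊔p 0ℚ ((finish s ⊓ τ) - start s))

  elapsed-before : ∀ τ (s : Segment n) → τ ≤ start s → elapsed τ s ≤ 0ℚ
  elapsed-before τ s h = ⊔-lub ≤-refl (minus≤0 (≤-trans (p⊓q≤q (finish s) τ) h))

  for-nonNeg : ∀ (i : Fin n) {f} s → 0ℚ ≤ f s → 0ℚ ≤ for i f s
  for-nonNeg i s h with does (worksOn s Fin.≟ i)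
  ... | true  = h
  ... | false = ≤-refl

  for-mono : ∀ (i : Fin n) f g s → f s ≤ g s → for i f s ≤ for i g s
  for-mono i f g s h with does (worksOn s Fin.≟ i)
  ... | true  = h
  ... | false = ≤-refl

  for-here : ∀ (i : Fin n) f s → worksOn s ≡ i → for i f s ≡ f s
  for-here i f s eq with worksOn s Fin.≟ i
  ... | yes _ = refl
  ... | no ¬e = ⊥-elim (¬e eq)

  for-else : ∀ (i : Fin n) f s → worksOn s ≢ i → for i f s ≡ 0ℚ
  for-else i f s ne with worksOn s Fin.≟ i
  ... | yes e = ⊥-elim (ne e)
  ... | no _  = refl

  Nonempty : Segment n → Set
  Nonempty s = start s < finish s

  Before : Segment n → Segment n → Set
  Before s s′ = finish s ≤ start s′

  sum-mono-All : ∀ {f g : Segment n → ℚ} {P : Segment n → Set} → (∀ s → P s → f s ≤ g s) → ∀ {σ} → All P σ → sumℚ (map f σ) ≤ sumℚ (map g σ)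
  sum-mono-All h []       = ≤-refl
  sum-mono-All h (p ∷ ps) = +-mono-≤ (h _ p) (sum-mono-All h ps)

  y-nonNeg : ∀ (σ : Schedule n) i τ → 0ℚ ≤ y σ i τ
  y-nonNeg σ i τ = ≤-trans (sumℚ-nonNeg (λ s → for-nonNeg i {elapsed τ} s (elapsed-nonNeg τ s)) σ) (≤-reflexive (sym (y-sum σ i τ)))

  y-mono : ∀ (σ : Schedule n) i {τ τ′} → τ ≤ τ′ → y σ i τ ≤ y σ i τ′
  y-mono σ i h = subst₂ _≤_ (sym (y-sum σ i _)) (sym (y-sum σ i _)) (sumℚ-mono (λ s → for-mono i (elapsed _) (elapsed _) s (elapsed-mono h s)) σ)

  y≤y∞ : ∀ {σ : Schedule n} → All Nonempty σ → ∀ i τ → y σ i τ ≤ y∞ σ i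
  y≤y∞ {σ = σ} ne i τ = subst₂ _≤_ (sym (y-sum σ i τ)) (sym (y∞-sum σ i)) (sum-mono-All (λ s h → for-mono i (elapsed τ) duration s (elapsed≤duration τ s h)) ne)

  y∞-nonNeg : ∀ {σ : Schedule n} → All Nonempty σ → ∀ i → 0ℚ ≤ y∞ σ i
  y∞-nonNeg {σ = σ} ne i = ≤-trans (y-nonNeg σ i 0ℚ) (y≤y∞ ne i 0ℚ)

  y∞≤y : ∀ (σ : Schedule n) i τ → All (λ s → worksOn s ≡ i → finish s ≤ τ) σ → y∞ σ i ≤ y σ i τ
  y∞≤y σ i τ all = subst₂ _≤_ (sym (y∞-sum σ i)) (sym (y-sum σ i τ)) (sum-mono-All le all)
    where
    le : ∀ s → (worksOn s ≡ i → finish s ≤ τ) → for i duration s ≤ for i (elapsed τ) s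
    le s h with worksOn s Fin.≟ i
    ... | yes e = duration≤elapsed τ s (h e)
    ... | no _  = ≤-refl

  working⇒y<y∞ : ∀ {σ : Schedule n} → All Nonempty σ → ∀ i τ → Working σ i τ → y σ i τ < y∞ σ i
  working⇒y<y∞ {σ = σ} ne i τ w = subst₂ _<_ (sym (y-sum σ i τ)) (sym (y∞-sum σ i)) (go ne w)
    where
    go : ∀ {σ} → All Nonempty σ → Working σ i τ → sumℚ (map (for i (elapsed τ)) σ) < sumℚ (map (for i duration) σ)
    go {s ∷ σ} (h ∷ hs) (here (e , _ , τ<f)) = +-mono-<-≤
      (subst₂ _<_ (sym (for-here i (elapsed τ) s e)) (sym (for-here i duration s e)) (elapsed<duration τ s h τ<f))
      (sum-mono-All (λ s h → for-mono i (elapsed τ) duration s (elapsed≤duration τ s h)) hs)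
    go {s ∷ σ} (h ∷ hs) (there w) = +-mono-≤-< (for-mono i (elapsed τ) duration s (elapsed≤duration τ s h)) (go hs w)

  y∞-pos : ∀ {σ : Schedule n} → All Nonempty σ → ∀ {s} → s ∈ σ → 0ℚ < y∞ σ (worksOn s)
  y∞-pos {σ = σ} ne {s} s∈ = ≤-<-trans (y-nonNeg σ (worksOn s) (start s))
    (working⇒y<y∞ ne (worksOn s) (start s) (lose s∈ (refl , ≤-refl , All.lookup ne s∈)))

  y∞-absent : ∀ (σ : Schedule n) i → All (λ s → worksOn s ≢ i) σ → y∞ σ i ≡ 0ℚ
  y∞-absent σ i all = trans (y∞-sum σ i) (go all)
    where
    go : ∀ {σ} → All (λ s → worksOn s ≢ i) σ → sumℚ (map (for i duration) σ) ≡ 0ℚ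
    go [] = refl
    go {s ∷ σ} (h ∷ hs) = cong₂ _+_ (for-else i duration s h) (go hs)

  -- y is 1-Lipschitz since segments do not overlap

  elapsed-lipschitz : ∀ (s : Segment n) {τ τ′} → τ ≤ τ′ → elapsed τ′ s + τ ≤ elapsed τ s + τ′
  elapsed-lipschitz s {τ} {τ′} h with ≤-total (finish s) τ
  ... | inj₁ f≤τ = +-mono-≤ (≤-reflexive (cong (λ z → 0ℚ ⊔ (z - start s)) (trans (p≤q⇒p⊓q≡p (≤-trans f≤τ h)) (sym (p≤q⇒p⊓q≡p f≤τ))))) h
  ... | inj₂ τ≤f = minus-≤ {elapsed τ′ s} {elapsed τ s + τ′} {τ} (⊔-lub (≤-minus {0ℚ} {elapsed τ s + τ′} {τ} (≤-trans (≤-reflexive (+-identityˡ τ)) (≤-trans h (≤-+ˡ (elapsed τ s) (elapsed-nonNeg τ s) ≤-refl))))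
      (≤-minus {(finish s ⊓ τ′) - start s} {elapsed τ s + τ′} {τ} (≤-trans (≤-reflexive swap) (+-mono-≤ (≤-trans (≤-reflexive (cong (_- start s) (sym (p≥q⇒p⊓q≡q τ≤f)))) (p≤q⊔p 0ℚ ((finish s ⊓ τ) - start s))) (p⊓q≤q (finish s) τ′)))))
    where
    swap : ((finish s ⊓ τ′) - start s) + τ ≡ (τ - start s) + (finish s ⊓ τ′)
    swap = solve 3 (λ f b t → (f :- b) :+ t := (t :- b) :+ f) refl (finish s ⊓ τ′) (start s) τ
      where open +-*-Solver

  private
    sum-before : ∀ (σ : Schedule n) i τ → All (λ s → τ ≤ start s) σ → sumℚ (map (for i (elapsed τ)) σ) ≤ 0ℚ
    sum-before []      i τ []       = ≤-refl
    sum-before (s ∷ σ) i τ (h ∷ hs) = ≤-trans (+-mono-≤ le (sum-before σ i τ hs)) (≤-reflexive (+-identityˡ 0ℚ))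
      where
      le : for i (elapsed τ) s ≤ 0ℚ
      le with does (worksOn s Fin.≟ i)
      ... | true  = elapsed-before τ s h
      ... | false = ≤-refl

    -- Look at the end of the first segment, if it serves job `i`. If it is not before `τ′`, later
    -- segments have contributed nothing by `τ′`; if it is not after `τ`, the segment contributes
    -- the same at both times; otherwise the interval is cut there, and growth passes from this
    -- segment to the later ones.
    sum-lipschitz : ∀ {σ : Schedule n} → AllPairs Before σ → ∀ i {τ τ′} → τ ≤ τ′ →
      sumℚ (map (for i (elapsed τ′)) σ) + τ ≤ sumℚ (map (for i (elapsed τ)) σ) + τ′
    sum-lipschitz [] i {τ} {τ′} h = +-monoʳ-≤ 0ℚ h
    sum-lipschitz {σ = s ∷ σ} (b ∷ bs) i {τ} {τ′} h with worksOn s Fin.≟ i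
    ... | no _ = subst₂ _≤_ (cong (_+ τ) (sym (+-identityˡ (sumℚ (map (for i (elapsed τ′)) σ))))) (cong (_+ τ′) (sym (+-identityˡ (sumℚ (map (for i (elapsed τ)) σ))))) (sum-lipschitz bs i h)
    ... | yes _ with ≤-total τ′ (finish s)
    ... | inj₁ τ′≤f = ≤-trans (≤-reflexive (shuffle (elapsed τ′ s) _ τ))
          (≤-trans (+-mono-≤ (elapsed-lipschitz s h) (≤-trans (sum-before σ i τ′ (All.map (≤-trans τ′≤f) b)) (sumℚ-nonNeg (λ s → for-nonNeg i {elapsed τ} s (elapsed-nonNeg τ s)) σ)))
            (≤-reflexive (sym (shuffle (elapsed τ s) _ τ′))))
      where
      shuffle : ∀ a b c → (a + b) + c ≡ (a + c) + b
      shuffle = solve 3 (λ a b c → (a :+ b) :+ c := (a :+ c) :+ b) refl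
        where open +-*-Solver
    ... | inj₂ f≤τ′ with ≤-total (finish s) τ
    ... | inj₁ f≤τ = ≤-trans (≤-reflexive (+-assoc (elapsed τ′ s) _ τ))
          (≤-trans (+-mono-≤ (≤-reflexive (cong (λ z → 0ℚ ⊔ (z - start s)) (trans (p≤q⇒p⊓q≡p f≤τ′) (sym (p≤q⇒p⊓q≡p f≤τ))))) (sum-lipschitz bs i h))
            (≤-reflexive (sym (+-assoc (elapsed τ s) _ τ′))))
    ... | inj₂ τ≤f = cancelʳ-≤ (finish s) (≤-trans (≤-reflexive (regroup (elapsed τ′ s) _ τ (finish s)))
          (≤-trans (+-mono-≤ first rest) (≤-reflexive (regroup′ (elapsed τ s) _ τ′ (finish s)))))
      where
      regroup : ∀ a b c d → ((a + b) + c) + d ≡ (a + c) + (b + d)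
      regroup = solve 4 (λ a b c d → ((a :+ b) :+ c) :+ d := (a :+ c) :+ (b :+ d)) refl
        where open +-*-Solver
      regroup′ : ∀ a b c d → (a + d) + (b + c) ≡ ((a + b) + c) + d
      regroup′ = solve 4 (λ a b c d → (a :+ d) :+ (b :+ c) := ((a :+ b) :+ c) :+ d) refl
        where open +-*-Solver
      first : elapsed τ′ s + τ ≤ elapsed τ s + finish s
      first = ≤-trans (+-monoˡ-≤ τ (≤-reflexive (cong (λ z → 0ℚ ⊔ (z - start s)) (trans (p≤q⇒p⊓q≡p f≤τ′) (sym (⊓-idem (finish s))))))) (elapsed-lipschitz s τ≤f)
      rest : sumℚ (map (for i (elapsed τ′)) σ) + finish s ≤ sumℚ (map (for i (elapsed τ)) σ) + τ′
      rest = ≤-trans (sum-lipschitz bs i f≤τ′)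
        (+-monoˡ-≤ τ′ (≤-trans (sum-before σ i (finish s) b) (sumℚ-nonNeg (λ s → for-nonNeg i {elapsed τ} s (elapsed-nonNeg τ s)) σ)))

  y-lipschitz : ∀ {σ : Schedule n} → AllPairs Before σ → ∀ i {τ τ′} → τ ≤ τ′ → y σ i τ′ + τ ≤ y σ i τ + τ′
  y-lipschitz {σ = σ} ch i {τ} {τ′} h = subst₂ _≤_ (cong (_+ τ) (sym (y-sum σ i τ′))) (cong (_+ τ′) (sym (y-sum σ i τ))) (sum-lipschitz ch i h)

  ifℚ : Bool → ℚ → ℚ
  ifℚ b q = if b then q else 0ℚ

  measure : (Fin n → Bool) → Schedule n → ℚ
  measure c σ = sumℚ (map (λ s → ifℚ (c (worksOn s)) (duration s)) σ)

  ifℚ-nonNeg : ∀ b {q} → 0ℚ ≤ q → 0ℚ ≤ ifℚ b q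
  ifℚ-nonNeg true  h = h
  ifℚ-nonNeg false h = ≤-refl

  measure-nonNeg : ∀ c {σ : Schedule n} → All Nonempty σ → 0ℚ ≤ measure c σ
  measure-nonNeg c [] = ≤-refl
  measure-nonNeg c {s ∷ σ} (h ∷ hs) = ≤-+ʳ _ (measure-nonNeg c hs) (ifℚ-nonNeg (c (worksOn s)) (0≤minus (<⇒≤ h)))

  -- Disjoint segments inside `[r , D]` are removed one by one. The rest lies to the right of the
  -- end of the removed segment, which takes over the role of `r`.
  measure-upper : ∀ c {σ : Schedule n} → All Nonempty σ → AllPairs Before σ → ∀ {r D} → r ≤ D →
    All (λ s → c (worksOn s) ≡ true → r ≤ start s × finish s ≤ D) σ → measure c σ + r ≤ D
  measure-upper c [] [] r≤D [] = ≤-trans (≤-reflexive (+-identityˡ _)) r≤D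
  measure-upper c {s ∷ σ} (h ∷ hs) (b ∷ bs) {r} {D} r≤D (w ∷ ws) with c (worksOn s)
  ... | false = ≤-trans (≤-reflexive (cong (_+ r) (+-identityˡ (measure c σ)))) (measure-upper c hs bs r≤D ws)
  ... | true  = ≤-trans (+-monoʳ-≤ (duration s + measure c σ) (proj₁ (w refl)))
        (≤-trans (≤-reflexive (regroup (finish s) (start s) (measure c σ)))
          (measure-upper c hs bs (proj₂ (w refl)) (All.zipWith (λ (b , w) e → b , proj₂ (w e)) (b , ws))))
    where
    regroup : ∀ f b m → ((f - b) + m) + b ≡ m + f
    regroup = solve 3 (λ f b m → ((f :- b) :+ m) :+ b := m :+ f) refl
      where open +-*-Solver

  Covers : (Fin n → Bool) → ℚ → Segment n → Set
  Covers c τ s = c (worksOn s) ≡ true × start s ≤ τ × τ < finish s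

  -- The inequality is strict because segments are half-open and the endpoint `u` is covered too.
  -- For integers strictness is worth a whole unit, which accounts for the `suc` in the condition
  -- `covered`.
  measure-lower : ∀ c {σ : Schedule n} → All Nonempty σ → AllPairs Before σ → ∀ {l u} → l ≤ u →
    (∀ τ → l ≤ τ → τ ≤ u → Any (Covers c τ) σ) → u < measure c σ + l
  measure-lower c [] [] {l} l≤u cov with cov l ≤-refl l≤u
  ... | ()
  measure-lower c {s ∷ σ} (h ∷ hs) (b ∷ bs) {l} {u} l≤u cov with finish s ≤? l
  ... | yes f≤l = <-≤-trans (measure-lower c hs bs l≤u later)
        (+-monoˡ-≤ l (≤-+ˡ _ (ifℚ-nonNeg (c (worksOn s)) (0≤minus (<⇒≤ h))) ≤-refl))
    where
    later : ∀ τ → l ≤ τ → τ ≤ u → Any (Covers c τ) σ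
    later τ l≤τ τ≤u with cov τ l≤τ τ≤u
    ... | here (_ , _ , τ<f) = ⊥-elim (<-irrefl refl (<-≤-trans τ<f (≤-trans f≤l l≤τ)))
    ... | there a = a
  ... | no f≰l with cov l ≤-refl l≤u
  ... | there a = ⊥-elim (too-late b a)
    where
    too-late : ∀ {σ} → All (λ s′ → finish s ≤ start s′) σ → Any (Covers c l) σ → ⊥
    too-late (p ∷ _)  (here (_ , st , _)) = f≰l (≤-trans p st)
    too-late (_ ∷ ps) (there a) = too-late ps a
  ... | here (cs , st , l<f) rewrite cs with finish s ≤? u
  ... | no f≰u = <-≤-trans (≰⇒> f≰u) (≤-trans (≤-reflexive (sym (minus+ (finish s) (start s))))
          (+-mono-≤ (≤-+ʳ {duration s} (measure c σ) (measure-nonNeg c hs) ≤-refl) st))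
  ... | yes f≤u = <-≤-trans (measure-lower c hs bs f≤u later)
          (≤-trans (≤-reflexive (sym (regroup (finish s) (start s) (measure c σ)))) (+-monoʳ-≤ (duration s + measure c σ) st))
    where
    regroup : ∀ f b m → ((f - b) + m) + b ≡ m + f
    regroup = solve 3 (λ f b m → ((f :- b) :+ m) :+ b := m :+ f) refl
      where open +-*-Solver
    later : ∀ τ → finish s ≤ τ → τ ≤ u → Any (Covers c τ) σ
    later τ f≤τ τ≤u with cov τ (≤-trans (<⇒≤ l<f) f≤τ) τ≤u
    ... | here (_ , _ , τ<f) = ⊥-elim (<-irrefl refl (<-≤-trans τ<f f≤τ))
    ... | there a = a

  -- Double counting: the segments are grouped by the job that they serve.
  measure-ΣF : ∀ (c : Fin n → Bool) (σ : Schedule n) → measure c σ ≡ ΣF (λ i → ifℚ (c i) (y∞ σ i))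
  measure-ΣF {n} c σ = trans (go σ) (ΣF-cong λ i → cong (ifℚ (c i)) (sym (y∞-sum σ i)))
    where
    single : ∀ {n} (c : Fin n → Bool) w q → ΣF (λ i → ifℚ (c i) (ifℚ (does (w Fin.≟ i)) q)) ≡ ifℚ (c w) q
    single {suc n} c Fin.zero q = trans (cong (λ z → ifℚ (c Fin.zero) q + z) (trans (ΣF-cong λ i → zeros (c (Fin.suc i))) (ΣF-zero n))) (+-identityʳ _)
      where
      zeros : ∀ b → ifℚ b 0ℚ ≡ 0ℚ
      zeros true  = refl
      zeros false = refl
    single {suc n} c (Fin.suc w) q = trans (cong₂ _+_ (zeros (c Fin.zero)) (single (c ∘ Fin.suc) w q)) (+-identityˡ _)
      where
      zeros : ∀ b → ifℚ b 0ℚ ≡ 0ℚ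
      zeros true  = refl
      zeros false = refl
    ifℚ-+ : ∀ b p q → ifℚ b (p + q) ≡ ifℚ b p + ifℚ b q
    ifℚ-+ true  p q = refl
    ifℚ-+ false p q = refl
    go : ∀ σ → measure c σ ≡ ΣF (λ i → ifℚ (c i) (sumℚ (map (for i duration) σ)))
    go [] = sym (trans (ΣF-cong λ i → zeros (c i)) (ΣF-zero n))
      where
      zeros : ∀ b → ifℚ b 0ℚ ≡ 0ℚ
      zeros true  = refl
      zeros false = refl
    go (s ∷ σ) = trans (cong₂ _+_ (sym (single c (worksOn s) (duration s))) (go σ))
      (trans (sym (ΣF-+ (λ i → ifℚ (c i) (for i duration s)) (λ i → ifℚ (c i) (sumℚ (map (for i duration) σ)))))
        (ΣF-cong λ i → sym (ifℚ-+ (c i) _ _)))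

  measure-ℕ : ∀ (c : Fin n → Bool) (σ : Schedule n) (w : Fin n → ℕ) → (∀ i → y∞ σ i ≡ fromℕ (w i)) →
    measure c σ ≡ fromℕ (sumF (λ i → when (c i) (w i)))
  measure-ℕ c σ w h = trans (measure-ΣF c σ) (trans (ΣF-cong λ i → trans (cong (ifℚ (c i)) (h i)) (conv (c i) (w i))) (ΣF-fromℕ (λ i → when (c i) (w i))))
    where
    conv : ∀ b m → ifℚ b (fromℕ m) ≡ fromℕ (when b m)
    conv true  m = refl
    conv false m = refl

-- The jobs processed by a feasible schedule form a schedulable set.

module FeasibleSchedules where

  open import Defs
  open UnitStepSchedules
  open Rationals
  open Measure
  open import Data.Bool.Base using (Bool; true; false; _∧_)
  open import Data.Empty using (⊥-elim)
  open import Data.Fin.Base using (Fin)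
  open import Data.List.Base using (length; lookup)
  import Data.List.Relation.Unary.All as All
  open import Data.List.Relation.Unary.Any as Any using (Any)
  open import Data.List.Membership.Propositional using (_∈_; lose; find)
  open import Data.Nat.Base as ℕ using (ℕ; zero; suc; _∸_; _≤ᵇ_; _<ᵇ_; s≤s; z≤n)
  import Data.Nat.Properties as ℕ
  open import Data.Nat.Induction using (<-rec)
  open import Data.Product.Base using (∃-syntax; _×_; _,_; proj₁; proj₂)
  open import Data.Rational.Base hiding (_≤ᵇ_)
  open import Data.Rational.Properties
  open import Data.Rational.Solver using (module +-*-Solver)
  open import Data.Sum.Base using (_⊎_; inj₁; inj₂)
  open import Relation.Binary.PropositionalEquality using (_≡_; refl; sym; trans; cong; subst)
  open import Relation.Nullary using (Dec; yes; no; does)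
  open import Relation.Nullary.Decidable using (_×-dec_)

  module _ (I : Instance) where

    procN arrN dueN : Fin (length I) → ℕ
    procN i = Job.processing (lookup I i)
    arrN  i = Job.arrival    (lookup I i)
    dueN  i = Job.deadline   (lookup I i)

  abstract
    isPositive : ℚ → Bool
    isPositive q = does (0ℚ <? q)

    isPositive-cases : ∀ q → (0ℚ < q × isPositive q ≡ true) ⊎ (q ≤ 0ℚ × isPositive q ≡ false)
    isPositive-cases q = cases (0ℚ <? q)
      where
      cases : (q? : Dec (0ℚ < q)) → (0ℚ < q × does q? ≡ true) ⊎ (q ≤ 0ℚ × does q? ≡ false)
      cases (yes h) = inj₁ (h , refl)
      cases (no ¬h) = inj₂ (≮⇒≥ ¬h , refl)

  selected : ∀ {n} → Schedule n → Fin n → Bool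
  selected σ i = isPositive (y∞ σ i)

  module _ {I : Instance} {σ : Schedule (length I)} (feas : Feasible I σ) where
    open Feasible feas

    -- All or nothing: a job that is processed at all must be completed, so it receives its full
    -- length, and it never receives more.
    y∞-selected : ∀ i → y∞ σ i ≡ fromℕ (when (selected σ i) (procN I i))
    y∞-selected i with isPositive-cases (y∞ σ i)
    ... | inj₁ (pos , e) = trans (≤-antisym (notExceeded i) (≤-trans (committed i pos) (y≤y∞ nonempty i (d I i))))
                                 (cong (λ b → fromℕ (when b (procN I i))) (sym e))
    ... | inj₂ (np , e) = trans (≤-antisym np (y∞-nonNeg nonempty i)) (cong (λ b → fromℕ (when b (procN I i))) (sym e))

    selected-true : ∀ i → 0ℚ < y∞ σ i → selected σ i ≡ true
    selected-true i h with isPositive-cases (y∞ σ i)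
    ... | inj₁ (_ , e) = e
    ... | inj₂ (np , _) = ⊥-elim (<-irrefl refl (<-≤-trans h np))

    unselected : ∀ i → selected σ i ≡ false → y∞ σ i ≡ 0ℚ
    unselected i h = trans (y∞-selected i) (cong (λ b → fromℕ (when b (procN I i))) h)

    arrival≤start : ∀ {s} → s ∈ σ → a I (worksOn s) ≤ start s
    arrival≤start {s} s∈ = proj₁ (executable (worksOn s) (start s) (lose s∈ (refl , ≤-refl , All.lookup nonempty s∈)))

    -- Executability concerns the instants of a half-open segment and so not its end. Were the end
    -- late, density would provide an instant of the segment that is already past the deadline.
    finish≤deadline : ∀ {s} → s ∈ σ → finish s ≤ d I (worksOn s)
    finish≤deadline {s} s∈ with finish s ≤? d I (worksOn s)
    ... | yes h = h
    ... | no ¬h with <-dense (≰⇒> ¬h)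
    ... | τ , d<τ , τ<f = ⊥-elim (<-irrefl refl (<-≤-trans d<τ (≤-trans (p≤q⊔p (start s) τ)
        (proj₁ (proj₂ (executable (worksOn s) (start s ⊔ τ) (lose s∈ (refl , p≤p⊔q (start s) τ , ⊔<))))))))
      where
      ⊔< : start s ⊔ τ < finish s
      ⊔< with ⊔-sel (start s) τ
      ... | inj₁ e = subst (_< finish s) (sym e) (All.lookup nonempty s∈)
      ... | inj₂ e = subst (_< finish s) (sym e) τ<f

    private
      S : Fin (length I) → Bool
      S = selected σ

      At : ℚ → Segment (length I) → Set
      At τ s = start s ≤ τ × τ < finish s

      at? : ∀ τ → Dec (Any (At τ) σ)
      at? τ = Any.any? (λ s → (start s ≤? τ) ×-dec (τ <? finish s)) σ

      busy-at : ∀ τ → 0ℚ ≤ τ → ∀ i → Completable I σ i τ → Any (At τ) σ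
      busy-at τ 0≤τ i c with at? τ
      ... | yes h = h
      ... | no ¬h = ⊥-elim (busy τ 0≤τ (λ j w → ¬h (Any.map (λ (_ , h) → h) w)) i c)

      measure-set : ∀ c → measure c σ ≡ fromℕ (sumF (λ k → when (S k ∧ c k) (procN I k)))
      measure-set c = trans (measure-ℕ c σ _ y∞-selected) (cong fromℕ (sumF-cong λ k → sym (when-∧ (S k) (c k) (procN I k))))

    module _ (dl : Fin (length I) → ℕ) (dl-ok : ∀ {s} → s ∈ σ → finish s ≤ fromℕ (dl (worksOn s))) where

      private
        window : ℕ → ℕ → Fin (length I) → Bool
        window r D k = (r ≤ᵇ arrN I k) ∧ (dl k ≤ᵇ D)

        hall′ : ∀ r D → sumF (λ k → when (S k ∧ window r D k) (procN I k)) ℕ.≤ D ∸ r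
        hall′ r D = ℕ.+-cancelʳ-≤ r _ _ (ℕ.≤-trans (fromℕ-cancel-≤ main) (ℕ.≤-trans (ℕ.m≤n+m∸n (D ℕ.⊔ r) r)
            (ℕ.≤-reflexive (trans (cong (r ℕ.+_) (⊔∸ D r)) (ℕ.+-comm r (D ∸ r))))))
          where
          ⊔∸ : ∀ D r → (D ℕ.⊔ r) ∸ r ≡ D ∸ r
          ⊔∸ D r = trans (ℕ.∸-distribʳ-⊔ r D r) (trans (cong ((D ∸ r) ℕ.⊔_) (ℕ.n∸n≡0 r)) (ℕ.⊔-identityʳ _))
          inside : ∀ {s} → s ∈ σ → window r D (worksOn s) ≡ true → fromℕ r ≤ start s × finish s ≤ fromℕ (D ℕ.⊔ r)
          inside {s} s∈ e with ∧-true {r ≤ᵇ arrN I (worksOn s)} e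
          ... | e₁ , e₂ = ≤-trans (fromℕ-mono-≤ (true-≤ᵇ e₁)) (arrival≤start s∈) ,
                          ≤-trans (dl-ok s∈) (fromℕ-mono-≤ (ℕ.≤-trans (true-≤ᵇ e₂) (ℕ.m≤m⊔n D r)))
          main : fromℕ (sumF (λ k → when (S k ∧ window r D k) (procN I k)) ℕ.+ r) ≤ fromℕ (D ℕ.⊔ r)
          main = ≤-trans (≤-reflexive (trans (fromℕ-+ _ r) (cong (_+ fromℕ r) (sym (measure-set (window r D))))))
            (measure-upper (window r D) nonempty chronological (fromℕ-mono-≤ (ℕ.m≤n⊔m D r)) (All.tabulate inside))

      -- A job arriving before s and still worked on after s keeps the processor busy from its arrival on.
      private
        extend : ∀ {g} → g ∈ σ → ∀ s → arrN I (worksOn g) ℕ.< s → fromℕ s < finish g →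
          ∀ τ → a I (worksOn g) ≤ τ → τ < fromℕ s → Any (At τ) σ
        extend {g} g∈ s a<s s<f τ a≤τ τ<s = busy-at τ (≤-trans (0≤fromℕ _) a≤τ) j (a≤τ , y<t , can)
          where
          j = worksOn g
          τ′ = start g ⊔ fromℕ s
          τ′<f : τ′ < finish g
          τ′<f with ⊔-sel (start g) (fromℕ s)
          ... | inj₁ e = subst (_< finish g) (sym e) (All.lookup nonempty g∈)
          ... | inj₂ e = subst (_< finish g) (sym e) s<f
          ex : Executable I σ j τ′
          ex = executable j τ′ (lose g∈ (refl , p≤p⊔q (start g) (fromℕ s) , τ′<f))
          τ≤τ′ : τ ≤ τ′
          τ≤τ′ = ≤-trans (<⇒≤ τ<s) (p≤q⊔p (start g) (fromℕ s))
          y<t : y σ j τ < t I j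
          y<t = ≤-<-trans (y-mono σ j τ≤τ′) (proj₂ (proj₂ ex))
          rearrange : ∀ d t y → (d + y) - t ≡ (d - t) + y
          rearrange = solve 3 (λ d t y → (d :+ y) :- t := (d :- t) :+ y) refl
            where open +-*-Solver
          can : τ ≤ (d I j - t I j) + y σ j τ
          can = ≤-trans (≤-minus {τ} {d I j + y σ j τ} {t I j} (≤-trans (≤-reflexive (+-comm τ (t I j)))
                  (≤-trans (+-monoˡ-≤ τ (committed j (y∞-pos nonempty g∈)))
                    (≤-trans (y-lipschitz chronological j (≤-trans τ≤τ′ (proj₁ (proj₂ ex)))) (≤-reflexive (+-comm (y σ j τ) (d I j)))))))
                (≤-reflexive (rearrange (d I j) (t I j) (y σ j τ)))

        Goal : ℕ → ℕ → Set
        Goal q i = ∃[ k ] S k ≡ true × arrN I k ℕ.≤ i ×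
          (∀ m → m ℕ.≤ suc q → m ℕ.≤ arrN I k ℕ.+ sumF (λ l → when (S l ∧ ((arrN I k ≤ᵇ arrN I l) ∧ (arrN I l <ᵇ m))) (procN I l)))

        -- Descent on the beginning `s` of a stretch in which the processor is busy up to `q`. If a
        -- segment reaching beyond `s` belongs to a job that arrived before `s`, `extend` moves the
        -- beginning back to that arrival. Otherwise everything processed in the stretch arrived in
        -- it, `s` is the arrival of the job running at `s`, and this job is the witness `k`.
        descend : ∀ q i s → s ℕ.≤ i → i ℕ.≤ q → (∀ τ → fromℕ s ≤ τ → τ ≤ fromℕ q → Any (At τ) σ) → Goal q i
        descend q i = <-rec (λ s → s ℕ.≤ i → i ℕ.≤ q → (∀ τ → fromℕ s ≤ τ → τ ≤ fromℕ q → Any (At τ) σ) → Goal q i) body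
          where
          body : ∀ s → (∀ {s′} → s′ ℕ.< s → s′ ℕ.≤ i → i ℕ.≤ q → (∀ τ → fromℕ s′ ≤ τ → τ ≤ fromℕ q → Any (At τ) σ) → Goal q i) →
            s ℕ.≤ i → i ℕ.≤ q → (∀ τ → fromℕ s ≤ τ → τ ≤ fromℕ q → Any (At τ) σ) → Goal q i
          body s rec s≤i i≤q cov with Any.any? (λ g → (start g ≤? fromℕ q) ×-dec ((fromℕ s <? finish g) ×-dec (arrN I (worksOn g) ℕ.<? s))) σ
          ... | yes some with find some
          ... | g , g∈ , (_ , s<f , a<s) = rec a<s (ℕ.≤-trans (ℕ.<⇒≤ a<s) s≤i) i≤q cov′
            where
            cov′ : ∀ τ → fromℕ (arrN I (worksOn g)) ≤ τ → τ ≤ fromℕ q → Any (At τ) σ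
            cov′ τ lo hi with fromℕ s ≤? τ
            ... | yes h = cov τ h hi
            ... | no ¬h = extend g∈ s a<s s<f τ lo (≰⇒> ¬h)
          body s rec s≤i i≤q cov | no none with find (cov (fromℕ s) ≤-refl (fromℕ-mono-≤ (ℕ.≤-trans s≤i i≤q)))
          ... | g , g∈ , (st , fi) = k , selected-true k (y∞-pos nonempty g∈) , ℕ.≤-trans (ℕ.≤-reflexive ak≡s) s≤i , bound
            where
            k = worksOn g
            late : ∀ {h} → h ∈ σ → start h ≤ fromℕ q → fromℕ s < finish h → s ℕ.≤ arrN I (worksOn h)
            late h∈ u v = ℕ.≮⇒≥ λ w → none (lose h∈ (u , v , w))
            ak≡s : arrN I k ≡ s
            ak≡s = ℕ.≤-antisym (fromℕ-cancel-≤ (≤-trans (arrival≤start g∈) st))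
                     (late g∈ (≤-trans st (fromℕ-mono-≤ (ℕ.≤-trans s≤i i≤q))) fi)
            bound′ : ∀ m → m ℕ.≤ suc q → m ℕ.≤ s ℕ.+ sumF (λ l → when (S l ∧ ((s ≤ᵇ arrN I l) ∧ (arrN I l <ᵇ m))) (procN I l))
            bound′ m m≤ with m ℕ.≤? s
            ... | yes h = ℕ.≤-trans h (ℕ.m≤m+n s _)
            bound′ zero m≤ | no ¬h = z≤n
            bound′ (suc m) (s≤s m≤) | no ¬h = ℕ.≤-trans (fromℕ-cancel-< main) (ℕ.≤-reflexive (ℕ.+-comm _ s))
              where
              c : Fin (length I) → Bool
              c l = (s ≤ᵇ arrN I l) ∧ (arrN I l <ᵇ suc m)
              s≤m : s ℕ.≤ m
              s≤m = ℕ.≤-pred (ℕ.≰⇒> ¬h)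
              -- A job running at a time in `[s , m]` has arrived by `m`. So class `c` covers the
              -- closed interval and its measure exceeds `m - s`.
              cover : ∀ τ → fromℕ s ≤ τ → τ ≤ fromℕ m → Any (Covers c τ) σ
              cover τ lo hi with find (cov τ lo (≤-trans hi (fromℕ-mono-≤ m≤)))
              ... | h , h∈ , (u , v) = lose h∈
                ( true-∧ (≤ᵇ-true (late h∈ (≤-trans u (≤-trans hi (fromℕ-mono-≤ m≤))) (≤-<-trans lo v)))
                         (<ᵇ-true (s≤s (fromℕ-cancel-≤ (≤-trans (arrival≤start h∈) (≤-trans u hi)))))
                , u , v )
              main : fromℕ m < fromℕ (sumF (λ l → when (S l ∧ c l) (procN I l)) ℕ.+ s)
              main = <-≤-trans (measure-lower c nonempty chronological (fromℕ-mono-≤ s≤m) cover)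
                (≤-reflexive (trans (cong (_+ fromℕ s) (measure-set c)) (sym (fromℕ-+ _ s))))
            bound : ∀ m → m ℕ.≤ suc q → m ℕ.≤ arrN I k ℕ.+ sumF (λ l → when (S l ∧ ((arrN I k ≤ᵇ arrN I l) ∧ (arrN I l <ᵇ m))) (procN I l))
            bound m m≤ rewrite ak≡s = bound′ m m≤

      feasible⇒schedulable : Schedulable (procN I) (arrN I) (dueN I) dl (selected σ)
      feasible⇒schedulable = record { hall = hall′ ; covered = covered′ }
        where
        covered′ : ∀ i → S i ≡ false → 0 ℕ.< procN I i → arrN I i ℕ.+ procN I i ℕ.≤ dueN I i → _
        covered′ i Si pos fits with descend q (arrN I i) (arrN I i) ℕ.≤-refl a≤q cov
          where
          -- The last time at which job `i` could be started. Being skipped, the job stays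
          -- completable from its arrival until then and keeps the processor busy.
          q = dueN I i ∸ procN I i
          a≤q : arrN I i ℕ.≤ q
          a≤q = ℕ.m+n≤o⇒m≤o∸n (arrN I i) fits
          q+p : q ℕ.+ procN I i ≡ dueN I i
          q+p = ℕ.m∸n+n≡m (ℕ.≤-trans (ℕ.m≤n+m _ (arrN I i)) fits)
          zero-y : ∀ τ → y σ i τ ≡ 0ℚ
          zero-y τ = ≤-antisym (≤-trans (y≤y∞ nonempty i τ) (≤-reflexive (unselected i Si))) (y-nonNeg σ i τ)
          cov : ∀ τ → fromℕ (arrN I i) ≤ τ → τ ≤ fromℕ q → Any (At τ) σ
          cov τ lo hi = busy-at τ (≤-trans (0≤fromℕ _) lo) i
            ( lo , subst (_< t I i) (sym (zero-y τ)) (fromℕ-mono-< {0} pos)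
            , ≤-+ʳ (y σ i τ) (y-nonNeg σ i τ) (≤-minus {τ} {d I i} {t I i}
                (≤-trans (+-monoˡ-≤ (t I i) hi) (≤-reflexive (trans (sym (fromℕ-+ q (procN I i))) (cong fromℕ q+p))))) )
        ... | k , Sk , ak , h = k , Sk , ak , λ m m≤ → h m (le m m≤)
          where
          le : ∀ m → m ℕ.+ procN I i ℕ.≤ suc (dueN I i) → m ℕ.≤ suc (dueN I i ∸ procN I i)
          le m m≤ = ℕ.≤-trans (ℕ.m+n≤o⇒m≤o∸n m m≤) (ℕ.≤-reflexive (ℕ.+-∸-assoc 1 (ℕ.≤-trans (ℕ.m≤n+m _ (arrN I i)) fits)))

-- Schedules read off from traces, and the values of the objectives.

module Witnesses where

  open import Defs
  open UnitStepSchedules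
  open Rationals
  open Measure
  open FeasibleSchedules
  open import Data.Bool.Base using (Bool; true; false; if_then_else_; _∧_)
  open import Data.Empty using (⊥-elim)
  open import Data.Fin.Base as Fin using (Fin)
  import Data.Fin.Properties as Fin
  open import Data.List.Base using ([]; _∷_; map; length)
  open import Data.List.Relation.Unary.All as All using (All; []; _∷_)
  open import Data.List.Relation.Unary.AllPairs using (AllPairs; []; _∷_)
  open import Data.List.Relation.Unary.Any using (here; there)
  open import Data.List.Membership.Propositional using (_∈_; find)
  open import Data.Nat.Base as ℕ using (ℕ; suc; z≤n)
  import Data.Nat.Properties as ℕ
  open import Data.Product.Base using (∃-syntax; _×_; _,_; proj₂)
  open import Data.Rational.Base hiding (_≤ᵇ_)
  open import Data.Rational.Properties
  open import Data.Rational.Solver using (module +-*-Solver)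
  open import Data.Sum.Base using (inj₁; inj₂)
  open import Relation.Binary.PropositionalEquality using (_≡_; _≢_; refl; sym; trans; cong; cong₂)
  open import Relation.Nullary using (¬_; Dec; yes; no; does)

  module _ {n : ℕ} {p a d dl : Fin n → ℕ} {S : Fin n → Bool} where

    private
      Tr = Trace p a d dl S

    unit : Fin n → ℕ → Segment n
    unit j τ = segment j (fromℕ τ) (fromℕ (suc τ))

    traceSchedule : ∀ {f τ rem} → Tr f τ rem → Schedule n
    traceSchedule (stop _ _)             = []
    traceSchedule (idle _ _ tr)          = traceSchedule tr
    traceSchedule (work {τ = τ} j _ _ _ tr) = unit j τ ∷ traceSchedule tr

    private
      unit<  : ∀ τ → fromℕ τ < fromℕ (suc τ)
      unit<  τ = fromℕ-mono-< ℕ.≤-refl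

      unit≤  : ∀ τ → fromℕ τ ≤ fromℕ (suc τ)
      unit≤  τ = <⇒≤ (unit< τ)

    trace-nonempty : ∀ {f τ rem} (tr : Tr f τ rem) → All Nonempty (traceSchedule tr)
    trace-nonempty (stop _ _)       = []
    trace-nonempty (idle _ _ tr)    = trace-nonempty tr
    trace-nonempty (work {τ = τ} j _ _ _ tr) = unit< τ ∷ trace-nonempty tr

    trace-after : ∀ {f τ rem} (tr : Tr f τ rem) → All (λ s → fromℕ τ ≤ start s) (traceSchedule tr)
    trace-after (stop _ _)       = []
    trace-after (idle {τ = τ} _ _ tr)    = All.map (≤-trans (unit≤ τ)) (trace-after tr)
    trace-after (work {τ = τ} j _ _ _ tr) = ≤-refl ∷ All.map (≤-trans (unit≤ τ)) (trace-after tr)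

    trace-chronological : ∀ {f τ rem} (tr : Tr f τ rem) → AllPairs Before (traceSchedule tr)
    trace-chronological (stop _ _)       = []
    trace-chronological (idle _ _ tr)    = trace-chronological tr
    trace-chronological (work j _ _ _ tr) = trace-after tr ∷ trace-chronological tr

    trace-window : ∀ {f τ rem} (tr : Tr f τ rem) →
      All (λ s → fromℕ (a (worksOn s)) ≤ start s × finish s ≤ fromℕ (dl (worksOn s))) (traceSchedule tr)
    trace-window (stop _ _)       = []
    trace-window (idle _ _ tr)    = trace-window tr
    trace-window (work j h _ h′ tr) = (fromℕ-mono-≤ h , fromℕ-mono-≤ h′) ∷ trace-window tr

    private
      sum-rem : ∀ {f τ rem} (tr : Tr f τ rem) i → sumℚ (map (for i duration) (traceSchedule tr)) ≡ fromℕ (rem i)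
      sum-rem (stop z _)    i = cong fromℕ (sym (z i))
      sum-rem (idle _ _ tr) i = sum-rem tr i
      sum-rem (work {τ = τ} {rem} j _ pos _ tr) i with i Fin.≟ j
      ... | yes refl = trans (cong₂ _+_ (for-here i duration (unit i τ) refl) (sum-rem tr i))
              (trans (cong (_+ fromℕ (dec i rem i)) one) (trans (sym (fromℕ-suc (dec i rem i))) (cong fromℕ (sym (dec-same i rem pos)))))
        where
        one : fromℕ (suc τ) - fromℕ τ ≡ 1ℚ
        one = trans (cong (_- fromℕ τ) (fromℕ-suc τ)) (solve 1 (λ x → (con 1ℚ :+ x) :- x := con 1ℚ) refl (fromℕ τ))
          where open +-*-Solver
      ... | no i≢j = trans (cong₂ _+_ (for-else i duration (unit j τ) (λ e → i≢j (sym e))) (sum-rem tr i))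
              (trans (+-identityˡ _) (cong fromℕ (sym (dec-other j rem i i≢j))))

    trace-y∞ : ∀ {f τ rem} (tr : Tr f τ rem) i → y∞ (traceSchedule tr) i ≡ fromℕ (rem i)
    trace-y∞ tr i = trans (y∞-sum (traceSchedule tr) i) (sum-rem tr i)

    private
      absent : ∀ {f τ rem} (tr : Tr f τ rem) i → rem i ≡ 0 → All (λ s → worksOn s ≢ i) (traceSchedule tr)
      absent (stop _ _)    i z = []
      absent (idle _ _ tr) i z = absent tr i z
      absent (work {rem = rem} j _ pos _ tr) i z = (λ { refl → i≢j refl }) ∷ absent tr i (trans (sym (dec-other j rem i i≢j)) z)
        where
        i≢j : i ≢ j
        i≢j refl = ℕ.<-irrefl (sym z) pos

      below : ∀ {m τ q} → fromℕ m ≤ q → q < fromℕ (suc τ) → m ℕ.≤ τ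
      below h k = ℕ.≤-pred (fromℕ-cancel-< (≤-<-trans h k))

    -- An idle instant `q` is rational and falls inside a unit step. Arrivals are integers, so a job
    -- that has arrived by `q` has arrived when this step begins, and an idle step certifies that
    -- nothing of it is outstanding.
    trace-done : ∀ {f τ rem} (tr : Tr f τ rem) i q → fromℕ τ ≤ q → fromℕ (a i) ≤ q → Idle (traceSchedule tr) q →
      All (λ s → worksOn s ≡ i → finish s ≤ q) (traceSchedule tr)
    trace-done (stop _ _) i q τ≤q a≤q idl = []
    trace-done (idle {τ = τ} z _ tr) i q τ≤q a≤q idl with fromℕ (suc τ) ≤? q
    ... | yes h = trace-done tr i q h a≤q idl
    ... | no ¬h = All.map (λ ne e → ⊥-elim (ne e)) (absent tr i (z i (below a≤q (≰⇒> ¬h))))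
    trace-done (work {τ = τ} j _ _ _ tr) i q τ≤q a≤q idl with fromℕ (suc τ) ≤? q
    ... | yes h = (λ _ → h) ∷ trace-done tr i q h a≤q (λ k w → idl k (there w))
    ... | no ¬h = ⊥-elim (idl j (here (refl , τ≤q , ≰⇒> ¬h)))

    -- Rounding `q` down to the beginning of its unit step leaves job `i` arrived and still
    -- startable, which an idle step excludes. After the last step all deadlines have passed.
    trace-busy : ∀ {f τ rem} (tr : Tr f τ rem) i q → S i ≡ false → 0 ℕ.< p i → fromℕ τ ≤ q → fromℕ (a i) ≤ q →
      q + fromℕ (p i) ≤ fromℕ (d i) → ¬ Idle (traceSchedule tr) q
    trace-busy (stop {τ} _ end) i q Si pos τ≤q a≤q fits idl = <-irrefl refl (<-≤-trans strict (≤-trans fits (fromℕ-mono-≤ (end i))))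
      where
      strict : fromℕ τ < q + fromℕ (p i)
      strict = ≤-<-trans (≤-trans τ≤q (≤-reflexive (sym (+-identityʳ q)))) (+-monoʳ-< q (fromℕ-mono-< {0} pos))
    trace-busy (idle {τ = τ} _ none tr) i q Si pos τ≤q a≤q fits idl with fromℕ (suc τ) ≤? q
    ... | yes h = trace-busy tr i q Si pos h a≤q fits idl
    ... | no ¬h = none i Si pos (below a≤q (≰⇒> ¬h))
          (fromℕ-cancel-≤ (≤-trans (≤-reflexive (fromℕ-+ τ (p i))) (≤-trans (+-monoˡ-≤ (fromℕ (p i)) τ≤q) fits)))
    trace-busy (work {τ = τ} j _ _ _ tr) i q Si pos τ≤q a≤q fits idl with fromℕ (suc τ) ≤? q
    ... | yes h = trace-busy tr i q Si pos h a≤q fits (λ k w → idl k (there w))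
    ... | no ¬h = idl j (here (refl , τ≤q , ≰⇒> ¬h))

  schedulable⇒feasible : ∀ {I : Instance} {dl S} → Schedulable (procN I) (arrN I) (dueN I) dl S → (∀ i → dl i ℕ.≤ dueN I i) →
    ∃[ σ ] Feasible I σ × (∀ i → y∞ σ i ≡ fromℕ (when (S i) (procN I i))) × (∀ {s} → s ∈ σ → finish s ≤ fromℕ (dl (worksOn s)))
  schedulable⇒feasible {I} {dl} {S} sch dl≤d = σ , feas , yσ , λ s∈ → proj₂ (All.lookup (trace-window tr) s∈)
    where
    tr = trace sch dl≤d
    σ = traceSchedule tr
    yσ : ∀ i → y∞ σ i ≡ fromℕ (when (S i) (procN I i))
    yσ = trace-y∞ tr
    y≤t : ∀ i → y∞ σ i ≤ t I i
    y≤t i = ≤-trans (≤-reflexive (yσ i)) (fromℕ-mono-≤ (when≤ (S i) (procN I i)))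
    exec : ∀ i τ → Working σ i τ → Executable I σ i τ
    exec i τ w with find w
    ... | s , s∈ , (refl , st , fi) with All.lookup (trace-window tr) s∈
    ... | lo , hi = ≤-trans lo st , <⇒≤ (<-≤-trans fi (≤-trans hi (fromℕ-mono-≤ (dl≤d (worksOn s))))) ,
                    <-≤-trans (working⇒y<y∞ (trace-nonempty tr) (worksOn s) τ w) (y≤t (worksOn s))
    commit : ∀ i → 0ℚ < y∞ σ i → Completed I σ i
    commit i pos with S i in e
    ... | false = ⊥-elim (<-irrefl (sym (trans (yσ i) (cong (λ b → fromℕ (when b (procN I i))) e))) pos)
    ... | true  = ≤-trans (≤-reflexive (sym (trans (yσ i) (cong (λ b → fromℕ (when b (procN I i))) e))))
          (y∞≤y σ i (d I i) (All.map (λ { (_ , hi) refl → ≤-trans hi (fromℕ-mono-≤ (dl≤d i)) }) (trace-window tr)))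
    no-idle : ∀ τ → 0ℚ ≤ τ → Idle σ τ → ∀ i → ¬ Completable I σ i τ
    no-idle τ 0≤τ idl i (a≤τ , y<t , can) with S i in e
    ... | true  = <-irrefl refl (<-≤-trans y<t (≤-trans (≤-reflexive (sym (trans (yσ i) (cong (λ b → fromℕ (when b (procN I i))) e))))
          (y∞≤y σ i τ (trace-done tr i τ 0≤τ a≤τ idl))))
    ... | false = trace-busy tr i τ e (fromℕ-cancel-< (≤-<-trans (y-nonNeg σ i τ) y<t)) 0≤τ a≤τ fits idl
      where
      y0 : y σ i τ ≤ 0ℚ
      y0 = ≤-trans (y≤y∞ (trace-nonempty tr) i τ) (≤-reflexive (trans (yσ i) (cong (λ b → fromℕ (when b (procN I i))) e)))
      fits : τ + t I i ≤ d I i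
      fits = minus-≤ {τ} {d I i} {t I i} (≤-trans can (≤-trans (+-monoʳ-≤ (d I i - t I i) y0) (≤-reflexive (+-identityʳ _))))
    feas : Feasible I σ
    feas = record
      { nonempty = trace-nonempty tr ; chronological = trace-chronological tr ; notExceeded = y≤t
      ; executable = exec ; committed = commit ; busy = no-idle }

  module _ {I : Instance} {σ : Schedule (length I)} (feas : Feasible I σ) where
    open Feasible feas

    workload : ℕ
    workload = sumF (λ k → when (selected σ k) (procN I k))

    totalWork-value : value totalWork I σ ≡ fromℕ workload
    totalWork-value = trans (sumℚ-allFin (y∞ σ)) (trans (ΣF-cong (y∞-selected feas)) (ΣF-fromℕ (λ k → when (selected σ k) (procN I k))))

    private
      term : ∀ i → (if does (completed? I σ i) then t I i else 0ℚ) ≡ fromℕ (when (selected σ i) (procN I i))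
      term i = cases (completed? I σ i)
        where
        cases : (c? : Dec (Completed I σ i)) → (if does c? then t I i else 0ℚ) ≡ fromℕ (when (selected σ i) (procN I i))
        cases (yes c) = ≤-antisym (≤-trans c (≤-trans (y≤y∞ nonempty i (d I i)) (≤-reflexive (y∞-selected feas i)))) (fromℕ-mono-≤ (when≤ (selected σ i) _))
        cases (no ¬c) with isPositive-cases (y∞ σ i)
        ... | inj₁ (pos , _) = ⊥-elim (¬c (committed i pos))
        ... | inj₂ (_ , e) = cong (λ b → fromℕ (when b (procN I i))) (sym e)

    -- The sums agree term by term: a processed job is completed, and a job completed without
    -- processing has length zero.
    completedWork-value : value completedWork I σ ≡ fromℕ workload
    completedWork-value = trans (sumℚ-allFin (λ i → if does (completed? I σ i) then t I i else 0ℚ)) (trans (ΣF-cong term) (ΣF-fromℕ (λ k → when (selected σ k) (procN I k))))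

  finish≤makespan : ∀ {I} (σ : Schedule (length I)) {s} → s ∈ σ → finish s ≤ value makespan I σ
  finish≤makespan (s ∷ σ) (here refl) = p≤p⊔q (finish s) _
  finish≤makespan {I} (s ∷ σ) (there s∈) = ≤-trans (finish≤makespan {I} σ s∈) (p≤q⊔p (finish s) _)

  makespan≤ : ∀ {I} (σ : Schedule (length I)) {q} → 0ℚ ≤ q → (∀ {s} → s ∈ σ → finish s ≤ q) → value makespan I σ ≤ q
  makespan≤ []      0≤q h = 0≤q
  makespan≤ {I} (s ∷ σ) 0≤q h = ⊔-lub (h (here refl)) (makespan≤ {I} σ 0≤q (λ s∈ → h (there s∈)))

  0≤makespan : ∀ {I} (σ : Schedule (length I)) → 0ℚ ≤ value makespan I σ
  0≤makespan []      = ≤-refl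
  0≤makespan {I} (s ∷ σ) = ≤-trans (0≤makespan {I} σ) (p≤q⊔p (finish s) _)

  -- Applied to the long job of the reduction: processing it makes every objective expensive. For
  -- the makespan, all work fits between 0 and the last finish.
  y∞≤value : ∀ obj {I} {σ : Schedule (length I)} → Feasible I σ → ∀ i → y∞ σ i ≤ value obj I σ
  y∞≤value totalWork feas i = ≤-trans (≤-reflexive (y∞-selected feas i))
    (≤-trans (fromℕ-mono-≤ (term≤sumF _ i)) (≤-reflexive (sym (totalWork-value feas))))
  y∞≤value completedWork feas i = ≤-trans (≤-reflexive (y∞-selected feas i))
    (≤-trans (fromℕ-mono-≤ (term≤sumF _ i)) (≤-reflexive (sym (completedWork-value feas))))
  y∞≤value makespan {I} {σ} feas i = ≤-trans (≤-trans y≤m (≤-reflexive (sym (+-identityʳ _))))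
    (measure-upper c nonempty chronological (0≤makespan {I} σ)
      (All.tabulate λ s∈ _ → ≤-trans (0≤fromℕ _) (arrival≤start feas s∈) , finish≤makespan {I} σ s∈))
    where
    open Feasible feas
    c : Fin (length I) → Bool
    c _ = true
    y≤m : y∞ σ i ≤ measure c σ
    y≤m = ≤-trans (term≤ΣF (λ i → y∞-nonNeg nonempty i) i) (≤-reflexive (sym (measure-ΣF c σ)))

  -- A makespan of at most `K` means that every segment ends by `K`, which amounts to earlier
  -- deadlines for the processed jobs. Whether a skipped job could have been completed is still
  -- judged by the original deadlines.
  due : Objective → (I : Instance) → ℕ → Fin (length I) → ℕ
  due totalWork     I K i = dueN I i
  due completedWork I K i = dueN I i
  due makespan      I K i = dueN I i ℕ.⊓ K

  due≤dueN : ∀ obj I K i → due obj I K i ℕ.≤ dueN I i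
  due≤dueN totalWork     I K i = ℕ.≤-refl
  due≤dueN completedWork I K i = ℕ.≤-refl
  due≤dueN makespan      I K i = ℕ.m⊓n≤m _ K

  record Witness (obj : Objective) (I : Instance) (K : ℕ) (S : Fin (length I) → Bool) : Set where
    field
      schedulable : Schedulable (procN I) (arrN I) (dueN I) (due obj I K) S
      budget      : sumF (λ k → when (S k) (procN I k)) ℕ.≤ K

  witness-sound : ∀ obj {I K S} → Witness obj I K S → ∃[ σ ] Feasible I σ × value obj I σ ≤ fromℕ K
  witness-sound obj {I} {K} {S} w with schedulable⇒feasible {I} (Witness.schedulable w) (due≤dueN obj I K)
  ... | σ , feas , yσ , fin = σ , feas , bound obj fin
    where
    work≤ : workload feas ℕ.≤ K
    work≤ = ℕ.≤-trans (sumF-mono λ i → fromℕ-cancel-≤ (≤-reflexive (trans (sym (y∞-selected feas i)) (yσ i)))) (Witness.budget w)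
    bound : ∀ obj → (∀ {s} → s ∈ σ → finish s ≤ fromℕ (due obj I K (worksOn s))) → value obj I σ ≤ fromℕ K
    bound totalWork     fin = ≤-trans (≤-reflexive (totalWork-value feas)) (fromℕ-mono-≤ work≤)
    bound completedWork fin = ≤-trans (≤-reflexive (completedWork-value feas)) (fromℕ-mono-≤ work≤)
    bound makespan      fin = makespan≤ {I} σ (0≤fromℕ K) (λ {s} s∈ → ≤-trans (fin s∈) (fromℕ-mono-≤ (ℕ.m⊓n≤n (dueN I (worksOn s)) K)))

  witness-complete : ∀ obj {I K σ} → Feasible I σ → value obj I σ ≤ fromℕ K → Witness obj I K (selected σ)
  witness-complete totalWork {I} {K} feas v = record
    { schedulable = feasible⇒schedulable feas (dueN I) (finish≤deadline feas)
    ; budget = fromℕ-cancel-≤ (≤-trans (≤-reflexive (sym (totalWork-value feas))) v) }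
  witness-complete completedWork {I} {K} feas v = record
    { schedulable = feasible⇒schedulable feas (dueN I) (finish≤deadline feas)
    ; budget = fromℕ-cancel-≤ (≤-trans (≤-reflexive (sym (completedWork-value feas))) v) }
  witness-complete makespan {I} {K} {σ} feas v = record
    { schedulable = sch
    -- All capped deadlines are at most `K`, so the window from 0 to `K` contains the whole
    -- workload.
    ; budget = ℕ.≤-trans (sumF-mono le) (Schedulable.hall sch 0 K) }
    where
    sch : Schedulable (procN I) (arrN I) (dueN I) (due makespan I K) (selected σ)
    sch = feasible⇒schedulable feas (due makespan I K) fin
      where
      fin : ∀ {s} → s ∈ σ → finish s ≤ fromℕ (dueN I (worksOn s) ℕ.⊓ K)
      fin {s} s∈ with ℕ.⊓-sel (dueN I (worksOn s)) K
      ... | inj₁ e = ≤-trans (finish≤deadline feas s∈) (≤-reflexive (cong fromℕ (sym e)))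
      ... | inj₂ e = ≤-trans (≤-trans (finish≤makespan {I} σ s∈) v) (≤-reflexive (cong fromℕ (sym e)))
    le : ∀ k → when (selected σ k) (procN I k) ℕ.≤ when (selected σ k ∧ ((0 ℕ.≤ᵇ arrN I k) ∧ (due makespan I K k ℕ.≤ᵇ K))) (procN I k)
    le k with selected σ k
    ... | false = z≤n
    ... | true rewrite ≤ᵇ-true {0} {arrN I k} z≤n | ≤ᵇ-true (ℕ.m⊓n≤n (dueN I k) K) = ℕ.≤-refl

-- Codes of instances and certificates.

module ProblemCodes where

  open import Defs
  open Computable
  open ListPrograms
  open BinaryPrograms
  open import Data.Bool.Base using (Bool; false)
  open import Data.Fin.Base as Fin using (Fin; toℕ)
  open import Data.List.Base using (List; []; _∷_; _++_; map; length; _ʳ++_; concatMap; foldr; reverse; tabulate)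
  import Data.List.Properties as List
  open import Data.Nat.Base using (ℕ; zero; suc; _+_; _*_; _≤_; s≤s)
  open import Data.Nat.Properties
  open import Data.Product.Base using (_×_; _,_; proj₁; proj₂)
  open import Function.Base using (_∘_)
  open import Relation.Binary.PropositionalEquality using (_≡_; refl; sym; trans; cong; cong₂)

  private
    variable
      A B C Γ Z S : Ty

  jobTy : Ty
  jobTy = prim Job λ (job p r e) → frame (binary p) ++ frame (binary r) ++ binary e

  jobᶜ : ∀ {p r e : El Γ → ℕ} → Comp Γ nat p → Comp Γ nat r → Comp Γ nat e → Comp Γ jobTy (λ γ → job (p γ) (r γ) (e γ))
  jobᶜ p∈ r∈ e∈ = compᶜ {B = nat ⊠ (nat ⊠ nat)} {C = jobTy} {g = λ (p , (r , e)) → job p r e} (retype λ _ → refl) (pairᶜ p∈ (pairᶜ r∈ e∈))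

  private
    unjobᶜ : Comp jobTy (nat ⊠ (nat ⊠ nat)) (λ (job p r e) → p , (r , e))
    unjobᶜ = retype λ _ → refl

  procᶜ : ∀ {j : El Γ → Job} → Comp Γ jobTy j → Comp Γ nat (λ γ → Job.processing (j γ))
  procᶜ j∈ = compᶜ fstᶜ (compᶜ unjobᶜ j∈)

  arrᶜ : ∀ {j : El Γ → Job} → Comp Γ jobTy j → Comp Γ nat (λ γ → Job.arrival (j γ))
  arrᶜ j∈ = compᶜ fstᶜ (compᶜ sndᶜ (compᶜ unjobᶜ j∈))

  dueᶜ : ∀ {j : El Γ → Job} → Comp Γ jobTy j → Comp Γ nat (λ γ → Job.deadline (j γ))
  dueᶜ j∈ = compᶜ sndᶜ (compᶜ sndᶜ (compᶜ unjobᶜ j∈))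

  fields : Job → List ℕ
  fields (job p r e) = p ∷ r ∷ e ∷ []

  encodeProblem : ℕ × Instance → Bits
  encodeProblem (K , I) = encodeℕ K ++ encodeInstance I

  -- The given code of an instance has no frames around jobs, so it is also the code of a flat list
  -- of numbers, which `parse` can read.
  enc-fields : ∀ I → enc (list nat) (concatMap fields I) ≡ encodeInstance I
  enc-fields []              = refl
  enc-fields (job p r e ∷ I) = trans (cong (λ w → encodeℕ p ++ encodeℕ r ++ encodeℕ e ++ w) (enc-fields I))
    (trans (cong (encodeℕ p ++_) (sym (List.++-assoc (encodeℕ r) (encodeℕ e) _))) (sym (List.++-assoc (encodeℕ p) (encodeℕ r ++ encodeℕ e) _)))

  fieldsᶜ : Comp jobTy (list nat) fields
  fieldsᶜ = consᶜ (procᶜ idᶜ) (consᶜ (arrᶜ idᶜ) (consᶜ (dueᶜ idᶜ) (constᶜ [])))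

  encodeInstanceᶜ : ∀ {I : El Γ → Instance} → Comp Γ (list jobTy) I → Comp Γ bits (λ γ → encodeInstance (I γ))
  encodeInstanceᶜ {I = I} I∈ = retypeResult (concatMapᶜ {A = jobTy} {B = nat} {f = λ (_ , j) → fields j} I∈ (compᶜ fieldsᶜ sndᶜ)) λ γ → enc-fields (I γ)

  encodeProblemᶜ : ∀ {K : El Γ → ℕ} {I : El Γ → Instance} → Comp Γ nat K → Comp Γ (list jobTy) I → Comp Γ bits (λ γ → encodeProblem (K γ , I γ))
  encodeProblemᶜ {K = K} {I} K∈ I∈ = retypeResult {B = nat ⊠ bits} {C = bits} {f = λ γ → K γ , encodeInstance (I γ)} (pairᶜ K∈ (encodeInstanceᶜ I∈)) λ _ → refl

  -- Groups numbers in threes, starting from the right end of the list. For a proper code exactly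
  -- one number is left over at the front, the bound `K`.
  collect : ℕ → List ℕ × Instance → List ℕ × Instance
  collect a ([] , I)            = a ∷ [] , I
  collect a (r ∷ [] , I)        = a ∷ r ∷ [] , I
  collect a (r ∷ e ∷ _ , I)     = [] , job a r e ∷ I

  headOr0 : List ℕ → ℕ
  headOr0 []      = 0
  headOr0 (n ∷ _) = n

  decodeProblem : Bits → ℕ × Instance
  decodeProblem x = let (buf , I) = foldr collect ([] , []) (map val (parse x)) in headOr0 buf , I

  decode-encode : ∀ K I → decodeProblem (encodeProblem (K , I)) ≡ (K , I)
  decode-encode K I = cong (λ b → headOr0 (proj₁ b) , proj₂ b)
      (trans (cong (foldr collect ([] , []) ∘ map val) parse-problem)
        (trans (cong (foldr collect ([] , [])) (vals (K ∷ concatMap fields I))) (cong (collect K) (collects I))))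
    where
    enc-binary : ∀ ns → enc (list nat) ns ≡ enc (list bits) (map binary ns)
    enc-binary []       = refl
    enc-binary (n ∷ ns) = cong (frame (binary n) ++_) (enc-binary ns)
    parse-problem : parse (encodeProblem (K , I)) ≡ map binary (K ∷ concatMap fields I)
    parse-problem = trans (cong (λ w → parse (encodeℕ K ++ w)) (sym (enc-fields I)))
      (trans (cong parse (enc-binary (K ∷ concatMap fields I))) (parse-enc (map binary (K ∷ concatMap fields I))))
    vals : ∀ ns → map val (map binary ns) ≡ ns
    vals []       = refl
    vals (n ∷ ns) = cong₂ _∷_ (val-binary n) (vals ns)
    collects : ∀ I → foldr collect ([] , []) (concatMap fields I) ≡ ([] , I)
    collects []              = refl
    collects (job p r e ∷ I) = cong (collect p ∘ collect r ∘ collect e) (collects I)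

  private
    St : Ty
    St = list nat ⊠ list jobTy

    collect∈ : Comp (nat ⊠ St) St (λ (a , st) → collect a st)
    collect∈ = extᶜ (λ { (a , ([] , I)) → refl ; (a , (r ∷ [] , I)) → refl ; (a , (r ∷ e ∷ _ , I)) → refl })
      (compᶜ (listCase {Γ = nat ⊠ list jobTy} {A = nat}
               {f = λ (a , I) → a ∷ [] , I}
               {g = λ ((r , buf) , (a , I)) → listMatch (λ (r , (a , I)) → a ∷ r ∷ [] , I) (λ ((e , _) , (r , (a , I))) → [] , job a r e ∷ I) (buf , (r , (a , I)))}
               (pairᶜ (consᶜ fstᶜ (constᶜ [])) sndᶜ)
               (compᶜ (listCase {Γ = nat ⊠ (nat ⊠ list jobTy)} {A = nat}
                        (pairᶜ (consᶜ (compᶜ fstᶜ sndᶜ) (consᶜ fstᶜ (constᶜ []))) (compᶜ sndᶜ sndᶜ))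
                        (pairᶜ (constᶜ []) (consᶜ (jobᶜ (compᶜ fstᶜ (compᶜ sndᶜ sndᶜ)) (compᶜ fstᶜ sndᶜ) (compᶜ fstᶜ fstᶜ)) (compᶜ sndᶜ (compᶜ sndᶜ sndᶜ)))))
                 (pairᶜ (compᶜ sndᶜ fstᶜ) (pairᶜ (compᶜ fstᶜ fstᶜ) sndᶜ))))
        (pairᶜ (compᶜ fstᶜ sndᶜ) (pairᶜ fstᶜ (compᶜ sndᶜ sndᶜ))))

    -- A number of `l` bits waiting in the buffer is framed twice, as a list element and with the
    -- buffer, which costs `2 + 4 l` bits. Inside a job of the list it costs no more than that.
    collect-len : ∀ a st → len St (collect a st) ≤ len St st + (2 + len nat a * 4)
    collect-len a ([] , I) = ≤-reflexive (trans (len-⊠ (list nat) (list jobTy) (a ∷ []) I)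
      (trans (cong (λ k → suc (k * 2) + len (list jobTy) I) (len-∷ nat a []))
        (trans (solve 2 (λ a i → con 1 :+ ((con 1 :+ a :* con 2) :+ con 0) :* con 2 :+ i := (con 1 :+ con 0 :+ i) :+ (con 2 :+ a :* con 4)) refl (len nat a) (len (list jobTy) I))
          (cong (_+ (2 + len nat a * 4)) (sym (len-⊠ (list nat) (list jobTy) [] I))))))
      where
      open import Data.Nat.Solver using (module +-*-Solver)
      open +-*-Solver
    collect-len a (r ∷ [] , I) = ≤-reflexive (trans (len-⊠ (list nat) (list jobTy) (a ∷ r ∷ []) I)
      (trans (cong (λ k → suc (k * 2) + len (list jobTy) I) (trans (len-∷ nat a (r ∷ [])) (cong (suc (len nat a * 2) +_) (len-∷ nat r []))))
        (trans (solve 3 (λ a r i → con 1 :+ ((con 1 :+ a :* con 2) :+ ((con 1 :+ r :* con 2) :+ con 0)) :* con 2 :+ i := (con 1 :+ ((con 1 :+ r :* con 2) :+ con 0) :* con 2 :+ i) :+ (con 2 :+ a :* con 4)) refl (len nat a) (len nat r) (len (list jobTy) I))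
          (cong (_+ (2 + len nat a * 4)) (trans (cong (λ k → suc (k * 2) + len (list jobTy) I) (sym (len-∷ nat r []))) (sym (len-⊠ (list nat) (list jobTy) (r ∷ []) I)))))))
      where
      open import Data.Nat.Solver using (module +-*-Solver)
      open +-*-Solver
    collect-len a (r ∷ e ∷ ns , I) = ≤-trans (≤-reflexive (trans (len-⊠ (list nat) (list jobTy) [] (job a r e ∷ I)) (cong suc (trans (len-∷ jobTy (job a r e) I)
        (cong (λ k → suc (k * 2) + i) (trans (length-frame-++ (binary a) (frame (binary r) ++ binary e)) (cong (suc (len nat a * 2) +_) (length-frame-++ (binary r) (binary e)))))))))
      (≤-trans (≤-trans (m≤m+n _ (1 + len nat e * 2 + len (list nat) ns * 2))
        (≤-reflexive (solve 5 (λ a r e n i → con 1 :+ ((con 1 :+ ((con 1 :+ a :* con 2) :+ ((con 1 :+ r :* con 2) :+ e)) :* con 2) :+ i) :+ (con 1 :+ e :* con 2 :+ n :* con 2)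
            := (con 1 :+ ((con 1 :+ r :* con 2) :+ ((con 1 :+ e :* con 2) :+ n)) :* con 2 :+ i) :+ (con 2 :+ a :* con 4)) refl (len nat a) (len nat r) (len nat e) (len (list nat) ns) i)))
        (≤-reflexive (cong (_+ (2 + len nat a * 4)) (trans (cong (λ k → suc (k * 2) + i) (trans (cong (suc (len nat r * 2) +_) (sym (len-∷ nat e ns))) (sym (len-∷ nat r (e ∷ ns))))) (sym (len-⊠ (list nat) (list jobTy) (r ∷ e ∷ ns) I))))))
      where
      open import Data.Nat.Solver using (module +-*-Solver)
      open +-*-Solver
      i = len (list jobTy) I

  headOr0ᶜ : Comp (list nat) nat headOr0
  headOr0ᶜ = extᶜ (λ { [] → refl ; (_ ∷ _) → refl })
    (compᶜ (listCase {Γ = bits} {A = nat} {f = λ _ → 0} {g = λ ((n , _) , _) → n} (constᶜ 0) (compᶜ fstᶜ fstᶜ)) (pairᶜ idᶜ (constᶜ [])))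

  decodeProblemᶜ : Comp bits (nat ⊠ list jobTy) decodeProblem
  decodeProblemᶜ = compᶜ {B = St} {f = λ x → foldr collect ([] , []) (map val (parse x))} {g = λ (buf , I) → headOr0 buf , I}
    (pairᶜ (compᶜ headOr0ᶜ fstᶜ) sndᶜ)
    (foldrᶜ {Γ = bits} {A = nat} {S = St} {g = λ (_ , (a , st)) → collect a st} (mapᶜ {f = λ (_ , w) → val w} parseᶜ (valᶜ sndᶜ)) (constᶜ ([] , []))
      (compᶜ collect∈ sndᶜ) (𝕂 2 ⊕ 𝕏 ⊗ 𝕂 4)
      (λ γ a st → ≤-trans (collect-len a st) (+-monoʳ-≤ (len St st) (+-monoʳ-≤ 2 (*-monoˡ-≤ 4 (m≤n+m (len nat a) (length γ)))))))

  -- Jobs together with the bits of a certificate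

  Marked : Set
  Marked = Bool × Job

  marked : Ty
  marked = bool ⊠ jobTy

  -- Missing bits count as 0, so every word is a possible certificate for every instance.
  markJobs : Bits → Instance → List Marked
  markJobs c       []      = []
  markJobs []      (j ∷ I) = (false , j) ∷ markJobs [] I
  markJobs (b ∷ c) (j ∷ I) = (b , j) ∷ markJobs c I

  bitAt : Bits → ℕ → Bool
  bitAt []      _       = false
  bitAt (b ∷ c) zero    = b
  bitAt (b ∷ c) (suc i) = bitAt c i

  bitAt-tabulate : ∀ {n} (S : Fin n → Bool) i → bitAt (tabulate S) (toℕ i) ≡ S i
  bitAt-tabulate S Fin.zero    = refl
  bitAt-tabulate S (Fin.suc i) = bitAt-tabulate (S ∘ Fin.suc) i

  markJobsᶜ : ∀ {c : El Γ → Bits} {I : El Γ → Instance} → Comp Γ bits c → Comp Γ (list jobTy) I → Comp Γ (list marked) (λ γ → markJobs (c γ) (I γ))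
  markJobsᶜ {c = c} {I} c∈ I∈ = extᶜ (λ γ → trans (cong reverse (fold-mark (I γ) (c γ) [])) (List.reverse-involutive (markJobs (c γ) (I γ))))
    (compᶜ {f = λ γ → proj₂ (foldTail g [] (I γ) (c γ , []))} reverseᶜ (compᶜ {f = λ γ → foldTail g [] (I γ) (c γ , [])} sndᶜ
      (compᶜ {f = λ γ → I γ , ([] , (c γ , []))} (foldTailᶜ {Γ = bits} {S = St′} {g = g} g∈ (𝕂 7 ⊕ 𝕏 ⊗ 𝕂 2) grow) (pairᶜ I∈ (pairᶜ (constᶜ []) (pairᶜ c∈ (constᶜ [])))))))
    where
    St′ : Ty
    St′ = bits ⊠ list marked
    g : Bits × (Job × List Job) × (Bits × List Marked) → Bits × List Marked
    g (_ , (j , _) , ([] , out))    = [] , (false , j) ∷ out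
    g (_ , (j , _) , (b ∷ c , out)) = c , (b , j) ∷ out
    g∈ : Comp (bits ⊠ ((jobTy ⊠ list jobTy) ⊠ St′)) St′ g
    g∈ = extᶜ (λ { (_ , (j , _) , ([] , out)) → refl ; (_ , (j , _) , (b ∷ c , out)) → refl })
      (compᶜ (bitsCase {Γ = jobTy ⊠ list marked} {f = λ (j , out) → [] , (false , j) ∷ out} {g = λ b (c , (j , out)) → c , (b , j) ∷ out}
               (pairᶜ (constᶜ []) (consᶜ (pairᶜ (constᶜ false) fstᶜ) sndᶜ))
               (λ b → pairᶜ fstᶜ (consᶜ (pairᶜ (constᶜ b) (compᶜ fstᶜ sndᶜ)) (compᶜ sndᶜ sndᶜ))))
        (pairᶜ (compᶜ fstᶜ (compᶜ sndᶜ sndᶜ)) (pairᶜ (compᶜ fstᶜ (compᶜ fstᶜ sndᶜ)) (compᶜ sndᶜ (compᶜ sndᶜ sndᶜ)))))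
    add : ∀ (c c′ : Bits) b j out → length c′ ≤ length c → len St′ (c′ , (b , j) ∷ out) ≤ len St′ (c , out) + (7 + len jobTy j * 2)
    add c c′ b j out le = ≤-trans (≤-reflexive (trans (len-⊠ bits (list marked) c′ ((b , j) ∷ out))
        (cong (suc (length c′ * 2) +_) (trans (len-∷ marked (b , j) out) (cong (λ k → suc (k * 2) + len (list marked) out) (len-⊠ bool jobTy b j))))))
      (≤-trans (+-mono-≤ (s≤s (*-monoˡ-≤ 2 le)) (+-monoˡ-≤ (len (list marked) out) (s≤s (*-monoˡ-≤ 2 (s≤s (+-monoˡ-≤ (len jobTy j) (*-monoˡ-≤ 2 (len-bool b))))))))
        (≤-reflexive (trans (solve 3 (λ c j o → (con 1 :+ c :* con 2) :+ ((con 1 :+ (con 3 :+ j) :* con 2) :+ o) := (con 1 :+ c :* con 2 :+ o) :+ (con 7 :+ j :* con 2)) refl (length c) (len jobTy j) (len (list marked) out))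
          (cong (_+ (7 + len jobTy j * 2)) (sym (len-⊠ bits (list marked) c out))))))
      where
      open import Data.Nat.Solver using (module +-*-Solver)
      open +-*-Solver
    grow : ∀ γ j js st → len St′ (g (γ , (j , js) , st)) ≤ len St′ st + ⟦ 𝕂 7 ⊕ 𝕏 ⊗ 𝕂 2 ⟧ (length γ + len (list jobTy) (j ∷ js))
    grow γ j js ([] , out) = ≤-trans (add [] [] false j out ≤-refl) (+-monoʳ-≤ (len St′ ([] , out)) (+-monoʳ-≤ 7 (*-monoˡ-≤ 2 (≤-trans (len-head jobTy j js) (m≤n+m (len (list jobTy) (j ∷ js)) (length γ))))))
    grow γ j js (b ∷ c , out) = ≤-trans (add (b ∷ c) c b j out (n≤1+n _)) (+-monoʳ-≤ (len St′ (b ∷ c , out)) (+-monoʳ-≤ 7 (*-monoˡ-≤ 2 (≤-trans (len-head jobTy j js) (m≤n+m (len (list jobTy) (j ∷ js)) (length γ))))))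
    fold-mark : ∀ I c out → proj₂ (foldTail g [] I (c , out)) ≡ markJobs c I ʳ++ out
    fold-mark []      c       out = refl
    fold-mark (j ∷ I) []      out = fold-mark I [] ((false , j) ∷ out)
    fold-mark (j ∷ I) (b ∷ c) out = fold-mark I c ((b , j) ∷ out)

-- A polynomial-time test for schedulable sets.

module WitnessCheck where

  open import Defs hiding (t; a; d)
  open Computable
  open ListPrograms
  open BinaryPrograms
  open UnitStepSchedules
  open ProblemCodes
  open import Data.Bool.Base using (Bool; true; false; if_then_else_; _∧_; _∨_; not)
  open import Data.Empty using (⊥; ⊥-elim)
  open import Data.Fin.Base as Fin using (Fin)
  open import Data.List.Base using (List; []; _∷_; map; length; lookup)
  open import Data.Nat.Base using (ℕ; suc; _+_; _∸_; _⊓_; _≤_; _<_; _≥_; _≤ᵇ_; _<ᵇ_; z≤n)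
  open import Data.Nat.ListAction using (sum)
  open import Data.Nat.Properties
  open import Data.Product.Base using (∃-syntax; _×_; _,_; proj₁; proj₂)
  open import Data.Sum.Base using (_⊎_; inj₁; inj₂)
  open import Function.Base using (_∘_)
  open import Relation.Binary.PropositionalEquality using (_≡_; refl; sym; trans; cong)

  private
    variable
      Γ : Ty

    p a d : Marked → ℕ
    p m = Job.processing (proj₂ m)
    a m = Job.arrival (proj₂ m)
    d m = Job.deadline (proj₂ m)

  cap : Objective → ℕ → ℕ → ℕ
  cap totalWork     K e = e
  cap completedWork K e = e
  cap makespan      K e = e ⊓ K

  weight : (Marked → Bool) → List Marked → ℕ
  weight c M = sum (map (λ m → when (proj₁ m ∧ c m) (p m)) M)

  -- It suffices to consider windows from an arrival to a deadline.
  hallᵇ : (Marked → ℕ) → List Marked → Marked → Marked → Bool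
  hallᵇ dl M x z = (w ≤ᵇ 0) ∨ (w + a x ≤ᵇ dl z)
    where
    w : ℕ
    w = weight (λ m → (a x ≤ᵇ a m) ∧ (dl m ≤ᵇ dl z)) M

  -- The covering bound jumps only at arrivals: reachᵇ tests it there and lastᵇ at
  -- the end of its range.
  reachᵇ : List Marked → Marked → Marked → Marked → Bool
  reachᵇ M x k z = not (a z + p x ≤ᵇ 1 + d x) ∨ (a z ≤ᵇ a k + weight (λ m → (a k ≤ᵇ a m) ∧ (1 + a m ≤ᵇ a z)) M)

  lastᵇ : List Marked → Marked → Marked → Bool
  lastᵇ M x k = 1 + d x ≤ᵇ p x + (a k + weight (λ m → (a k ≤ᵇ a m) ∧ (a m + p x ≤ᵇ d x)) M)

  coverᵇ : List Marked → Marked → Marked → Bool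
  coverᵇ M x k = (proj₁ k ∧ (a k ≤ᵇ a x)) ∧ (allᵇ (reachᵇ M x k) M ∧ lastᵇ M x k)

  skippableᵇ : List Marked → Marked → Bool
  skippableᵇ M x = (proj₁ x ∨ (p x ≤ᵇ 0)) ∨ (not (a x + p x ≤ᵇ d x) ∨ anyᵇ (coverᵇ M x) M)

  checkᵇ : Objective → ℕ → List Marked → Bool
  checkᵇ obj K M = (weight (λ _ → true) M ≤ᵇ K) ∧
    (allᵇ (λ x → allᵇ (hallᵇ (λ m → cap obj K (d m)) M x) M) M ∧ allᵇ (skippableᵇ M) M)

  private
    whenᶜ : ∀ {b : El Γ → Bool} {f : El Γ → ℕ} → Comp Γ bool b → Comp Γ nat f → Comp Γ nat (λ γ → when (b γ) (f γ))
    whenᶜ {b = b} {f} b∈ f∈ = extᶜ (λ γ → if-when (b γ) (f γ)) (ifᶜ b∈ f∈ (constᶜ 0))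
      where
      if-when : ∀ b n → (if b then n else 0) ≡ when b n
      if-when true  n = refl
      if-when false n = refl

    capᶜ : ∀ obj {K e : El Γ → ℕ} → Comp Γ nat K → Comp Γ nat e → Comp Γ nat (λ γ → cap obj (K γ) (e γ))
    capᶜ totalWork     K∈ e∈ = e∈
    capᶜ completedWork K∈ e∈ = e∈
    capᶜ makespan {K} {e} K∈ e∈ = extᶜ (λ γ → min (e γ) (K γ)) (ifᶜ (e∈ ≤ᶜ K∈) e∈ K∈)
      where
      min : ∀ m n → (if m ≤ᵇ n then m else n) ≡ m ⊓ n
      min m n with m ≤ᵇ n in eq
      ... | true  = sym (m≤n⇒m⊓n≡m (true-≤ᵇ eq))
      ... | false = sym (m≥n⇒m⊓n≡n (≰⇒≥ λ h → absurd (trans (sym eq) (≤ᵇ-true h))))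
        where
        absurd : false ≡ true → ⊥
        absurd ()

    pᶜ : ∀ {m : El Γ → Marked} → Comp Γ marked m → Comp Γ nat (λ γ → p (m γ))
    pᶜ m∈ = procᶜ (compᶜ sndᶜ m∈)

    aᶜ : ∀ {m : El Γ → Marked} → Comp Γ marked m → Comp Γ nat (λ γ → a (m γ))
    aᶜ m∈ = arrᶜ (compᶜ sndᶜ m∈)

    dᶜ : ∀ {m : El Γ → Marked} → Comp Γ marked m → Comp Γ nat (λ γ → d (m γ))
    dᶜ m∈ = dueᶜ (compᶜ sndᶜ m∈)

    weightᶜ : ∀ {c : El (Γ ⊠ marked) → Bool} {M : El Γ → List Marked} → Comp (Γ ⊠ marked) bool c → Comp Γ (list marked) M →
      Comp Γ nat (λ γ → weight (λ m → c (γ , m)) (M γ))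
    weightᶜ {c = c} c∈ M∈ = sumᶜ (mapᶜ {f = λ (γ , m) → when (proj₁ m ∧ c (γ , m)) (p m)} M∈ (whenᶜ (compᶜ fstᶜ sndᶜ ∧ᶜ c∈) (pᶜ sndᶜ)))

    G₀ G₁ G₂ G₃ : Ty
    G₀ = nat ⊠ list marked
    G₁ = G₀ ⊠ marked
    G₂ = G₁ ⊠ marked
    G₃ = G₂ ⊠ marked

    M₁ : Comp G₁ (list marked) (λ ((_ , M) , _) → M)
    M₁ = compᶜ sndᶜ fstᶜ
    M₂ : Comp G₂ (list marked) (λ (((_ , M) , _) , _) → M)
    M₂ = compᶜ M₁ fstᶜ
    M₃ : Comp G₃ (list marked) (λ ((((_ , M) , _) , _) , _) → M)
    M₃ = compᶜ M₂ fstᶜ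

    hall∈ : ∀ obj → Comp G₂ bool (λ (((K , M) , x) , z) → hallᵇ (λ m → cap obj K (d m)) M x z)
    hall∈ obj = (w∈ ≤ᶜ constᶜ 0) ∨ᶜ ((w∈ +ᶜ aᶜ (compᶜ sndᶜ fstᶜ)) ≤ᶜ capᶜ obj (compᶜ fstᶜ (compᶜ fstᶜ fstᶜ)) (dᶜ sndᶜ))
      where
      w∈ : Comp G₂ nat (λ (((K , M) , x) , z) → weight (λ m → (a x ≤ᵇ a m) ∧ (cap obj K (d m) ≤ᵇ cap obj K (d z))) M)
      w∈ = weightᶜ {c = λ ((((K , M) , x) , z) , m) → (a x ≤ᵇ a m) ∧ (cap obj K (d m) ≤ᵇ cap obj K (d z))}
        ((aᶜ (compᶜ sndᶜ (compᶜ fstᶜ fstᶜ)) ≤ᶜ aᶜ sndᶜ) ∧ᶜ (capᶜ obj K∈ (dᶜ sndᶜ) ≤ᶜ capᶜ obj K∈ (dᶜ (compᶜ sndᶜ fstᶜ)))) M₂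
        where
        K∈ : Comp G₃ nat (λ ((((K , M) , x) , z) , m) → K)
        K∈ = compᶜ fstᶜ (compᶜ fstᶜ (compᶜ fstᶜ fstᶜ))

    reach∈ : Comp G₃ bool (λ ((((K , M) , x) , k) , z) → reachᵇ M x k z)
    reach∈ = notᶜ ((aᶜ sndᶜ +ᶜ pᶜ x∈) ≤ᶜ (constᶜ 1 +ᶜ dᶜ x∈)) ∨ᶜ
      (aᶜ sndᶜ ≤ᶜ (aᶜ k∈ +ᶜ weightᶜ {c = λ (((((K , M) , x) , k) , z) , m) → (a k ≤ᵇ a m) ∧ (1 + a m ≤ᵇ a z)}
        ((aᶜ (compᶜ k∈ fstᶜ) ≤ᶜ aᶜ sndᶜ) ∧ᶜ ((constᶜ 1 +ᶜ aᶜ sndᶜ) ≤ᶜ aᶜ (compᶜ sndᶜ fstᶜ))) M₃))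
      where
      x∈ : Comp G₃ marked (λ ((((K , M) , x) , k) , z) → x)
      x∈ = compᶜ sndᶜ (compᶜ fstᶜ fstᶜ)
      k∈ : Comp G₃ marked (λ ((((K , M) , x) , k) , z) → k)
      k∈ = compᶜ sndᶜ fstᶜ

    last∈ : Comp G₂ bool (λ (((K , M) , x) , k) → lastᵇ M x k)
    last∈ = (constᶜ 1 +ᶜ dᶜ x∈) ≤ᶜ (pᶜ x∈ +ᶜ (aᶜ sndᶜ +ᶜ weightᶜ {c = λ ((((K , M) , x) , k) , m) → (a k ≤ᵇ a m) ∧ (a m + p x ≤ᵇ d x)}
        ((aᶜ (compᶜ sndᶜ fstᶜ) ≤ᶜ aᶜ sndᶜ) ∧ᶜ ((aᶜ sndᶜ +ᶜ pᶜ (compᶜ x∈ fstᶜ)) ≤ᶜ dᶜ (compᶜ x∈ fstᶜ))) M₂))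
      where
      x∈ : Comp G₂ marked (λ (((K , M) , x) , k) → x)
      x∈ = compᶜ sndᶜ fstᶜ

    cover∈ : Comp G₂ bool (λ (((K , M) , x) , k) → coverᵇ M x k)
    cover∈ = (compᶜ fstᶜ sndᶜ ∧ᶜ (aᶜ sndᶜ ≤ᶜ aᶜ (compᶜ sndᶜ fstᶜ))) ∧ᶜ (allᶜ M₂ reach∈ ∧ᶜ last∈)

    skippable∈ : Comp G₁ bool (λ ((K , M) , x) → skippableᵇ M x)
    skippable∈ = (compᶜ fstᶜ sndᶜ ∨ᶜ (pᶜ sndᶜ ≤ᶜ constᶜ 0)) ∨ᶜ (notᶜ ((aᶜ sndᶜ +ᶜ pᶜ sndᶜ) ≤ᶜ dᶜ sndᶜ) ∨ᶜ anyᶜ M₁ cover∈)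

  check∈ : ∀ obj → Comp (nat ⊠ list marked) bool (λ (K , M) → checkᵇ obj K M)
  check∈ obj = (weightᶜ {c = λ _ → true} (constᶜ true) sndᶜ ≤ᶜ fstᶜ) ∧ᶜ (allᶜ sndᶜ (allᶜ M₁ (hall∈ obj)) ∧ᶜ allᶜ sndᶜ skippable∈)

  module _ {A : Set} where

    all⇒ : ∀ (q : A → Bool) l → allᵇ q l ≡ true → ∀ i → q (lookup l i) ≡ true
    all⇒ q (x ∷ l) h Fin.zero    = proj₁ (∧-true {q x} h)
    all⇒ q (x ∷ l) h (Fin.suc i) = all⇒ q l (proj₂ (∧-true {q x} h)) i

    ⇒all : ∀ (q : A → Bool) l → (∀ i → q (lookup l i) ≡ true) → allᵇ q l ≡ true
    ⇒all q []      h = refl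
    ⇒all q (x ∷ l) h = true-∧ (h Fin.zero) (⇒all q l (h ∘ Fin.suc))

    any⇒ : ∀ (q : A → Bool) l → anyᵇ q l ≡ true → ∃[ i ] q (lookup l i) ≡ true
    any⇒ q (x ∷ l) h with q x in eq
    ... | true  = Fin.zero , eq
    ... | false = let (i , e) = any⇒ q l h in Fin.suc i , e

    ⇒any : ∀ (q : A → Bool) l i → q (lookup l i) ≡ true → anyᵇ q l ≡ true
    ⇒any q (x ∷ l) Fin.zero    h rewrite h = refl
    ⇒any q (x ∷ l) (Fin.suc i) h with q x
    ... | true  = refl
    ... | false = ⇒any q l i h

    sum-lookup : ∀ (f : A → ℕ) l → sum (map f l) ≡ sumF (λ i → f (lookup l i))
    sum-lookup f []      = refl
    sum-lookup f (x ∷ l) = cong (f x +_) (sum-lookup f l)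

  private
    ∨-true : ∀ {b c} → b ∨ c ≡ true → b ≡ true ⊎ c ≡ true
    ∨-true {true}  h = inj₁ refl
    ∨-true {false} h = inj₂ h

    ∨-introˡ : ∀ {b c} → b ≡ true → b ∨ c ≡ true
    ∨-introˡ refl = refl

    ∨-introʳ : ∀ {b c} → c ≡ true → b ∨ c ≡ true
    ∨-introʳ {true}  h = refl
    ∨-introʳ {false} h = h

    not-true : ∀ {b} → not b ≡ true → b ≡ true → ⊥
    not-true {false} h ()
    not-true {true} () e

    by-cases : ∀ {b c} → (b ≡ true → c ≡ true) → not b ∨ c ≡ true
    by-cases {true}  h = h refl
    by-cases {false} h = refl

    when-mono : ∀ b c n → (b ≡ true → c ≡ true) → when b n ≤ when c n
    when-mono false c n h = z≤n
    when-mono true  c n h rewrite h refl = ≤-refl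

  module _ (obj : Objective) (K : ℕ) (M : List Marked) where
    private
      n = length M
      at : Fin n → Marked
      at = lookup M
      P Ar De Dl : Fin n → ℕ
      P i  = p (at i)
      Ar i = a (at i)
      De i = d (at i)
      Dl i = cap obj K (De i)
      S : Fin n → Bool
      S i = proj₁ (at i)

      weight-sumF : ∀ c → weight c M ≡ sumF (λ i → when (S i ∧ c (at i)) (P i))
      weight-sumF c = sum-lookup _ M

      ∧-map : ∀ {s c c′} → (c ≡ true → c′ ≡ true) → s ∧ c ≡ true → s ∧ c′ ≡ true
      ∧-map {true} h e = h e

    check-sound : checkᵇ obj K M ≡ true → Schedulable P Ar De Dl S × sumF (λ k → when (S k) (P k)) ≤ K
    check-sound h with ∧-true {weight (λ _ → true) M ≤ᵇ K} h
    ... | h₁ , h₂₃ with ∧-true {allᵇ (λ x → allᵇ (hallᵇ (λ m → cap obj K (d m)) M x) M) M} h₂₃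
    ... | h₂ , h₃ = record { hall = hall′ ; covered = covered′ } ,
        ≤-trans (sumF-mono λ k → when-mono (S k) _ (P k) λ e → true-∧ e refl) (≤-trans (≤-reflexive (sym (weight-sumF (λ _ → true)))) (true-≤ᵇ h₁))
      where
      hall′ : ∀ r D → sumF (λ k → when (S k ∧ ((r ≤ᵇ Ar k) ∧ (Dl k ≤ᵇ D))) (P k)) ≤ D ∸ r
      -- The window is shrunk to the earliest arrival and the latest deadline of the selected jobs
      -- in it. It still contains them all and is one of those tested.
      hall′ r D with optimum _≤_ ≤-total ≤-trans Q Ar | optimum _≥_ (λ x y → ≤-total y x) (λ u v → ≤-trans v u) Q Dl
        where
        Q : Fin n → Bool
        Q k = S k ∧ ((r ≤ᵇ Ar k) ∧ (Dl k ≤ᵇ D))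
      ... | inj₁ none | _ = ≤-trans (≤-reflexive (sumF-zero λ k → cong (λ b → when b (P k)) (none k))) z≤n
      ... | inj₂ _ | inj₁ none = ≤-trans (≤-reflexive (sumF-zero λ k → cong (λ b → when b (P k)) (none k))) z≤n
      ... | inj₂ (x , Qx , minx) | inj₂ (z , Qz , maxz) = ≤-trans smaller (bound (∨-true (all⇒ _ M (all⇒ _ M h₂ x) z)))
        where
        w : ℕ
        w = weight (λ m → (a (at x) ≤ᵇ a m) ∧ (cap obj K (d m) ≤ᵇ Dl z)) M
        smaller : sumF (λ k → when (S k ∧ ((r ≤ᵇ Ar k) ∧ (Dl k ≤ᵇ D))) (P k)) ≤ w
        smaller = ≤-trans (sumF-mono λ k → when-mono _ _ (P k) λ e → true-∧ (proj₁ (∧-true {S k} e)) (true-∧ (≤ᵇ-true (minx k e)) (≤ᵇ-true (maxz k e))))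
          (≤-reflexive (sym (weight-sumF _)))
        r≤x : r ≤ Ar x
        r≤x = true-≤ᵇ (proj₁ (∧-true {r ≤ᵇ Ar x} (proj₂ (∧-true {S x} Qx))))
        z≤D : Dl z ≤ D
        z≤D = true-≤ᵇ (proj₂ (∧-true {r ≤ᵇ Ar z} (proj₂ (∧-true {S z} Qz))))
        bound : (w ≤ᵇ 0) ≡ true ⊎ (w + Ar x ≤ᵇ Dl z) ≡ true → w ≤ D ∸ r
        bound (inj₁ e) = ≤-trans (true-≤ᵇ e) z≤n
        bound (inj₂ e) = ≤-trans (m+n≤o⇒m≤o∸n w (true-≤ᵇ e)) (∸-mono z≤D r≤x)
      covered′ : ∀ i → S i ≡ false → 0 < P i → Ar i + P i ≤ De i →
        ∃[ k ] S k ≡ true × Ar k ≤ Ar i × (∀ m → m + P i ≤ suc (De i) → m ≤ Ar k + sumF (λ l → when (S l ∧ ((Ar k ≤ᵇ Ar l) ∧ (Ar l <ᵇ m))) (P l)))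
      covered′ i Si pos fits with ∨-true {S i ∨ (P i ≤ᵇ 0)} (all⇒ _ M h₃ i)
      ... | inj₁ e with ∨-true {S i} e
      ... | inj₁ e′ = ⊥-elim (absurd (trans (sym Si) e′))
        where
        absurd : false ≡ true → ⊥
        absurd ()
      ... | inj₂ e′ = ⊥-elim (<-irrefl refl (≤-trans pos (true-≤ᵇ e′)))
      covered′ i Si pos fits | inj₂ e with ∨-true {not (Ar i + P i ≤ᵇ De i)} e
      ... | inj₁ e′ = ⊥-elim (not-true e′ (≤ᵇ-true fits))
      ... | inj₂ e′ with any⇒ _ M e′
      ... | k , ek with ∧-true {proj₁ (at k) ∧ (Ar k ≤ᵇ Ar i)} ek
      ... | ek₁ , ek₂ with ∧-true {proj₁ (at k)} ek₁ | ∧-true {allᵇ (reachᵇ M (at i) (at k)) M} ek₂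
      ... | Sk , ak | reach , last′ = k , Sk , true-≤ᵇ ak , bound
        where
        bound : ∀ m → m + P i ≤ suc (De i) → m ≤ Ar k + sumF (λ l → when (S l ∧ ((Ar k ≤ᵇ Ar l) ∧ (Ar l <ᵇ m))) (P l))
        -- Take the earliest admissible arrival that is not before `m`. No admissible arrival lies
        -- between, so the sum there counts only jobs arriving before `m`. If there is none, the end
        -- of the range takes its place.
        bound m m≤ with optimum _≤_ ≤-total ≤-trans (λ l → (m ≤ᵇ Ar l) ∧ (Ar l + P i ≤ᵇ suc (De i))) Ar
        ... | inj₁ none = +-cancelˡ-≤ (P i) _ _ (≤-trans (≤-reflexive (+-comm (P i) m)) (≤-trans m≤ (≤-trans (true-≤ᵇ last′)
              (+-monoʳ-≤ (P i) (+-monoʳ-≤ (Ar k) (≤-trans (≤-reflexive (weight-sumF _))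
                (sumF-mono λ l → when-mono _ _ (P l) (∧-map {S l} λ e → true-∧ (proj₁ (∧-true {Ar k ≤ᵇ Ar l} e)) (<ᵇ-true (early l (true-≤ᵇ (proj₂ (∧-true {Ar k ≤ᵇ Ar l} e)))))))))))))
          where
          early : ∀ l → Ar l + P i ≤ De i → Ar l < m
          early l le = ≰⇒> λ m≤l → absurd (trans (sym (none l)) (true-∧ (≤ᵇ-true m≤l) (≤ᵇ-true (≤-trans le (n≤1+n _)))))
            where
            absurd : false ≡ true → ⊥
            absurd ()
        ... | inj₂ (z , Qz , minz) with ∧-true {m ≤ᵇ Ar z} Qz
        ... | m≤z , z≤ with ∨-true {not (Ar z + P i ≤ᵇ 1 + De i)} (all⇒ _ M reach z)
        ... | inj₁ e″ = ⊥-elim (not-true e″ z≤)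
        ... | inj₂ e″ = ≤-trans (true-≤ᵇ m≤z) (≤-trans (true-≤ᵇ e″) (+-monoʳ-≤ (Ar k) (≤-trans (≤-reflexive (weight-sumF _))
                (sumF-mono λ l → when-mono _ _ (P l) (∧-map {S l} λ e → true-∧ (proj₁ (∧-true {Ar k ≤ᵇ Ar l} e)) (<ᵇ-true (early l (true-<ᵇ (proj₂ (∧-true {Ar k ≤ᵇ Ar l} e))))))))))
          where
          early : ∀ l → Ar l < Ar z → Ar l < m
          early l l<z = ≰⇒> λ m≤l → <-irrefl refl (≤-trans l<z (minz l (true-∧ (≤ᵇ-true m≤l) (≤ᵇ-true (≤-trans (+-monoˡ-≤ (P i) (<⇒≤ l<z)) (true-≤ᵇ z≤))))))

    check-complete : Schedulable P Ar De Dl S → sumF (λ k → when (S k) (P k)) ≤ K → checkᵇ obj K M ≡ true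
    check-complete sch bud = true-∧ (≤ᵇ-true (≤-trans (≤-trans (≤-reflexive (weight-sumF (λ _ → true))) (sumF-mono λ k → when-mono _ _ (P k) λ e → proj₁ (∧-true {S k} e))) bud))
      (true-∧ (⇒all _ M λ x → ⇒all _ M (hall″ x)) (⇒all _ M skip″))
      where
      open Schedulable sch
      hall″ : ∀ x z → hallᵇ (λ m → cap obj K (d m)) M (at x) (at z) ≡ true
      hall″ x z = cases (≤-total (Ar x) (Dl z))
        where
        w = weight (λ m → (Ar x ≤ᵇ a m) ∧ (cap obj K (d m) ≤ᵇ Dl z)) M
        w≤ : w ≤ Dl z ∸ Ar x
        w≤ = ≤-trans (≤-reflexive (weight-sumF _)) (hall (Ar x) (Dl z))
        cases : Ar x ≤ Dl z ⊎ Dl z ≤ Ar x → (w ≤ᵇ 0) ∨ (w + Ar x ≤ᵇ Dl z) ≡ true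
        cases (inj₁ le) = ∨-introʳ {w ≤ᵇ 0} (≤ᵇ-true (≤-trans (+-monoˡ-≤ (Ar x) w≤) (≤-reflexive (m∸n+n≡m le))))
        -- A window that ends before it begins has truncated length 0, which is why `hallᵇ` also
        -- accepts weight 0.
        cases (inj₂ ge) = ∨-introˡ (≤ᵇ-true (≤-trans w≤ (≤-reflexive (m≤n⇒m∸n≡0 ge))))
      skip″ : ∀ i → skippableᵇ M (at i) ≡ true
      skip″ i with bool-cases (S i)
      ... | inj₁ e = ∨-introˡ {S i ∨ (P i ≤ᵇ 0)} (∨-introˡ e)
      ... | inj₂ Si with bool-cases (P i ≤ᵇ 0)
      ... | inj₁ e = ∨-introˡ {S i ∨ (P i ≤ᵇ 0)} (∨-introʳ {S i} e)
      ... | inj₂ np = ∨-introʳ {S i ∨ (P i ≤ᵇ 0)} (by-cases {Ar i + P i ≤ᵇ De i} λ e → some (true-≤ᵇ e))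
        where
        absurd : false ≡ true → ⊥
        absurd ()
        pos : 0 < P i
        pos = ≰⇒> λ le → absurd (trans (sym np) (≤ᵇ-true le))
        some : Ar i + P i ≤ De i → anyᵇ (coverᵇ M (at i)) M ≡ true
        some fits with covered i Si pos fits
        ... | k , Sk , ak , bound = ⇒any (coverᵇ M (at i)) M k
            (true-∧ (true-∧ Sk (≤ᵇ-true ak)) (true-∧ (⇒all _ M reach) (≤ᵇ-true last′)))
          where
          reach : ∀ z → reachᵇ M (at i) (at k) (at z) ≡ true
          reach z = by-cases {Ar z + P i ≤ᵇ 1 + De i} λ e → ≤ᵇ-true (≤-trans (bound (Ar z) (true-≤ᵇ e)) (+-monoʳ-≤ (Ar k) (≤-reflexive (sym (weight-sumF _)))))
          e′ : ℕ
          e′ = suc (De i) ∸ P i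
          P≤ : P i ≤ suc (De i)
          P≤ = ≤-trans (≤-trans (m≤n+m _ (Ar i)) fits) (n≤1+n _)
          last′ : 1 + De i ≤ P i + (Ar k + weight (λ m → (Ar k ≤ᵇ a m) ∧ (a m + P i ≤ᵇ De i)) M)
          last′ = ≤-trans (≤-reflexive (sym (m+[n∸m]≡n P≤))) (+-monoʳ-≤ (P i) (≤-trans (bound e′ (≤-reflexive (m∸n+n≡m P≤)))
            (+-monoʳ-≤ (Ar k) (≤-trans (sumF-mono λ l → when-mono _ _ (P l) (∧-map {S l} λ e → true-∧ (proj₁ (∧-true {Ar k ≤ᵇ Ar l} e)) (≤ᵇ-true (early l (true-<ᵇ (proj₂ (∧-true {Ar k ≤ᵇ Ar l} e)))))))
              (≤-reflexive (sym (weight-sumF _)))))))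
            where
            early : ∀ l → Ar l < e′ → Ar l + P i ≤ De i
            early l lt = ≤-pred (≤-trans (+-monoˡ-≤ (P i) lt) (≤-reflexive (m∸n+n≡m P≤)))

-- Membership in NP.

module Membership where

  open import Defs hiding (t; a; d)
  open Computable
  open ListPrograms
  open BinaryPrograms
  open UnitStepSchedules
  open ProblemCodes
  open WitnessCheck
  open FeasibleSchedules using (procN; dueN; selected)
  open Witnesses
  open import Data.Bool.Base using (Bool; true; false; if_then_else_; _∧_; T)
  open import Data.Fin.Base as Fin using (Fin; toℕ; cast)
  open import Data.Fin.Properties using (cast-is-id)
  open import Data.List.Base using ([]; _∷_; _++_; length; lookup; tabulate)
  import Data.List.Properties as List
  open import Data.Nat.Base using (ℕ; suc; _+_; _∸_; _≤_; _<_; _≤ᵇ_; _<ᵇ_; z≤n; s≤s)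
  open import Data.Nat.Properties
  open import Data.Product.Base using (∃-syntax; _×_; _,_; proj₁; proj₂)
  open import Data.Unit.Base using (tt)
  open import Function.Bundles using (mk⇔)
  open import Relation.Binary.PropositionalEquality using (_≡_; refl; sym; trans; cong; cong₂; subst; subst₂)

  schedulable-cong : ∀ {n} {p a d dl p′ a′ d′ dl′ : Fin n → ℕ} {S S′ : Fin n → Bool} →
    (∀ i → p i ≡ p′ i) → (∀ i → a i ≡ a′ i) → (∀ i → d i ≡ d′ i) → (∀ i → dl i ≡ dl′ i) → (∀ i → S i ≡ S′ i) →
    Schedulable p a d dl S → Schedulable p′ a′ d′ dl′ S′
  schedulable-cong {n} {p} {a} {d} {dl} {p′} {a′} {d′} {dl′} {S} {S′} ep ea ed edl eS sch = record { hall = hall′ ; covered = covered′ }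
    where
    open Schedulable sch
    hall′ : ∀ r D → sumF (λ k → when (S′ k ∧ ((r ≤ᵇ a′ k) ∧ (dl′ k ≤ᵇ D))) (p′ k)) ≤ D ∸ r
    hall′ r D = ≤-trans (≤-reflexive (sumF-cong term)) (hall r D)
      where
      term : ∀ k → when (S′ k ∧ ((r ≤ᵇ a′ k) ∧ (dl′ k ≤ᵇ D))) (p′ k) ≡ when (S k ∧ ((r ≤ᵇ a k) ∧ (dl k ≤ᵇ D))) (p k)
      term k rewrite eS k | ea k | edl k | ep k = refl
    covered′ : ∀ i → S′ i ≡ false → 0 < p′ i → a′ i + p′ i ≤ d′ i → ∃[ k ] S′ k ≡ true × a′ k ≤ a′ i ×
      (∀ m → m + p′ i ≤ suc (d′ i) → m ≤ a′ k + sumF (λ l → when (S′ l ∧ ((a′ k ≤ᵇ a′ l) ∧ (a′ l <ᵇ m))) (p′ l)))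
    covered′ i Si pos fits with covered i (trans (eS i) Si) (subst (0 <_) (sym (ep i)) pos)
      (subst₂ _≤_ (cong₂ _+_ (sym (ea i)) (sym (ep i))) (sym (ed i)) fits)
    ... | k , Sk , ak , h = k , trans (sym (eS k)) Sk , subst₂ _≤_ (ea k) (ea i) ak ,
        λ m m≤ → ≤-trans (h m (subst₂ _≤_ (cong (m +_) (sym (ep i))) (cong suc (sym (ed i))) m≤))
          (≤-reflexive (cong₂ _+_ (ea k) (sumF-cong (term m))))
      where
      term : ∀ m l → when (S l ∧ ((a k ≤ᵇ a l) ∧ (a l <ᵇ m))) (p l) ≡ when (S′ l ∧ ((a′ k ≤ᵇ a′ l) ∧ (a′ l <ᵇ m))) (p′ l)
      term m l rewrite eS l | ea k | ea l | ep l = refl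

  private
    length-markJobs : ∀ c I → length (markJobs c I) ≡ length I
    length-markJobs c       []      = refl
    length-markJobs []      (j ∷ I) = cong suc (length-markJobs [] I)
    length-markJobs (b ∷ c) (j ∷ I) = cong suc (length-markJobs c I)

    lookup-markJobs : ∀ c I i → lookup (markJobs c I) i ≡ (bitAt c (toℕ i) , lookup I (cast (length-markJobs c I) i))
    lookup-markJobs []      (j ∷ I) Fin.zero    = refl
    lookup-markJobs []      (j ∷ I) (Fin.suc i) = lookup-markJobs [] I i
    lookup-markJobs (b ∷ c) (j ∷ I) Fin.zero    = refl
    lookup-markJobs (b ∷ c) (j ∷ I) (Fin.suc i) = lookup-markJobs c I i

    toℕ-cast : ∀ {m n} (eq : m ≡ n) (i : Fin m) → toℕ (cast eq i) ≡ toℕ i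
    toℕ-cast refl i = cong toℕ (cast-is-id refl i)

    module Index (obj : Objective) (K : ℕ) where
      Props : (l : ℕ) → (Fin l → Marked) → Set
      Props l at = Schedulable (λ i → Job.processing (proj₂ (at i))) (λ i → Job.arrival (proj₂ (at i))) (λ i → Job.deadline (proj₂ (at i)))
                     (λ i → cap obj K (Job.deadline (proj₂ (at i)))) (λ i → proj₁ (at i))
                 × sumF (λ k → when (proj₁ (at k)) (Job.processing (proj₂ (at k)))) ≤ K

      pointwise : ∀ {l} {at at′ : Fin l → Marked} → (∀ i → at i ≡ at′ i) → Props l at → Props l at′
      pointwise h (s , b) =
        schedulable-cong (λ i → cong (λ m → Job.processing (proj₂ m)) (h i)) (λ i → cong (λ m → Job.arrival (proj₂ m)) (h i))
          (λ i → cong (λ m → Job.deadline (proj₂ m)) (h i)) (λ i → cong (λ m → cap obj K (Job.deadline (proj₂ m))) (h i)) (λ i → cong proj₁ (h i)) s ,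
        ≤-trans (≤-reflexive (sumF-cong λ k → cong (λ m → when (proj₁ m) (Job.processing (proj₂ m))) (sym (h k)))) b

    -- Marking preserves the number of jobs only up to a proved equality, so properties of indexed
    -- families are transported along it.
    reindex : ∀ obj K {m n} (eq : m ≡ n) {at : Fin m → Marked} {at′ : Fin n → Marked} → (∀ i → at i ≡ at′ (cast eq i)) →
      (Index.Props obj K m at → Index.Props obj K n at′) × (Index.Props obj K n at′ → Index.Props obj K m at)
    reindex obj K refl {at} {at′} h =
      Index.pointwise obj K (λ i → trans (h i) (cong at′ (cast-is-id refl i))) ,
      Index.pointwise obj K (λ i → sym (trans (h i) (cong at′ (cast-is-id refl i))))

    cap-due : ∀ obj I K i → cap obj K (dueN I i) ≡ due obj I K i
    cap-due totalWork     I K i = refl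
    cap-due completedWork I K i = refl
    cap-due makespan      I K i = refl

  check⇔witness : ∀ obj K c I → (checkᵇ obj K (markJobs c I) ≡ true → Witness obj I K (λ i → bitAt c (toℕ i)))
                              × (Witness obj I K (λ i → bitAt c (toℕ i)) → checkᵇ obj K (markJobs c I) ≡ true)
  check⇔witness obj K c I = sound , complete
    where
    M = markJobs c I
    eq = length-markJobs c I
    at′ : Fin (length I) → Marked
    at′ i = bitAt c (toℕ i) , lookup I i
    h : ∀ i → lookup M i ≡ at′ (cast eq i)
    h i = trans (lookup-markJobs c I i) (cong (λ k → bitAt c k , lookup I (cast eq i)) (sym (toℕ-cast eq i)))
    sound : checkᵇ obj K M ≡ true → Witness obj I K (λ i → bitAt c (toℕ i))
    sound e with proj₁ (reindex obj K eq {lookup M} {at′} h) (check-sound obj K M e)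
    ... | s , b = record { schedulable = schedulable-cong (λ _ → refl) (λ _ → refl) (λ _ → refl) (cap-due obj I K) (λ _ → refl) s ; budget = b }
    complete : Witness obj I K (λ i → bitAt c (toℕ i)) → checkᵇ obj K M ≡ true
    complete w with proj₂ (reindex obj K eq {lookup M} {at′} h)
      (schedulable-cong (λ _ → refl) (λ _ → refl) (λ _ → refl) (λ i → sym (cap-due obj I K i)) (λ _ → refl) (Witness.schedulable w) , Witness.budget w)
    ... | s , b = check-complete obj K M s b

  -- The decoder turns every word into some problem. Comparison with the re-encoding rejects the
  -- words that are not codes.
  accepts : Objective → Bits → ℕ × Instance → Bits → Bool
  accepts obj x D c = eqBits x (encodeProblem D) ∧ checkᵇ obj (proj₁ D) (markJobs c (proj₂ D))

  verify : Objective → Bits → Bool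
  verify obj z = accepts obj (unframe z) (decodeProblem (unframe z)) (afterFrame z)

  verdictᶜ : ∀ {v : Bits → Bool} → Comp bits bool v → Comp bits bits (λ x → v x ∷ [])
  verdictᶜ {v} v∈ = extᶜ (λ x → answer (v x)) (ifᶜ v∈ (constᶜ (true ∷ [])) (constᶜ (false ∷ [])))
    where
    answer : ∀ b → (if b then true ∷ [] else false ∷ []) ≡ b ∷ []
    answer true  = refl
    answer false = refl

  verifyᶜ : ∀ obj → Comp bits bool (verify obj)
  verifyᶜ obj = eqBitsᶜ unframeᶜ (encodeProblemᶜ (compᶜ fstᶜ dec∈) (compᶜ sndᶜ dec∈))
    ∧ᶜ compᶜ (check∈ obj) (pairᶜ (compᶜ fstᶜ dec∈) (markJobsᶜ afterFrameᶜ (compᶜ sndᶜ dec∈)))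
    where
    dec∈ : Comp bits (nat ⊠ list jobTy) (λ z → decodeProblem (unframe z))
    dec∈ = compᶜ decodeProblemᶜ unframeᶜ

  length-instance : ∀ I → length I ≤ length (encodeInstance I)
  length-instance []              = z≤n
  length-instance (job p r e ∷ I) = ≤-trans (+-mono-≤ nonempty (length-instance I))
      (≤-reflexive (sym (List.length-++ (encodeℕ p ++ encodeℕ r ++ encodeℕ e))))
    where
    nonempty : 1 ≤ length (encodeℕ p ++ encodeℕ r ++ encodeℕ e)
    nonempty = ≤-trans (s≤s z≤n) (≤-reflexive (sym (length-frame-++ (binary p) (encodeℕ r ++ encodeℕ e))))

  LazyBureaucrat-InNP : ∀ obj → InNP (LazyBureaucrat obj)
  -- The coefficients denote the polynomial `n`: the certificate has one bit per job, and every job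
  -- takes at least one bit of the input.
  LazyBureaucrat-InNP obj = verify obj , (0 ∷ 1 ∷ []) , Comp⇒PolyTime (verdictᶜ (verifyᶜ obj)) , λ x → mk⇔ (to x) (from x)
    where
    to : ∀ x → LazyBureaucrat obj x → ∃[ c ] length c ≤ eval (0 ∷ 1 ∷ []) (length x) × T (verify obj (pair x c))
    to x (I , K , refl , σ , feas , v) = c , short , subst T (sym accept) tt
      where
      c = tabulate (selected σ)
      short : length c ≤ eval (0 ∷ 1 ∷ []) (length x)
      short = ≤-trans (≤-reflexive (List.length-tabulate (selected σ)))
        (≤-trans (length-instance I) (≤-trans (≤-trans (m≤n+m _ (length (encodeℕ K))) (≤-reflexive (sym (List.length-++ (encodeℕ K)))))
          (≤-reflexive (sym (toPolynomial-eval 𝕏 (length x))))))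
      w : Witness obj I K (λ i → bitAt c (toℕ i))
      w with witness-complete obj feas v
      ... | w = record
        { schedulable = schedulable-cong (λ _ → refl) (λ _ → refl) (λ _ → refl) (λ _ → refl) (λ i → sym (bitAt-tabulate (selected σ) i)) (Witness.schedulable w)
        ; budget = ≤-trans (≤-reflexive (sumF-cong λ k → cong (λ b → when b (procN I k)) (bitAt-tabulate (selected σ) k))) (Witness.budget w) }
      accept : verify obj (pair x c) ≡ true
      accept = trans (cong₂ (λ u w → accepts obj u (decodeProblem u) w) (unframe-frame x c) (afterFrame-frame x c))
        (trans (cong (λ D → accepts obj x D c) (decode-encode K I)) (true-∧ (eqBits-refl x) (proj₂ (check⇔witness obj K c I) w)))
    from : ∀ x → ∃[ c ] length c ≤ eval (0 ∷ 1 ∷ []) (length x) × T (verify obj (pair x c)) → LazyBureaucrat obj x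
    from x (c , _ , acc) = I , K , eqBits-sound x _ (subst T (sym (proj₁ both)) tt) ,
        witness-sound obj (proj₁ (check⇔witness obj K c I) (proj₂ both))
      where
      K = proj₁ (decodeProblem x)
      I = proj₂ (decodeProblem x)
      both : eqBits x (encodeProblem (decodeProblem x)) ≡ true × checkᵇ obj K (markJobs c I) ≡ true
      both = ∧-true {eqBits x (encodeProblem (decodeProblem x))}
        (subst₂ (λ u w → accepts obj u (decodeProblem u) w ≡ true)
          (unframe-frame x c) (afterFrame-frame x c) (T⇒true acc))

-- Wang tilings as subset sums.

module TilingToSubsetSum where

  open import Data.Empty using (⊥-elim)
  open import Data.List.Base using (List; []; _∷_; _++_; map; length)
  open import Data.List.Properties using (length-++)
  open import Data.List.Membership.Propositional using (_∈_)
  open import Data.List.Relation.Unary.All as All using (All; []; _∷_)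
  open import Data.List.Relation.Unary.Any using (here; there)
  open import Data.List.Relation.Unary.All.Properties using () renaming (++⁺ to All-++)
  open import Data.Nat.Base
  open import Data.Nat.ListAction using (sum)
  open import Data.Nat.Properties
  open import Data.Nat.Solver using (module +-*-Solver)
  open import Data.Nat.Tactic.RingSolver using (solve-∀)
  open import Data.Product.Base using (∃-syntax; _×_; _,_; proj₁; proj₂)
  open import Relation.Binary.PropositionalEquality using (_≡_; refl; sym; trans; cong; cong₂; subst; subst₂)

  data Sub : List ℕ → ℕ → Set where
    done : Sub [] 0
    skip : ∀ {w ws x} → Sub ws x → Sub (w ∷ ws) x
    take : ∀ {w ws x} → Sub ws x → Sub (w ∷ ws) (w + x)

  sub-++ : ∀ {ws vs x y} → Sub ws x → Sub vs y → Sub (ws ++ vs) (x + y)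
  sub-++ done t = t
  sub-++ (skip s) t = skip (sub-++ s t)
  sub-++ {w ∷ ws} {vs} (take {x = x} s) t = subst (Sub _) (sym (+-assoc w x _)) (take (sub-++ s t))

  sub-split : ∀ ws {vs x} → Sub (ws ++ vs) x → ∃[ y ] ∃[ z ] x ≡ y + z × Sub ws y × Sub vs z
  sub-split []       s = 0 , _ , refl , done , s
  sub-split (w ∷ ws) (skip s) with sub-split ws s
  ... | y , z , eq , p , q = y , z , eq , skip p , q
  sub-split (w ∷ ws) (take s) with sub-split ws s
  ... | y , z , refl , p , q = w + y , z , sym (+-assoc w y z) , take p , q

  sub-scale : ∀ c {ws x} → Sub ws x → Sub (map (c *_) ws) (c * x)
  sub-scale c done = subst (Sub []) (sym (*-zeroʳ c)) done
  sub-scale c (skip s) = skip (sub-scale c s)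
  sub-scale c (take {w} {x = x} s) = subst (Sub _) (sym (*-distribˡ-+ c w x)) (take (sub-scale c s))

  sub-unscale : ∀ c ws {x} → Sub (map (c *_) ws) x → ∃[ y ] x ≡ c * y × Sub ws y
  sub-unscale c []       done = 0 , sym (*-zeroʳ c) , done
  sub-unscale c (w ∷ ws) (skip s) with sub-unscale c ws s
  ... | y , eq , p = y , eq , skip p
  sub-unscale c (w ∷ ws) (take s) with sub-unscale c ws s
  ... | y , refl , p = w + y , sym (*-distribˡ-+ c w y) , take p

  sub-none : ∀ ws → Sub ws 0
  sub-none []       = done
  sub-none (w ∷ ws) = skip (sub-none ws)

  sub-one : ∀ {w ws} → w ∈ ws → Sub ws w
  sub-one {w} (here refl) = subst (Sub _) (+-identityʳ w) (take (sub-none _))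
  sub-one (there p) = skip (sub-one p)

  -- Uniqueness of quotient and remainder, used to read off one digit field at a time.
  digit : ∀ b {x y X Y} → x < b → y < b → x + b * X ≡ y + b * Y → x ≡ y × X ≡ Y
  digit b {x} {y} {zero}  {zero}  x<b y<b eq = trans (sym (unit x)) (trans eq (unit y)) , refl
    where
    unit : ∀ x → x + b * 0 ≡ x
    unit x = trans (cong (x +_) (*-zeroʳ b)) (+-identityʳ x)
  digit b {x} {y} {zero}  {suc Y} x<b y<b eq = ⊥-elim (<-irrefl refl (<-≤-trans x<b (≤-trans (≤-trans (m≤m+n b (b * Y)) (≤-trans (≤-reflexive (sym (*-suc b Y))) (m≤n+m _ y)))
    (≤-reflexive (trans (sym eq) (trans (cong (x +_) (*-zeroʳ b)) (+-identityʳ x)))))))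
  digit b {x} {y} {suc X} {zero}  x<b y<b eq = ⊥-elim (<-irrefl refl (<-≤-trans y<b (≤-trans (≤-trans (m≤m+n b (b * X)) (≤-trans (≤-reflexive (sym (*-suc b X))) (m≤n+m _ x)))
    (≤-reflexive (trans eq (trans (cong (y +_) (*-zeroʳ b)) (+-identityʳ y)))))))
  digit b {x} {y} {suc X} {suc Y} x<b y<b eq with digit b {x} {y} {X} {Y} x<b y<b (+-cancelˡ-≡ b _ _ (trans (sym (peel x X)) (trans eq (peel y Y))))
    where
    peel : ∀ x X → x + b * suc X ≡ b + (x + b * X)
    peel x X = solve 3 (λ b x X → x :+ b :* (con 1 :+ X) := b :+ (x :+ b :* X)) refl b x X
      where open +-*-Solver
  ... | p , q = p , cong suc q

  -- Helical Wang tilings: cells are filled one after the other, each matching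
  -- its left neighbour and the cell a fixed number of places before it. The
  -- queue lists the colours awaited by the next cells from below.

  record Tile : Set where
    constructor tile
    field
      south west north east : ℕ

  open Tile public

  data Tiling (ts : List Tile) : ℕ → ℕ → List ℕ → Set where
    end   : ∀ {Q} → All (_≡ 0) Q → Tiling ts 0 0 Q
    place : ∀ {τ L Q} → τ ∈ ts → Tiling ts L (east τ) (Q ++ north τ ∷ []) → Tiling ts (suc L) (west τ) (south τ ∷ Q)

  horner : ℕ → List ℕ → ℕ
  horner b []      = 0
  horner b (q ∷ Q) = q + b * horner b Q

  horner-++ : ∀ b Q n → horner b (Q ++ n ∷ []) ≡ horner b Q + b ^ length Q * n
  horner-++ b []      n = trans (cong (n +_) (*-zeroʳ b)) (trans (+-identityʳ n) (sym (+-identityʳ n)))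
  horner-++ b (q ∷ Q) n = trans (cong (λ h → q + b * h) (horner-++ b Q n))
    (solve 5 (λ q b h e n → q :+ b :* (h :+ e :* n) := (q :+ b :* h) :+ b :* e :* n) refl q b (horner b Q) (b ^ length Q) n)
    where open +-*-Solver

  -- In base b³, digit i of the sum consists of a counter, a south and a west
  -- field.  The tile in cell i contributes 1 to the counter, C minus its south
  -- and west colours to the fields of digit i, its east colour to the west field
  -- of digit i + 1 and its north colour to the south field of digit i + W + 1.
  -- So matching colours add up to C, and b is too large for carries.
  module Coding (ts : List Tile) (C b : ℕ)
    (bounded : All (λ τ → (south τ ≤ C × west τ ≤ C) × (north τ ≤ C × east τ ≤ C)) ts)
    (large : length ts * suc C + suc C < b) where

    base : ℕ
    base = b * (b * b)

    module _ (W : ℕ) where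

      weigh : Tile → ℕ
      weigh τ = (1 + b * ((C ∸ south τ) + b * (C ∸ west τ))) + base * (b * b * east τ + base ^ W * (b * north τ))

      -- Any number of tiles may be taken for a cell; that exactly one is taken will be enforced by
      -- the counter in its digit.
      items : ℕ → List ℕ
      items zero    = []
      items (suc L) = map weigh ts ++ map (base *_) (items L)

      full : ℕ → ℕ
      full zero    = 0
      full (suc L) = (1 + b * (C + b * C)) + base * full L

      private
        C<b : C < b
        C<b = ≤-trans (s≤s (≤-trans (n≤1+n C) (m≤n+m _ (length ts * suc C)))) large

        1<b : 1 < b
        1<b = ≤-trans (s≤s (≤-trans (s≤s z≤n) (m≤n+m (suc C) (length ts * suc C)))) large

        member : ∀ {τ} → τ ∈ ts → (south τ ≤ C × west τ ≤ C) × (north τ ≤ C × east τ ≤ C)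
        member = All.lookup bounded

      -- The term added to `x` is what the tiles already placed contribute to the open digits: the
      -- west colour that the next cell must match and the south colours in the queue. Together with
      -- the remaining weights it makes every digit correct.
      tiling⇒sub : ∀ {L w Q} → length Q ≡ suc W → Tiling ts L w Q →
        ∃[ x ] Sub (items L) x × x + (b * b * w + b * horner base Q) ≡ full L
      tiling⇒sub len (end zs) = 0 , done , cong₂ _+_ (*-zeroʳ (b * b)) (trans (cong (b *_) (zero-horner zs)) (*-zeroʳ b))
        where
        zero-horner : ∀ {Q} → All (_≡ 0) Q → horner base Q ≡ 0
        zero-horner []          = refl
        zero-horner (refl ∷ zs) = trans (cong (base *_) (zero-horner zs)) (*-zeroʳ base)
      tiling⇒sub {suc L} len (place {τ} {Q = Q} τ∈ T) with tiling⇒sub (trans (length-++ Q) (trans (+-comm (length Q) 1) len)) T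
      ... | x , s , eq = weigh τ + base * x , sub-++ (sub-one (∈-map τ∈)) (sub-scale base s) , goal
        where
        ∈-map : ∀ {τ ts} → τ ∈ ts → weigh τ ∈ map weigh ts
        ∈-map (here refl) = here refl
        ∈-map (there p)   = there (∈-map p)
        len′ : length Q ≡ W
        len′ = suc-injective len
        s≤C = proj₁ (proj₁ (member τ∈))
        w≤C = proj₂ (proj₁ (member τ∈))
        identity : ∀ b s′ s w′ w e E n x h →
          (1 + b * (s′ + b * w′)) + b * (b * b) * (b * b * e + E * (b * n)) + b * (b * b) * x + (b * b * w + b * (s + b * (b * b) * h))
          ≡ (1 + b * ((s′ + s) + b * (w′ + w))) + b * (b * b) * (x + (b * b * e + b * (h + E * n)))
        identity = solve-∀
        goal : weigh τ + base * x + (b * b * west τ + b * (south τ + base * horner base Q)) ≡ full (suc L)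
        goal = trans (identity b (C ∸ south τ) (south τ) (C ∸ west τ) (west τ) (east τ) (base ^ W) (north τ) x (horner base Q))
          (cong₂ (λ u v → 1 + b * u + base * v)
            (cong₂ (λ p q → p + b * q) (m∸n+n≡m s≤C) (m∸n+n≡m w≤C))
            (trans (cong (λ h → x + (b * b * east τ + b * h)) (trans (cong (λ k → horner base Q + base ^ k * north τ) (sym len′)) (sym (horner-++ base Q (north τ))))) eq))

      private
        sums : (Tile → ℕ) → List Tile → ℕ
        sums f τs = sum (map f τs)

        -- A partial sum of the weights of one cell may involve several tiles or none. They are kept
        -- as a list until the counter shows that it has one element.
        chosen : ∀ us {x} → Sub (map weigh us) x →
          ∃[ τs ] All (_∈ us) τs × length τs ≤ length us × x ≡ sums weigh τs
        chosen []       done = [] , [] , z≤n , refl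
        chosen (u ∷ us) (skip s) with chosen us s
        ... | τs , m , l , eq = τs , All.map there m , ≤-trans l (n≤1+n _) , eq
        chosen (u ∷ us) (take s) with chosen us s
        ... | τs , m , l , refl = u ∷ τs , here refl ∷ All.map there m , s≤s l , refl

        sums-weigh : ∀ τs → sums weigh τs ≡ (length τs + b * (sums (λ τ → C ∸ south τ) τs + b * sums (λ τ → C ∸ west τ) τs))
          + base * (b * b * sums east τs + base ^ W * (b * sums north τs))
        sums-weigh []       = sym (zeros b (base ^ W))
          where
          zeros : ∀ b E → 0 + b * (0 + b * 0) + b * (b * b) * (b * b * 0 + E * (b * 0)) ≡ 0
          zeros = solve-∀
        sums-weigh (τ ∷ τs) = trans (cong (weigh τ +_) (sums-weigh τs))
          (identity b (base ^ W) (C ∸ south τ) (C ∸ west τ) (east τ) (north τ) (length τs) (sums (λ τ → C ∸ south τ) τs) (sums (λ τ → C ∸ west τ) τs) (sums east τs) (sums north τs))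
          where
          identity : ∀ b E s w e n l S W e′ n′ →
            ((1 + b * (s + b * w)) + b * (b * b) * (b * b * e + E * (b * n))) + ((l + b * (S + b * W)) + b * (b * b) * (b * b * e′ + E * (b * n′)))
            ≡ ((1 + l) + b * ((s + S) + b * (w + W))) + b * (b * b) * (b * b * (e + e′) + E * (b * (n + n′)))
          identity = solve-∀

        sums-bound : ∀ (f : Tile → ℕ) τs → sums (λ τ → C ∸ f τ) τs ≤ length τs * C
        sums-bound f []       = z≤n
        sums-bound f (τ ∷ τs) = +-mono-≤ (m∸n≤m C (f τ)) (sums-bound f τs)

        digit<b : ∀ (f : Tile → ℕ) τs q → length τs ≤ length ts → q ≤ C → sums (λ τ → C ∸ f τ) τs + q < b
        digit<b f τs q l q≤C = ≤-<-trans (+-mono-≤ (≤-trans (sums-bound f τs) (≤-trans (*-monoˡ-≤ C l) (*-monoʳ-≤ (length ts) (n≤1+n C)))) (≤-trans q≤C (n≤1+n C))) large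

        count<b : ∀ (τs : List Tile) → length τs ≤ length ts → length τs < b
        count<b τs l = ≤-<-trans (≤-trans l (≤-trans (m≤m*n (length ts) (suc C)) (m≤m+n _ (suc C)))) large

        positive-digit : ∀ {x} → b * x ≡ 0 → x ≡ 0
        positive-digit {zero}  eq = refl
        positive-digit {suc x} eq = ⊥-elim (<-irrefl (sym (m+n≡0⇒m≡0 b (trans (sym (*-suc b x)) eq))) (<-trans (s≤s z≤n) 1<b))

        zero-queue : ∀ Q → horner base Q ≡ 0 → All (_≡ 0) Q
        zero-queue []      eq = []
        zero-queue (q ∷ Q) eq = m+n≡0⇒m≡0 q eq ∷ zero-queue Q
          (positive-digit (positive-digit (positive-digit (trans (assoc b (horner base Q)) (m+n≡0⇒n≡0 q eq)))))
          where
          assoc : ∀ b h → b * (b * (b * h)) ≡ b * (b * b) * h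
          assoc = solve-∀

        cancel-∸ : ∀ {s q} → s ≤ C → (C ∸ s) + q ≡ C → q ≡ s
        cancel-∸ {s} {q} s≤C eq = +-cancelˡ-≡ (C ∸ s) q s (trans eq (sym (m∸n+n≡m s≤C)))

        -- Each field of the lowest digit, apart from the counter, is a sum over at most `length ts`
        -- tiles plus one pending colour, hence below `b`. After three fields are read off, the same
        -- kind of equation remains for the following cells.
        digits : ∀ τs {w q Q x′ L} → length τs ≤ length ts → w ≤ C → q ≤ C →
          (sums weigh τs + base * x′) + (b * b * w + b * horner base (q ∷ Q)) ≡ full (suc L) →
          length τs ≡ 1 × (sums (λ τ → C ∸ south τ) τs + q ≡ C × (sums (λ τ → C ∸ west τ) τs + w ≡ C ×
            x′ + (b * b * sums east τs + b * (horner base Q + base ^ W * sums north τs)) ≡ full L))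
        digits τs {w} {q} {Q} {x′} {L} l w≤C q≤C eq
          with digit b (count<b τs l) 1<b (trans (sym (trans (cong (λ k → (k + base * x′) + (b * b * w + b * (q + base * horner base Q))) (sums-weigh τs))
                 (identity b (base ^ W) (length τs) S q W′ w (sums east τs) (sums north τs) x′ (horner base Q)))) (trans eq (target b C (full L))))
          where
          S = sums (λ τ → C ∸ south τ) τs
          W′ = sums (λ τ → C ∸ west τ) τs
          identity : ∀ b E l S q W w e n x h →
            (((l + b * (S + b * W)) + b * (b * b) * (b * b * e + E * (b * n))) + b * (b * b) * x) + (b * b * w + b * (q + b * (b * b) * h))
            ≡ l + b * ((S + q) + b * ((W + w) + b * (x + (b * b * e + b * (h + E * n)))))
          identity = solve-∀
          target : ∀ b C f → (1 + b * (C + b * C)) + b * (b * b) * f ≡ 1 + b * (C + b * (C + b * f))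
          target = solve-∀
        ... | e₁ , r₁ with digit b (digit<b south τs q l q≤C) C<b r₁
        ... | e₂ , r₂ with digit b (digit<b west τs w l w≤C) C<b r₂
        ... | e₃ , r₃ = e₁ , e₂ , e₃ , r₃

      sub⇒tiling : ∀ L {w Q x} → length Q ≡ suc W → w ≤ C → All (_≤ C) Q → Sub (items L) x →
        x + (b * b * w + b * horner base Q) ≡ full L → Tiling ts L w Q
      -- With no cells left the total is 0, so all pending colours vanish, as `end` demands.
      sub⇒tiling zero {w} {Q} len w≤C Q≤C done eq = subst (λ w → Tiling ts 0 w Q) (sym w≡0)
          (end (zero-queue Q (positive-digit (m+n≡0⇒n≡0 (b * b * w) eq))))
        where
        w≡0 : w ≡ 0
        w≡0 = positive-digit (positive-digit (trans (sym (*-assoc b b w)) (m+n≡0⇒m≡0 (b * b * w) eq)))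
      sub⇒tiling (suc L) {w} {q ∷ Q} {x} len w≤C (q≤C ∷ Q≤C) s eq with sub-split (map weigh ts) s
      ... | y , z , x≡ , sy , sz with chosen ts sy | sub-unscale base (items L) sz
      ... | τs , mem , l , y≡ | x′ , z≡ , sx = single τs mem
          (digits τs {Q = Q} {x′} {L} l w≤C q≤C (trans (cong (_+ (b * b * w + b * horner base (q ∷ Q))) (sym (trans x≡ (cong₂ _+_ y≡ z≡)))) eq))
        where
        single : ∀ τs → All (_∈ ts) τs → length τs ≡ 1 × (sums (λ τ → C ∸ south τ) τs + q ≡ C × (sums (λ τ → C ∸ west τ) τs + w ≡ C ×
            x′ + (b * b * sums east τs + b * (horner base Q + base ^ W * sums north τs)) ≡ full L)) → Tiling ts (suc L) w (q ∷ Q)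
        single (τ ∷ []) (τ∈ ∷ []) (_ , e₂ , e₃ , r) = subst₂ (λ w q → Tiling ts (suc L) w (q ∷ Q)) (sym west≡) (sym south≡)
            (place τ∈ (sub⇒tiling L (trans (length-++ Q) (trans (+-comm (length Q) 1) len)) (proj₂ (proj₂ (member τ∈)))
              (All-++ Q≤C (proj₁ (proj₂ (member τ∈)) ∷ [])) sx rest))
          where
          south≡ : q ≡ south τ
          south≡ = cancel-∸ (proj₁ (proj₁ (member τ∈))) (trans (cong (_+ q) (sym (+-identityʳ (C ∸ south τ)))) e₂)
          west≡ : w ≡ west τ
          west≡ = cancel-∸ (proj₂ (proj₁ (member τ∈))) (trans (cong (_+ w) (sym (+-identityʳ (C ∸ west τ)))) e₃)
          rest : x′ + (b * b * east τ + b * horner base (Q ++ north τ ∷ [])) ≡ full L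
          rest = trans (cong (x′ +_) (cong₂ (λ e h → b * b * e + b * h) (sym (+-identityʳ (east τ)))
              (trans (horner-++ base Q (north τ)) (cong₂ (λ k n → horner base Q + base ^ k * n) (suc-injective len) (sym (+-identityʳ (north τ))))))) r

-- Tiles for the configurations of a machine.

module MachineTiles where

  open import Defs
  open Automata
  open import Data.Bool.Base using (Bool; true; false)
  open import Data.Empty using (⊥; ⊥-elim)
  open import Data.Fin.Base as Fin using (Fin; _↑ˡ_; _↑ʳ_; splitAt)
  import Data.Fin.Properties as Fin
  open import Data.List.Base using (List; []; _∷_; map)
  open import Data.Maybe.Base using (Maybe; just; nothing)
  open import Data.Nat.Base using (ℕ; zero; suc; _+_; _≤_; z≤n; s≤s)
  open import Data.Product.Base using (_×_; _,_; proj₁; proj₂)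
  open import Data.Sum.Base using (_⊎_; inj₁; inj₂; [_,_]′)
  open import Data.Unit.Base using (⊤; tt)
  open import Data.Vec.Base as Vec using (Vec; []; _∷_; lookup; tabulate; _[_]≔_)
  import Data.Vec.Properties as Vec
  open import Function.Base using (_∘_)
  open import Relation.Binary.Definitions using (DecidableEquality)
  open import Relation.Binary.PropositionalEquality using (_≡_; _≢_; refl; sym; trans; cong; cong₂; subst)
  open import Relation.Nullary using (Dec; yes; no)
  open import Relation.Nullary.Decidable using (_×-dec_; _⊎-dec_; map′)

  decEq : ∀ {A : Set} → Finite A → DecidableEquality A
  decEq FA x y = map′ (λ e → trans (sym (from-to x)) (trans (cong from e) (from-to y))) (cong to) (to x Fin.≟ to y)
    where open Finite FA

  lookup-ext : ∀ {A : Set} {n} {u v : Vec A n} → (∀ i → lookup u i ≡ lookup v i) → u ≡ v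
  lookup-ext {u = []}    {[]}    h = refl
  lookup-ext {u = x ∷ u} {y ∷ v} h = cong₂ _∷_ (h Fin.zero) (lookup-ext (h ∘ Fin.suc))

  -- Commands to a stack: one half of a tape, its top next to the head

  data Cmd (A : Set) : Set where
    keep : Cmd A
    push : A → Cmd A
    pop  : A → Cmd A

  Finite-Cmd : ∀ {A} → Finite A → Finite (Cmd A)
  Finite-Cmd {A} FA = Finite-retract {⊤ ⊎ (A ⊎ A)}
    (λ { keep → inj₁ tt ; (push a) → inj₂ (inj₁ a) ; (pop a) → inj₂ (inj₂ a) })
    (λ { (inj₁ _) → keep ; (inj₂ (inj₁ a)) → push a ; (inj₂ (inj₂ a)) → pop a })
    (λ { keep → refl ; (push a) → refl ; (pop a) → refl })
    (Finite-⊎ Finite-⊤ (Finite-⊎ FA FA))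

  -- Colours below the bottom row: a known input bit, a place for a certificate bit, a blank of the
  -- padding, and the right end.
  data Init : Set where
    given      : Bool → Init
    wild empty : Init
    last       : Init

  Finite-Init : Finite Init
  Finite-Init = Finite-retract {Bool ⊎ (⊤ ⊎ (⊤ ⊎ ⊤))}
    (λ { (given b) → inj₁ b ; wild → inj₂ (inj₁ tt) ; empty → inj₂ (inj₂ (inj₁ tt)) ; last → inj₂ (inj₂ (inj₂ tt)) })
    (λ { (inj₁ b) → given b ; (inj₂ (inj₁ _)) → wild ; (inj₂ (inj₂ (inj₁ _))) → empty ; (inj₂ (inj₂ (inj₂ _))) → last })
    (λ { (given b) → refl ; wild → refl ; empty → refl ; last → refl })
    (Finite-⊎ Finite-Bool (Finite-⊎ Finite-⊤ (Finite-⊎ Finite-⊤ Finite-⊤)))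

  -- A row of tiles is a configuration with the head in the first cell; the
  -- cell at distance i carries the i-th symbols on both sides of every head.
  -- The bottom row guesses the certificate.
  module Tableau (M : Machine) where
    open Machine M

    private
      k lanes# : ℕ
      k = suc workTapes
      lanes# = k + k

    Cell : Set
    Cell = Vec Sym lanes#

    data V : Set where
      init : Init → V
      head : State → Vec Sym k → V
      mid  : Cell → V
      fin  : V

    -- Signals travelling to the right. In the bottom row `guess true` announces that the
    -- certificate has ended, so that no bit can follow a blank. In the other rows `cmds` says what
    -- happens to the top of every stack.
    data E : Set where
      guess : Bool → E
      cmds  : Vec (Cmd Sym) lanes# → E

    finiteV : Finite V
    finiteV = Finite-retract {Init ⊎ ((State × Vec Sym k) ⊎ (Cell ⊎ ⊤))}
      (λ { (init i) → inj₁ i ; (head q v) → inj₂ (inj₁ (q , v)) ; (mid c) → inj₂ (inj₂ (inj₁ c)) ; fin → inj₂ (inj₂ (inj₂ tt)) })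
      (λ { (inj₁ i) → init i ; (inj₂ (inj₁ (q , v))) → head q v ; (inj₂ (inj₂ (inj₁ c))) → mid c ; (inj₂ (inj₂ (inj₂ _))) → fin })
      (λ { (init i) → refl ; (head q v) → refl ; (mid c) → refl ; fin → refl })
      (Finite-⊎ Finite-Init (Finite-⊎ (Finite-× Finite-Fin (Finite-Vec k finiteSym)) (Finite-⊎ (Finite-Vec lanes# finiteSym) Finite-⊤)))
      where
      finiteSym = Finite-Symbol auxSymbols

    finiteE : Finite E
    finiteE = Finite-retract {Bool ⊎ Vec (Cmd Sym) lanes#}
      (λ { (guess b) → inj₁ b ; (cmds w) → inj₂ w }) (λ { (inj₁ b) → guess b ; (inj₂ w) → cmds w })
      (λ { (guess b) → refl ; (cmds w) → refl })
      (Finite-⊎ Finite-Bool (Finite-Vec lanes# (Finite-Cmd (Finite-Symbol auxSymbols))))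

    private
      _≟V_ = decEq finiteV
      _≟E_ = decEq (Finite-Maybe finiteE)
      _≟S_ = decEq (Finite-Symbol auxSymbols)
      _≟C_ = decEq (Finite-Cmd (Finite-Symbol auxSymbols))

    cell : Sym → Cell
    cell s = Vec.replicate lanes# blank [ k ↑ʳ Fin.zero ]≔ s

    -- `c` and `c′` are the old and the new content. A push displaces `c`, which is pushed onto the
    -- next cell. A pop names the symbol that leaves this cell, and the new content is popped from
    -- the next one. Thus half a tape is shifted within one row.
    Lane : Sym → Cmd Sym → Sym → Cmd Sym → Set
    Lane c keep     c′ e = e ≡ keep × c′ ≡ c
    Lane c (push s) c′ e = e ≡ push c × c′ ≡ s
    Lane c (pop s)  c′ e = e ≡ pop c′ × s ≡ c

    -- At the right end only blanks may be shifted out or in.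
    Quiet : Cmd Sym → Set
    Quiet keep     = ⊤
    Quiet (push s) = s ≡ blank
    Quiet (pop s)  = s ≡ blank

    HeadLane : Sym × Move → Sym → Cmd Sym → Cmd Sym → Set
    HeadLane (s , stay)    v l r = v ≡ s × (l ≡ keep × r ≡ keep)
    HeadLane (s , goRight) v l r = l ≡ push s × r ≡ pop v
    HeadLane (s , goLeft)  v l r = r ≡ push s × l ≡ pop v

    -- A halting configuration can be repeated only if the first tape scans 1, that is, if the
    -- answer is yes. So a tableau with more rows than the machine has steps exists only for
    -- accepting runs.
    HeadStep : Maybe (State × Vec (Sym × Move) k) → State → Vec Sym k → State → Vec Sym k → Vec (Cmd Sym) lanes# → Set
    HeadStep nothing          q v q′ v′ w = Vec.head v ≡ bit true × (q′ ≡ q × v′ ≡ v) × (∀ j → lookup w j ≡ keep)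
    HeadStep (just (q₁ , as)) q v q′ v′ w = q′ ≡ q₁ × (∀ i → HeadLane (lookup as i) (lookup v′ i) (lookup w (i ↑ˡ k)) (lookup w (k ↑ʳ i)))

    -- south, west, north, east; north = nothing is allowed everywhere but can only occur in the top row
    Fits : V → Maybe E → Maybe V → Maybe E → Set
    Fits s                w                nothing          e                = ⊤
    Fits (init (given b)) nothing          (just n)         e                = n ≡ head Fin.zero (bit b ∷ Vec.replicate workTapes blank) × e ≡ just (guess false)
    Fits (init (given b)) (just (guess g)) (just n)         e                = n ≡ mid (cell (bit b)) × e ≡ just (guess g)
    Fits (init wild)      (just (guess g)) (just n)         e                =
      (n ≡ mid (cell blank) × e ≡ just (guess true))
      ⊎ (g ≡ false × e ≡ just (guess false) × (n ≡ mid (cell (bit false)) ⊎ n ≡ mid (cell (bit true))))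
    Fits (init empty)     (just (guess g)) (just n)         e                = n ≡ mid (cell blank) × e ≡ just (guess g)
    Fits (init last)      (just (guess g)) (just n)         e                = n ≡ fin × e ≡ nothing
    Fits (head q v)       nothing          (just (head q′ v′)) (just (cmds w)) = HeadStep (δ q v) q v q′ v′ w
    Fits (mid c)          (just (cmds w))  (just (mid c′))  (just (cmds e))  = ∀ j → Lane (lookup c j) (lookup w j) (lookup c′ j) (lookup e j)
    Fits fin              (just (cmds w))  (just n)         e                = (n ≡ fin × e ≡ nothing) × (∀ j → Quiet (lookup w j))
    Fits _                _                _                _                = ⊥

    private
      lane? : ∀ c w c′ e → Dec (Lane c w c′ e)
      lane? c keep     c′ e = (e ≟C keep) ×-dec (c′ ≟S c)
      lane? c (push s) c′ e = (e ≟C push c) ×-dec (c′ ≟S s)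
      lane? c (pop s)  c′ e = (e ≟C pop c′) ×-dec (s ≟S c)

      quiet? : ∀ w → Dec (Quiet w)
      quiet? keep     = yes tt
      quiet? (push s) = s ≟S blank
      quiet? (pop s)  = s ≟S blank

      headLane? : ∀ a v l r → Dec (HeadLane a v l r)
      headLane? (s , stay)    v l r = (v ≟S s) ×-dec ((l ≟C keep) ×-dec (r ≟C keep))
      headLane? (s , goRight) v l r = (l ≟C push s) ×-dec (r ≟C pop v)
      headLane? (s , goLeft)  v l r = (r ≟C push s) ×-dec (l ≟C pop v)

      headStep? : ∀ x q v q′ v′ w → Dec (HeadStep x q v q′ v′ w)
      headStep? nothing q v q′ v′ w = (Vec.head v ≟S bit true) ×-dec
        (((q′ Fin.≟ q) ×-dec decEq (Finite-Vec k (Finite-Symbol auxSymbols)) v′ v) ×-dec Fin.all? (λ j → lookup w j ≟C keep))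
      headStep? (just (q₁ , as)) q v q′ v′ w = (q′ Fin.≟ q₁) ×-dec
        Fin.all? (λ i → headLane? (lookup as i) (lookup v′ i) (lookup w (i ↑ˡ k)) (lookup w (k ↑ʳ i)))

    fits? : ∀ s w n e → Dec (Fits s w n e)
    fits? s w nothing e = yes tt
    fits? (init (given b)) nothing (just n) e = (n ≟V _) ×-dec (e ≟E _)
    fits? (init (given b)) (just (guess g)) (just n) e = (n ≟V _) ×-dec (e ≟E _)
    fits? (init (given b)) (just (cmds w)) (just n) e = no λ ()
    fits? (init wild) nothing (just n) e = no λ ()
    fits? (init wild) (just (guess g)) (just n) e =
      ((n ≟V _) ×-dec (e ≟E _)) ⊎-dec ((decEq Finite-Bool g false) ×-dec ((e ≟E _) ×-dec ((n ≟V _) ⊎-dec (n ≟V _))))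
    fits? (init wild) (just (cmds w)) (just n) e = no λ ()
    fits? (init empty) nothing (just n) e = no λ ()
    fits? (init empty) (just (guess g)) (just n) e = (n ≟V _) ×-dec (e ≟E _)
    fits? (init empty) (just (cmds w)) (just n) e = no λ ()
    fits? (init last) nothing (just n) e = no λ ()
    fits? (init last) (just (guess g)) (just n) e = (n ≟V _) ×-dec (e ≟E _)
    fits? (init last) (just (cmds w)) (just n) e = no λ ()
    fits? (head q v) nothing (just (init _)) e = no λ ()
    fits? (head q v) nothing (just (head q′ v′)) nothing = no λ ()
    fits? (head q v) nothing (just (head q′ v′)) (just (guess _)) = no λ ()
    fits? (head q v) nothing (just (head q′ v′)) (just (cmds w)) = headStep? (δ q v) q v q′ v′ w
    fits? (head q v) nothing (just (mid _)) e = no λ ()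
    fits? (head q v) nothing (just fin) e = no λ ()
    fits? (head q v) (just _) (just n) e = no λ ()
    fits? (mid c) nothing (just n) e = no λ ()
    fits? (mid c) (just (guess _)) (just n) e = no λ ()
    fits? (mid c) (just (cmds w)) (just (init _)) e = no λ ()
    fits? (mid c) (just (cmds w)) (just (head _ _)) e = no λ ()
    fits? (mid c) (just (cmds w)) (just (mid c′)) nothing = no λ ()
    fits? (mid c) (just (cmds w)) (just (mid c′)) (just (guess _)) = no λ ()
    fits? (mid c) (just (cmds w)) (just (mid c′)) (just (cmds e)) = Fin.all? (λ j → lane? (lookup c j) (lookup w j) (lookup c′ j) (lookup e j))
    fits? (mid c) (just (cmds w)) (just fin) e = no λ ()
    fits? fin nothing (just n) e = no λ ()
    fits? fin (just (guess _)) (just n) e = no λ ()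
    fits? fin (just (cmds w)) (just n) e = ((n ≟V _) ×-dec (e ≟E _)) ×-dec Fin.all? (λ j → quiet? (lookup w j))

    data Row : Maybe E → List V → List (Maybe V) → Maybe E → Set where
      []  : ∀ {w} → Row w [] [] w
      _∷_ : ∀ {w s n e ss ns e′} → Fits s w n e → Row e ss ns e′ → Row w (s ∷ ss) (n ∷ ns) e′

    -- Rows stacked upwards; the signal leaving a row on the right enters the next one on the left,
    -- as in a helical tiling. Of the top row only nonemptiness is asked, because tiles with north
    -- `nothing` fit everywhere.
    data Chain : ℕ → Maybe E → List V → Set where
      top   : ∀ {w s ss} → Chain 1 w (s ∷ ss)
      above : ∀ {t w e ss ns} → Row w ss (map just ns) e → Chain t e ns → Chain (suc t) w ss

    Lanes : Set
    Lanes = Fin lanes# → ℕ → Sym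

    front : Lanes → Cell
    front f = tabulate (λ j → f j 0)

    rest : Lanes → Lanes
    rest f j i = f j (suc i)

    mids : ℕ → Lanes → List V
    mids zero    f = fin ∷ []
    mids (suc m) f = mid (front f) ∷ mids m (rest f)

    mids-cong : ∀ m {f g : Lanes} → (∀ j i → f j i ≡ g j i) → mids m f ≡ mids m g
    mids-cong zero    h = refl
    mids-cong (suc m) h = cong₂ _∷_ (cong mid (Vec.tabulate-cong (λ j → h j 0))) (mids-cong m (λ j i → h j (suc i)))

    applyLane : Cmd Sym → (ℕ → Sym) → ℕ → Sym
    applyLane keep     f i       = f i
    applyLane (push s) f zero    = s
    applyLane (push s) f (suc i) = f i
    applyLane (pop s)  f i       = f (suc i)

    apply : Vec (Cmd Sym) lanes# → Lanes → Lanes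
    apply w f j = applyLane (lookup w j) (f j)

    Pops : Vec (Cmd Sym) lanes# → Lanes → Set
    Pops w f = ∀ j {s} → lookup w j ≡ pop s → s ≡ f j 0

    BlankFrom : ℕ → Lanes → Set
    BlankFrom m f = ∀ j i → m ≤ i → f j i ≡ blank

    -- Induction along the row: the signal passed on is the command for the remaining stacks. That a
    -- pop names the actual top is not presupposed but enforced by the cell that receives it.
    mids-sound : ∀ m f w {ns e} → BlankFrom m f → Row (just (cmds w)) (mids m f) (map just ns) e → Pops w f × ns ≡ mids m (apply w f) × e ≡ nothing
    mids-sound zero f w {n ∷ []} bl (((refl , refl) , q) ∷ []) = pops , refl , refl
      where
      pops : Pops w f
      pops j {s} eq with lookup w j | q j
      pops j refl | .(pop _) | refl = sym (bl j 0 z≤n)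
    mids-sound (suc m) f w {mid c′ ∷ ns} bl (_∷_ {e = just (cmds e)} h r)
      with mids-sound m (rest f) e (λ j i le → bl j (suc i) (s≤s le)) r
    ... | pops′ , refl , eq = pops , cong₂ _∷_ (cong mid (lookup-ext fronts)) (mids-cong m rests) , eq
      where
      pops : Pops w f
      pops j {s} eq with lookup w j | h j
      pops j refl | .(pop _) | _ , refl = Vec.lookup∘tabulate (λ j → f j 0) j
      fronts : ∀ j → lookup c′ j ≡ lookup (front (apply w f)) j
      fronts j = trans (go (lookup w j) (h j)) (sym (Vec.lookup∘tabulate (λ j → apply w f j 0) j))
        where
        go : ∀ u → Lane (lookup (front f) j) u (lookup c′ j) (lookup e j) → lookup c′ j ≡ applyLane u (f j) 0
        go keep     (_ , q) = trans q (Vec.lookup∘tabulate (λ j → f j 0) j)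
        go (push s) (_ , q) = q
        go (pop s)  (p , _) = pops′ j p
      rests : ∀ j i → apply e (rest f) j i ≡ rest (apply w f) j i
      rests j i = go (lookup w j) (lookup e j) (h j) i
        where
        go : ∀ u v → Lane (lookup (front f) j) u (lookup c′ j) v → ∀ i → applyLane v (rest f j) i ≡ applyLane u (f j) (suc i)
        go keep     .keep     (refl , _) i       = refl
        go (push s) .(push _) (refl , _) zero    = Vec.lookup∘tabulate (λ j → f j 0) j
        go (push s) .(push _) (refl , _) (suc i) = refl
        go (pop s)  .(pop _)  (refl , _) i       = refl

    private
      -- For a push the displaced top is passed on, for a pop the symbol below the top, which moves
      -- up.
      eastward : Cmd Sym → (ℕ → Sym) → Cmd Sym
      eastward keep     f = keep
      eastward (push s) f = push (f 0)
      eastward (pop s)  f = pop (f 1)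

    mids-complete : ∀ m f w → Pops w f → BlankFrom m f → BlankFrom m (apply w f) →
      Row (just (cmds w)) (mids m f) (map just (mids m (apply w f))) nothing
    mids-complete zero f w pops bl bl′ = ((refl , refl) , quiet) ∷ []
      where
      quiet : ∀ j → Quiet (lookup w j)
      quiet j with lookup w j | pops j | bl′ j 0 z≤n
      ... | keep   | _ | _ = tt
      ... | push s | _ | q = q
      ... | pop s  | p | _ = trans (p refl) (bl j 0 z≤n)
    mids-complete (suc m) f w pops bl bl′ = lanes ∷
        subst (λ l → Row (just (cmds e)) (mids m (rest f)) (map just l) nothing) (mids-cong m rests)
          (mids-complete m (rest f) e pops′ (λ j i le → bl j (suc i) (s≤s le)) (λ j i le → trans (rests j i) (bl′ j (suc i) (s≤s le))))
      where
      e : Vec (Cmd Sym) lanes#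
      e = tabulate (λ j → eastward (lookup w j) (f j))
      e-at : ∀ j → lookup e j ≡ eastward (lookup w j) (f j)
      e-at j = Vec.lookup∘tabulate (λ j → eastward (lookup w j) (f j)) j
      pops′ : Pops e (rest f)
      pops′ j {s} eq with lookup w j | trans (sym (e-at j)) eq
      ... | pop _ | refl = refl
      rests : ∀ j i → apply e (rest f) j i ≡ rest (apply w f) j i
      rests j i = trans (cong (λ u → applyLane u (rest f j) i) (e-at j)) (go (lookup w j) i)
        where
        go : ∀ u i → applyLane (eastward u (f j)) (rest f j) i ≡ applyLane u (f j) (suc i)
        go keep     i       = refl
        go (push s) zero    = refl
        go (push s) (suc i) = refl
        go (pop s)  i       = refl
      lanes : ∀ j → Lane (lookup (front f) j) (lookup w j) (lookup (front (apply w f)) j) (lookup e j)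
      lanes j = go (lookup w j) (pops j) (Vec.lookup∘tabulate (λ j → f j 0) j) (Vec.lookup∘tabulate (λ j → apply w f j 0) j) (e-at j)
        where
        go : ∀ u → (∀ {s} → u ≡ pop s → s ≡ f j 0) → ∀ {c c′ v} → c ≡ f j 0 → c′ ≡ applyLane u (f j) 0 → v ≡ eastward u (f j) → Lane c u c′ v
        go keep     p refl refl refl = refl , refl
        go (push s) p refl refl refl = refl , refl
        go (pop s)  p refl refl refl = refl , p refl

    half : Tape auxSymbols → Bool → ℕ → Sym
    half t false = nth (leftOf t)
    half t true  = nth (rightOf t)

    stacks : Vec (Tape auxSymbols) k → Lanes
    stacks ts j = [ (λ i → half (lookup ts i) false) , (λ i → half (lookup ts i) true) ]′ (splitAt k j)

    stacks-left : ∀ ts i n → stacks ts (i ↑ˡ k) n ≡ nth (leftOf (lookup ts i)) n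
    stacks-left ts i n rewrite Fin.splitAt-↑ˡ k i k = refl

    stacks-right : ∀ ts i n → stacks ts (k ↑ʳ i) n ≡ nth (rightOf (lookup ts i)) n
    stacks-right ts i n rewrite Fin.splitAt-↑ʳ k k i = refl

    both-halves : (P : Fin lanes# → Set) → (∀ i → P (i ↑ˡ k)) → (∀ i → P (k ↑ʳ i)) → ∀ j → P j
    both-halves P l r j with splitAt k j | Fin.join-splitAt k k j
    ... | inj₁ i | refl = l i
    ... | inj₂ i | refl = r i

    row : ℕ → Config M → List V
    row m (q , ts) = head q (Vec.map scanned ts) ∷ mids m (stacks ts)

    private
      leftCmd rightCmd : Sym × Move → Tape auxSymbols → Cmd Sym
      leftCmd (s , stay)    t = keep
      leftCmd (s , goRight) t = push s
      leftCmd (s , goLeft)  t = pop (nth (leftOf t) 0)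
      rightCmd (s , stay)    t = keep
      rightCmd (s , goRight) t = pop (nth (rightOf t) 0)
      rightCmd (s , goLeft)  t = push s

      left-moves : ∀ a t i → nth (leftOf (writeMove t a)) i ≡ applyLane (leftCmd a t) (nth (leftOf t)) i
      left-moves (s , stay)    t i       = refl
      left-moves (s , goRight) t zero    = cong (λ l → nth l 0) (left-goRight (tape (leftOf t) s (rightOf t)))
      left-moves (s , goRight) t (suc i) = cong (λ l → nth l (suc i)) (left-goRight (tape (leftOf t) s (rightOf t)))
      left-moves (s , goLeft)  t i       = nth-left-goLeft (tape (leftOf t) s (rightOf t)) i

      right-moves : ∀ a t i → nth (rightOf (writeMove t a)) i ≡ applyLane (rightCmd a t) (nth (rightOf t)) i
      right-moves (s , stay)    t i       = refl
      right-moves (s , goLeft)  t zero    = cong (λ l → nth l 0) (right-goLeft (tape (leftOf t) s (rightOf t)))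
      right-moves (s , goLeft)  t (suc i) = cong (λ l → nth l (suc i)) (right-goLeft (tape (leftOf t) s (rightOf t)))
      right-moves (s , goRight) t i       = nth-right-goRight (tape (leftOf t) s (rightOf t)) i

      scan-moves : ∀ a t → HeadLane a (scanned (writeMove t a)) (leftCmd a t) (rightCmd a t)
      scan-moves (s , stay)    t = refl , refl , refl
      scan-moves (s , goRight) t = refl , cong pop (sym (scanned-goRight (tape (leftOf t) s (rightOf t))))
      scan-moves (s , goLeft)  t = refl , cong pop (sym (scanned-goLeft (tape (leftOf t) s (rightOf t))))

      -- The action fixes which half is pushed and which is popped; the popped symbol, known to be
      -- the top of its half, is the symbol scanned next.
      headLane-cmds : ∀ a t {v l r} → HeadLane a v l r → (∀ {s} → l ≡ pop s → s ≡ nth (leftOf t) 0) → (∀ {s} → r ≡ pop s → s ≡ nth (rightOf t) 0) →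
        v ≡ scanned (writeMove t a) × l ≡ leftCmd a t × r ≡ rightCmd a t
      headLane-cmds (s , stay)    t (refl , refl , refl) pl pr = refl , refl , refl
      headLane-cmds (s , goRight) t (refl , refl) pl pr =
        trans (pr refl) (sym (scanned-goRight (tape (leftOf t) s (rightOf t)))) , refl , cong pop (pr refl)
      headLane-cmds (s , goLeft)  t (refl , refl) pl pr =
        trans (pl refl) (sym (scanned-goLeft (tape (leftOf t) s (rightOf t)))) , cong pop (pl refl) , refl

      lookup-write : ∀ {n} (ts : Vec (Tape auxSymbols) n) as i → lookup (Vec.zipWith writeMove ts as) i ≡ writeMove (lookup ts i) (lookup as i)
      lookup-write ts as i = Vec.lookup-zipWith writeMove i ts as

      stacks-apply : ∀ ts as w → (∀ i → lookup w (i ↑ˡ k) ≡ leftCmd (lookup as i) (lookup ts i)) →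
        (∀ i → lookup w (k ↑ʳ i) ≡ rightCmd (lookup as i) (lookup ts i)) →
        ∀ j n → apply w (stacks ts) j n ≡ stacks (Vec.zipWith writeMove ts as) j n
      stacks-apply ts as w wl wr = both-halves _ left right
        where
        cong-lane : ∀ {u u′ f f′} → u ≡ u′ → (∀ n → f n ≡ f′ n) → ∀ n → applyLane u f n ≡ applyLane u′ f′ n
        cong-lane {keep}   refl h n       = h n
        cong-lane {push s} refl h zero    = refl
        cong-lane {push s} refl h (suc n) = h n
        cong-lane {pop s}  refl h n       = h (suc n)
        left : ∀ i n → apply w (stacks ts) (i ↑ˡ k) n ≡ stacks (Vec.zipWith writeMove ts as) (i ↑ˡ k) n
        left i n = trans (cong-lane (wl i) (stacks-left ts i) n) (trans (sym (left-moves (lookup as i) (lookup ts i) n))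
          (trans (cong (λ t → nth (leftOf t) n) (sym (lookup-write ts as i))) (sym (stacks-left (Vec.zipWith writeMove ts as) i n))))
        right : ∀ i n → apply w (stacks ts) (k ↑ʳ i) n ≡ stacks (Vec.zipWith writeMove ts as) (k ↑ʳ i) n
        right i n = trans (cong-lane (wr i) (stacks-right ts i) n) (trans (sym (right-moves (lookup as i) (lookup ts i) n))
          (trans (cong (λ t → nth (rightOf t) n) (sym (lookup-write ts as i))) (sym (stacks-right (Vec.zipWith writeMove ts as) i n))))

    row-step-sound : ∀ m q ts {ns e q′ as} → BlankFrom m (stacks ts) → δ q (Vec.map scanned ts) ≡ just (q′ , as) →
      Row nothing (row m (q , ts)) (map just ns) e → ns ≡ row m (q′ , Vec.zipWith writeMove ts as) × e ≡ nothing
    row-step-sound m q ts {head q′ v′ ∷ ns} {q′ = q₁} {as} bl eq (_∷_ {e = just (cmds w)} h r) with mids-sound m (stacks ts) w bl r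
    row-step-sound m q ts {head q′ v′ ∷ ns} {q′ = q₁} {as} bl eq (_∷_ {e = just (cmds w)} h r) | pops , refl , e≡
      = cong₂ _∷_ (cong₂ head (proj₁ hs) (lookup-ext scans)) (mids-cong m (stacks-apply ts as w (λ i → proj₁ (proj₂ (each i))) (λ i → proj₂ (proj₂ (each i))))) , e≡
      where
      hs : HeadStep (just (q₁ , as)) q (Vec.map scanned ts) q′ v′ w
      hs = subst (λ x → HeadStep x q (Vec.map scanned ts) q′ v′ w) eq h
      each : ∀ i → lookup v′ i ≡ scanned (writeMove (lookup ts i) (lookup as i)) × lookup w (i ↑ˡ k) ≡ leftCmd (lookup as i) (lookup ts i) × lookup w (k ↑ʳ i) ≡ rightCmd (lookup as i) (lookup ts i)
      each i = headLane-cmds (lookup as i) (lookup ts i) (proj₂ hs i)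
        (λ p → trans (pops (i ↑ˡ k) p) (stacks-left ts i 0)) (λ p → trans (pops (k ↑ʳ i) p) (stacks-right ts i 0))
      scans : ∀ i → lookup v′ i ≡ lookup (Vec.map scanned (Vec.zipWith writeMove ts as)) i
      scans i = trans (proj₁ (each i)) (trans (cong scanned (sym (lookup-write ts as i))) (sym (Vec.lookup-map i scanned (Vec.zipWith writeMove ts as))))

    row-halt-sound : ∀ m q ts {ns e} → δ q (Vec.map scanned ts) ≡ nothing →
      Row nothing (row m (q , ts)) (map just ns) e → Vec.head (Vec.map scanned ts) ≡ bit true
    row-halt-sound m q ts {head q′ v′ ∷ ns} eq (_∷_ {e = just (cmds w)} h r) =
      proj₁ (subst (λ x → HeadStep x q (Vec.map scanned ts) q′ v′ w) eq h)

    row-step-complete : ∀ m q ts {q′ as} → BlankFrom m (stacks ts) → BlankFrom m (stacks (Vec.zipWith writeMove ts as)) →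
      δ q (Vec.map scanned ts) ≡ just (q′ , as) →
      Row nothing (row m (q , ts)) (map just (row m (q′ , Vec.zipWith writeMove ts as))) nothing
    row-step-complete m q ts {q′} {as} bl bl′ eq = _∷_ {e = just (cmds w)}
        (subst (λ x → HeadStep x q (Vec.map scanned ts) q′ (Vec.map scanned (Vec.zipWith writeMove ts as)) w) (sym eq) (refl , lanes))
        (subst (λ l → Row (just (cmds w)) (mids m (stacks ts)) (map just l) nothing) (mids-cong m applied)
          (mids-complete m (stacks ts) w pops bl (λ j i le → trans (applied j i) (bl′ j i le))))
      where
      pick : Fin k ⊎ Fin k → Cmd Sym
      pick = [ (λ i → leftCmd (lookup as i) (lookup ts i)) , (λ i → rightCmd (lookup as i) (lookup ts i)) ]′
      w : Vec (Cmd Sym) lanes#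
      w = tabulate (λ j → pick (splitAt k j))
      wl : ∀ i → lookup w (i ↑ˡ k) ≡ leftCmd (lookup as i) (lookup ts i)
      wl i = trans (Vec.lookup∘tabulate (λ j → pick (splitAt k j)) (i ↑ˡ k)) (cong pick (Fin.splitAt-↑ˡ k i k))
      wr : ∀ i → lookup w (k ↑ʳ i) ≡ rightCmd (lookup as i) (lookup ts i)
      wr i = trans (Vec.lookup∘tabulate (λ j → pick (splitAt k j)) (k ↑ʳ i)) (cong pick (Fin.splitAt-↑ʳ k k i))
      applied : ∀ j n → apply w (stacks ts) j n ≡ stacks (Vec.zipWith writeMove ts as) j n
      applied = stacks-apply ts as w wl wr
      pops : Pops w (stacks ts)
      pops = both-halves _
        (λ i {s} p → trans (leftPop (lookup as i) (trans (sym (wl i)) p)) (sym (stacks-left ts i 0)))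
        (λ i {s} p → trans (rightPop (lookup as i) (trans (sym (wr i)) p)) (sym (stacks-right ts i 0)))
        where
        leftPop : ∀ a {t s} → leftCmd a t ≡ pop s → s ≡ nth (leftOf t) 0
        leftPop (_ , goLeft) refl = refl
        rightPop : ∀ a {t s} → rightCmd a t ≡ pop s → s ≡ nth (rightOf t) 0
        rightPop (_ , goRight) refl = refl
      lanes : ∀ i → HeadLane (lookup as i) (lookup (Vec.map scanned (Vec.zipWith writeMove ts as)) i) (lookup w (i ↑ˡ k)) (lookup w (k ↑ʳ i))
      lanes i rewrite wl i | wr i | Vec.lookup-map i scanned (Vec.zipWith writeMove ts as) | lookup-write ts as i = scan-moves (lookup as i) (lookup ts i)

    row-halt-complete : ∀ m q ts → BlankFrom m (stacks ts) → δ q (Vec.map scanned ts) ≡ nothing → Vec.head (Vec.map scanned ts) ≡ bit true →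
      Row nothing (row m (q , ts)) (map just (row m (q , ts))) nothing
    row-halt-complete m q ts bl eq acc = _∷_ {e = just (cmds w)}
        (subst (λ x → HeadStep x q (Vec.map scanned ts) q (Vec.map scanned ts) w) (sym eq) (acc , (refl , refl) , w-at))
        (subst (λ l → Row (just (cmds w)) (mids m (stacks ts)) (map just l) nothing) (mids-cong m same)
          (mids-complete m (stacks ts) w (λ j p → ⊥-elim (keep≢pop (trans (sym (w-at j)) p))) bl (λ j i le → trans (same j i) (bl j i le))))
      where
      w : Vec (Cmd Sym) lanes#
      w = Vec.replicate lanes# keep
      w-at : ∀ j → lookup w j ≡ keep
      w-at j = Vec.lookup-replicate j keep
      keep≢pop : ∀ {s : Sym} → keep ≢ pop s
      keep≢pop ()
      same : ∀ j i → apply w (stacks ts) j i ≡ stacks ts j i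
      same j i = cong (λ u → applyLane u (stacks ts j) i) (w-at j)

-- Accepting computations as tilings.

module TilingAcceptance where

  open import Defs
  open Automata
  open MachineComposition using (step-nothing; step-just)
  open TilingToSubsetSum
  open MachineTiles
  open import Data.Bool.Base using (Bool; true; false; T)
  open import Data.Empty using (⊥)
  open import Data.Fin.Base as Fin using (_↑ˡ_; _↑ʳ_; splitAt; toℕ)
  import Data.Fin.Properties as Fin
  open import Data.List.Base using (List; []; _∷_; _++_; map; length; replicate; allFin; filter; cartesianProduct)
  import Data.List.Properties as List
  open import Data.List.Membership.Propositional using (_∈_)
  open import Data.List.Membership.Propositional.Properties using (∈-map⁺; ∈-map⁻; ∈-filter⁺; ∈-filter⁻; ∈-allFin; ∈-cartesianProduct⁺)
  open import Data.List.Relation.Unary.All as All using (All; []; _∷_)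
  open import Data.Maybe.Base using (Maybe; just; nothing)
  open import Data.Nat.Base using (ℕ; zero; suc; _+_; _*_; _≤_; _<_; z≤n; s≤s)
  open import Data.Nat.Properties using (≤-trans; n≤1+n; m≤n+m; m≤m+n; +-suc; ≤-reflexive; +-monoʳ-≤; +-assoc; ≤-<-trans; <⇒≤)
  open import Data.Product.Base using (∃-syntax; _×_; _,_; proj₁; proj₂)
  open import Data.Sum.Base using (inj₁; inj₂)
  open import Data.Unit.Base using (tt)
  open import Data.Vec.Base as Vec using (Vec; []; _∷_; lookup)
  import Data.Vec.Properties as Vec
  open import Function.Base using (_∘_)
  open import Function.Bundles using (_⇔_; mk⇔)
  open import Relation.Binary.PropositionalEquality using (_≡_; _≢_; refl; sym; trans; cong; cong₂; subst; subst₂)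
  open import Relation.Nullary using (Dec)

  module AllTiles {V E : Set} (Fits : V → Maybe E → Maybe V → Maybe E → Set) (fits? : ∀ s w n e → Dec (Fits s w n e))
    (FV₁ : Finite V) (FV : Finite (Maybe V)) (FE : Finite (Maybe E)) where

    private
      elements : ∀ {A : Set} → Finite A → List A
      elements FA = map (Finite.from FA) (allFin (Finite.size FA))

      ∈-elements : ∀ {A : Set} (FA : Finite A) a → a ∈ elements FA
      ∈-elements FA a = subst (_∈ elements FA) (Finite.from-to FA a) (∈-map⁺ (Finite.from FA) (∈-allFin (Finite.to FA a)))

      code-injective : ∀ {A : Set} (FA : Finite A) {x y} → toℕ (Finite.to FA x) ≡ toℕ (Finite.to FA y) → x ≡ y
      code-injective FA {x} {y} e = trans (sym (from-to x)) (trans (cong from (Fin.toℕ-injective e)) (from-to y))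
        where open Finite FA

      Quad : Set
      Quad = V × Maybe E × Maybe V × Maybe E

      fitting : Quad → Set
      fitting (s , w , n , e) = Fits s w n e

      fitting? : ∀ q → Dec (fitting q)
      fitting? (s , w , n , e) = fits? s w n e

      candidates quads : List Quad
      candidates = cartesianProduct (elements FV₁) (cartesianProduct (elements FE) (cartesianProduct (elements FV) (elements FE)))
      quads      = filter fitting? candidates

    northCode : Maybe V → ℕ
    northCode v = toℕ (Finite.to FV v)

    sideCode : Maybe E → ℕ
    sideCode e = toℕ (Finite.to FE e)

    private
      toTile : Quad → Tile
      toTile (s , w , n , e) = tile (northCode (just s)) (sideCode w) (northCode n) (sideCode e)

    northCode-injective : ∀ {x y} → northCode x ≡ northCode y → x ≡ y
    northCode-injective = code-injective FV

    sideCode-injective : ∀ {x y} → sideCode x ≡ sideCode y → x ≡ y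
    sideCode-injective = code-injective FE

    colours : ℕ
    colours = Finite.size FV + Finite.size FE

    northCode≤ : ∀ v → northCode v ≤ colours
    northCode≤ v = ≤-trans (<⇒≤ (Fin.toℕ<n (Finite.to FV v))) (m≤m+n _ _)

    sideCode≤ : ∀ e → sideCode e ≤ colours
    sideCode≤ e = ≤-trans (<⇒≤ (Fin.toℕ<n (Finite.to FE e))) (m≤n+m _ _)

    tiles : List Tile
    tiles = map toTile quads

    ∈-tiles : ∀ {s w n e} → Fits s w n e → tile (northCode (just s)) (sideCode w) (northCode n) (sideCode e) ∈ tiles
    ∈-tiles {s} {w} {n} {e} h = ∈-map⁺ toTile {x = s , w , n , e} (∈-filter⁺ fitting? {xs = candidates}
      (∈-cartesianProduct⁺ (∈-elements FV₁ s) (∈-cartesianProduct⁺ (∈-elements FE w) (∈-cartesianProduct⁺ (∈-elements FV n) (∈-elements FE e)))) h)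

    tiles-∈ : ∀ {τ} → τ ∈ tiles → ∃[ s ] ∃[ w ] ∃[ n ] ∃[ e ] τ ≡ tile (northCode (just s)) (sideCode w) (northCode n) (sideCode e) × Fits s w n e
    tiles-∈ τ∈ with ∈-map⁻ toTile τ∈
    ... | (s , w , n , e) , q∈ , eq = s , w , n , e , eq , proj₂ (∈-filter⁻ fitting? {xs = candidates} q∈)

  module Acceptance (M : Machine) where
    open Machine M
    open Tableau M

    private
      k : ℕ
      k = suc workTapes

    bottom : List Bool → ℕ → ℕ → List V
    bottom fx Q Z = map (init ∘ given) fx ++ replicate Q (init wild) ++ replicate Z (init empty) ++ init last ∷ []

    private
      symbols : List Sym → List V
      symbols l = map (mid ∘ cell) l ++ fin ∷ []

      cell-here : ∀ s → lookup (cell s) (k ↑ʳ Fin.zero) ≡ s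
      cell-here s = Vec.lookup∘updateAt (k ↑ʳ Fin.zero) (Vec.replicate (k + k) blank)

      cell-else : ∀ s j → j ≢ k ↑ʳ Fin.zero → lookup (cell s) j ≡ blank
      cell-else s j ne = trans (Vec.lookup∘updateAt′ j (k ↑ʳ Fin.zero) ne (Vec.replicate (k + k) blank)) (Vec.lookup-replicate j blank)

      symbols-mids : ∀ l (f : Lanes) → (∀ j i → f j i ≡ lookup (cell (nth l i)) j) → symbols l ≡ mids (length l) f
      symbols-mids []      f h = refl
      symbols-mids (s ∷ l) f h = cong₂ _∷_ (cong mid (lookup-ext λ j → trans (sym (h j 0)) (sym (Vec.lookup∘tabulate (λ j → f j 0) j))))
        (symbols-mids l (rest f) (λ j i → h j (suc i)))

      -- The cells spell `c` followed by blanks. Comparison by `nth` leaves open how many blanks are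
      -- written out.
      Spelled : List Bool → ℕ → List V → Set
      Spelled c n ns = ∃[ l ] ns ≡ symbols l × length l ≡ n × (∀ i → nth l i ≡ nth (map bit c) i)

      spell-blank : ∀ {n ns} → Spelled [] n ns → Spelled [] (suc n) (mid (cell blank) ∷ ns)
      spell-blank (l , eq , len , h) = blank ∷ l , cong (_ ∷_) eq , cong suc len , λ { zero → refl ; (suc i) → h i }

      spell-bit : ∀ b {c n ns} → Spelled c n ns → Spelled (b ∷ c) (suc n) (mid (cell (bit b)) ∷ ns)
      spell-bit b (l , eq , len , h) = bit b ∷ l , cong (_ ∷_) eq , cong suc len , λ { zero → refl ; (suc i) → h i }

      empty-sound : ∀ g Z {ns e} → Row (just (guess g)) (replicate Z (init empty) ++ init last ∷ []) (map just ns) e → Spelled [] Z ns × e ≡ nothing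
      empty-sound g zero    {n ∷ []} ((refl , refl) ∷ []) = ([] , refl , refl , λ _ → refl) , refl
      empty-sound g (suc Z) {n ∷ ns} ((refl , refl) ∷ r) with empty-sound g Z r
      ... | sp , e≡ = spell-blank sp , e≡

      -- The clause for `g ≡ true` carries along that guessing has stopped and the rest of the
      -- certificate is empty; without it a bit after a blank could not be excluded.
      wild-sound : ∀ g Q Z {ns e} → Row (just (guess g)) (replicate Q (init wild) ++ replicate Z (init empty) ++ init last ∷ []) (map just ns) e →
        ∃[ c ] length c ≤ Q × (g ≡ true → c ≡ []) × Spelled c (Q + Z) ns × e ≡ nothing
      wild-sound g zero Z r with empty-sound g Z r
      ... | sp , e≡ = [] , z≤n , (λ _ → refl) , sp , e≡
      wild-sound g (suc Q) Z {n ∷ ns} (inj₁ (refl , refl) ∷ r) with wild-sound true Q Z r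
      ... | c , le , only , sp , e≡ with only refl
      ... | refl = [] , z≤n , (λ _ → refl) , spell-blank sp , e≡
      wild-sound g (suc Q) Z {n ∷ ns} (inj₂ (refl , refl , inj₁ refl) ∷ r) with wild-sound false Q Z r
      ... | c , le , only , sp , e≡ = false ∷ c , s≤s le , (λ ()) , spell-bit false sp , e≡
      wild-sound g (suc Q) Z {n ∷ ns} (inj₂ (refl , refl , inj₂ refl) ∷ r) with wild-sound false Q Z r
      ... | c , le , only , sp , e≡ = true ∷ c , s≤s le , (λ ()) , spell-bit true sp , e≡

      given-sound : ∀ w Q Z {ns e} → Row (just (guess false)) (bottom w Q Z) (map just ns) e →
        ∃[ c ] length c ≤ Q × Spelled (w ++ c) (length w + (Q + Z)) ns × e ≡ nothing
      given-sound [] Q Z r with wild-sound false Q Z r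
      ... | c , le , _ , sp , e≡ = c , le , sp , e≡
      given-sound (b ∷ w) Q Z {n ∷ ns} ((refl , refl) ∷ r) with given-sound w Q Z r
      ... | c , le , sp , e≡ = c , le , spell-bit b sp , e≡

      empty-complete : ∀ g Z → ∃[ ns ] Row (just (guess g)) (replicate Z (init empty) ++ init last ∷ []) (map just ns) nothing × Spelled [] Z ns
      empty-complete g zero    = fin ∷ [] , ((refl , refl) ∷ []) , ([] , refl , refl , λ _ → refl)
      empty-complete g (suc Z) with empty-complete g Z
      ... | ns , r , sp = mid (cell blank) ∷ ns , ((refl , refl) ∷ r) , spell-blank sp

      wild-complete : ∀ g c Q Z → length c ≤ Q → (g ≡ true → c ≡ []) →
        ∃[ ns ] Row (just (guess g)) (replicate Q (init wild) ++ replicate Z (init empty) ++ init last ∷ []) (map just ns) nothing × Spelled c (Q + Z) ns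
      wild-complete g [] zero    Z le only = empty-complete g Z
      wild-complete g [] (suc Q) Z le only with wild-complete true [] Q Z z≤n (λ _ → refl)
      ... | ns , r , sp = mid (cell blank) ∷ ns , (inj₁ (refl , refl) ∷ r) , spell-blank sp
      wild-complete true (b ∷ c) Q Z le only with only refl
      ... | ()
      wild-complete false (b ∷ c) (suc Q) Z (s≤s le) only with wild-complete false c Q Z le (λ ())
      wild-complete false (false ∷ c) (suc Q) Z (s≤s le) only | ns , r , sp = mid (cell (bit false)) ∷ ns , (inj₂ (refl , refl , inj₁ refl) ∷ r) , spell-bit false sp
      wild-complete false (true ∷ c)  (suc Q) Z (s≤s le) only | ns , r , sp = mid (cell (bit true)) ∷ ns , (inj₂ (refl , refl , inj₂ refl) ∷ r) , spell-bit true sp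

      given-complete : ∀ w c Q Z → length c ≤ Q →
        ∃[ ns ] Row (just (guess false)) (bottom w Q Z) (map just ns) nothing × Spelled (w ++ c) (length w + (Q + Z)) ns
      given-complete []      c Q Z le = wild-complete false c Q Z le (λ ())
      given-complete (b ∷ w) c Q Z le with given-complete w c Q Z le
      ... | ns , r , sp = mid (cell (bit b)) ∷ ns , ((refl , refl) ∷ r) , spell-bit b sp

      initial-stacks : ∀ b w {l : List Sym} → (∀ i → nth l i ≡ nth (map bit w) i) →
        ∀ j i → stacks (proj₂ (initial M (b ∷ w))) j i ≡ lookup (cell (nth l i)) j
      initial-stacks b w {l} h = both-halves _ left right
        where
        ts = proj₂ (initial M (b ∷ w))
        lefts : ∀ i n → nth (leftOf (lookup ts i)) n ≡ blank
        lefts Fin.zero    n = refl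
        lefts (Fin.suc i) n = cong (λ t → nth (leftOf t) n) (Vec.lookup-replicate i (fromSymbols []))
        left : ∀ i n → stacks ts (i ↑ˡ k) n ≡ lookup (cell (nth l n)) (i ↑ˡ k)
        left i n = trans (stacks-left ts i n) (trans (lefts i n) (sym (cell-else (nth l n) (i ↑ˡ k) λ e → ↑ˡ≢↑ʳ e)))
          where
          ↑ˡ≢↑ʳ : i ↑ˡ k ≡ k ↑ʳ Fin.zero {workTapes} → ⊥
          ↑ˡ≢↑ʳ e with trans (sym (Fin.splitAt-↑ˡ k i k)) (trans (cong (splitAt k) e) (Fin.splitAt-↑ʳ k k Fin.zero))
          ... | ()
        right : ∀ i n → stacks ts (k ↑ʳ i) n ≡ lookup (cell (nth l n)) (k ↑ʳ i)
        right Fin.zero    n = trans (stacks-right ts Fin.zero n) (trans (sym (h n)) (sym (cell-here (nth l n))))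
        right (Fin.suc i) n = trans (stacks-right ts (Fin.suc i) n)
          (trans (cong (λ t → nth (rightOf t) n) (Vec.lookup-replicate i (fromSymbols []))) (sym (cell-else (nth l n) (k ↑ʳ Fin.suc i) λ e → Fin.0≢1+n (sym (Fin.↑ʳ-injective k _ _ e)))))

      spelled-row : ∀ b w {n ns} → Spelled w n ns → head Fin.zero (bit b ∷ Vec.replicate workTapes blank) ∷ ns ≡ row n (initial M (b ∷ w))
      spelled-row b w (l , refl , refl , h) = cong₂ _∷_ (cong (head Fin.zero) (cong (bit b ∷_) (sym (scans workTapes))))
          (symbols-mids l (stacks (proj₂ (initial M (b ∷ w)))) (initial-stacks b w {l} h))
        where
        scans : ∀ n → Vec.map scanned (Vec.replicate n (fromSymbols {auxSymbols} [])) ≡ Vec.replicate n blank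
        scans zero    = refl
        scans (suc n) = cong (blank ∷_) (scans n)

    bottom-sound : ∀ b w Q Z {ns e} → Row nothing (bottom (b ∷ w) Q Z) (map just ns) e →
      ∃[ c ] length c ≤ Q × ns ≡ row (length w + (Q + Z)) (initial M (b ∷ w ++ c)) × e ≡ nothing
    bottom-sound b w Q Z {n ∷ ns} ((refl , refl) ∷ r) with given-sound w Q Z r
    ... | c , le , sp , e≡ = c , le , spelled-row b (w ++ c) sp , e≡

    bottom-complete : ∀ b w c Q Z → length c ≤ Q →
      Row nothing (bottom (b ∷ w) Q Z) (map just (row (length w + (Q + Z)) (initial M (b ∷ w ++ c)))) nothing
    bottom-complete b w c Q Z le with given-complete w c Q Z le
    ... | ns , r , sp = subst (λ l → Row nothing (bottom (b ∷ w) Q Z) (map just l) nothing) (spelled-row b (w ++ c) sp) ((refl , refl) ∷ r)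

    -- Half a tape grows by at most one cell per step. With `R` rows to come and `l + R ≤ m`,
    -- nothing reaches the right end of a row.
    Short : ℕ → Vec (Tape auxSymbols) k → Set
    Short l ts = ∀ i → length (leftOf (lookup ts i)) ≤ l × length (rightOf (lookup ts i)) ≤ l

    private
      nth-beyond : ∀ (w : List Sym) i → length w ≤ i → nth w i ≡ blank
      nth-beyond []      i       le       = refl
      nth-beyond (s ∷ w) (suc i) (s≤s le) = nth-beyond w i le

      short-blank : ∀ l m ts → l ≤ m → Short l ts → BlankFrom m (stacks ts)
      short-blank l m ts l≤m sh = both-halves _
        (λ i n le → trans (stacks-left ts i n) (nth-beyond (leftOf (lookup ts i)) n (≤-trans (proj₁ (sh i)) (≤-trans l≤m le))))
        (λ i n le → trans (stacks-right ts i n) (nth-beyond (rightOf (lookup ts i)) n (≤-trans (proj₂ (sh i)) (≤-trans l≤m le))))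

      short-step : ∀ l ts as → Short l ts → Short (suc l) (Vec.zipWith writeMove ts as)
      short-step l ts as sh i rewrite Vec.lookup-zipWith writeMove i ts as = go (lookup ts i) (lookup as i) (sh i)
        where
        go : ∀ t a → length (leftOf t) ≤ l × length (rightOf t) ≤ l → length (leftOf (writeMove t a)) ≤ suc l × length (rightOf (writeMove t a)) ≤ suc l
        go (tape [] _ rs)       (s , goLeft)  (p , q) = z≤n , s≤s q
        go (tape (_ ∷ ls) _ rs) (s , goLeft)  (p , q) = ≤-trans (n≤1+n _) (≤-trans p (n≤1+n _)) , s≤s q
        go (tape ls _ rs)       (s , stay)    (p , q) = ≤-trans p (n≤1+n _) , ≤-trans q (n≤1+n _)
        go (tape ls _ [])       (s , goRight) (p , q) = s≤s p , z≤n
        go (tape ls _ (_ ∷ rs)) (s , goRight) (p , q) = s≤s p , ≤-trans (n≤1+n _) (≤-trans q (n≤1+n _))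

    -- `n < R` guarantees a constrained row at the halting configuration, where only the repeating
    -- tile fits, and that tile tests for acceptance.
    chain-sound : ∀ {n q ts d} R m l → Run (step M) n (q , ts) d → step M d ≡ nothing → n < R → Short l ts → l + R ≤ m →
      Chain (suc R) nothing (row m (q , ts)) → Vec.head (Vec.map scanned (proj₂ d)) ≡ bit true
    chain-sound (suc R) m l done h n<R sh le (above r ch) = row-halt-sound m _ _ (step-nothing M h) r
    chain-sound {q = q} {ts} (suc R) m l (more p run) h (s≤s n<R) sh le (above r ch) with step-just M p
    ... | q′ , as , eq , refl with row-step-sound m q ts (short-blank l m ts (≤-trans (m≤m+n l (suc R)) le) sh) eq r
    ... | refl , refl = chain-sound R m (suc l) run h n<R (short-step l ts as sh) (≤-trans (≤-reflexive (sym (+-suc l R))) le) ch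

    chain-complete : ∀ {n q ts d} R m l → Run (step M) n (q , ts) d → step M d ≡ nothing → Short l ts → l + R ≤ m →
      Vec.head (Vec.map scanned (proj₂ d)) ≡ bit true → Chain (suc R) nothing (row m (q , ts))
    chain-complete zero m l run h sh le acc = top
    chain-complete {q = q} {ts} (suc R) m l done h sh le acc =
      above (row-halt-complete m q ts (short-blank l m ts (≤-trans (m≤m+n l (suc R)) le) sh) (step-nothing M h) acc)
        (chain-complete R m l done h sh (≤-trans (+-monoʳ-≤ l (n≤1+n R)) le) acc)
    chain-complete {q = q} {ts} (suc R) m l (more p run) h sh le acc with step-just M p
    ... | q′ , as , eq , refl = above
      (row-step-complete m q ts (short-blank l m ts (≤-trans (m≤m+n l (suc R)) le) sh)
        (short-blank (suc l) m (Vec.zipWith writeMove ts as) (≤-trans (≤-trans (m≤m+n (suc l) R) (≤-reflexive (sym (+-suc l R)))) le) (short-step l ts as sh)) eq)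
      (chain-complete R m (suc l) run h (short-step l ts as sh) (≤-trans (≤-reflexive (sym (+-suc l R))) le) acc)

    private
      short-initial : ∀ b w → Short (length w) (proj₂ (initial M (b ∷ w)))
      short-initial b w Fin.zero    = z≤n , ≤-reflexive (List.length-map bit w)
      short-initial b w (Fin.suc i) rewrite Vec.lookup-replicate i (fromSymbols {auxSymbols} []) = z≤n , z≤n

      short-mono : ∀ {l l′} ts → l ≤ l′ → Short l ts → Short l′ ts
      short-mono ts le sh i = ≤-trans (proj₁ (sh i)) le , ≤-trans (proj₂ (sh i)) le

      output-true : ∀ d {b} → output M d ≡ b ∷ [] → Vec.head (Vec.map scanned (proj₂ d)) ≡ bit true → T b
      output-true (q , tape ls .(bit true) rs ∷ ts) eq refl = subst T (proj₁ (List.∷-injective eq)) tt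

      true-output : ∀ d {b} → output M d ≡ b ∷ [] → T b → Vec.head (Vec.map scanned (proj₂ d)) ≡ bit true
      true-output (q , tape ls (bit c) rs ∷ ts) {true} eq _ = cong bit (proj₁ (List.∷-injective eq))

    -- Two rows are added to `R`: the bottom row, which produces the initial configuration, and the
    -- unconstrained top row.
    chain⇔accept : ∀ {v : List Bool → Bool} {time : ℕ → ℕ} → (∀ z → OutputsWithin M (time (length z)) z (v z ∷ [])) →
      ∀ b w Q R → (∀ c → length c ≤ Q → time (length (b ∷ w ++ c)) < R) →
      Chain (suc (suc R)) nothing (bottom (b ∷ w) Q R) ⇔ (∃[ c ] length c ≤ Q × T (v (b ∷ w ++ c)))
    chain⇔accept {v} {time} decides b w Q R fast = mk⇔ sound complete
      where
      m : ℕ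
      m = length w + (Q + R)
      room : length w + Q + R ≤ m
      room = ≤-reflexive (+-assoc (length w) Q R)
      short : ∀ c → length c ≤ Q → Short (length w + Q) (proj₂ (initial M (b ∷ w ++ c)))
      short c le = short-mono (proj₂ (initial M (b ∷ w ++ c))) (≤-trans (≤-reflexive (List.length-++ w)) (+-monoʳ-≤ (length w) le)) (short-initial b (w ++ c))
      sound : Chain (suc (suc R)) nothing (bottom (b ∷ w) Q R) → ∃[ c ] length c ≤ Q × T (v (b ∷ w ++ c))
      sound (above r ch) with bottom-sound b w Q R r
      ... | c , le , refl , refl with decides (b ∷ w ++ c)
      ... | n , d , n≤ , h , out with halts⇒run h
      ... | run , stop = c , le , output-true d out (chain-sound R m (length w + Q) run stop (≤-<-trans n≤ (fast c le)) (short c le) room ch)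
      complete : (∃[ c ] length c ≤ Q × T (v (b ∷ w ++ c))) → Chain (suc (suc R)) nothing (bottom (b ∷ w) Q R)
      complete (c , le , acc) with decides (b ∷ w ++ c)
      ... | n , d , n≤ , h , out with halts⇒run h
      ... | run , stop = above (bottom-complete b w c Q R le) (chain-complete R m (length w + Q) run stop (short c le) room (true-output d out acc))

    private
      abstract
        FV₁ : Finite V
        FV₁ = finiteV

        FV : Finite (Maybe V)
        FV = Finite-Maybe finiteV

        FE : Finite (Maybe E)
        FE = Finite-Maybe finiteE

        -- 0 is the colour that `Tiling` requires at its end, so it has to be the code of the
        -- border.
        FV-nothing : toℕ (Finite.to FV nothing) ≡ 0
        FV-nothing = refl

        FE-nothing : toℕ (Finite.to FE nothing) ≡ 0
        FE-nothing = refl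

    open AllTiles Fits fits? FV₁ FV FE public

    northCode-nothing : northCode nothing ≡ 0
    northCode-nothing = FV-nothing

    sideCode-nothing : sideCode nothing ≡ 0
    sideCode-nothing = FE-nothing

    tiles-bounded : All (λ τ → (south τ ≤ colours × west τ ≤ colours) × (north τ ≤ colours × east τ ≤ colours)) tiles
    tiles-bounded = All.tabulate bound
      where
      bound : ∀ {τ} → τ ∈ tiles → (south τ ≤ colours × west τ ≤ colours) × (north τ ≤ colours × east τ ≤ colours)
      bound τ∈ with tiles-∈ τ∈
      ... | s , w , n , e , refl , _ = (northCode≤ (just s) , sideCode≤ w) , (northCode≤ n , sideCode≤ e)

    southCodes : List V → List ℕ
    southCodes = map (λ s → northCode (just s))

    private
      -- Every placement takes a south colour from the front of the queue and appends a north
      -- colour. After a whole row the queue therefore consists of the colours below the next row;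
      -- `acc` holds those appended so far.
      row⇒tiling : ∀ {w ss ns e L} acc → Row w ss ns e → Tiling tiles L (sideCode e) (acc ++ map northCode ns) →
        Tiling tiles (length ss + L) (sideCode w) (southCodes ss ++ acc)
      row⇒tiling acc [] t = subst (Tiling tiles _ _) (List.++-identityʳ acc) t
      row⇒tiling {w} {s ∷ ss} {n ∷ ns} {e′} acc (_∷_ {e = e} h r) t = place (∈-tiles h)
        (subst (Tiling tiles _ (sideCode e)) (sym (List.++-assoc (southCodes ss) acc (northCode n ∷ [])))
          (row⇒tiling (acc ++ northCode n ∷ []) r (subst (Tiling tiles _ (sideCode e′)) (sym (List.++-assoc acc (northCode n ∷ []) (map northCode ns))) t)))

      split-place : ∀ {L c q Q} → Tiling tiles (suc L) c (q ∷ Q) →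
        ∃[ s ] ∃[ w ] ∃[ n ] ∃[ e ] q ≡ northCode (just s) × c ≡ sideCode w × Fits s w n e × Tiling tiles L (sideCode e) (Q ++ northCode n ∷ [])
      split-place (place τ∈ t) with tiles-∈ τ∈
      ... | s , w , n , e , refl , h = s , w , n , e , refl , refl , h , t

      tiling⇒row : ∀ ss {w acc L} → Tiling tiles (length ss + L) (sideCode w) (southCodes ss ++ acc) →
        ∃[ ns ] ∃[ e ] Row w ss ns e × length ns ≡ length ss × Tiling tiles L (sideCode e) (acc ++ map northCode ns)
      tiling⇒row [] {w} {acc} t = [] , w , [] , refl , subst (Tiling tiles _ _) (sym (List.++-identityʳ acc)) t
      tiling⇒row (s ∷ ss) {w} {acc} {L} t with split-place t
      ... | s′ , w′ , n , e , q≡ , c≡ , h , t′ with northCode-injective {just s} {just s′} q≡ | sideCode-injective {w} {w′} c≡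
      ... | refl | refl with tiling⇒row ss {e} {acc ++ northCode n ∷ []} {L} (subst (Tiling tiles _ (sideCode e)) (List.++-assoc (southCodes ss) acc (northCode n ∷ [])) t′)
      ... | ns , e′ , r , len , t″ = n ∷ ns , e′ , h ∷ r , cong suc len , subst (Tiling tiles L (sideCode e′)) (List.++-assoc acc (northCode n ∷ []) (map northCode ns)) t″

      -- A tile always has a proper south colour, so no border can lie below a further row.
      all-just : ∀ ns {L c acc} → Tiling tiles (length ns + L) c (map northCode ns ++ acc) → ∃[ ss ] ns ≡ map just ss
      all-just []       t = [] , refl
      all-just (n ∷ ns) {L} {c} {acc} t with split-place t
      ... | s , w , n′ , e , q≡ , _ , _ , t′ with northCode-injective {n} {just s} q≡
      ... | refl with all-just ns {L} {sideCode e} {acc ++ northCode n′ ∷ []} (subst (Tiling tiles _ (sideCode e)) (List.++-assoc (map northCode ns) acc _) t′)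
      ... | ss , refl = s ∷ ss , refl

      cleared : ∀ {w} s ss → Row w (s ∷ ss) (map (λ _ → nothing) (s ∷ ss)) nothing
      cleared s []        = tt ∷ []
      cleared s (s′ ∷ ss) = _∷_ {e = nothing} tt (cleared s′ ss)

      row-length : ∀ {w ss ns e} → Row w ss ns e → length ns ≡ length ss
      row-length []      = refl
      row-length (_ ∷ r) = cong suc (row-length r)

    chain⇒tiling : ∀ {t w ss} → Chain t w ss → Tiling tiles (t * length ss) (sideCode w) (southCodes ss)
    chain⇒tiling {w = w} (top {s = s} {ss}) = subst (Tiling tiles _ (sideCode w)) (List.++-identityʳ (southCodes (s ∷ ss)))
        (row⇒tiling [] (cleared s ss) (subst (λ c → Tiling tiles 0 c (map northCode (map (λ _ → nothing) (s ∷ ss)))) (sym sideCode-nothing) (end (zeros (s ∷ ss)))))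
      where
      zeros : ∀ ss → All (_≡ 0) (map northCode (map (λ (_ : V) → nothing) ss))
      zeros []       = []
      zeros (s ∷ ss) = northCode-nothing ∷ zeros ss
    chain⇒tiling {suc t} {w} {ss} (above {e = e} {ns = ns} r ch) = subst (Tiling tiles _ (sideCode w)) (List.++-identityʳ (southCodes ss))
      (row⇒tiling [] r (subst₂ (λ L Q → Tiling tiles (t * L) (sideCode e) Q) (trans (sym (List.length-map just ns)) (row-length r)) (List.map-∘ ns) (chain⇒tiling ch)))

    tiling⇒chain : ∀ t w ss → 1 ≤ length ss → Tiling tiles (suc t * length ss) (sideCode w) (southCodes ss) → Chain (suc t) w ss
    tiling⇒chain zero    w (s ∷ ss) _ T = top
    tiling⇒chain (suc t) w ss pos T
      with tiling⇒row ss {w} {[]} {suc t * length ss} (subst (Tiling tiles _ (sideCode w)) (sym (List.++-identityʳ (southCodes ss))) T)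
    ... | ns , e , r , len , T′
      with all-just ns {t * length ss} {sideCode e} {[]} (subst₂ (λ k Q → Tiling tiles (k + t * length ss) (sideCode e) Q) (sym len) (sym (List.++-identityʳ (map northCode ns))) T′)
    ... | ss′ , refl = above r (tiling⇒chain t e ss′ (≤-trans pos (≤-reflexive (sym len′)))
        (subst₂ (λ k Q → Tiling tiles (suc t * k) (sideCode e) Q) (sym len′) (sym (List.map-∘ ss′)) T′))
      where
      len′ : length ss′ ≡ length ss
      len′ = trans (sym (List.length-map just ss′)) len

-- From subset sums to jobs.

module SubsetSumGadget where

  open import Defs hiding (t; a; d)
  open UnitStepSchedules
  open Rationals
  open FeasibleSchedules
  open Witnesses
  open TilingToSubsetSum using (Sub; done; skip; take)
  open import Data.Bool.Base using (Bool; true; false; _∧_)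
  open import Data.Empty using (⊥; ⊥-elim)
  open import Data.Fin.Base as Fin using (Fin)
  open import Data.List.Base using (List; []; _∷_; map; length; lookup)
  open import Data.Nat.Base using (ℕ; zero; suc; _+_; _*_; _∸_; _⊓_; _≤_; _<_; _≤ᵇ_; _<ᵇ_; z≤n; s≤s)
  open import Data.Nat.Properties
  open import Data.Product.Base using (Σ; ∃-syntax; _×_; _,_; proj₁; proj₂)
  import Data.Rational.Base as ℚ
  import Data.Rational.Properties as ℚ
  open import Function.Base using (_∘_)
  open import Relation.Nullary using (Dec; yes; no)
  open import Relation.Binary.PropositionalEquality using (_≡_; refl; sym; trans; cong; subst)

  -- The first job can be skipped only if the others keep the processor busy
  -- up to their common deadline.

  small : ℕ → ℕ → Job
  small B w = job w 0 B

  -- With `B = suc B₀` the long job has length `c B` and deadline `c B + B - 1`. It can be started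
  -- up to time `B - 1`, and to skip it the chosen work must reach past that time, hence up to `B`.
  gadget : ℕ → ℕ → List ℕ → Instance
  gadget c B₀ ws = job (c * suc B₀) 0 (c * suc B₀ + B₀) ∷ map (small (suc B₀)) ws

  module _ (c B₀ : ℕ) (ws : List ℕ) (1<c : 1 < c) where

    private
      B : ℕ
      B = suc B₀

      I : Instance
      I = gadget c B₀ ws

      Choice : Set
      Choice = Fin (length I) → Bool

      arr≡0 : ∀ i → arrN I i ≡ 0
      arr≡0 Fin.zero    = refl
      arr≡0 (Fin.suc i) = go ws i
        where
        go : ∀ ws (i : Fin (length (map (small B) ws))) → Job.arrival (lookup (map (small B) ws) i) ≡ 0
        go (w ∷ ws) Fin.zero    = refl
        go (w ∷ ws) (Fin.suc i) = go ws i

      due≡B : ∀ i → dueN I (Fin.suc i) ≡ B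
      due≡B = go ws
        where
        go : ∀ ws (i : Fin (length (map (small B) ws))) → Job.deadline (lookup (map (small B) ws) i) ≡ B
        go (w ∷ ws) Fin.zero    = refl
        go (w ∷ ws) (Fin.suc i) = go ws i

      sub⇒choice : ∀ {ws x} → Sub ws x →
        Σ (Fin (length (map (small B) ws)) → Bool) λ S → sumF (λ i → when (S i) (Job.processing (lookup (map (small B) ws) i))) ≡ x
      sub⇒choice done = (λ ()) , refl
      sub⇒choice (skip s) with sub⇒choice s
      ... | S , eq = (λ { Fin.zero → false ; (Fin.suc i) → S i }) , eq
      sub⇒choice (take {w} s) with sub⇒choice s
      ... | S , eq = (λ { Fin.zero → true ; (Fin.suc i) → S i }) , cong (w +_) eq

      choice⇒sub : ∀ ws (S : Fin (length (map (small B) ws)) → Bool) →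
        Sub ws (sumF (λ i → when (S i) (Job.processing (lookup (map (small B) ws) i))))
      choice⇒sub []       S = done
      choice⇒sub (w ∷ ws) S with S Fin.zero
      ... | true  = take (choice⇒sub ws (S ∘ Fin.suc))
      ... | false = skip (choice⇒sub ws (S ∘ Fin.suc))

      pickOne : ∀ {m} (S : Fin m → Bool) (p : Fin m → ℕ) → 0 < sumF (λ i → when (S i) (p i)) → ∃[ k ] S k ≡ true
      pickOne {zero}  S p ()
      pickOne {suc m} S p pos with S Fin.zero in eq
      ... | true  = Fin.zero , eq
      ... | false with pickOne (S ∘ Fin.suc) (p ∘ Fin.suc) pos
      ... | k , Sk = Fin.suc k , Sk

      when-≤ : ∀ b b′ m → (b ≡ true → b′ ≡ true) → when b m ≤ when b′ m
      when-≤ false b′ m h = z≤n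
      when-≤ true  b′ m h rewrite h refl = ≤-refl

      select-mono : ∀ (b b′ : Choice) → (∀ k → b k ≡ true → b′ k ≡ true) → sumF (λ k → when (b k) (procN I k)) ≤ sumF (λ k → when (b′ k) (procN I k))
      select-mono b b′ h = sumF-mono λ k → when-≤ (b k) (b′ k) (procN I k) (h k)

      select-none : ∀ (b : Choice) → (∀ k → b k ≡ true → ⊥) → sumF (λ k → when (b k) (procN I k)) ≡ 0
      select-none b h = sumF-zero λ k → cong (λ b → when b (procN I k)) (≢true⇒false (h k))

    -- A choice of total length `B` keeps the processor busy until `B`. From then on no skipped job
    -- can be completed: a short one would miss `B`, the long one `c B + B₀`.
    sub⇒witness : ∀ obj → Sub ws B → ∃[ S ] Witness obj I B S
    sub⇒witness obj s with sub⇒choice s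
    ... | S₀ , total = S , record { schedulable = record { hall = hall ; covered = covered } ; budget = ≤-reflexive total }
      where
      S : Choice
      S Fin.zero    = false
      S (Fin.suc i) = S₀ i
      due-S : ∀ i → S i ≡ true → due obj I B i ≡ B
      due-S (Fin.suc i) _ = lemma obj
        where
        lemma : ∀ obj → due obj I B (Fin.suc i) ≡ B
        lemma totalWork     = due≡B i
        lemma completedWork = due≡B i
        lemma makespan      = trans (cong (_⊓ B) (due≡B i)) (⊓-idem B)
      hall : ∀ r D → sumF (λ k → when (S k ∧ ((r ≤ᵇ arrN I k) ∧ (due obj I B k ≤ᵇ D))) (procN I k)) ≤ D ∸ r
      hall zero D = bound (B ≤? D)
        where
        bound : Dec (B ≤ D) → sumF (λ k → when (S k ∧ ((0 ≤ᵇ arrN I k) ∧ (due obj I B k ≤ᵇ D))) (procN I k)) ≤ D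
        window : Choice
        window k = (0 ≤ᵇ arrN I k) ∧ (due obj I B k ≤ᵇ D)
        bound (yes le) = ≤-trans (select-mono (λ k → S k ∧ window k) S λ k e → proj₁ (∧-true {S k} {window k} e)) (≤-trans (≤-reflexive total) le)
        bound (no ¬le) = ≤-trans (≤-reflexive (select-none (λ k → S k ∧ window k) λ k e →
          let (Sk , wk) = ∧-true {S k} {window k} e in
          ¬le (subst (_≤ D) (due-S k Sk) (true-≤ᵇ (proj₂ (∧-true {0 ≤ᵇ arrN I k} {due obj I B k ≤ᵇ D} wk)))))) z≤n
      hall (suc r) D = ≤-trans (≤-reflexive (select-none (λ k → S k ∧ window k) λ k e →
          impossible (subst (suc r ≤_) (arr≡0 k) (true-≤ᵇ (proj₁ (∧-true {suc r ≤ᵇ arrN I k} {due obj I B k ≤ᵇ D} (proj₂ (∧-true {S k} {window k} e)))))))) z≤n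
        where
        window : Choice
        window k = (suc r ≤ᵇ arrN I k) ∧ (due obj I B k ≤ᵇ D)
        impossible : suc r ≤ 0 → ⊥
        impossible ()
      covered : ∀ i → S i ≡ false → 0 < procN I i → arrN I i + procN I i ≤ dueN I i → ∃[ k ] S k ≡ true × arrN I k ≤ arrN I i ×
        (∀ m → m + procN I i ≤ suc (dueN I i) → m ≤ arrN I k + sumF (λ l → when (S l ∧ ((arrN I k ≤ᵇ arrN I l) ∧ (arrN I l <ᵇ m))) (procN I l)))
      covered i Si pos fits with pickOne S (procN I) (≤-trans (s≤s z≤n) (≤-reflexive (sym total)))
      ... | k , Sk = k , Sk , ≤-trans (≤-reflexive (arr≡0 k)) z≤n , bound
        where
        m≤B : ∀ i m → 0 < procN I i → m + procN I i ≤ suc (dueN I i) → m ≤ B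
        m≤B Fin.zero    m pos le = +-cancelʳ-≤ (c * B) m B (≤-trans le (≤-reflexive (trans (sym (+-suc (c * B) B₀)) (+-comm (c * B) B))))
        m≤B (Fin.suc i) m pos le = ≤-pred (≤-trans (≤-reflexive (+-comm 1 m)) (≤-trans (+-monoʳ-≤ m pos) (≤-trans le (≤-reflexive (cong suc (due≡B i))))))
        bound : ∀ m → m + procN I i ≤ suc (dueN I i) → m ≤ arrN I k + sumF (λ l → when (S l ∧ ((arrN I k ≤ᵇ arrN I l) ∧ (arrN I l <ᵇ m))) (procN I l))
        bound zero    le = z≤n
        bound (suc m) le = ≤-trans (m≤B i (suc m) pos le) (≤-trans (≤-reflexive (sym total)) (≤-trans
          (select-mono S (λ l → S l ∧ ((arrN I k ≤ᵇ arrN I l) ∧ (arrN I l <ᵇ suc m))) λ l e →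
            true-∧ e (true-∧ (≤ᵇ-true {arrN I k} {arrN I l} (≤-trans (≤-reflexive (arr≡0 k)) z≤n)) (<ᵇ-true {arrN I l} {suc m} (subst (_< suc m) (sym (arr≡0 l)) (s≤s z≤n)))))
          (m≤n+m _ (arrN I k))))

    -- `hall` for the window from 0 to `B` bounds the chosen total by `B`. Skipping the long job
    -- forces at least `B`, by `covered` at the largest admissible `m`.
    schedulable⇒sub : ∀ {S : Choice} → S Fin.zero ≡ false → Schedulable (procN I) (arrN I) (dueN I) (dueN I) S → Sub ws B
    schedulable⇒sub {S} S0 sch = subst (Sub ws) (≤-antisym upper lower) (choice⇒sub ws (S ∘ Fin.suc))
      where
      open Schedulable sch
      total : ℕ
      total = sumF (λ i → when (S (Fin.suc i)) (procN I (Fin.suc i)))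
      all≡ : sumF (λ k → when (S k) (procN I k)) ≡ total
      all≡ = cong (λ b → when b (c * B) + total) S0
      upper : total ≤ B
      upper = ≤-trans (≤-reflexive (sym all≡)) (≤-trans (select-mono S (λ k → S k ∧ ((0 ≤ᵇ arrN I k) ∧ (dueN I k ≤ᵇ B))) inside) (hall 0 B))
        where
        inside : ∀ k → S k ≡ true → S k ∧ ((0 ≤ᵇ arrN I k) ∧ (dueN I k ≤ᵇ B)) ≡ true
        inside Fin.zero    e = ⊥-elim (absurd (trans (sym S0) e))
          where
          absurd : false ≡ true → ⊥
          absurd ()
        inside (Fin.suc i) e = true-∧ e (≤ᵇ-true (≤-reflexive (due≡B i)))
      window : Fin (length I) → Choice
      window k l = (arrN I k ≤ᵇ arrN I l) ∧ (arrN I l <ᵇ B)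
      lower : B ≤ total
      lower with covered Fin.zero S0 (≤-trans (s≤s z≤n) (≤-trans (<⇒≤ 1<c) (m≤m*n c B))) (m≤m+n (c * B) B₀)
      ... | k , Sk , ak , h = ≤-trans (h B (≤-reflexive (trans (+-comm B (c * B)) (+-suc (c * B) B₀))))
        (≤-trans (+-monoˡ-≤ _ ak) (≤-trans (select-mono (λ l → S l ∧ window k l) S λ l e → proj₁ (∧-true {S l} {window k l} e)) (≤-reflexive all≡)))

    feasible⇒sub : ∀ {σ} → Feasible I σ → selected σ Fin.zero ≡ false → Sub ws B
    feasible⇒sub feas s0 = schedulable⇒sub s0 (feasible⇒schedulable feas (dueN I) (finish≤deadline feas))

    cheap⇒unselected : ∀ obj {σ} → Feasible I σ → value obj I σ ℚ.< fromℕ (c * B) → selected σ Fin.zero ≡ false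
    cheap⇒unselected obj {σ} feas v = ≢true⇒false λ e → ℚ.<-irrefl refl (ℚ.≤-<-trans (ℚ.≤-trans
      (ℚ.≤-reflexive (sym (trans (y∞-selected feas Fin.zero) (cong (λ b → fromℕ (when b (c * B))) e)))) (y∞≤value obj feas Fin.zero)) v)

    sub⇔cheap : ∀ obj → (Sub ws B → ∃[ σ ] Feasible I σ × value obj I σ ℚ.≤ fromℕ B) × ((∃[ σ ] Feasible I σ × value obj I σ ℚ.≤ fromℕ B) → Sub ws B)
    sub⇔cheap obj = (λ s → witness-sound obj (proj₂ (sub⇒witness obj s))) ,
      λ (σ , feas , v) → feasible⇒sub feas (cheap⇒unselected obj feas (ℚ.≤-<-trans v (fromℕ-mono-< (m<n*m B c 1<c))))
      where
      m<n*m : ∀ m n → .{{_ : Data.Nat.Base.NonZero m}} → 1 < n → m < n * m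
      m<n*m m n h = subst (_< n * m) (*-identityˡ m) (*-monoˡ-< m h)

-- The subset sum instance of an input word.

module SubsetSumInstance where

  open import Defs hiding (t; a; d)
  open TilingToSubsetSum
  open MachineTiles
  open TilingAcceptance
  open import Data.Bool.Base using (Bool; T)
  open import Data.List.Base using (List; []; _∷_; _++_; map; length; replicate)
  import Data.List.Properties as List
  open import Data.List.Relation.Unary.All using (All; []; _∷_)
  open import Data.Maybe.Base using (just; nothing)
  open import Data.Nat.Base
  open import Data.Nat.Properties
  open import Data.Nat.Tactic.RingSolver using (solve-∀)
  open import Data.Product.Base using (∃-syntax; _×_; _,_)
  open import Function.Base using (_∘_)
  open import Function.Bundles using (_⇔_; mk⇔; Equivalence)
  open import Relation.Binary.PropositionalEquality using (_≡_; refl; sym; trans; cong; cong₂; subst; subst₂)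

  eval-mono : ∀ p {m n} → m ≤ n → eval p m ≤ eval p n
  eval-mono []      h = z≤n
  eval-mono (c ∷ p) h = +-monoʳ-≤ c (*-mono-≤ h (eval-mono p h))

  n<2^n : ∀ n → n < 2 ^ n
  n<2^n zero    = s≤s z≤n
  n<2^n (suc n) = ≤-trans (s≤s (n<2^n n)) (≤-trans (+-monoˡ-≤ (2 ^ n) (≤-trans (s≤s z≤n) (n<2^n n))) (≤-reflexive (cong (2 ^ n +_) (sym (+-identityʳ (2 ^ n))))))

  module Numbers (M : Machine) (p q : Polynomial) where
    open Tableau M
    open Acceptance M

    -- `2 ^ β` exceeds `β`, the bound that excludes carries, and as a power of two it turns
    -- multiplication into shifting.
    C β : ℕ
    C = colours
    β = length tiles * suc C + suc C

    private
      b : ℕ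
      b = 2 ^ β

    open Coding tiles C (2 ^ β) tiles-bounded (n<2^n β) public

    -- `rounds` exceeds the running time on every candidate `frame x ++ c`. A row has
    -- `suc (width x)` cells, the last one being its right end.
    certLength rounds width : List Bool → ℕ
    certLength x = eval q (length x)
    rounds x     = suc (eval p (length (frame x) + certLength x))
    width x      = length (frame x) + (certLength x + rounds x)

    cells : List Bool → List V
    cells x = bottom (frame x) (certLength x) (rounds x)

    -- A digit of the goal without its counter. The colour `c` is deducted from the south field
    -- because the initial queue contributes it; in this way `goal` is `full` minus the initial
    -- queue, formed digit by digit without borrows.
    digit′ : ℕ → ℕ
    digit′ c = 2 ^ β * ((C ∸ c) + 2 ^ β * C)

    digitsOf : List ℕ → ℕ → List ℕ
    digitsOf cs r = map (suc ∘ digit′) cs ++ replicate r (suc (digit′ 0))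

    padding : List Bool → ℕ
    padding x = suc (rounds x) * suc (width x)

    goal : List Bool → ℕ
    goal x = horner base (digitsOf (southCodes (cells x)) (padding x))

    weights : List Bool → List ℕ
    weights x = items (width x) (suc (suc (rounds x)) * suc (width x))

    private
      length-cells : ∀ x → length (cells x) ≡ suc (width x)
      length-cells x = trans (List.length-++ (map (init ∘ given) (frame x)))
        (trans (cong₂ _+_ (List.length-map (init ∘ given) (frame x))
          (trans (List.length-++ (replicate (certLength x) (init wild)))
            (cong₂ _+_ (List.length-replicate (certLength x)) (trans (List.length-++ (replicate (rounds x) (init empty))) (cong (_+ 1) (List.length-replicate (rounds x)))))))
          (shift (length (frame x)) (certLength x) (rounds x)))
        where
        shift : ∀ f c r → f + (c + (r + 1)) ≡ suc (f + (c + r))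
        shift = solve-∀

      length-codes : ∀ x → length (southCodes (cells x)) ≡ suc (width x)
      length-codes x = trans (List.length-map _ (cells x)) (length-cells x)

      codes≤C : ∀ ss → All (_≤ C) (southCodes ss)
      codes≤C []       = []
      codes≤C (s ∷ ss) = northCode≤ (just s) ∷ codes≤C ss

      digits-full : ∀ W r cs → All (_≤ C) cs → horner base (digitsOf cs r) + b * horner base cs ≡ full W (length cs + r)
      digits-full W zero    []       [] = *-zeroʳ b
      digits-full W (suc r) []       [] = trans (cong (_+ b * 0) (refl {x = suc (digit′ 0) + base * horner base (digitsOf [] r)}))
        (trans (cong (suc (digit′ 0) + base * horner base (digitsOf [] r) +_) (*-zeroʳ b))
          (trans (+-identityʳ _) (cong (λ k → suc (digit′ 0) + base * k)
            (trans (sym (+-identityʳ _)) (trans (cong (horner base (digitsOf [] r) +_) (sym (*-zeroʳ b))) (digits-full W r [] []))))))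
      digits-full W r (c ∷ cs) (c≤ ∷ cs≤) = trans (identity b (C ∸ c) c C (horner base (digitsOf cs r)) (horner base cs))
        (cong₂ (λ k h → 1 + b * (k + b * C) + base * h) (m∸n+n≡m c≤) (digits-full W r cs cs≤))
        where
        identity : ∀ b c′ c C h k → suc (b * (c′ + b * C)) + b * (b * b) * h + b * (c + b * (b * b) * k) ≡ 1 + b * ((c′ + c) + b * C) + b * (b * b) * (h + b * k)
        identity = solve-∀

      total : ∀ x → length (southCodes (cells x)) + padding x ≡ suc (suc (rounds x)) * suc (width x)
      total x = cong (_+ padding x) (length-codes x)

      goal-full : ∀ x → goal x + (b * b * 0 + b * horner base (southCodes (cells x))) ≡ full (width x) (suc (suc (rounds x)) * suc (width x))
      goal-full x = trans (cong (λ k → goal x + (k + b * horner base (southCodes (cells x)))) (*-zeroʳ (b * b)))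
        (trans (digits-full (width x) (padding x) (southCodes (cells x)) (codes≤C (cells x))) (cong (full (width x)) (total x)))

      -- The head cell of the tableau carries the first input bit, so the input must be nonempty; a
      -- frame always is.
      framed : ∀ x → ∃[ c ] ∃[ w ] frame x ≡ c ∷ w
      framed []      = _ , _ , refl
      framed (c ∷ x) = _ , _ , refl

    module _ {v : List Bool → Bool} (decides : ∀ z → OutputsWithin M (eval p (length z)) z (v z ∷ [])) where

      private
        chain⇔ : ∀ x → Chain (suc (suc (rounds x))) nothing (cells x) ⇔ (∃[ c ] length c ≤ certLength x × T (v (frame x ++ c)))
        chain⇔ x = go (frame x) (framed x) refl
          where
          go : ∀ f → (∃[ c ] ∃[ w ] f ≡ c ∷ w) → f ≡ frame x →
            Chain (suc (suc (rounds x))) nothing (bottom f (certLength x) (rounds x)) ⇔ (∃[ c ] length c ≤ certLength x × T (v (f ++ c)))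
          go f (c , w , refl) eq = chain⇔accept {v} {eval p} decides c w (certLength x) (rounds x)
            (λ u le → s≤s (eval-mono p (≤-trans (≤-reflexive (List.length-++ (c ∷ w))) (+-mono-≤ (≤-reflexive (cong length eq)) le))))

        tiling⇔ : ∀ x → Tiling tiles (suc (suc (rounds x)) * suc (width x)) 0 (southCodes (cells x)) ⇔ Chain (suc (suc (rounds x))) nothing (cells x)
        tiling⇔ x = mk⇔
          (λ t → tiling⇒chain (suc (rounds x)) nothing (cells x) (≤-trans (s≤s z≤n) (≤-reflexive (sym (length-cells x))))
            (subst₂ (λ k c → Tiling tiles (suc (suc (rounds x)) * k) c (southCodes (cells x))) (sym (length-cells x)) (sym sideCode-nothing) t))
          (λ ch → subst₂ (λ k c → Tiling tiles (suc (suc (rounds x)) * k) c (southCodes (cells x))) (length-cells x) sideCode-nothing (chain⇒tiling ch))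

        sub⇔ : ∀ x → Sub (weights x) (goal x) ⇔ Tiling tiles (suc (suc (rounds x)) * suc (width x)) 0 (southCodes (cells x))
        sub⇔ x = mk⇔
          (λ s → sub⇒tiling (width x) _ (length-codes x) z≤n (codes≤C (cells x)) s (goal-full x))
          (λ t → let (y , s , eq) = tiling⇒sub (width x) (length-codes x) t
                 in subst (Sub (weights x)) (+-cancelʳ-≡ _ y (goal x) (trans eq (sym (goal-full x)))) s)

      subset-sum⇔ : ∀ x → (∃[ c ] length c ≤ certLength x × T (v (pair x c))) ⇔ Sub (weights x) (goal x)
      subset-sum⇔ x = mk⇔
        (λ h → Equivalence.from (sub⇔ x) (Equivalence.from (tiling⇔ x) (Equivalence.from (chain⇔ x) h)))
        (λ s → Equivalence.to (chain⇔ x) (Equivalence.to (tiling⇔ x) (Equivalence.to (sub⇔ x) s)))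

-- The reduction as a program.

module ReductionProgram where

  open import Defs hiding (t; a; d)
  open Computable
  open ListPrograms
  open BinaryPrograms
  open ProblemCodes
  open TilingToSubsetSum
  open MachineTiles
  open TilingAcceptance
  open SubsetSumGadget using (gadget; small)
  open SubsetSumInstance
  open import Data.Bool.Base using (Bool; true; false)
  open import Data.List.Base using (List; []; _∷_; _++_; map; length; replicate; foldr; concatMap; reverse; _ʳ++_)
  import Data.List.Properties as List
  open import Data.Maybe.Base using (just)
  open import Data.Nat.Base
  open import Data.Nat.Properties
  open import Data.Product.Base using (_,_)
  open import Data.Unit.Base using (⊤; tt)
  open import Function.Base using (_∘_)
  open import Relation.Binary.PropositionalEquality using (_≡_; refl; sym; trans; cong; cong₂)

  private
    variable
      A B Γ : Ty

  -- Lengths of rows and numbers of rounds are polynomial in the input. They are computed in unary,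
  -- where they can drive loops; only weights and goal are binary.
  unit unary : Ty
  unit  = prim ⊤ (λ _ → [])
  unary = list unit

  ticks : ℕ → List ⊤
  ticks n = replicate n tt

  Unary : (Γ : Ty) → (El Γ → ℕ) → Set
  Unary Γ f = Comp Γ unary (λ γ → ticks (f γ))

  private
    ticks-+ : ∀ m n → ticks m ++ ticks n ≡ ticks (m + n)
    ticks-+ zero    n = refl
    ticks-+ (suc m) n = cong (tt ∷_) (ticks-+ m n)

    ticks-* : ∀ m n → concatMap (λ _ → ticks n) (ticks m) ≡ ticks (m * n)
    ticks-* zero    n = refl
    ticks-* (suc m) n = trans (cong (ticks n ++_) (ticks-* m n)) (ticks-+ n (m * n))

  lengthᵁ : ∀ {f : El Γ → Bits} → Comp Γ bits f → Unary Γ (λ γ → length (f γ))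
  lengthᵁ {f = f} f∈ = compᶜ {g = λ w → ticks (length w)} (extᶜ (λ w → trans (go w []) (List.++-identityʳ _))
      (compᶜ (zfoldᶜ {S = unary} {g = λ _ _ s → tt ∷ s} (λ _ _ → consᶜ (constᶜ tt) idᶜ) 1 (λ _ _ s → ≤-reflexive (+-comm 1 (len unary s))))
        (pairᶜ idᶜ (pairᶜ (constᶜ []) (constᶜ []))))) f∈
    where
    ticks-suc : ∀ n s → ticks n ++ tt ∷ s ≡ tt ∷ ticks n ++ s
    ticks-suc zero    s = refl
    ticks-suc (suc n) s = cong (tt ∷_) (ticks-suc n s)
    go : ∀ w s → zfold (λ _ _ s → tt ∷ s) w [] s ≡ ticks (length w) ++ s
    go []      s = refl
    go (x ∷ w) s = trans (go w (tt ∷ s)) (ticks-suc (length w) s)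

  constᵁ : ∀ n → Unary Γ (λ _ → n)
  constᵁ n = constᶜ (ticks n)

  _+ᵁ_ : ∀ {f g : El Γ → ℕ} → Unary Γ f → Unary Γ g → Unary Γ (λ γ → f γ + g γ)
  _+ᵁ_ {f = f} {g} f∈ g∈ = extᶜ (λ γ → ticks-+ (f γ) (g γ)) (appendᶜ f∈ g∈)

  _*ᵁ_ : ∀ {f g : El Γ → ℕ} → Unary Γ f → Unary Γ g → Unary Γ (λ γ → f γ * g γ)
  _*ᵁ_ {f = f} {g} f∈ g∈ = extᶜ (λ γ → ticks-* (f γ) (g γ)) (concatMapᶜ {f = λ (γ , _) → ticks (g γ)} f∈ (compᶜ g∈ fstᶜ))

  evalᵁ : ∀ p {f : El Γ → ℕ} → Unary Γ f → Unary Γ (λ γ → eval p (f γ))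
  evalᵁ []      f∈ = constᵁ 0
  evalᵁ (c ∷ p) f∈ = constᵁ c +ᵁ (f∈ *ᵁ evalᵁ p f∈)

  copiesᶜ : ∀ (b : El B) {f : El Γ → ℕ} → Unary Γ f → Comp Γ (list B) (λ γ → replicate (f γ) b)
  copiesᶜ b {f} f∈ = extᶜ (λ γ → go (f γ)) (mapᶜ {f = λ _ → b} f∈ (constᶜ b))
    where
    go : ∀ n → map (λ _ → b) (ticks n) ≡ replicate n b
    go zero    = refl
    go (suc n) = cong (b ∷_) (go n)

  initials : ℕ → List (List ⊤)
  initials zero    = []
  initials (suc n) = [] ∷ map (tt ∷_) (initials n)

  -- The proper tails of a list of `n` ticks are the unary numbers below `n`. The fold meets them in
  -- decreasing order, so consing collects them in increasing order.
  initialsᶜ : ∀ {f : El Γ → ℕ} → Unary Γ f → Comp Γ (list unary) (λ γ → initials (f γ))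
  initialsᶜ {f = f} f∈ = extᶜ (λ γ → trans (go (f γ) []) (List.++-identityʳ (initials (f γ))))
    (compᶜ (foldTailᶜ {A = unit} {Γ = bits} {S = list unary} {g = λ (_ , (_ , u) , s) → u ∷ s}
             (consᶜ (compᶜ sndᶜ (compᶜ fstᶜ sndᶜ)) (compᶜ sndᶜ sndᶜ)) (𝕂 1 ⊕ 𝕏 ⊗ 𝕂 2)
             (λ γ a u s → ≤-trans (≤-reflexive (trans (len-∷ unary u s) (+-comm (suc (len unary u * 2)) (len (list unary) s))))
               (+-monoʳ-≤ (len (list unary) s) (s≤s (*-monoˡ-≤ 2 (≤-trans (len-tail unit a u) (m≤n+m (len unary (a ∷ u)) (length γ))))))))
      (pairᶜ f∈ (pairᶜ (constᶜ []) (constᶜ []))))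
    where
    initials-last : ∀ n → initials (suc n) ≡ initials n ++ ticks n ∷ []
    initials-last zero    = refl
    initials-last (suc n) = cong ([] ∷_) (trans (cong (map (tt ∷_)) (initials-last n)) (List.map-++ (tt ∷_) (initials n) (ticks n ∷ [])))
    go : ∀ n s → foldTail {Γ = Bits} (λ (_ , (_ , u) , s) → u ∷ s) [] (ticks n) s ≡ initials n ++ s
    go zero    s = refl
    go (suc n) s = trans (go n (ticks n ∷ s)) (trans (sym (List.++-assoc (initials n) (ticks n ∷ []) s)) (cong (_++ s) (sym (initials-last n))))

  multipleᶜ : ∀ k {f : El Γ → ℕ} → Comp Γ nat f → Comp Γ nat (λ γ → k * f γ)
  multipleᶜ zero    f∈ = constᶜ 0
  multipleᶜ (suc k) f∈ = f∈ +ᶜ multipleᶜ k f∈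

  powerᶜ : ∀ k {f : El Γ → ℕ} → Comp Γ nat f → Comp Γ nat (λ γ → 2 ^ k * f γ)
  powerᶜ zero    {f} f∈ = extᶜ (λ γ → sym (+-identityʳ (f γ))) f∈
  powerᶜ (suc k) {f} f∈ = extᶜ (λ γ → sym (*-assoc 2 (2 ^ k) (f γ))) (doubleᶜ (powerᶜ k f∈))

  len-power : ∀ k n → len nat (2 ^ k * n) ≤ k + len nat n
  len-power zero    n = ≤-reflexive (cong (len nat) (+-identityʳ n))
  len-power (suc k) n = ≤-trans (≤-reflexive (cong (len nat) (*-assoc 2 (2 ^ k) n))) (≤-trans (len-double (2 ^ k * n)) (s≤s (len-power k n)))

  module Program (M : Machine) (p q : Polynomial) where
    open Tableau M using (init)
    open Acceptance M
    open Numbers M p q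

    private
      b : ℕ
      b = 2 ^ β

      assoc³ : ∀ n → b * (b * (b * n)) ≡ base * n
      assoc³ n = trans (cong (b *_) (sym (*-assoc b b n))) (sym (*-assoc b (b * b) n))

      baseᶜ : ∀ {f : El Γ → ℕ} → Comp Γ nat f → Comp Γ nat (λ γ → base * f γ)
      baseᶜ {f = f} f∈ = extᶜ (λ γ → assoc³ (f γ)) (powerᶜ β (powerᶜ β (powerᶜ β f∈)))

      len-base : ∀ n → len nat (base * n) ≤ len nat n + (β + (β + β))
      len-base n = ≤-trans (≤-reflexive (cong (len nat) (sym (assoc³ n))))
        (≤-trans (len-power β (b * (b * n))) (≤-trans (+-monoʳ-≤ β (≤-trans (len-power β (b * n)) (+-monoʳ-≤ β (len-power β n))))
          (≤-reflexive (trans (cong (β +_) (sym (+-assoc β β (len nat n)))) (trans (sym (+-assoc β (β + β) (len nat n))) (+-comm (β + (β + β)) (len nat n)))))))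

      shiftBy : ℕ → List ⊤ → ℕ
      shiftBy c u = foldr (λ _ s → base * s) c u

      shiftᶜ : ∀ {c : El Γ → ℕ} {u : El Γ → List ⊤} → Comp Γ nat c → Comp Γ unary u → Comp Γ nat (λ γ → shiftBy (c γ) (u γ))
      shiftᶜ c∈ u∈ = foldrᶜ {A = unit} {S = nat} {g = λ (_ , (_ , s)) → base * s} u∈ c∈ (baseᶜ (compᶜ sndᶜ sndᶜ)) (𝕂 (β + (β + β)))
        (λ _ _ s → len-base s)

      shift-ticks : ∀ c n → shiftBy c (ticks n) ≡ base ^ n * c
      shift-ticks c zero    = sym (+-identityʳ c)
      shift-ticks c (suc n) = trans (cong (base *_) (shift-ticks c n)) (sym (*-assoc base (base ^ n) c))

      certLengthᵁ : ∀ {x : El Γ → Bits} → Comp Γ bits x → Unary Γ (λ γ → certLength (x γ))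
      certLengthᵁ x∈ = evalᵁ q (lengthᵁ x∈)

      roundsᵁ : ∀ {x : El Γ → Bits} → Comp Γ bits x → Unary Γ (λ γ → rounds (x γ))
      roundsᵁ x∈ = constᵁ 1 +ᵁ evalᵁ p (lengthᵁ (compᶜ frameᶜ x∈) +ᵁ certLengthᵁ x∈)

      widthᵁ : ∀ {x : El Γ → Bits} → Comp Γ bits x → Unary Γ (λ γ → width (x γ))
      widthᵁ x∈ = lengthᵁ (compᶜ frameᶜ x∈) +ᵁ (certLengthᵁ x∈ +ᵁ roundsᵁ x∈)

      paddingᵁ : ∀ {x : El Γ → Bits} → Comp Γ bits x → Unary Γ (λ γ → padding (x γ))
      paddingᵁ x∈ = (constᵁ 1 +ᵁ roundsᵁ x∈) *ᵁ (constᵁ 1 +ᵁ widthᵁ x∈)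

      weighᶜ : ∀ τ {x : El Γ → Bits} → Comp Γ bits x → Comp Γ nat (λ γ → weigh (width (x γ)) τ)
      weighᶜ τ {x} x∈ = extᶜ (λ γ → cong (λ k → (1 + b * ((C ∸ south τ) + b * (C ∸ west τ))) + base * (b * b * east τ + k)) (shift-ticks (b * north τ) (width (x γ))))
        (constᶜ (1 + b * ((C ∸ south τ) + b * (C ∸ west τ))) +ᶜ baseᶜ (constᶜ (b * b * east τ) +ᶜ shiftᶜ (constᶜ (b * north τ)) (widthᵁ x∈)))

      weighsᶜ : ∀ ts {x : El Γ → Bits} → Comp Γ bits x → Comp Γ (list nat) (λ γ → map (weigh (width (x γ))) ts)
      weighsᶜ []       x∈ = constᶜ []
      weighsᶜ (τ ∷ ts) x∈ = consᶜ (weighᶜ τ x∈) (weighsᶜ ts x∈)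

      -- `items` rescales all later weights at every cell. Shifting the weights of each cell once,
      -- by its own number of places, gives the same list in two nested loops.
      shifted-items : ∀ W L → concatMap (λ u → map (λ c → shiftBy c u) (map (weigh W) tiles)) (initials L) ≡ items W L
      shifted-items W zero    = refl
      shifted-items W (suc L) = cong₂ _++_ (List.map-id (map (weigh W) tiles)) (trans (tail (initials L)) (cong (map (base *_)) (shifted-items W L)))
        where
        cs = map (weigh W) tiles
        tail : ∀ us → concatMap (λ u → map (λ c → shiftBy c u) cs) (map (tt ∷_) us) ≡ map (base *_) (concatMap (λ u → map (λ c → shiftBy c u) cs) us)
        tail []       = refl
        tail (u ∷ us) = trans (cong₂ _++_ (List.map-∘ cs) (tail us)) (sym (List.map-++ (base *_) (map (λ c → shiftBy c u) cs) _))

    weightsᶜ : Comp bits (list nat) weights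
    weightsᶜ = extᶜ (λ x → shifted-items (width x) (suc (suc (rounds x)) * suc (width x)))
      (concatMapᶜ {Γ = bits} {A = unary} {B = nat} {f = λ (x , u) → map (λ c → shiftBy c u) (map (weigh (width x)) tiles)}
        (initialsᶜ ((constᵁ 2 +ᵁ roundsᵁ idᶜ) *ᵁ (constᵁ 1 +ᵁ widthᵁ idᶜ)))
        (mapᶜ {f = λ ((x , u) , c) → shiftBy c u} (weighsᶜ tiles fstᶜ) (shiftᶜ sndᶜ (compᶜ sndᶜ fstᶜ))))

    private
      code : Init → ℕ
      code i = northCode (just (init i))

      dig : Init → ℕ
      dig i = suc (digit′ (code i))

      layout : Bits → Bits → List ℕ
      layout w x = map (dig ∘ given) w ++ (replicate (certLength x) (dig wild) ++ (replicate (rounds x) (dig empty) ++ (dig last ∷ replicate (padding x) (suc (digit′ 0)))))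

      layout-digits : ∀ x → digitsOf (southCodes (cells x)) (padding x) ≡ layout (frame x) x
      layout-digits x = trans (cong (_++ pad) (trans (sym (List.map-∘ (cells x))) (parts (frame x)))) (regroup (frame x))
        where
        pad = replicate (padding x) (suc (digit′ 0))
        f : _ → ℕ
        f = λ s → suc (digit′ (northCode (just s)))
        trailer = replicate (certLength x) (dig wild) ++ (replicate (rounds x) (dig empty) ++ (dig last ∷ []))
        parts : ∀ w → map f (bottom w (certLength x) (rounds x)) ≡ map (dig ∘ given) w ++ trailer
        parts []      = trans (List.map-++ f (replicate (certLength x) (init wild)) _)
          (cong₂ _++_ (List.map-replicate f (certLength x) (init wild)) (trans (List.map-++ f (replicate (rounds x) (init empty)) _)
            (cong (_++ (dig last ∷ [])) (List.map-replicate f (rounds x) (init empty)))))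
        parts (c ∷ w) = cong (dig (given c) ∷_) (parts w)
        regroup : ∀ w → (map (dig ∘ given) w ++ trailer) ++ pad ≡ layout w x
        regroup []      = trans (List.++-assoc (replicate (certLength x) (dig wild)) _ pad)
          (cong (replicate (certLength x) (dig wild) ++_) (List.++-assoc (replicate (rounds x) (dig empty)) _ pad))
        regroup (c ∷ w) = cong (dig (given c) ∷_) (regroup w)

      spellᶜ : ∀ (f : Bool → ℕ) {w : El Γ → Bits} → Comp Γ bits w → Comp Γ (list nat) (λ γ → map f (w γ))
      spellᶜ f {w} w∈ = compᶜ {g = map f} (extᶜ (λ w → trans (cong reverse (go w [])) (List.reverse-involutive (map f w)))
          (compᶜ {f = λ w → zfold (λ x _ s → f x ∷ s) w [] []} reverseᶜ
            (compᶜ (zfoldᶜ {S = list nat} {g = λ x _ s → f x ∷ s} (λ x _ → consᶜ (constᶜ (f x)) idᶜ) (suc ((len nat (f false) + len nat (f true)) * 2)) grow)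
              (pairᶜ idᶜ (pairᶜ (constᶜ []) (constᶜ [])))))) w∈
        where
        go : ∀ w s → zfold (λ x _ s → f x ∷ s) w [] s ≡ map f w ʳ++ s
        go []      s = refl
        go (x ∷ w) s = go w (f x ∷ s)
        either : ∀ x → len nat (f x) ≤ len nat (f false) + len nat (f true)
        either false = m≤m+n _ _
        either true  = m≤n+m _ _
        grow : ∀ x y s → len (list nat) (f x ∷ s) ≤ len (list nat) s + suc ((len nat (f false) + len nat (f true)) * 2)
        grow x y s = ≤-trans (≤-reflexive (trans (len-∷ nat (f x) s) (+-comm (suc (len nat (f x) * 2)) (len (list nat) s))))
          (+-monoʳ-≤ (len (list nat) s) (s≤s (*-monoˡ-≤ 2 (either x))))

      layoutᶜ : Comp (bits ⊠ bits) (list nat) (λ (w , x) → layout w x)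
      layoutᶜ = appendᶜ (spellᶜ (dig ∘ given) fstᶜ) (appendᶜ (copiesᶜ (dig wild) (certLengthᵁ sndᶜ)) (appendᶜ (copiesᶜ (dig empty) (roundsᵁ sndᶜ))
        (consᶜ (constᶜ (dig last)) (copiesᶜ (suc (digit′ 0)) (paddingᵁ sndᶜ)))))

      hornerᶜ : ∀ {l : El Γ → List ℕ} → Comp Γ (list nat) l → Comp Γ nat (λ γ → horner base (l γ))
      hornerᶜ {l = l} l∈ = extᶜ (λ γ → go (l γ))
        (foldrᶜ {A = nat} {S = nat} {g = λ (_ , (d , s)) → d + base * s} l∈ (constᶜ 0) (compᶜ fstᶜ sndᶜ +ᶜ baseᶜ (compᶜ sndᶜ sndᶜ))
          (𝕂 (suc (β + (β + β))) ⊕ 𝕏) grow)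
        where
        go : ∀ l → foldr (λ d s → d + base * s) 0 l ≡ horner base l
        go []      = refl
        go (d ∷ l) = cong (λ h → d + base * h) (go l)
        grow : ∀ γ d s → len nat (d + base * s) ≤ len nat s + (suc (β + (β + β)) + (_ + len nat d))
        grow γ d s = ≤-trans (len-+ d (base * s)) (≤-trans (s≤s (+-monoʳ-≤ (len nat d) (len-base s)))
          (≤-trans (≤-reflexive (rearrange (len nat d) (len nat s) (β + (β + β)))) (+-monoʳ-≤ (len nat s) (+-monoʳ-≤ (suc (β + (β + β))) (m≤n+m (len nat d) _)))))
          where
          open import Data.Nat.Tactic.RingSolver using (solve-∀)
          rearrange : ∀ d s B → suc (d + (s + B)) ≡ s + (suc B + d)
          rearrange = solve-∀

    -- The predecessor of the goal, which is the parameter of `gadget`. It is obtained without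
    -- subtraction by leaving the counter out of the lowest digit.
    goal₀ : Bits → ℕ
    goal₀ x = bitsMatch (λ _ → 0) (λ c (w , x) → digit′ (code (given c)) + base * horner base (layout w x)) (frame x , x)

    goal₀ᶜ : Comp bits nat goal₀
    goal₀ᶜ = compᶜ (bitsCase (constᶜ 0) (λ c → constᶜ (digit′ (code (given c))) +ᶜ baseᶜ (hornerᶜ layoutᶜ))) (pairᶜ frameᶜ idᶜ)

    goal≡suc : ∀ x → goal x ≡ suc (goal₀ x)
    goal≡suc x = trans (cong (horner base) (layout-digits x)) (go x)
      where
      go : ∀ x → horner base (layout (frame x) x) ≡ suc (goal₀ x)
      go []      = refl
      go (c ∷ x) = refl

    module _ (c : ℕ) where

      instanceOf : Bits → Instance
      instanceOf x = gadget c (goal₀ x) (weights x)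

      private
        goalᶜ : Comp bits nat (λ x → suc (goal₀ x))
        goalᶜ = constᶜ 1 +ᶜ goal₀ᶜ

      instanceOfᶜ : Comp bits (list jobTy) instanceOf
      instanceOfᶜ = consᶜ (jobᶜ (multipleᶜ c goalᶜ) (constᶜ 0) (multipleᶜ c goalᶜ +ᶜ goal₀ᶜ))
        (mapᶜ {f = λ (x , w) → small (suc (goal₀ x)) w} weightsᶜ (jobᶜ sndᶜ (constᶜ 0) (compᶜ goalᶜ fstᶜ)))

      problemOfᶜ : Comp bits bits (λ x → encodeProblem (suc (goal₀ x) , instanceOf x))
      problemOfᶜ = encodeProblemᶜ goalᶜ instanceOfᶜ

-- NP-hardness and inapproximability.

module Hardness where

  open import Defs hiding (t; a; d)
  open MachineComposition
  open Computable
  open ListPrograms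
  open BinaryPrograms
  open UnitStepSchedules using (≢true⇒false)
  open ProblemCodes
  open Membership
  open Rationals
  open Measure using (y∞-absent; y∞-pos)
  open FeasibleSchedules using (selected; selected-true; isPositive-cases)
  open TilingToSubsetSum using (Sub)
  open SubsetSumGadget
  open SubsetSumInstance
  open ReductionProgram
  open import Data.Bool.Base using (Bool; true; false; not; T)
  open import Data.Empty using (⊥; ⊥-elim)
  open import Data.Fin.Base as Fin using (Fin; toℕ)
  import Data.Fin.Properties as Fin
  open import Data.Integer.Base as ℤ using (+_; -[1+_])
  import Data.Integer.Properties as ℤ
  open import Data.List.Base using (List; []; _∷_; _++_; length; concatMap)
  import Data.List.Properties as List
  open import Data.List.Membership.Propositional using (_∈_)
  open import Data.List.Relation.Unary.All as All using (All)
  open import Data.List.Relation.Unary.Any as Any using (Any; here; there)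
  open import Data.Nat.Base as ℕ using (ℕ; suc; _+_; _*_; _≤_; _<_; z≤n; s≤s)
  import Data.Nat.Properties as ℕ
  open import Data.Product.Base using (Σ; ∃-syntax; _×_; _,_; proj₁; proj₂)
  open import Data.Rational.Base as ℚ using (0ℚ; 1ℚ; ↥_; ↧ₙ_)
  import Data.Rational.Properties as ℚ
  import Data.Rational.Unnormalised.Base as ℚᵘ
  import Data.Rational.Unnormalised.Properties as ℚᵘ
  open import Data.Sum.Base using (_⊎_; inj₁; inj₂)
  open import Data.Unit.Base using (tt)
  open import Function.Base using (_∘_)
  open import Function.Bundles using (_⇔_; mk⇔; Equivalence)
  open import Relation.Binary.PropositionalEquality using (_≡_; _≢_; refl; sym; trans; cong; subst)

  encodeProblem-injective : ∀ {K K′ I I′} → encodeProblem (K , I) ≡ encodeProblem (K′ , I′) → (K , I) ≡ (K′ , I′)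
  encodeProblem-injective {K} {K′} {I} {I′} eq = trans (sym (decode-encode K I)) (trans (cong decodeProblem eq) (decode-encode K′ I′))

  LazyBureaucrat-encoded : ∀ {obj K I} → LazyBureaucrat obj (encodeProblem (K , I)) → ∃[ σ ] Feasible I σ × value obj I σ ℚ.≤ fromℕ K
  LazyBureaucrat-encoded {obj} {K} {I} (I′ , K′ , eq , sol) =
    subst (λ (K , I) → ∃[ σ ] Feasible I σ × value obj I σ ℚ.≤ fromℕ K) (encodeProblem-injective {K′} {K} {I′} {I} (sym eq)) sol

  LazyBureaucrat-hard : ∀ obj A → InNP A → A ≤ₚ LazyBureaucrat obj
  LazyBureaucrat-hard obj A (v , q , (M , p , decides) , iff) =
    -- 2 is the least `c` for which the long job alone exceeds the bound `B`.
    (λ x → encodeProblem (suc (goal₀ x) , instanceOf 2 x)) , Comp⇒PolyTime (problemOfᶜ 2) , λ x → mk⇔ (to x) (from x)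
    where
    open Numbers M p q
    open Program M p q
    sub : ∀ x → A x ⇔ Sub (weights x) (suc (goal₀ x))
    sub x = mk⇔ (λ h → subst (Sub (weights x)) (goal≡suc x) (Equivalence.to (subset-sum⇔ decides x) (Equivalence.to (iff x) h)))
                (λ s → Equivalence.from (iff x) (Equivalence.from (subset-sum⇔ decides x) (subst (Sub (weights x)) (sym (goal≡suc x)) s)))
    cheap = λ x → sub⇔cheap 2 (goal₀ x) (weights x) (s≤s (s≤s z≤n)) obj
    to : ∀ x → A x → LazyBureaucrat obj (encodeProblem (suc (goal₀ x) , instanceOf 2 x))
    to x h = instanceOf 2 x , suc (goal₀ x) , refl , proj₁ (cheap x) (Equivalence.to (sub x) h)
    from : ∀ x → LazyBureaucrat obj (encodeProblem (suc (goal₀ x) , instanceOf 2 x)) → A x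
    from x h = Equivalence.from (sub x) (proj₂ (cheap x) (LazyBureaucrat-encoded {obj} {suc (goal₀ x)} {instanceOf 2 x} h))

  -- Stated for single inputs and not for polynomial-time functions, because an approximation
  -- algorithm is only known to behave on codes of instances.
  compose-within : ∀ M₁ p₁ M₂ p₂ → Σ Machine λ M → Σ Polynomial λ p → ∀ {x y z} →
    OutputsWithin M₁ (eval p₁ (length x)) x y → OutputsWithin M₂ (eval p₂ (length y)) y z → OutputsWithin M (eval p (length x)) x z
  compose-within M₁ p₁ M₂ p₂ = Composition.compose M₁ M₂ , toPolynomial bd , λ {x} {y} o₁ o₂ → outputs-mono (bound x y o₁) (Composition.compose-outputs M₁ M₂ o₁ o₂)
    where
    P₁ P₂ out bd : Px
    P₁ = fromPolynomial p₁
    P₂ = fromPolynomial p₂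
    out = 𝕂 1 ⊕ (P₁ ⊕ 𝕏)
    bd = ((𝕂 1 ⊕ 𝕏) ⊕ (𝕂 1 ⊕ 𝕏)) ⊕ ((P₁ ⊕ 𝕂 1) ⊕ (((𝕂 1 ⊕ out) ⊕ (𝕂 1 ⊕ out)) ⊕ (P₂ ∘ₚ out)))
    outputs-mono : ∀ {M t t′ x z} → t ≤ t′ → OutputsWithin M t x z → OutputsWithin M t′ x z
    outputs-mono le (n , d , n≤ , h , o) = n , d , ℕ.≤-trans n≤ le , h , o
    bound : ∀ x y → OutputsWithin M₁ (eval p₁ (length x)) x y →
      Composition.compose-time M₁ M₂ (eval p₁ (length x)) (eval p₂ (length y)) (length x) (length y) ≤ eval (toPolynomial bd) (length x)
    bound x y o₁ = ℕ.≤-trans (ℕ.+-monoʳ-≤ (suc (length x) + suc (length x)) (ℕ.+-mono-≤ (ℕ.≤-reflexive (cong (_+ 1) e₁))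
        (ℕ.+-mono-≤ (ℕ.+-mono-≤ (s≤s len-y) (s≤s len-y)) time₂))) (ℕ.≤-reflexive (sym (toPolynomial-eval bd (length x))))
      where
      e₁ : eval p₁ (length x) ≡ ⟦ P₁ ⟧ (length x)
      e₁ = sym (fromPolynomial-eval p₁ (length x))
      len-y : length y ≤ ⟦ out ⟧ (length x)
      len-y = ℕ.≤-trans (output-length o₁) (ℕ.≤-reflexive (cong (λ k → suc (k + length x)) e₁))
      time₂ : eval p₂ (length y) ≤ ⟦ P₂ ∘ₚ out ⟧ (length x)
      time₂ = ℕ.≤-trans (ℕ.≤-reflexive (sym (fromPolynomial-eval p₂ (length y)))) (mono-∘ₚ P₂ out (length x) len-y)

  PolyTime-∘ : ∀ {f g} → PolyTime g → PolyTime f → PolyTime (g ∘ f)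
  PolyTime-∘ {f} (M₂ , p₂ , run₂) (M₁ , p₁ , run₁) =
    let M , p , composed = compose-within M₁ p₁ M₂ p₂ in M , p , λ x → composed (run₁ x) (run₂ (f x))

  -- The zero polynomial admits only the empty certificate; the verifier strips the frame and
  -- decides.
  P⊆NP : ∀ {L} → InP L → InNP L
  P⊆NP {L} (v , (M , p , decides) , iff) = v ∘ unframe , [] , time , λ x → mk⇔
      (λ h → [] , z≤n , subst (T ∘ v) (sym (unframe-frame x [])) (Equivalence.to (iff x) h))
      (λ (c , _ , h) → Equivalence.from (iff x) (subst (T ∘ v) (unframe-frame x c) h))
    where
    time : PolyTimeTest (v ∘ unframe)
    time = PolyTime-∘ (M , p , decides) (Comp⇒PolyTime unframeᶜ)

  private
    segmentFrames : ∀ {n} → Segment n → List Bits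
    segmentFrames (segment i b e) =
      binary (toℕ i) ∷ signedBinary (↥ b) ∷ binary (↧ₙ b) ∷ signedBinary (↥ e) ∷ binary (↧ₙ e) ∷ []

    -- The code of a schedule is a sequence of frames, five to a segment, which `parse` recovers.
    enc-schedule : ∀ {n} (σ : Schedule n) → enc (list bits) (concatMap segmentFrames σ) ≡ encodeSchedule σ
    enc-schedule []                    = refl
    enc-schedule (segment i b e ∷ σ) = trans (cong (λ w → encodeℕ (toℕ i) ++ frame (signedBinary (↥ b)) ++ encodeℕ (↧ₙ b) ++ frame (signedBinary (↥ e)) ++ encodeℕ (↧ₙ e) ++ w) (enc-schedule σ))
      (regroup (encodeℕ (toℕ i)) (frame (signedBinary (↥ b))) (encodeℕ (↧ₙ b)) (frame (signedBinary (↥ e))) (encodeℕ (↧ₙ e)) (encodeSchedule σ))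
      where
      regroup : ∀ (i s t u v w : Bits) → i ++ s ++ t ++ u ++ v ++ w ≡ (i ++ (s ++ t) ++ (u ++ v)) ++ w
      regroup i s t u v w = trans (cong (i ++_) (trans (cong (λ z → s ++ t ++ z) (sym (List.++-assoc u v w)))
        (trans (sym (List.++-assoc s t ((u ++ v) ++ w))) (sym (List.++-assoc (s ++ t) (u ++ v) w))))) (sym (List.++-assoc i ((s ++ t) ++ (u ++ v)) w))

  isNil : Bits → Bool
  isNil []      = true
  isNil (_ ∷ _) = false

  private
    isNil-binary-suc : ∀ n → isNil (binary (suc n)) ≡ false
    isNil-binary-suc n with binary n
    ... | []        = refl
    ... | false ∷ w = refl
    ... | true ∷ w  = refl

    isNil-signed : ∀ z → isNil (signedBinary z) ≡ false
    isNil-signed (+ n)    = refl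
    isNil-signed -[1+ n ] = refl

    isNil-denominator : ∀ q → isNil (binary (↧ₙ q)) ≡ false
    isNil-denominator (ℚ.mkℚ n d c) = isNil-binary-suc d

    isNil-index : ∀ {n} (i : Fin (suc n)) → isNil (binary (toℕ i)) ≡ true → i ≡ Fin.zero
    isNil-index Fin.zero    e = refl
    isNil-index (Fin.suc i) e with trans (sym (isNil-binary-suc (toℕ i))) e
    ... | ()

  -- 0 is the only number whose code is an empty frame, numerators carry a sign
  -- bit and denominators are positive; so job 0 is processed iff a frame is empty.
  skipsFirst : Bits → Bool
  skipsFirst y = not (anyᵇ isNil (parse y))

  private
    any-segments : ∀ {n} (σ : Schedule (suc n)) →
      (anyᵇ isNil (concatMap segmentFrames σ) ≡ true → Any (λ s → worksOn s ≡ Fin.zero) σ)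
      × (Any (λ s → worksOn s ≡ Fin.zero) σ → anyᵇ isNil (concatMap segmentFrames σ) ≡ true)
    any-segments []                    = (λ ()) , (λ ())
    any-segments (segment i b e ∷ σ)
      rewrite isNil-signed (↥ b) | isNil-denominator b | isNil-signed (↥ e) | isNil-denominator e
      with isNil (binary (toℕ i)) in eq
    ... | true  = (λ _ → here (isNil-index i eq)) , (λ _ → refl)
    ... | false = (λ h → there (proj₁ (any-segments σ) h)) , λ { (here refl) → ⊥-elim (absurd eq) ; (there h) → proj₂ (any-segments σ) h }
      where
      absurd : true ≡ false → ⊥
      absurd ()

    skipsFirst-schedule : ∀ {n} (σ : Schedule n) → skipsFirst (encodeSchedule σ) ≡ not (anyᵇ isNil (concatMap segmentFrames σ))
    skipsFirst-schedule σ = cong (not ∘ anyᵇ isNil) (trans (cong parse (sym (enc-schedule σ))) (parse-enc (concatMap segmentFrames σ)))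

  skipsFirst⇔ : ∀ {I j} (σ : Schedule (length (j ∷ I))) → Feasible (j ∷ I) σ →
    (T (skipsFirst (encodeSchedule σ)) → selected σ Fin.zero ≡ false) × (selected σ Fin.zero ≡ false → T (skipsFirst (encodeSchedule σ)))
  skipsFirst⇔ {I} {j} σ feas = sound , complete
    where
    open Feasible feas
    sound : T (skipsFirst (encodeSchedule σ)) → selected σ Fin.zero ≡ false
    sound h = ≢true⇒false λ e → present (isPositive-cases (y∞ σ Fin.zero)) e
      where
      none : anyᵇ isNil (concatMap segmentFrames σ) ≡ true → ⊥
      none e = subst T (trans (skipsFirst-schedule σ) (cong not e)) h
      absent : All (λ s → worksOn s ≢ Fin.zero) σ
      absent = All.tabulate λ s∈ w → none (proj₂ (any-segments σ) (Any.map (λ { refl → w }) s∈))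
      present : (0ℚ ℚ.< y∞ σ Fin.zero × selected σ Fin.zero ≡ true) ⊎ (y∞ σ Fin.zero ℚ.≤ 0ℚ × selected σ Fin.zero ≡ false) → selected σ Fin.zero ≡ true → ⊥
      present (inj₁ (pos , _)) e = ℚ.<-irrefl (sym (y∞-absent σ Fin.zero absent)) pos
      present (inj₂ (_ , f)) e with trans (sym f) e
      ... | ()
    complete : selected σ Fin.zero ≡ false → T (skipsFirst (encodeSchedule σ))
    complete f = subst T (sym (trans (skipsFirst-schedule σ) (cong not (≢true⇒false some)))) tt
      where
      some : anyᵇ isNil (concatMap segmentFrames σ) ≡ true → ⊥
      some e = found (proj₁ (any-segments σ) e) (λ s∈ → y∞-pos nonempty s∈)
        where
        found : ∀ {τ} → Any (λ s → worksOn s ≡ Fin.zero) τ → (∀ {s} → s ∈ τ → 0ℚ ℚ.< y∞ σ (worksOn s)) → ⊥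
        found (here w)  pos with trans (sym f) (selected-true feas Fin.zero (subst (λ i → 0ℚ ℚ.< y∞ σ i) w (pos (here refl))))
        ... | ()
        found (there a) pos = found a (pos ∘ there)

  skipsFirstᶜ : Comp bits bool skipsFirst
  skipsFirstᶜ = notᶜ (anyᶜ {Γ = bits} {A = bits} {p = λ (_ , w) → isNil w} parseᶜ (compᶜ {g = isNil} isNil∈ sndᶜ))
    where
    isNil∈ : Comp bits bool isNil
    isNil∈ = extᶜ (λ { [] → refl ; (_ ∷ _) → refl })
      (compᶜ (bitsCase {Γ = bits} {f = λ _ → true} {g = λ _ _ → false} (constᶜ true) (λ _ → constᶜ false)) (pairᶜ idᶜ (constᶜ [])))

  fromℕ-* : ∀ m n → fromℕ (m * n) ≡ fromℕ m ℚ.* fromℕ n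
  fromℕ-* m n = ℚ.toℚᵘ-injective (ℚᵘ.≃-trans (ℚᵘ.*≡* (cong (ℤ._* + 1) (ℤ.pos-* m n))) (ℚᵘ.≃-sym (ℚ.toℚᵘ-homo-* (fromℕ m) (fromℕ n))))

  -- The denominator is at least 1. This provides a natural number above the ratio.
  ≤-numerator : ∀ ρ → ρ ℚ.≤ fromℕ ℤ.∣ ↥ ρ ∣
  ≤-numerator (ℚ.mkℚ (+ n) d c) = ℚ.*≤* (ℤ.≤-trans (ℤ.≤-reflexive (ℤ.*-identityʳ (+ n)))
    (ℤ.≤-trans (ℤ.+≤+ (ℕ.m≤m*n n (suc d))) (ℤ.≤-reflexive (ℤ.pos-* n (suc d)))))
  ≤-numerator (ℚ.mkℚ (-[1+ n ]) d c) = ℚ.*≤* (ℤ.≤-trans (ℤ.≤-reflexive (ℤ.*-identityʳ -[1+ n ])) (ℤ.≤-trans ℤ.-≤+ (ℤ.≤-reflexive (ℤ.pos-* (suc n) (suc d)))))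

  -- If the goal can be reached, some schedule has value at most `B`, and the approximate one has
  -- value at most `ρ B < c B`, too little to contain the long job. Conversely, any feasible
  -- schedule without that job exhibits a solution, whatever its value.
  approximable⇒P≡NP : ∀ obj ρ → 1ℚ ℚ.≤ ρ → ApproximableWithin obj ρ → P≡NP
  approximable⇒P≡NP obj ρ 1≤ρ (Mₐ , pₐ , approx) L = mk⇔ P⊆NP NP⊆P
    where
    c : ℕ
    -- At least `ρ + 2`, which gives both `1 < c` and `ρ B < c B`.
    c = suc (suc ℤ.∣ ↥ ρ ∣)
    1<c : 1 < c
    1<c = s≤s (s≤s z≤n)
    NP⊆P : InNP L → InP L
    NP⊆P (v , q , (M , p , decides) , iff) = w , time , λ x → mk⇔ (to x) (from x)
      where
      open Numbers M p q
      open Program M p q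
      J : Bits → Instance
      J = instanceOf c
      σ : ∀ x → Schedule (length (J x))
      σ x = proj₁ (approx (J x))
      run : ∀ x → OutputsWithin Mₐ (eval pₐ (length (encodeInstance (J x)))) (encodeInstance (J x)) (encodeSchedule (σ x))
      run x = proj₁ (proj₂ (approx (J x)))
      feas : ∀ x → Feasible (J x) (σ x)
      feas x = proj₁ (proj₂ (proj₂ (approx (J x))))
      w : Bits → Bool
      w x = skipsFirst (encodeSchedule (σ x))
      time : PolyTimeTest w
      time = PolyTime-∘ {f = encodeSchedule ∘ σ} (Comp⇒PolyTime (verdictᶜ skipsFirstᶜ)) (solve (Comp⇒PolyTime (encodeInstanceᶜ (instanceOfᶜ c))))
        where
        solve : PolyTime (encodeInstance ∘ J) → PolyTime (encodeSchedule ∘ σ)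
        solve (M₁ , p₁ , reduces) = let M′ , p′ , composed = compose-within M₁ p₁ Mₐ pₐ in M′ , p′ , λ x → composed (reduces x) (run x)
      sub : ∀ x → L x ⇔ Sub (weights x) (suc (goal₀ x))
      sub x = mk⇔ (λ h → subst (Sub (weights x)) (goal≡suc x) (Equivalence.to (subset-sum⇔ decides x) (Equivalence.to (iff x) h)))
                  (λ s → Equivalence.from (iff x) (Equivalence.from (subset-sum⇔ decides x) (subst (Sub (weights x)) (sym (goal≡suc x)) s)))
      to : ∀ x → L x → T (w x)
      to x h = proj₂ (skipsFirst⇔ (σ x) (feas x)) (cheap⇒unselected c (goal₀ x) (weights x) 1<c obj (feas x) small-value)
        where
        cheap : ∃[ σ′ ] Feasible (J x) σ′ × value obj (J x) σ′ ℚ.≤ fromℕ (suc (goal₀ x))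
        cheap = proj₁ (sub⇔cheap c (goal₀ x) (weights x) 1<c obj) (Equivalence.to (sub x) h)
        σ′ = proj₁ cheap
        feas′ = proj₁ (proj₂ cheap)
        v′ = proj₂ (proj₂ cheap)
        B : ℕ
        B = suc (goal₀ x)
        small-value : value obj (J x) (σ x) ℚ.< fromℕ (c * B)
        small-value = ℚ.≤-<-trans (proj₂ (proj₂ (proj₂ (approx (J x)))) σ′ feas′)
          (ℚ.≤-<-trans (ℚ.*-monoˡ-≤-nonNeg ρ {{ℚ.nonNegative (ℚ.≤-trans (fromℕ-mono-≤ {0} {1} z≤n) 1≤ρ)}} v′)
            (ℚ.≤-<-trans (ℚ.*-monoʳ-≤-nonNeg (fromℕ B) {{ℚ.nonNegative (0≤fromℕ B)}} (≤-numerator ρ))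
              (ℚ.≤-<-trans (ℚ.≤-reflexive (sym (fromℕ-* ℤ.∣ ↥ ρ ∣ B))) (fromℕ-mono-< (ℕ.≤-trans (ℕ.m<n+m (ℤ.∣ ↥ ρ ∣ * B) (s≤s z≤n)) (ℕ.+-monoʳ-≤ B (ℕ.m≤n+m _ B)))))))
      from : ∀ x → T (w x) → L x
      from x h = Equivalence.from (sub x) (feasible⇒sub c (goal₀ x) (weights x) 1<c (feas x) (proj₁ (skipsFirst⇔ (σ x) (feas x)) h))

open import Defs
open import Data.Product.Base using (_×_; _,_)
open import Data.Rational.Base using (ℚ; 1ℚ; _≤_)
open import Relation.Nullary using (¬_)

theorem8 : (obj : Objective) →
    NPComplete (LazyBureaucrat obj) ×
    ((ρ : ℚ) → 1ℚ ≤ ρ → ¬ P≡NP → ¬ ApproximableWithin obj ρ)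
theorem8 obj = (Membership.LazyBureaucrat-InNP obj , Hardness.LazyBureaucrat-hard obj) ,
  λ ρ 1≤ρ P≢NP approx → P≢NP (Hardness.approximable⇒P≡NP obj ρ 1≤ρ approx)
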